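{- There exists $\delta_0>0$ such that for every $0<\delta<\delta_0$: \begin{itemize} \item $\varrho(K_3,K_3,\delta)=\frac{1}{4}+\frac{\delta}{2}$; \item $\varrho(K_3,K_4,\delta)=\frac{1}{3}+\frac{\delta}{2}+\frac{3\delta^2}{2}$; \item $\varrho(K_3,K_5,\delta)=\frac{2}{5}+\frac{\delta}{2}$. \end{itemize}
   Context: Given graphs $H_1,\ldots,H_k$, a graph $G$ is called $(H_1,\ldots,H_k)$-free if there is an edge-colouring $\phi:E(G)\to\{1,\ldots,k\}$ such that for each $i$, the spanning subgraph $G_i$ formed by the edges of colour $i$ contains no copy of $H_i$. For $n,m\in\mathbb{N}$, $\mathrm{RT}(n,H_1,\ldots,H_k,m)$ denotes the maximum number of edges of an $n$-vertex $(H_1,\ldots,H_k)$-free graph $G$ with independence number $\alpha(G)\le m$. For $\delta\in(0,1)$, $\varrho(H_1,\ldots,H_k,\delta):=\lim_{n\to\infty}\mathrm{RT}(n,H_1,\ldots,H_k,\delta n)/n^2$. $K_s$ denotes the complete graph on $s$ vertices.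
   Formalization: The formal theorem proves the three formulas for every rational δ with 0<δ<δ₀ (δ₀ rational), whereas the statement is for all real δ in that range. -}

module Defs where

open import Data.Bool using (Bool; true; false; if_then_else_; _∧_)
open import Data.Nat as ℕ using (ℕ; _<ᵇ_)
open import Data.Fin using (Fin; toℕ)
open import Data.Vec using (Vec; lookup; _∷_; [])
open import Data.List using (List; map; allFin)
open import Data.Nat.ListAction using (sum)
open import Data.Product using (Σ; _×_; ∃; ∃-syntax)
open import Data.Integer using (+_)
open import Data.Rational using (ℚ; _/_; _+_; _-_; _*_; _≤_; _<_; 0ℚ)
open import Relation.Binary.PropositionalEquality using (_≡_; _≢_)
open import Relation.Nullary using (¬_)
open import Function.Definitions using (Injective)

record Graph (n : ℕ) : Set where
  field
    adj    : Fin n → Fin n → Bool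
    sym    : ∀ i j → adj i j ≡ adj j i
    irrefl : ∀ i → adj i i ≡ false
open Graph public

edgeCount : ∀ {n} → Graph n → ℕ
edgeCount {n} G =
  sum (map (λ i → sum (map (λ j → if (toℕ i <ᵇ toℕ j) ∧ adj G i j then 1 else 0)
                           (allFin n)))
           (allFin n))

-- Edge-colouring with k colours: a symmetric colour assignment to pairs
-- (only its values on edges matter).
record Colouring {n : ℕ} (k : ℕ) (G : Graph n) : Set where
  field
    col     : Fin n → Fin n → Fin k
    col-sym : ∀ i j → col i j ≡ col j i
open Colouring public

MonoClique : ∀ {n k} (G : Graph n) → Colouring k G → Fin k → ℕ → Set
MonoClique {n} G φ c s =
  Σ (Fin s → Fin n) λ f →
    Injective _≡_ _≡_ f ×
    (∀ a b → a ≢ b → (adj G (f a) (f b) ≡ true) × (col φ (f a) (f b) ≡ c))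

CliquesFree : ∀ {n k} → Vec ℕ k → Graph n → Set
CliquesFree {n} {k} ss G =
  Σ (Colouring k G) λ φ → ∀ (c : Fin k) → ¬ MonoClique G φ c (lookup ss c)

IndepSet : ∀ {n} → Graph n → ℕ → Set
IndepSet {n} G t =
  Σ (Fin t → Fin n) λ f →
    Injective _≡_ _≡_ f × (∀ a b → a ≢ b → adj G (f a) (f b) ≡ false)

ℕ→ℚ : ℕ → ℚ
ℕ→ℚ m = (+ m) / 1

IndepAtMost : ∀ {n} → Graph n → ℚ → Set
IndepAtMost G x = ∀ t → IndepSet G t → ℕ→ℚ t ≤ x

-- ϱ(K_{s_1},…,K_{s_k}, δ) = r, i.e.
--   lim_{n→∞} RT(n, K_{s_1},…,K_{s_k}, δn) / n² = r,
-- with RT(n,…,δn) (a maximum over n-vertex graphs) unfolded: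
-- for every ε > 0 there is N such that for all n ≥ N, every n-vertex
-- (K_{s_1},…)-free G with α(G) ≤ δn has |E(G)| ≤ (r+ε)n², and some such
-- G has |E(G)| ≥ (r-ε)n².
RhoEq : ∀ {k} → Vec ℕ k → ℚ → ℚ → Set
RhoEq ss δ r =
  ∀ (ε : ℚ) → 0ℚ < ε →
  ∃[ N ] ∀ (n : ℕ) → N ℕ.≤ n →
    ((G : Graph n) → CliquesFree ss G → IndepAtMost G (δ * ℕ→ℚ n) →
        ℕ→ℚ (edgeCount G) ≤ (r + ε) * ℕ→ℚ (n ℕ.* n))
    ×
    (Σ (Graph n) λ G → CliquesFree ss G × IndepAtMost G (δ * ℕ→ℚ n) ×
        ((r - ε) * ℕ→ℚ (n ℕ.* n) ≤ ℕ→ℚ (edgeCount G)))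

module Submission where

-- Upper bounds. Deleting vertices of low degree leaves a set S in which every vertex misses about |S|/r others (r = 2, 3, 5). As every set of more than a
-- vertices contains an edge, vertices seeing a bounded set in the same colours include adjacent ones; such twins forbid cliques of more than 2r vertices,
-- so S is split into r parts inside which vertices have at most a neighbours, and Cauchy–Schwarz bounds the number of edges. Larger cliques occur only for
-- (K3, K4), when some blue neighbourhood has about 2|S|/3 vertices; it then splits into two parts, and the third part may contain blue edges between two
-- independent sets, whence the term 3δ²/2.
-- Lower bounds. Triangle-free graphs on N vertices, regular of degree d and without larger independent sets, have dense ratios N/d: circulant graphs fill
-- an interval, and Mycielski's construction, with weights, maps W to W + 1/W. Copies of them are joined completely in suitable colours and blown up.

-- Adjacent twins replace the vertices of a clique that they both miss. Hence all but few vertices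
-- miss at least two vertices of a largest clique, on 2r vertices, while the average is about two;
-- so nearly all miss exactly two, and the missed pairs turn out to match up the clique, one pair
-- for each part. The obstacle lies in bounding the cliques, for red twins say much less than blue
-- ones. Where all red degrees are linear, a set without blue edges meets each red neighbourhood in
-- an independent set and is small, so that twins can be chosen blue. Blue twins that miss few
-- vertices of a forbidden clique turn it into a rigid configuration; weights on its vertices whose
-- average lies below an integer yield further blue twins, until colours or sizes become
-- contradictory. In the constructions only approximate ratios N/d are available. As W + 1/W is
-- increasing and non-expanding for W at least 1, a fine chain of ratios whose end reaches the image
-- of its start yields approximations to every ratio from 4 on.

module LinearArithmetic where

 open import Data.Nat
 open import Data.Nat.Properties renaming (≤-reflexive to ≡⇒≤)
 open import Data.Nat.Tactic.RingSolver using (solve-∀)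
 open import Data.List using (List; []; _∷_; map)
 open import Data.Product using (_×_; _,_; proj₁; proj₂)
 open import Data.Bool using (Bool; true; false; _∧_; T)
 open import Data.Bool.Properties using (T-≡)
 open import Function.Bundles using (Equivalence)
 open import Data.Unit using (⊤; tt)
 open import Data.Empty using (⊥; ⊥-elim)
 open import Relation.Binary.PropositionalEquality
 open import Relation.Nullary using (¬_; Dec; yes; no)

 -- Linear arithmetic over ℕ: a goal l ≤ r is checked against a Farkas certificate, that is, multipliers λᵢ of the hypotheses lᵢ ≤ rᵢ and suc κ of the goal
 -- such that suc κ · l + Σ λᵢ rᵢ ≤ suc κ · r + Σ λᵢ lᵢ + κ coefficientwise.

 infixl 6 _:+_
 infixl 7 _:*_
 infix 4 _<:_

 data LExp : Set where
  k v : ℕ -> LExp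
  _:+_ : LExp -> LExp -> LExp
  _:*_ : ℕ -> LExp -> LExp

 v0 v1 v2 v3 v4 v5 v6 v7 v8 v9 v10 v11 v12 v13 : LExp
 v0 = v 0
 v1 = v 1
 v2 = v 2
 v3 = v 3
 v4 = v 4
 v5 = v 5
 v6 = v 6
 v7 = v 7
 v8 = v 8
 v9 = v 9
 v10 = v 10
 v11 = v 11
 v12 = v 12
 v13 = v 13

 record LIneq : Set where
  constructor _<:_
  field
   lower upper : LExp
 open LIneq

 nth : List ℕ -> ℕ -> ℕ
 nth [] _ = 0
 nth (x ∷ xs) zero = x
 nth (x ∷ xs) (suc i) = nth xs i

 ⟦_⟧ : LExp -> List ℕ -> ℕ
 ⟦ k c ⟧ ρ = c
 ⟦ v i ⟧ ρ = nth ρ i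
 ⟦ e :+ f ⟧ ρ = ⟦ e ⟧ ρ + ⟦ f ⟧ ρ
 ⟦ c :* e ⟧ ρ = c * ⟦ e ⟧ ρ

 val : List ℕ -> List ℕ -> ℕ
 val (c ∷ cs) (x ∷ xs) = c * x + val cs xs
 val _ _ = 0

 _⊞_ : List ℕ -> List ℕ -> List ℕ
 [] ⊞ ds = ds
 (c ∷ cs) ⊞ [] = c ∷ cs
 (c ∷ cs) ⊞ (d ∷ ds) = (c + d) ∷ (cs ⊞ ds)

 unit : ℕ -> List ℕ
 unit zero = 1 ∷ []
 unit (suc i) = 0 ∷ unit i

 nf : LExp -> List ℕ
 nf (k c) = c ∷ []
 nf (v i) = 0 ∷ unit i
 nf (e :+ f) = nf e ⊞ nf f
 nf (c :* e) = map (c *_) (nf e)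

 val-⊞ : ∀ cs ds xs -> val (cs ⊞ ds) xs ≡ val cs xs + val ds xs
 val-⊞ [] ds xs = refl
 val-⊞ (c ∷ cs) [] xs = sym (+-identityʳ _)
 val-⊞ (c ∷ cs) (d ∷ ds) [] = refl
 val-⊞ (c ∷ cs) (d ∷ ds) (x ∷ xs) rewrite val-⊞ cs ds xs = lemma c d x (val cs xs) (val ds xs)
  where
  lemma : ∀ c d x p q -> (c + d) * x + (p + q) ≡ c * x + p + (d * x + q)
  lemma = solve-∀

 val-scale : ∀ c ds xs -> val (map (c *_) ds) xs ≡ c * val ds xs
 val-scale c [] xs = sym (*-zeroʳ c)
 val-scale c (d ∷ ds) [] = sym (*-zeroʳ c)
 val-scale c (d ∷ ds) (x ∷ xs) rewrite val-scale c ds xs = lemma c d x (val ds xs)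
  where
  lemma : ∀ c d x p -> c * d * x + c * p ≡ c * (d * x + p)
  lemma = solve-∀

 val-unit : ∀ i xs -> val (unit i) xs ≡ nth xs i
 val-unit zero [] = refl
 val-unit zero (x ∷ xs) = trans (+-identityʳ _) (*-identityˡ x)
 val-unit (suc i) [] = refl
 val-unit (suc i) (x ∷ xs) = val-unit i xs

 nf-sound : ∀ e ρ -> ⟦ e ⟧ ρ ≡ val (nf e) (1 ∷ ρ)
 nf-sound (k c) ρ = sym (trans (+-identityʳ _) (*-identityʳ c))
 nf-sound (v i) ρ = sym (val-unit i ρ)
 nf-sound (e :+ f) ρ = trans (cong₂ _+_ (nf-sound e ρ) (nf-sound f ρ)) (sym (val-⊞ (nf e) (nf f) (1 ∷ ρ)))
 nf-sound (c :* e) ρ = trans (cong (c *_) (nf-sound e ρ)) (sym (val-scale c (nf e) (1 ∷ ρ)))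

 coeffs≤ : List ℕ -> List ℕ -> Bool
 coeffs≤ [] ds = true
 coeffs≤ (c ∷ cs) [] = (c ≤ᵇ 0) ∧ coeffs≤ cs []
 coeffs≤ (c ∷ cs) (d ∷ ds) = (c ≤ᵇ d) ∧ coeffs≤ cs ds

 ∧-true : ∀ {a b} -> a ∧ b ≡ true -> (a ≡ true) × (b ≡ true)
 ∧-true {true} {true} _ = refl , refl

 ≤ᵇ-sound : ∀ m n -> (m ≤ᵇ n) ≡ true -> m ≤ n
 ≤ᵇ-sound m n e = ≤ᵇ⇒≤ m n (subst T (sym e) tt)

 coeffs≤-sound : ∀ cs ds xs -> coeffs≤ cs ds ≡ true -> val cs xs ≤ val ds xs
 coeffs≤-sound [] ds xs e = z≤n
 coeffs≤-sound (c ∷ cs) ds [] e = z≤n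
 coeffs≤-sound (c ∷ cs) [] (x ∷ xs) e with n≤0⇒n≡0 (≤ᵇ-sound c 0 (proj₁ (∧-true e)))
 ... | refl = coeffs≤-sound cs [] xs (proj₂ (∧-true {c ≤ᵇ 0} e))
 coeffs≤-sound (c ∷ cs) (d ∷ ds) (x ∷ xs) e =
  +-mono-≤ (*-monoˡ-≤ x (≤ᵇ-sound c d (proj₁ (∧-true e)))) (coeffs≤-sound cs ds xs (proj₂ (∧-true {c ≤ᵇ d} e)))

 data Facts (ρ : List ℕ) : Set where
  □ : Facts ρ
  _by_·_&_ : (h : LIneq) -> ℕ -> ⟦ lower h ⟧ ρ ≤ ⟦ upper h ⟧ ρ -> Facts ρ -> Facts ρ

 infixr 2 _by_·_&_ _by_&_ _by≡_·_&_ _by≡_&_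

 _by_&_ : ∀ {ρ} (h : LIneq) -> ⟦ lower h ⟧ ρ ≤ ⟦ upper h ⟧ ρ -> Facts ρ -> Facts ρ
 h by p & fs = h by 1 · p & fs

 _by≡_·_&_ : ∀ {ρ} (h : LIneq) -> ℕ -> ⟦ lower h ⟧ ρ ≡ ⟦ upper h ⟧ ρ -> Facts ρ -> Facts ρ
 h by≡ m · p & fs = h by m · ≡⇒≤ p & fs

 _by≡_&_ : ∀ {ρ} (h : LIneq) -> ⟦ lower h ⟧ ρ ≡ ⟦ upper h ⟧ ρ -> Facts ρ -> Facts ρ
 h by≡ p & fs = h by 1 · ≡⇒≤ p & fs

 combine : ∀ {ρ} -> (LIneq -> LExp) -> Facts ρ -> LExp
 combine side □ = k 0
 combine side (h by m · _ & fs) = m :* side h :+ combine side fs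

 combine-≤ : ∀ {ρ} (fs : Facts ρ) -> ⟦ combine lower fs ⟧ ρ ≤ ⟦ combine upper fs ⟧ ρ
 combine-≤ □ = z≤n
 combine-≤ (h by m · p & fs) = +-mono-≤ (*-monoʳ-≤ m p) (combine-≤ fs)

 certified : ∀ {ρ} -> ℕ -> LIneq -> Facts ρ -> Bool
 certified κ g fs = coeffs≤ (nf (suc κ :* lower g :+ combine upper fs)) (nf (suc κ :* upper g :+ combine lower fs :+ k κ))

 -- If `r < l`, then `suc κ` copies of the goal gain `suc κ`, which the slack `κ` cannot absorb. The
 -- slack is what lets integrality round the combined inequality.
 lin-κ : ∀ κ ρ g (fs : Facts ρ) -> {_ : T (certified κ g fs)} -> ⟦ lower g ⟧ ρ ≤ ⟦ upper g ⟧ ρ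
 lin-κ κ ρ g fs {ok} = ≮⇒≥ \ r<l -> 1+n≰n {κ} (+-cancelˡ-≤ (suc κ * r + u) (suc κ) κ (begin
  suc κ * r + u + suc κ ≡⟨ rearrange (suc κ) r u ⟩
  suc κ * suc r + u ≤⟨ +-monoˡ-≤ u (*-monoʳ-≤ (suc κ) r<l) ⟩
  suc κ * l + u ≡⟨ nf-sound (suc κ :* lower g :+ combine upper fs) ρ ⟩
  val (nf (suc κ :* lower g :+ combine upper fs)) (1 ∷ ρ)
   ≤⟨ coeffs≤-sound (nf (suc κ :* lower g :+ combine upper fs)) _ (1 ∷ ρ) (Equivalence.to T-≡ ok) ⟩
  val (nf (suc κ :* upper g :+ combine lower fs :+ k κ)) (1 ∷ ρ)
   ≡⟨ nf-sound (suc κ :* upper g :+ combine lower fs :+ k κ) ρ ⟨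
  suc κ * r + ⟦ combine lower fs ⟧ ρ + κ
   ≤⟨ +-monoˡ-≤ κ (+-monoʳ-≤ (suc κ * r) (combine-≤ fs)) ⟩
  suc κ * r + u + κ ∎))
  where
  open ≤-Reasoning
  l = ⟦ lower g ⟧ ρ
  r = ⟦ upper g ⟧ ρ
  u = ⟦ combine upper fs ⟧ ρ
  rearrange : ∀ c r u -> c * r + u + c ≡ c * suc r + u
  rearrange = solve-∀

 lin : ∀ ρ g (fs : Facts ρ) -> {_ : T (certified 0 g fs)} -> ⟦ lower g ⟧ ρ ≤ ⟦ upper g ⟧ ρ
 lin ρ g fs {ok} = lin-κ 0 ρ g fs {ok}

-- Clearing denominators: from rational to natural inequalities

module RationalBounds where
 open import Data.Nat as ℕ using (ℕ; zero; suc; z≤n; s≤s)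
 import Data.Nat.Properties as ℕ
 open import Data.Nat.Coprimality using (1-coprimeTo) renaming (sym to coprime-sym)
 open import Data.Integer as ℤ using (+_; -[1+_]; +≤+; +<+)
 import Data.Integer.Properties as ℤ
 open import Data.Product using (_×_; _,_; proj₁; proj₂; ∃; ∃₂; Σ)
 open import Data.Rational
 open import Data.Rational.Properties
 open import Data.Rational.Unnormalised as ℚᵘ using (mkℚᵘ; *≡*)
 import Data.Rational.Unnormalised.Properties as ℚᵘ
 open import Data.Rational.Solver using (module +-*-Solver)
 open import Relation.Binary.PropositionalEquality
 open import Data.Empty using (⊥-elim)
 open import Defs using (ℕ→ℚ)

 -- `ℕ→ℚ` normalises a fraction; this literal has denominator 1 by definition, so that identities
 -- and inequalities of naturals carry over by computation.
 ι : ℕ -> ℚ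
 ι m = mkℚ (+ m) 0 (coprime-sym (1-coprimeTo m))

 ℕ→ℚ-ι : ∀ m -> ℕ→ℚ m ≡ ι m
 ℕ→ℚ-ι m = normalize-coprime (coprime-sym (1-coprimeTo m))

 ι-+ : ∀ m n -> ι (m ℕ.+ n) ≡ ι m + ι n
 ι-+ m n = toℚᵘ-injective (ℚᵘ.≃-trans (*≡* (cong (ℤ._* + 1) (sym (cong₂ ℤ._+_ (ℤ.*-identityʳ (+ m)) (ℤ.*-identityʳ (+ n)))))) (ℚᵘ.≃-sym (toℚᵘ-homo-+ (ι m) (ι n))))

 ι-* : ∀ m n -> ι (m ℕ.* n) ≡ ι m * ι n
 ι-* m n = toℚᵘ-injective (ℚᵘ.≃-trans (*≡* (cong (ℤ._* + 1) (ℤ.pos-* m n))) (ℚᵘ.≃-sym (toℚᵘ-homo-* (ι m) (ι n))))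

 ι-mono : ∀ {m n} -> m ℕ.≤ n -> ι m ≤ ι n
 ι-mono h = *≤* (ℤ.*-monoʳ-≤-nonNeg (+ 1) (+≤+ h))

 ι-cancel : ∀ {m n} -> ι m ≤ ι n -> m ℕ.≤ n
 ι-cancel {m} {n} h = ℤ.drop‿+≤+ (subst₂ ℤ._≤_ (ℤ.*-identityʳ (+ m)) (ℤ.*-identityʳ (+ n)) (drop-*≤* h))

 ι-positive : ∀ {m} -> 0 ℕ.< m -> Positive (ι m)
 ι-positive {suc m} _ = _

 unit-fraction : ℕ -> ℚ
 unit-fraction h = mkℚ (+ 1) h (1-coprimeTo (suc h))

 -- A positive rational as a quotient `u / w` of naturals; `below` turns the smallness of δ into the
 -- natural inequality on which the numerical estimates rest.
 record Fraction (q : ℚ) : Set where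
  field
   u w : ℕ
   0<u : 0 ℕ.< u
   0<w : 0 ℕ.< w
   value : q * ι w ≡ ι u
   below : ∀ h -> q < unit-fraction h -> suc h ℕ.* u ℕ.≤ w

 fraction : ∀ q -> 0ℚ < q -> Fraction q
 fraction (mkℚ (+ 0) d _) (*<* (+<+ ()))
 fraction (mkℚ -[1+ n ] d _) (*<* ())
 fraction q@(mkℚ (+ suc p) d _) _ = record
  { u = suc p ; w = suc d ; 0<u = s≤s z≤n ; 0<w = s≤s z≤n
  ; value = toℚᵘ-injective (ℚᵘ.≃-trans (toℚᵘ-homo-* q (ι (suc d))) (*≡* (trans (ℤ.*-identityʳ _) (cong (\ x -> + suc p ℤ.* + x) (sym (ℕ.*-identityʳ (suc d)))))))
  ; below = \ h lt -> ℕ.<⇒≤ (subst₂ ℕ._<_ (ℕ.*-comm (suc p) (suc h)) (ℕ.+-identityʳ (suc d)) (ℤ.drop‿+<+ (drop-*<* lt)))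
  }

 +-cancelʳ-≤ : ∀ x y z -> x + y ≤ z + y -> x ≤ z
 +-cancelʳ-≤ x y z h = subst₂ _≤_ (lemma x y) (lemma z y) (+-monoˡ-≤ (- y) h)
  where
  lemma : ∀ x y -> x + y - y ≡ x
  lemma x y = solve 2 (\ x y -> x :+ y :- y := x) refl x y
   where open +-*-Solver

 module _ {δ : ℚ} {u w : ℕ} (0<w : 0 ℕ.< w) (value : δ * ι w ≡ ι u) where

  private
   scaled : ∀ n -> ι w * (δ * ι n) ≡ ι (u ℕ.* n)
   scaled n = trans (lemma δ (ι w) (ι n)) (trans (cong (_* ι n) value) (sym (ι-* u n)))
    where
    lemma : ∀ d w n -> w * (d * n) ≡ d * w * n
    lemma = solve 3 (\ d w n -> w :* (d :* n) := d :* w :* n) refl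
     where open +-*-Solver

  clear-≤ : ∀ {t n} -> ℕ→ℚ t ≤ δ * ℕ→ℚ n -> w ℕ.* t ℕ.≤ u ℕ.* n
  clear-≤ {t} {n} h = ι-cancel (subst₂ _≤_ (sym (ι-* w t)) (scaled n) (*-monoˡ-≤-nonNeg (ι w) {{pos⇒nonNeg (ι w) {{ι-positive 0<w}}}}
   (subst₂ (\ x y -> x ≤ δ * y) (ℕ→ℚ-ι t) (ℕ→ℚ-ι n) h)))

  unclear-≤ : ∀ {t n} -> w ℕ.* t ℕ.≤ u ℕ.* n -> ℕ→ℚ t ≤ δ * ℕ→ℚ n
  unclear-≤ {t} {n} h = subst₂ (\ x y -> x ≤ δ * y) (sym (ℕ→ℚ-ι t)) (sym (ℕ→ℚ-ι n))
   (*-cancelˡ-≤-pos (ι w) {{ι-positive 0<w}} (subst₂ _≤_ (ι-* w t) (sym (scaled n)) (ι-mono h)))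

 module _ {r : ℚ} {A B : ℕ} (0<B : 0 ℕ.< B) (value : r * ι B ≡ ι A) where

  edges-≤ : ∀ {ε m x} -> 0ℚ < ε -> B ℕ.* x ℕ.≤ A ℕ.* m -> ℕ→ℚ x ≤ (r + ε) * ℕ→ℚ m
  edges-≤ {ε} {m} {x} 0<ε h = subst₂ (\ x m -> x ≤ (r + ε) * m) (sym (ℕ→ℚ-ι x)) (sym (ℕ→ℚ-ι m)) (≤-trans
   (*-cancelˡ-≤-pos (ι B) {{ι-positive 0<B}} (subst₂ _≤_ (ι-* B x) (trans (ι-* A m) (trans (cong (_* ι m) (sym value)) (lemma r (ι B) (ι m)))) (ι-mono h)))
   (*-monoʳ-≤-nonNeg (ι m) {{nonNegative-ι m}} (subst (_≤ r + ε) (+-identityʳ r) (+-monoʳ-≤ r (<⇒≤ 0<ε)))))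
   where
   nonNegative-ι : ∀ m -> NonNegative (ι m)
   nonNegative-ι m = _
   lemma : ∀ r b m -> r * b * m ≡ b * (r * m)
   lemma = solve 3 (\ r b m -> r :* b :* m := b :* (r :* m)) refl
    where open +-*-Solver

  -- Since `g` is at least 1, ε = g / e is at least 1 / e; an error of `m / e` in the number of
  -- edges is therefore affordable.
  ≤-edges : ∀ {ε e g m x} -> 0 ℕ.< e -> 0 ℕ.< g -> ε * ι e ≡ ι g -> A ℕ.* e ℕ.* m ℕ.≤ B ℕ.* e ℕ.* x ℕ.+ B ℕ.* m -> (r - ε) * ℕ→ℚ m ≤ ℕ→ℚ x
  ≤-edges {ε} {e} {g} {m} {x} 0<e 0<g ε-value h = subst₂ (\ m x -> (r - ε) * m ≤ x) (sym (ℕ→ℚ-ι m)) (sym (ℕ→ℚ-ι x))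
   (*-cancelˡ-≤-pos (ι B * ι e) {{subst Positive (ι-* B e) (ι-positive (ℕ.*-mono-< 0<B 0<e))}}
    (+-cancelʳ-≤ _ (ι B * ι g * ι m) _ (subst₂ _≤_ left right (ι-mono (ℕ.≤-trans h (ℕ.+-monoʳ-≤ (B ℕ.* e ℕ.* x) (ℕ.*-monoˡ-≤ m (ℕ.m≤m*n B g {{ℕ.>-nonZero 0<g}}))))))))
   where
   open +-*-Solver
   left : ι (A ℕ.* e ℕ.* m) ≡ ι B * ι e * ((r - ε) * ι m) + ι B * ι g * ι m
   left = trans (trans (ι-* (A ℕ.* e) m) (cong (_* ι m) (ι-* A e))) (trans (cong (\ a -> a * ι e * ι m) (sym value))
    (trans (lemma r (ι B) (ι e) ε (ι m)) (cong (\ c -> ι B * ι e * ((r - ε) * ι m) + ι B * c * ι m) ε-value)))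
    where
    lemma : ∀ r b e ε m -> r * b * e * m ≡ b * e * ((r - ε) * m) + b * (ε * e) * m
    lemma = solve 5 (\ r b e ε m -> r :* b :* e :* m := b :* e :* ((r :- ε) :* m) :+ b :* (ε :* e) :* m) refl
   right : ι (B ℕ.* e ℕ.* x ℕ.+ B ℕ.* g ℕ.* m) ≡ ι B * ι e * ι x + ι B * ι g * ι m
   right = trans (ι-+ (B ℕ.* e ℕ.* x) (B ℕ.* g ℕ.* m)) (cong₂ _+_ (trans (ι-* (B ℕ.* e) x) (cong (_* ι x) (ι-* B e))) (trans (ι-* (B ℕ.* g) m) (cong (_* ι m) (ι-* B g))))

 module _ {δ : ℚ} {u w : ℕ} (value : δ * ι w ≡ ι u) where
  open +-*-Solver

  value33 : ((+ 1 / 4) + (+ 1 / 2) * δ) * ι (2 ℕ.* (2 ℕ.* w)) ≡ ι (w ℕ.+ 2 ℕ.* u)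
  value33 = trans (cong (((+ 1 / 4) + (+ 1 / 2) * δ) *_) (trans (ι-* 2 (2 ℕ.* w)) (cong (ι 2 *_) (ι-* 2 w))))
   (trans (lemma δ (ι w)) (trans (cong (\ x -> ι w + ι 2 * x) value) (sym (trans (ι-+ w (2 ℕ.* u)) (cong (\ x -> ι w + x) (ι-* 2 u))))))
   where
   lemma : ∀ d w -> ((+ 1 / 4) + (+ 1 / 2) * d) * (ι 2 * (ι 2 * w)) ≡ w + ι 2 * (d * w)
   lemma = solve 2 (\ d w -> (con (+ 1 / 4) :+ con (+ 1 / 2) :* d) :* (con (ι 2) :* (con (ι 2) :* w)) := w :+ con (ι 2) :* (d :* w)) refl

  value34 : ((+ 1 / 3) + (+ 1 / 2) * δ + (+ 3 / 2) * (δ * δ)) * ι (2 ℕ.* (3 ℕ.* (w ℕ.* w))) ≡ ι (2 ℕ.* (w ℕ.* w) ℕ.+ 3 ℕ.* u ℕ.* w ℕ.+ 9 ℕ.* (u ℕ.* u))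
  value34 = trans (cong (((+ 1 / 3) + (+ 1 / 2) * δ + (+ 3 / 2) * (δ * δ)) *_) (trans (ι-* 2 (3 ℕ.* (w ℕ.* w))) (cong (ι 2 *_) (trans (ι-* 3 (w ℕ.* w)) (cong (ι 3 *_) (ι-* w w))))))
   (trans (lemma δ (ι w)) (trans (cong (\ x -> ι 2 * (ι w * ι w) + ι 3 * x * ι w + ι 9 * (x * x)) value) (sym right)))
   where
   lemma : ∀ d w -> ((+ 1 / 3) + (+ 1 / 2) * d + (+ 3 / 2) * (d * d)) * (ι 2 * (ι 3 * (w * w))) ≡ ι 2 * (w * w) + ι 3 * (d * w) * w + ι 9 * (d * w * (d * w))
   lemma = solve 2 (\ d w -> (con (+ 1 / 3) :+ con (+ 1 / 2) :* d :+ con (+ 3 / 2) :* (d :* d)) :* (con (ι 2) :* (con (ι 3) :* (w :* w))) :=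
    con (ι 2) :* (w :* w) :+ con (ι 3) :* (d :* w) :* w :+ con (ι 9) :* (d :* w :* (d :* w))) refl
   right : ι (2 ℕ.* (w ℕ.* w) ℕ.+ 3 ℕ.* u ℕ.* w ℕ.+ 9 ℕ.* (u ℕ.* u)) ≡ ι 2 * (ι w * ι w) + ι 3 * ι u * ι w + ι 9 * (ι u * ι u)
   right = trans (ι-+ (2 ℕ.* (w ℕ.* w) ℕ.+ 3 ℕ.* u ℕ.* w) (9 ℕ.* (u ℕ.* u))) (cong₂ _+_ (trans (ι-+ (2 ℕ.* (w ℕ.* w)) (3 ℕ.* u ℕ.* w))
    (cong₂ _+_ (trans (ι-* 2 (w ℕ.* w)) (cong (ι 2 *_) (ι-* w w))) (trans (ι-* (3 ℕ.* u) w) (cong (_* ι w) (ι-* 3 u))))) (trans (ι-* 9 (u ℕ.* u)) (cong (ι 9 *_) (ι-* u u))))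

  value35 : ((+ 2 / 5) + (+ 1 / 2) * δ) * ι (2 ℕ.* (5 ℕ.* w)) ≡ ι (4 ℕ.* w ℕ.+ 5 ℕ.* u)
  value35 = trans (cong (((+ 2 / 5) + (+ 1 / 2) * δ) *_) (trans (ι-* 2 (5 ℕ.* w)) (cong (ι 2 *_) (ι-* 5 w))))
   (trans (lemma δ (ι w)) (trans (cong (\ x -> ι 4 * ι w + ι 5 * x) value) (sym (trans (ι-+ (4 ℕ.* w) (5 ℕ.* u)) (cong₂ _+_ (ι-* 4 w) (ι-* 5 u))))))
   where
   lemma : ∀ d w -> ((+ 2 / 5) + (+ 1 / 2) * d) * (ι 2 * (ι 5 * w)) ≡ ι 4 * w + ι 5 * (d * w)
   lemma = solve 2 (\ d w -> (con (+ 2 / 5) :+ con (+ 1 / 2) :* d) :* (con (ι 2) :* (con (ι 5) :* w)) := con (ι 4) :* w :+ con (ι 5) :* (d :* w)) refl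

import Data.Bool.Properties as Bool
import Data.Fin as Fin
import Data.Fin.Properties as FinP
import Data.Integer as ℤ
import Data.List.Membership.DecPropositional as DecMembership
import Data.List.Relation.Unary.All.Properties as All
import Data.List.Relation.Unary.AllPairs.Properties as AllPairs
import Data.List.Relation.Unary.Unique.Propositional.Properties as Unique
import Data.Rational as ℚ
import Data.Vec as Vec
open import Data.Bool using (Bool; true; false; _∧_; _∨_; not; if_then_else_)
open import Data.Bool.Properties using (T-≡)
open import Data.Empty using (⊥; ⊥-elim)
open import Data.Fin using (Fin; zero; suc)
open import Data.Fin.Patterns using (1F; 2F)
open import Data.Fin.Properties using (toℕ-injective)
open import Data.List using (List; []; _∷_; map; length; filter; _++_; take; allFin; lookup; tabulate)
open import Data.List.Membership.Propositional using (_∈_; find; lose)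
open import Data.List.Membership.Propositional.Properties using (∈-∃++; ∈-filter⁺; ∈-filter⁻; ∈-allFin; ∈-lookup; ∈-++⁺ˡ; ∈-++⁺ʳ; ∈-++⁻; ∈-map⁺; ∈-map⁻)
open import Data.List.Properties using (length-tabulate; length-take; length-++; length-map; map-tabulate; tabulate-lookup)
open import Data.List.Relation.Unary.All as All using (All; []; _∷_; all?)
open import Data.List.Relation.Unary.AllPairs as AllPairs using (AllPairs; []; _∷_)
open import Data.List.Relation.Unary.Any using (here; there; Any; any?)
open import Data.List.Relation.Unary.Unique.Propositional using (Unique)
open import Data.List.Relation.Unary.Unique.Propositional.Properties using (allFin⁺)
open import Data.Nat
open import Data.Nat.DivMod using (_/_; _%_; m/n*n≤m; m≡m%n+[m/n]*n; m%n<n)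
open import Data.Nat.ListAction using (sum)
open import Data.Nat.Properties renaming (≤-reflexive to ≡⇒≤)
open import Data.Nat.Tactic.RingSolver using (solve-∀)
open import Data.Product using (_×_; _,_; proj₁; proj₂; ∃; ∃₂; Σ)
open import Data.Product.Properties using () renaming (≡-dec to ×-≡-dec)
open import Data.Sum using (_⊎_; inj₁; inj₂; [_,_]′)
open import Data.Sum.Properties using () renaming (≡-dec to ⊎-≡-dec)
open import Data.Unit using (⊤; tt)
open import Data.Vec as Vec using (Vec)
open import Defs using (Graph; adj; irrefl; edgeCount; Colouring; col; col-sym; MonoClique; CliquesFree; IndepSet; IndepAtMost; ℕ→ℚ; RhoEq) renaming (sym to adj-sym)
open import Function.Bundles using (Equivalence)
open import Function.Definitions using (Injective)
open import Relation.Binary.Definitions using (DecidableEquality; tri<; tri≈; tri>)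
open import Relation.Binary.PropositionalEquality
open import Relation.Nullary using (¬_; Dec; yes; no) renaming (contradiction to absurd)
open import Relation.Nullary.Decidable using (¬?; _⊎-dec_; map′; toWitness; _→-dec_) renaming (_×-dec_ to _×?_)
open import Relation.Unary using (Decidable)
open LinearArithmetic
open ≤-Reasoning hiding (start; strict; stop)
open RationalBounds using (ι; unit-fraction; Fraction; fraction; clear-≤; unclear-≤; edges-≤; ≤-edges; value33; value34; value35)

-- Indicators, finite sums and counting

𝟙 : ∀ {P : Set} -> Dec P -> ℕ
𝟙 (yes _) = 1
𝟙 (no _) = 0

𝟙-yes : ∀ {P : Set} (d : Dec P) -> P -> 𝟙 d ≡ 1
𝟙-yes (yes _) p = refl
𝟙-yes (no ¬p) p = absurd p ¬p

𝟙-no : ∀ {P : Set} (d : Dec P) -> ¬ P -> 𝟙 d ≡ 0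
𝟙-no (yes p) ¬p = absurd p ¬p
𝟙-no (no _) _ = refl

𝟙≤1 : ∀ {P : Set} (d : Dec P) -> 𝟙 d ≤ 1
𝟙≤1 (yes _) = s≤s z≤n
𝟙≤1 (no _) = z≤n

𝟙-mono : ∀ {P Q : Set} (d : Dec P) (e : Dec Q) -> (P -> Q) -> 𝟙 d ≤ 𝟙 e
𝟙-mono (no _) e f = z≤n
𝟙-mono (yes p) e f = ≡⇒≤ (sym (𝟙-yes e (f p)))

𝟙-⊎ : ∀ {P Q R : Set} (d : Dec P) (e : Dec Q) (f : Dec R) -> (P -> Q ⊎ R) -> 𝟙 d ≤ 𝟙 e + 𝟙 f
𝟙-⊎ (no _) e f g = z≤n
𝟙-⊎ (yes p) e f g with g p
... | inj₁ q = ≤-trans (≡⇒≤ (sym (𝟙-yes e q))) (m≤m+n _ _)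
... | inj₂ r = ≤-trans (≡⇒≤ (sym (𝟙-yes f r))) (m≤n+m _ _)

𝟙-disjoint : ∀ {P Q R : Set} (d : Dec P) (e : Dec Q) (f : Dec R) ->
 (P -> R) -> (Q -> R) -> (P -> ¬ Q) -> 𝟙 d + 𝟙 e ≤ 𝟙 f
𝟙-disjoint (no _) e f g h n = 𝟙-mono e f h
𝟙-disjoint (yes p) e f g h n rewrite 𝟙-no e (n p) = ≡⇒≤ (sym (𝟙-yes f (g p)))

module _ {A : Set} where

 ∑ : (A -> ℕ) -> List A -> ℕ
 ∑ f [] = 0
 ∑ f (x ∷ xs) = f x + ∑ f xs

 # : {P : A -> Set} -> Decidable P -> List A -> ℕ
 # P? = ∑ (\ x -> 𝟙 (P? x))

 ∑-mono : ∀ {f g : A -> ℕ} xs -> (∀ {x} -> x ∈ xs -> f x ≤ g x) -> ∑ f xs ≤ ∑ g xs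
 ∑-mono [] h = z≤n
 ∑-mono (x ∷ xs) h = +-mono-≤ (h (here refl)) (∑-mono xs (\ m -> h (there m)))

 ∑-cong : ∀ {f g : A -> ℕ} xs -> (∀ {x} -> x ∈ xs -> f x ≡ g x) -> ∑ f xs ≡ ∑ g xs
 ∑-cong [] h = refl
 ∑-cong (x ∷ xs) h = cong₂ _+_ (h (here refl)) (∑-cong xs (\ m -> h (there m)))

 ∑-+ : ∀ (f g : A -> ℕ) xs -> ∑ (\ x -> f x + g x) xs ≡ ∑ f xs + ∑ g xs
 ∑-+ f g [] = refl
 ∑-+ f g (x ∷ xs) rewrite ∑-+ f g xs = lemma (f x) (g x) (∑ f xs) (∑ g xs)
  where
  lemma : ∀ a b c d -> a + b + (c + d) ≡ a + c + (b + d)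
  lemma = solve-∀

 ∑-* : ∀ c (f : A -> ℕ) xs -> ∑ (\ x -> c * f x) xs ≡ c * ∑ f xs
 ∑-* c f [] = sym (*-zeroʳ c)
 ∑-* c f (x ∷ xs) rewrite ∑-* c f xs = sym (*-distribˡ-+ c (f x) (∑ f xs))

 ∑-const : ∀ c xs -> ∑ (\ (_ : A) -> c) xs ≡ length xs * c
 ∑-const c [] = refl
 ∑-const c (x ∷ xs) = cong (c +_) (∑-const c xs)

 ∑-ones : ∀ xs -> ∑ (\ (_ : A) -> 1) xs ≡ length xs
 ∑-ones xs = trans (∑-const 1 xs) (*-identityʳ _)

 ∑-++ : ∀ (f : A -> ℕ) xs ys -> ∑ f (xs ++ ys) ≡ ∑ f xs + ∑ f ys
 ∑-++ f [] ys = refl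
 ∑-++ f (x ∷ xs) ys rewrite ∑-++ f xs ys = sym (+-assoc (f x) _ _)

 ∑-≤-const : ∀ {f : A -> ℕ} c xs -> (∀ {x} -> x ∈ xs -> f x ≤ c) -> ∑ f xs ≤ length xs * c
 ∑-≤-const c xs h = ≤-trans (∑-mono xs h) (≡⇒≤ (∑-const c xs))

 ⟦_⟧ₛ : LExp -> ℕ -> List ℕ -> ℕ
 ⟦ k c ⟧ₛ n ρ = c * n
 ⟦ v i ⟧ₛ n ρ = nth ρ i
 ⟦ e :+ f ⟧ₛ n ρ = ⟦ e ⟧ₛ n ρ + ⟦ f ⟧ₛ n ρ
 ⟦ c :* e ⟧ₛ n ρ = c * ⟦ e ⟧ₛ n ρ

 ∑-⟦⟧ : ∀ (fs : List (A -> ℕ)) e xs ->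
  ∑ (\ x -> ⟦ e ⟧ (map (\ f -> f x) fs)) xs ≡ ⟦ e ⟧ₛ (length xs) (map (\ f -> ∑ f xs) fs)
 ∑-⟦⟧ fs (k c) xs = trans (∑-const c xs) (*-comm _ c)
 ∑-⟦⟧ fs (v i) xs = lookup-∑ fs i
  where
  lookup-∑ : ∀ fs i -> ∑ (\ x -> nth (map (\ f -> f x) fs) i) xs ≡ nth (map (\ f -> ∑ f xs) fs) i
  lookup-∑ [] i = trans (∑-const 0 xs) (*-zeroʳ (length xs))
  lookup-∑ (f ∷ fs) zero = refl
  lookup-∑ (f ∷ fs) (suc i) = lookup-∑ fs i
 ∑-⟦⟧ fs (e :+ f) xs = trans (∑-+ _ _ xs) (cong₂ _+_ (∑-⟦⟧ fs e xs) (∑-⟦⟧ fs f xs))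
 ∑-⟦⟧ fs (c :* e) xs = trans (∑-* c _ xs) (cong (c *_) (∑-⟦⟧ fs e xs))

 -- Summing a pointwise linear inequality; its constants get multiplied by the length.
 ∑-linear : ∀ (fs : List (A -> ℕ)) (h : LIneq) xs ->
  (∀ {x} -> x ∈ xs -> ⟦ LIneq.lower h ⟧ (map (\ f -> f x) fs) ≤ ⟦ LIneq.upper h ⟧ (map (\ f -> f x) fs)) ->
  ⟦ LIneq.lower h ⟧ₛ (length xs) (map (\ f -> ∑ f xs) fs) ≤ ⟦ LIneq.upper h ⟧ₛ (length xs) (map (\ f -> ∑ f xs) fs)
 ∑-linear fs h xs p = subst₂ _≤_ (∑-⟦⟧ fs (LIneq.lower h) xs) (∑-⟦⟧ fs (LIneq.upper h) xs) (∑-mono xs p)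

 private variable
  P Q R : A -> Set

 #-mono : (P? : Decidable P) (Q? : Decidable Q) -> ∀ xs -> (∀ {x} -> x ∈ xs -> P x -> Q x) -> # P? xs ≤ # Q? xs
 #-mono P? Q? xs h = ∑-mono xs (\ {x} m -> 𝟙-mono (P? x) (Q? x) (h m))

 #-cong : (P? : Decidable P) (Q? : Decidable Q) -> ∀ xs ->
  (∀ {x} -> x ∈ xs -> P x -> Q x) -> (∀ {x} -> x ∈ xs -> Q x -> P x) -> # P? xs ≡ # Q? xs
 #-cong P? Q? xs h g = ≤-antisym (#-mono P? Q? xs h) (#-mono Q? P? xs g)

 #-⊎ : (P? : Decidable P) (Q? : Decidable Q) (R? : Decidable R) -> ∀ xs ->
  (∀ {x} -> x ∈ xs -> P x -> Q x ⊎ R x) -> # P? xs ≤ # Q? xs + # R? xs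
 #-⊎ P? Q? R? xs h = ≤-trans (∑-mono xs (\ {x} m -> 𝟙-⊎ (P? x) (Q? x) (R? x) (h m))) (≡⇒≤ (∑-+ _ _ xs))

 #-disjoint : (P? : Decidable P) (Q? : Decidable Q) (R? : Decidable R) -> ∀ xs ->
  (∀ {x} -> x ∈ xs -> P x -> R x) -> (∀ {x} -> x ∈ xs -> Q x -> R x) -> (∀ {x} -> x ∈ xs -> P x -> ¬ Q x) ->
  # P? xs + # Q? xs ≤ # R? xs
 #-disjoint P? Q? R? xs h g n = ≤-trans (≡⇒≤ (sym (∑-+ _ _ xs)))
  (∑-mono xs (\ {x} m -> 𝟙-disjoint (P? x) (Q? x) (R? x) (h m) (g m) (n m)))

 #-all : (P? : Decidable P) -> ∀ xs -> (∀ {x} -> x ∈ xs -> P x) -> # P? xs ≡ length xs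
 #-all P? [] h = refl
 #-all P? (x ∷ xs) h rewrite 𝟙-yes (P? x) (h (here refl)) = cong suc (#-all P? xs (\ m -> h (there m)))

 #-none : (P? : Decidable P) -> ∀ xs -> (∀ {x} -> x ∈ xs -> ¬ P x) -> # P? xs ≡ 0
 #-none P? [] h = refl
 #-none P? (x ∷ xs) h rewrite 𝟙-no (P? x) (h (here refl)) = #-none P? xs (\ m -> h (there m))

 #≤length : (P? : Decidable P) -> ∀ xs -> # P? xs ≤ length xs
 #≤length P? [] = z≤n
 #≤length P? (x ∷ xs) = +-mono-≤ (𝟙≤1 (P? x)) (#≤length P? xs)

 #-partition : (P? : Decidable P) (Q? : Decidable Q) -> ∀ xs ->
  # P? xs ≡ # (\ x -> P? x ×? Q? x) xs + # (\ x -> P? x ×? ¬? (Q? x)) xs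
 #-partition P? Q? xs = trans (∑-cong xs (\ {x} _ -> pointwise (P? x) (Q? x))) (∑-+ _ _ xs)
  where
  pointwise : ∀ {P Q : Set} (d : Dec P) (e : Dec Q) -> 𝟙 d ≡ 𝟙 (d ×? e) + 𝟙 (d ×? ¬? e)
  pointwise (yes p) (yes q) = refl
  pointwise (yes p) (no ¬q) = refl
  pointwise (no ¬p) e = refl

 #+#¬ : (P? : Decidable P) -> ∀ xs -> # P? xs + # (\ x -> ¬? (P? x)) xs ≡ length xs
 #+#¬ P? [] = refl
 #+#¬ P? (x ∷ xs) with P? x
 ... | yes p = cong suc (#+#¬ P? xs)
 ... | no ¬p = trans (+-suc _ _) (cong suc (#+#¬ P? xs))

 #-witness : (P? : Decidable P) -> ∀ xs -> 0 < # P? xs -> ∃ \ x -> x ∈ xs × P x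
 #-witness P? (x ∷ xs) h with P? x
 ... | yes p = x , here refl , p
 ... | no _ = let y , m , q = #-witness P? xs h in y , there m , q

 #-∈ : (P? : Decidable P) -> ∀ {x} xs -> x ∈ xs -> P x -> 1 ≤ # P? xs
 #-∈ P? (x ∷ xs) (here refl) p rewrite 𝟙-yes (P? x) p = s≤s z≤n
 #-∈ P? (y ∷ xs) (there m) p = ≤-trans (#-∈ P? xs m p) (m≤n+m _ _)

 -- Recovers membership from counting: one element of Q outside P would make Q outnumber P.
 #-subset-full : (P? : Decidable P) (Q? : Decidable Q) -> ∀ xs -> (∀ {x} -> x ∈ xs -> P x -> Q x) ->
  # Q? xs ≤ # P? xs -> ∀ {x} -> x ∈ xs -> Q x -> P x
 #-subset-full P? Q? xs h le {x} m q with P? x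
 ... | yes p = p
 ... | no ¬p = absurd le (<⇒≱ (≤-trans (+-monoʳ-≤ 1 (≤-refl {# P? xs}))
   (≤-trans (+-monoˡ-≤ (# P? xs) (#-∈ (\ y -> Q? y ×? ¬? (P? y)) xs m (q , ¬p)))
    (#-disjoint (\ y -> Q? y ×? ¬? (P? y)) P? Q? xs (\ _ -> proj₁) h (\ _ qp p -> proj₂ qp p)))))

 #-length : (P? : Decidable P) -> ∀ xs -> length (filter P? xs) ≡ # P? xs
 #-length P? [] = refl
 #-length P? (x ∷ xs) with P? x
 ... | yes _ = cong suc (#-length P? xs)
 ... | no _ = #-length P? xs

 ∑-filter : (f : A -> ℕ) (P? : Decidable P) -> ∀ xs -> ∑ f (filter P? xs) ≡ ∑ (\ x -> 𝟙 (P? x) * f x) xs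
 ∑-filter f P? [] = refl
 ∑-filter f P? (x ∷ xs) with P? x
 ... | yes _ = cong₂ _+_ (sym (+-identityʳ (f x))) (∑-filter f P? xs)
 ... | no _ = ∑-filter f P? xs

 #-filter : (P? : Decidable P) (Q? : Decidable Q) -> ∀ xs ->
  # Q? (filter P? xs) ≡ # (\ x -> P? x ×? Q? x) xs
 #-filter P? Q? [] = refl
 #-filter P? Q? (x ∷ xs) with P? x
 ... | no _ = #-filter P? Q? xs
 ... | yes _ with Q? x
 ... | yes _ = cong suc (#-filter P? Q? xs)
 ... | no _ = #-filter P? Q? xs

∑-swap : ∀ {A B : Set} (f : A -> B -> ℕ) xs ys ->
 ∑ (\ x -> ∑ (f x) ys) xs ≡ ∑ (\ y -> ∑ (\ x -> f x y) xs) ys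
∑-swap f [] ys = sym (trans (∑-const 0 ys) (*-zeroʳ (length ys)))
∑-swap f (x ∷ xs) ys = trans (cong (∑ (f x) ys +_) (∑-swap f xs ys)) (sym (∑-+ (f x) _ ys))

-- Two-coloured graphs, dense sets and twins

data Colour : Set where
 none red blue : Colour

_≟ᶜ_ : DecidableEquality Colour
none ≟ᶜ none = yes refl
none ≟ᶜ red = no \ ()
none ≟ᶜ blue = no \ ()
red ≟ᶜ none = no \ ()
red ≟ᶜ red = yes refl
red ≟ᶜ blue = no \ ()
blue ≟ᶜ none = no \ ()
blue ≟ᶜ red = no \ ()
blue ≟ᶜ blue = yes refl

search : ∀ {A : Set} {P : A -> Set} -> Decidable P -> ∀ xs -> Dec (∃ \ x -> x ∈ xs × P x)
search P? xs = map′ find (\ (x , m , p) -> lose m p) (any? P? xs)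

record ColouredGraph (V : Set) : Set where
 field
  χ : V -> V -> Colour
  χ-sym : ∀ x y -> χ x y ≡ χ y x
  χ-irrefl : ∀ x -> χ x x ≡ none

module Graphs {V : Set} (𝒢 : ColouredGraph V) where
 open ColouredGraph 𝒢 public

 Adj Red Blue Non : V -> V -> Set
 Adj x y = ¬ χ x y ≡ none
 Red x y = χ x y ≡ red
 Blue x y = χ x y ≡ blue
 Non x y = χ x y ≡ none

 Adj? : ∀ x y -> Dec (Adj x y)
 Adj? x y = ¬? (χ x y ≟ᶜ none)

 Red? : ∀ x y -> Dec (Red x y)
 Red? x y = χ x y ≟ᶜ red

 Blue? : ∀ x y -> Dec (Blue x y)
 Blue? x y = χ x y ≟ᶜ blue

 Non? : ∀ x y -> Dec (Non x y)
 Non? x y = χ x y ≟ᶜ none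

 Adj-sym : ∀ {x y} -> Adj x y -> Adj y x
 Adj-sym a n = a (trans (χ-sym _ _) n)

 χ-flip : ∀ {x y c} -> χ x y ≡ c -> χ y x ≡ c
 χ-flip e = trans (χ-sym _ _) e

 red-adj : ∀ {x y} -> Red x y -> Adj x y
 red-adj r n = absurd (trans (sym r) n) \ ()

 blue-adj : ∀ {x y} -> Blue x y -> Adj x y
 blue-adj r n = absurd (trans (sym r) n) \ ()

 red≢blue : ∀ {x y} -> Red x y -> ¬ Blue x y
 red≢blue r b = absurd (trans (sym r) b) \ ()

 colour : ∀ {x y} -> Adj x y -> Red x y ⊎ Blue x y
 colour {x} {y} a with χ x y in eq
 ... | none = absurd refl a
 ... | red = inj₁ refl
 ... | blue = inj₂ refl

 degree miss : List V -> V -> ℕ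
 degree S x = # (Adj? x) S
 miss S x = # (Non? x) S

 RedFree : Set
 RedFree = ∀ {x y z} -> Red x y -> Red y z -> Red x z -> ⊥

 Low : List V -> ℕ -> Set
 Low S μ = ∀ {x} -> x ∈ S -> miss S x ≤ μ

 miss+degree : ∀ S x -> miss S x + degree S x ≡ length S
 miss+degree S x = #+#¬ (Non? x) S

 -- A bound on independent sets in contrapositive form, so that edges can be extracted. With `Blue`
 -- for `E` it concerns sets without blue edges.
 Dense : (V -> V -> Set) -> List V -> ℕ -> Set1
 Dense E S a = ∀ {P : V -> Set} (P? : Decidable P) -> a < # P? S ->
  ∃₂ \ x y -> x ∈ S × y ∈ S × P x × P y × E x y

 dense-from-independent : ∀ {E} (E? : ∀ x y -> Dec (E x y)) S a ->
  (∀ {P : V -> Set} (P? : Decidable P) ->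
   (∀ {x y} -> x ∈ S -> y ∈ S -> P x -> P y -> ¬ E x y) -> # P? S ≤ a) -> Dense E S a
 dense-from-independent E? S a bound {P} P? a<
  with search (\ x -> P? x ×? search (\ y -> P? y ×? E? x y) S) S
 ... | yes (x , x∈ , px , y , y∈ , py , e) = x , y , x∈ , y∈ , px , py , e
 ... | no ¬edge = absurd
  (bound P? \ x∈ y∈ px py e -> ¬edge (_ , x∈ , px , _ , y∈ , py , e)) (<⇒≱ a<)

 independent-bound : ∀ {E S a} -> Dense E S a -> ∀ {P : V -> Set} (P? : Decidable P) ->
  (∀ {x y} -> x ∈ S -> y ∈ S -> P x -> P y -> ¬ E x y) -> # P? S ≤ a
 independent-bound dense P? ind = ≮⇒≥ \ a< -> let _ , _ , x∈ , y∈ , px , py , e = dense P? a< in ind x∈ y∈ px py e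

 dense-filter : ∀ {E S a} {Q : V -> Set} (Q? : Decidable Q) -> Dense E S a -> Dense E (filter Q? S) a
 dense-filter {S = S} Q? dense P? a< =
  let x , y , x∈ , y∈ , (qx , px) , (qy , py) , e =
        dense (\ x -> Q? x ×? P? x) (subst (_ <_) (#-filter Q? P? S) a<)
  in x , y , ∈-filter⁺ Q? x∈ qx , ∈-filter⁺ Q? y∈ qy , px , py , e

 Same : List V -> V -> V -> Set
 Same K u w = All (\ x -> χ x u ≡ χ x w) K

 Same? : ∀ K u w -> Dec (Same K u w)
 Same? K u w = all? (\ x -> χ x u ≟ᶜ χ x w) K

 same : ∀ {K u w x} -> Same K u w -> x ∈ K -> χ x u ≡ χ x w
 same s m = All.lookup s m

 same-sym : ∀ {K u w} -> Same K u w -> Same K w u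
 same-sym = All.map sym

 same-trans : ∀ {K u v w} -> Same K u v -> Same K v w -> Same K u w
 same-trans s t = All.zipWith (\ (p , q) -> trans p q) (s , t)

 -- Each vertex of K can be seen in three ways, which gives `3 ^ length K` classes; one of them has
 -- more than `m` members.
 pigeonhole : ∀ K S {P : V -> Set} (P? : Decidable P) m -> 3 ^ length K * m < # P? S ->
  ∃ \ u -> u ∈ S × P u × m < # (\ w -> P? w ×? Same? K u w) S
 pigeonhole [] S P? m h =
  let u , u∈ , pu = #-witness P? S (≤-<-trans z≤n h)
  in u , u∈ , pu , <-≤-trans (subst (_< # P? S) (*-identityˡ m) h) (#-mono P? _ S \ _ p -> p , [])
 pigeonhole (x ∷ K) S {P} P? m h = [ go none , [ go red , go blue ]′ ]′ split
  where
  P?c : ∀ c -> Decidable (\ w -> P w × χ x w ≡ c)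
  P?c c w = P? w ×? (χ x w ≟ᶜ c)
  cases : ∀ {w} -> w ∈ S -> 𝟙 (P? w) ≤ 𝟙 (P?c none w) + 𝟙 (P?c red w) + 𝟙 (P?c blue w)
  cases {w} _ with P? w | χ x w
  ... | no _ | _ = z≤n
  ... | yes p | none = s≤s z≤n
  ... | yes p | red = s≤s z≤n
  ... | yes p | blue = s≤s z≤n
  total : # P? S ≤ # (P?c none) S + # (P?c red) S + # (P?c blue) S
  total = ∑-linear (_ ∷ _ ∷ _ ∷ _ ∷ []) (v0 <: v1 :+ v2 :+ v3) S cases
  M = 3 ^ length K * m
  split : M < # (P?c none) S ⊎ M < # (P?c red) S ⊎ M < # (P?c blue) S
  split with M <? # (P?c none) S | M <? # (P?c red) S | M <? # (P?c blue) S
  ... | yes p | _ | _ = inj₁ p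
  ... | no _ | yes p | _ = inj₂ (inj₁ p)
  ... | no _ | no _ | yes p = inj₂ (inj₂ p)
  ... | no p | no q | no s = absurd h (≤⇒≯ (≤-trans total
    (lin ((# (P?c none) S) ∷ M ∷ (# (P?c red) S) ∷ (# (P?c blue) S) ∷ (3 ^ length (x ∷ K) * m) ∷ []) (v0 :+ v2 :+ v3 <: v4) (v0 <: v1 by ≮⇒≥ p & v2 <: v1 by ≮⇒≥ q & v3 <: v1 by ≮⇒≥ s & 3 :* v1 <: v4 by≡ sym (*-assoc 3 (3 ^ length K) m) & □))))
  go : ∀ c -> M < # (P?c c) S -> ∃ \ u -> u ∈ S × P u × m < # (\ w -> P? w ×? Same? (x ∷ K) u w) S
  go c h' =
   let u , u∈ , (pu , e) , large = pigeonhole K S (P?c c) m h'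
   in u , u∈ , pu , <-≤-trans large (#-mono _ _ S \ _ ((p , e') , s) -> p , trans e (sym e') ∷ s)

 -- Density applies inside a single class of vertices that see K alike, so the twins are joined by
 -- an edge of the prescribed kind.
 twins : ∀ {E S a} -> Dense E S a -> ∀ K {P : V -> Set} (P? : Decidable P) -> 3 ^ length K * a < # P? S ->
  ∃₂ \ u w -> u ∈ S × w ∈ S × P u × P w × E u w × Same K u w
 twins {S = S} {a} dense K P? h =
  let c , _ , _ , large = pigeonhole K S P? a h
      u , w , u∈ , w∈ , (pu , su) , (pw , sw) , e = dense (\ w -> P? w ×? Same? K c w) large
  in u , w , u∈ , w∈ , pu , pw , e , same-trans (same-sym su) sw

 misses reds blues : List V -> V -> ℕ
 misses K w = # (\ x -> Non? x w) K
 reds K w = # (\ x -> Red? x w) K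
 blues K w = # (\ x -> Blue? x w) K

 colours-total : ∀ K w -> misses K w + reds K w + blues K w ≡ length K
 colours-total K w = trans (sym (trans (∑-+ _ _ K) (cong (_+ blues K w) (∑-+ _ _ K))))
  (trans (∑-cong K (\ {x} _ -> one (χ x w))) (∑-ones K))
  where
  one : ∀ c -> 𝟙 (c ≟ᶜ none) + 𝟙 (c ≟ᶜ red) + 𝟙 (c ≟ᶜ blue) ≡ 1
  one none = refl
  one red = refl
  one blue = refl

 ∑-misses : ∀ K S -> ∑ (misses K) S ≡ ∑ (miss S) K
 ∑-misses K S = ∑-swap (\ w x -> 𝟙 (Non? x w)) S K

 ∑-misses-≤ : ∀ {μ} K S -> All (\ x -> miss S x ≤ μ) K -> ∑ (misses K) S ≤ length K * μ
 ∑-misses-≤ {μ} K S h = ≤-trans (≡⇒≤ (∑-misses K S)) (∑-≤-const μ K (All.lookup h))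

 Clique : List V -> Set
 Clique = AllPairs Adj

 visible : V -> List V -> List V
 visible u = filter (\ x -> Adj? x u)

 visible-∈ : ∀ {u x} K -> x ∈ visible u K -> x ∈ K × Adj x u
 visible-∈ {u} K = ∈-filter⁻ (\ x -> Adj? x u)

 visible-misses : ∀ u K -> misses K u + length (visible u K) ≡ length K
 visible-misses u K = trans (cong (misses K u +_) (#-length (\ x -> Adj? x u) K)) (#+#¬ (\ x -> Non? x u) K)

 visible-clique : ∀ {u K} -> Clique K -> Clique (u ∷ visible u K)
 visible-clique {u} {K} c =
  All.tabulate (\ m -> Adj-sym (proj₂ (visible-∈ K m))) ∷ AllPairs.filter⁺ (\ x -> Adj? x u) c

 same-adj : ∀ {K u w x} -> Same K u w -> x ∈ K -> Adj x u -> Adj x w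
 same-adj s m a n = a (trans (same s m) n)

 -- Both twins see the same vertices of K, so both can be added to what is left when the missed
 -- vertices are removed.
 twin-clique : ∀ {u w K} -> Clique K -> Adj u w -> Same K u w -> Clique (u ∷ w ∷ visible u K)
 twin-clique {u} {w} {K} c a s with visible-clique {u} c
 ... | h ∷ t = (a ∷ h) ∷ All.tabulate (\ m -> Adj-sym (same-adj s (proj₁ (visible-∈ K m)) (proj₂ (visible-∈ K m)))) ∷ t

 twin-all : ∀ {Q : V -> Set} {u w K} -> Q u -> Q w -> All Q K -> All Q (u ∷ w ∷ visible u K)
 twin-all {u = u} {K = K} qu qw h = qu ∷ qw ∷ All.filter⁺ (\ x -> Adj? x u) h

 -- Cliques grow as long as their vertices cannot all miss two of the clique on average.
 grow : ∀ {S a μ} -> Dense Adj S a -> Low S μ -> ∀ m ->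
  m * μ + 2 * (3 ^ m * a) < 2 * length S -> ∃ \ K -> m < length K × Clique K × All (_∈ S) K
 grow-step : ∀ {S a μ} -> Dense Adj S a -> Low S μ -> ∀ m ->
  m * μ + 2 * (3 ^ m * a) < 2 * length S -> ∀ K -> Clique K -> All (_∈ S) K -> m ≤ length K ->
  ∃ \ K -> m < length K × Clique K × All (_∈ S) K

 grow dense low zero h = grow-step dense low zero h [] [] [] z≤n
 grow {S} {a} {μ} dense low (suc m) h =
  let K , m< , c , K⊆ = grow dense low m (≤-<-trans
        (+-mono-≤ (m≤n+m (m * μ) μ) (*-monoʳ-≤ 2 (*-monoˡ-≤ a (m≤m+n (3 ^ m) _)))) h)
  in grow-step dense low (suc m) h K c K⊆ m<

 grow-step {S} {a} {μ} dense low m h K c K⊆ m≤ with m <? length K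
 ... | yes m< = K , m< , c , K⊆
 ... | no m≮ with ≤-antisym m≤ (≮⇒≥ m≮)
 ... | refl with 3 ^ m * a <? # (\ w -> misses K w ≤? 1) S
 ... | yes large =
  let u , w , u∈ , w∈ , few , _ , e , s = twins dense K (\ w -> misses K w ≤? 1) large
  in u ∷ w ∷ visible u K
   , (lin ((misses K u) ∷ (length K) ∷ (length (visible u K)) ∷ []) (k 1 :+ v1 <: k 2 :+ v2) (v0 <: k 1 by few & v1 <: v0 :+ v2 by≡ sym (visible-misses u K) & □))
   , twin-clique c e s , twin-all u∈ w∈ K⊆
 ... | no small = absurd h (≤⇒≯
  (lin ((length S) ∷ (∑ (misses K) S) ∷ (# (\ w -> misses K w ≤? 1) S) ∷ (3 ^ m * a) ∷ (m * μ) ∷ []) (2 :* v0 <: v4 :+ 2 :* v3) (2 :* v0 <: v1 :+ 2 :* v2 by pointwise-sum & v2 <: v3 by 2 · ≮⇒≥ small & v1 <: v4 by ∑-misses-≤ K S (All.map low K⊆) & □)))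
  where
  pointwise : ∀ {w} -> w ∈ S -> 2 ≤ misses K w + 2 * 𝟙 (misses K w ≤? 1)
  pointwise {w} _ with misses K w ≤? 1
  ... | yes _ = m≤n+m 2 (misses K w)
  ... | no p = ≤-trans (≰⇒> p) (m≤m+n _ _)
  pointwise-sum : 2 * length S ≤ ∑ (misses K) S + 2 * # (\ w -> misses K w ≤? 1) S
  pointwise-sum = ∑-linear (misses K ∷ (\ w -> 𝟙 (misses K w ≤? 1)) ∷ []) (k 2 <: v0 :+ 2 :* v1) S pointwise

-- Bounds one summand from below when the others are at most M; the extra M on the left avoids
-- subtracting 1 from the length.
∑-other : ∀ {A : Set} (f : A -> ℕ) M xs -> (∀ {x} -> x ∈ xs -> f x ≤ M) -> ∀ {x} -> x ∈ xs ->
 ∑ f xs + M ≤ f x + length xs * M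
∑-other f M (x ∷ xs) h (here refl) =
 (lin ((∑ f xs) ∷ (length xs * M) ∷ (f x) ∷ M ∷ []) (v2 :+ v0 :+ v3 <: v2 :+ (v3 :+ v1)) (v0 <: v1 by (∑-≤-const M xs (\ m -> h (there m))) & □))
∑-other f M (y ∷ xs) h {x} (there m) =
 (lin ((∑ f xs) ∷ M ∷ (f x) ∷ (length xs * M) ∷ (f y) ∷ []) (v4 :+ v0 :+ v1 <: v2 :+ (v1 :+ v3)) (v0 :+ v1 <: v2 :+ v3 by (∑-other f M xs (\ m -> h (there m)) m) & v4 <: v1 by h (here refl) & □))

#-exclusive : ∀ {A : Set} {P : A -> Set} (P? : Decidable P) xs -> AllPairs (\ x y -> P x -> ¬ P y) xs -> # P? xs ≤ 1
#-exclusive P? [] _ = z≤n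
#-exclusive P? (x ∷ xs) (h ∷ hs) with P? x
... | yes p = s≤s (≡⇒≤ (#-none P? xs \ m -> All.lookup h m p))
... | no _ = #-exclusive P? xs hs

2xy≤x²+y² : ∀ x y -> 2 * (x * y) ≤ x * x + y * y
2xy≤x²+y² x y = [ go , (\ p -> subst₂ _≤_ (cong (2 *_) (*-comm y x)) (+-comm (y * y) (x * x)) (go p)) ]′ (≤-total x y)
 where
 expand : ∀ a d -> a * a + (a + d) * (a + d) ≡ 2 * (a * (a + d)) + d * d
 expand = solve-∀
 go : ∀ {a b} -> a ≤ b -> 2 * (a * b) ≤ a * a + b * b
 go {a} {b} p with m≤n⇒∃[o]m+o≡n p
 ... | d , refl = ≤-trans (m≤m+n _ (d * d)) (≡⇒≤ (sym (expand a d)))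

-- Induction on the list. The cross term `2 f(x) s` is estimated after multiplication by the length
-- `l`, by the inequality of the means for `l f(x)` and `s` together with the induction hypothesis
-- `s² ≤ l q`.
cauchy-schwarz : ∀ {A : Set} (f : A -> ℕ) xs -> ∑ f xs * ∑ f xs ≤ length xs * ∑ (\ x -> f x * f x) xs
cauchy-schwarz f [] = z≤n
cauchy-schwarz f (x ∷ xs) = subst₂ _≤_ (sym (expand (f x) s)) (sym (distribute (f x) l q)) (
 (lin ((f x * s) ∷ (l * (f x * f x)) ∷ q ∷ (s * s) ∷ (l * q) ∷ (f x * f x) ∷ []) (v5 :+ 2 :* v0 :+ v3 <: v5 :+ v1 :+ v2 :+ v4) (2 :* v0 <: v1 :+ v2 by cross l refl & v3 <: v4 by cauchy-schwarz f xs & □)))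
 where
 s = ∑ f xs
 l = length xs
 q = ∑ (\ x -> f x * f x) xs
 expand : ∀ a b -> (a + b) * (a + b) ≡ a * a + 2 * (a * b) + b * b
 expand = solve-∀
 distribute : ∀ a l q -> (1 + l) * (a * a + q) ≡ a * a + l * (a * a) + q + l * q
 distribute = solve-∀
 square : ∀ l a s -> l * (2 * (a * s)) ≡ 2 * (l * a * s)
 square = solve-∀
 -- The length is abstracted to `m` because cancelling it needs a positive number; for an empty tail
 -- the sum `s` vanishes.
 cross : ∀ m -> m ≡ l -> 2 * (f x * s) ≤ m * (f x * f x) + q
 cross zero eq = subst (\ t -> 2 * (f x * t) ≤ q) (sym (n≤0⇒n≡0 empty))
  (≤-trans (≡⇒≤ (cong (2 *_) (*-zeroʳ (f x)))) z≤n)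
  where
  empty : s ≤ 0
  empty = vanish xs (sym eq)
   where
   vanish : ∀ ys -> length ys ≡ 0 -> ∑ f ys ≤ 0
   vanish [] _ = z≤n
 cross (suc m) eq = *-cancelˡ-≤ (suc m) (begin
  suc m * (2 * (f x * s)) ≡⟨ square (suc m) (f x) s ⟩
  2 * (suc m * f x * s) ≤⟨ 2xy≤x²+y² (suc m * f x) s ⟩
  suc m * f x * (suc m * f x) + s * s ≤⟨ +-monoʳ-≤ _ (subst (\ l -> s * s ≤ l * q) (sym eq) (cauchy-schwarz f xs)) ⟩
  suc m * f x * (suc m * f x) + suc m * q ≡⟨ regroup (suc m) (f x) q ⟩
  suc m * (suc m * (f x * f x) + q) ∎)
  where
  regroup : ∀ l a q -> l * a * (l * a) + l * q ≡ l * (l * (a * a) + q)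
  regroup = solve-∀

-- Counting edges through a partition

module Partitions {V : Set} (𝒢 : ColouredGraph V) (S : List V) where
 open Graphs 𝒢

 degrees : ℕ
 degrees = ∑ (degree S) S

 -- `degrees` is twice the number of edges; after division by r this reads
 -- `2|E| ≤ (1 - 1/r)|S|² + X`.
 TuránBound : ℕ -> ℕ -> Set
 TuránBound r X = r * degrees + length S * length S ≤ r * (length S * length S) + r * X

 -- By Cauchy-Schwarz at least `|S|² / r` ordered pairs lie in a common part, and at most X of these
 -- are edges.
 turán-count : ∀ {r} (part : V -> Fin r) X ->
  ∑ (\ x -> # (\ y -> Adj? x y ×? (part x Fin.≟ part y)) S) S ≤ X -> TuránBound r X
 turán-count {r} part X inner = begin
  r * degrees + n * n ≤⟨ +-monoʳ-≤ (r * degrees) squares ⟩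
  r * degrees + r * ∑ same-part S ≡⟨ *-distribˡ-+ r degrees _ ⟨
  r * (degrees + ∑ same-part S) ≤⟨ *-monoʳ-≤ r total ⟩
  r * (n * n + X) ≡⟨ *-distribˡ-+ r (n * n) X ⟩
  r * (n * n) + r * X ∎
  where
  n = length S
  same-part : V -> ℕ
  same-part x = # (\ y -> part x Fin.≟ part y) S
  inside : V -> ℕ
  inside x = # (\ y -> Adj? x y ×? (part x Fin.≟ part y)) S
  vertex : ∀ {x} -> x ∈ S -> degree S x + same-part x ≤ n + inside x
  vertex {x} _ = subst (degree S x + same-part x ≤_) (cong (_+ inside x) (∑-ones S))
   (∑-linear ((\ y -> 𝟙 (Adj? x y)) ∷ (\ y -> 𝟙 (part x Fin.≟ part y)) ∷ (\ _ -> 1) ∷ (\ y -> 𝟙 (Adj? x y ×? (part x Fin.≟ part y))) ∷ [])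
    (v0 :+ v1 <: v2 :+ v3) S (\ {y} _ -> both (Adj? x y) (part x Fin.≟ part y)))
   where
   both : ∀ {P Q : Set} (d : Dec P) (e : Dec Q) -> 𝟙 d + 𝟙 e ≤ 1 + 𝟙 (d ×? e)
   both (yes _) (yes _) = ≤-refl
   both (yes _) (no _) = ≤-refl
   both (no _) e = ≤-trans (𝟙≤1 e) (m≤m+n 1 _)
  total : degrees + ∑ same-part S ≤ n * n + X
  total = ≤-trans (subst (degrees + ∑ same-part S ≤_) (cong (_+ ∑ inside S) (∑-const n S))
   (∑-linear (degree S ∷ same-part ∷ (\ _ -> n) ∷ inside ∷ []) (v0 :+ v1 <: v2 :+ v3) S vertex)) (+-monoʳ-≤ (n * n) inner)
  p : Fin r -> ℕ
  p i = # (\ y -> part y Fin.≟ i) S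
  indicator : ∀ j -> ∑ (\ i -> 𝟙 (j Fin.≟ i)) (allFin r) ≡ 1
  indicator j = ≤-antisym
   (#-exclusive (j Fin.≟_) (allFin r) (AllPairs.map (\ ne e f -> ne (trans (sym e) f)) (allFin⁺ r)))
   (#-∈ (j Fin.≟_) (allFin r) (∈-allFin j) refl)
  sum-p : ∑ p (allFin r) ≡ n
  sum-p = trans (∑-swap (\ i y -> 𝟙 (part y Fin.≟ i)) (allFin r) S)
   (trans (∑-cong S \ {y} _ -> indicator (part y)) (∑-ones S))
  squares-p : ∑ (\ i -> p i * p i) (allFin r) ≤ ∑ same-part S
  squares-p = begin
   ∑ (\ i -> p i * p i) (allFin r)
    ≡⟨ ∑-cong (allFin r) (\ {i} _ -> trans (sym (∑-* (p i) _ S)) (∑-cong S \ {x} _ -> *-comm (p i) _)) ⟩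
   ∑ (\ i -> ∑ (\ x -> 𝟙 (part x Fin.≟ i) * p i) S) (allFin r)
    ≡⟨ ∑-swap (\ i x -> 𝟙 (part x Fin.≟ i) * p i) (allFin r) S ⟩
   ∑ (\ x -> ∑ (\ i -> 𝟙 (part x Fin.≟ i) * p i) (allFin r)) S
    ≤⟨ ∑-mono S (\ {x} _ -> ∑-mono (allFin r) \ {i} _ -> select x i) ⟩
   ∑ (\ x -> ∑ (\ i -> 𝟙 (part x Fin.≟ i) * same-part x) (allFin r)) S
    ≡⟨ ∑-cong S (\ {x} _ -> trans (trans (∑-cong (allFin r) \ {i} _ -> *-comm _ (same-part x)) (∑-* (same-part x) _ (allFin r)))
      (trans (cong (same-part x *_) (indicator (part x))) (*-identityʳ _))) ⟩
   ∑ same-part S ∎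
   where
   select : ∀ x i -> 𝟙 (part x Fin.≟ i) * p i ≤ 𝟙 (part x Fin.≟ i) * same-part x
   select x i with part x Fin.≟ i
   ... | no _ = z≤n
   ... | yes e = *-monoʳ-≤ 1 (#-mono _ _ S \ _ e' -> trans e (sym e'))
  squares : n * n ≤ r * ∑ same-part S
  squares = begin
   n * n ≡⟨ cong₂ _*_ sum-p sum-p ⟨
   ∑ p (allFin r) * ∑ p (allFin r) ≤⟨ cauchy-schwarz p (allFin r) ⟩
   length (allFin r) * ∑ (\ i -> p i * p i) (allFin r) ≤⟨ *-monoʳ-≤ (length (allFin r)) squares-p ⟩
   length (allFin r) * ∑ same-part S ≡⟨ cong (_* ∑ same-part S) (length-tabulate {n = r} (\ i -> i)) ⟩
   r * ∑ same-part S ∎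

-- Splitting a set without large cliques into sparse parts

module Structure {V : Set} (𝒢 : ColouredGraph V) (S : List V) (a μ : ℕ)
 (dense : Graphs.Dense 𝒢 (Graphs.Adj 𝒢) S a) (low : Graphs.Low 𝒢 S μ) where
 open Graphs 𝒢
 open Partitions 𝒢 S

 -- The sets need not cover S. As vertices miss at most μ others, a part of nearly μ vertices with
 -- few inner edges uses up almost all vertices that its members miss.
 record Parts (r τ : ℕ) : Set1 where
  field
   U : Fin r -> V -> Set
   U? : ∀ i w -> Dec (U i w)
   disjoint : ∀ {i j w} -> U i w -> U j w -> i ≡ j
   large : ∀ i -> μ ≤ # (U? i) S + τ
   sparse : ∀ {i x} -> x ∈ S -> U i x -> # (\ w -> Adj? x w ×? U? i w) S ≤ a

  -- At least `μ - τ - θ` of the at most μ vertices missed by x lie in part i.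
  few-outside : ∀ θ i {x} -> x ∈ S -> # (\ w -> Adj? x w ×? U? i w) S ≤ θ ->
   # (\ w -> Non? x w ×? ¬? (U? i w)) S ≤ τ + θ
  few-outside θ i {x} x∈ h =
   (lin ((miss S x) ∷ μ ∷ (# (U? i) S) ∷ τ ∷ (# (\ w -> Adj? x w ×? U? i w) S) ∷ θ ∷ (# (\ w -> Non? x w ×? U? i w) S) ∷ (# (\ w -> Non? x w ×? ¬? (U? i w)) S) ∷ []) (v7 <: v3 :+ v5) (v0 <: v1 by low x∈ & v1 <: v2 :+ v3 by large i & v4 <: v5 by h & v2 <: v4 :+ v6 by covered & v6 :+ v7 <: v0 by≡ sym (#-partition (Non? x) (U? i) S) & □))
   where
   covered : # (U? i) S ≤ # (\ w -> Adj? x w ×? U? i w) S + # (\ w -> Non? x w ×? U? i w) S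
   covered = #-⊎ (U? i) _ _ S \ {w} _ u -> case (Non? x w) u
    where
    case : ∀ {w} -> Dec (Non x w) -> U i w -> (Adj x w × U i w) ⊎ (Non x w × U i w)
    case (yes n) u = inj₂ (n , u)
    case (no a) u = inj₁ (a , u)

  loss : ∀ i {j x} ε -> # (\ w -> Non? x w ×? ¬? (U? i w)) S ≤ ε -> i ≢ j ->
   ∀ {P : V -> Set} (P? : Decidable P) ->
   # (\ w -> U? j w ×? P? w) S ≤ # (\ w -> U? j w ×? (Adj? x w ×? P? w)) S + ε
  loss i {j} {x} ε h i≢j P? = ≤-trans
   (#-⊎ (\ w -> U? j w ×? P? w) (\ w -> U? j w ×? (Adj? x w ×? P? w)) (\ w -> Non? x w ×? ¬? (U? i w)) S
    \ {w} _ (u , p) -> [ (\ n -> inj₂ (n , \ u' -> i≢j (disjoint u' u))) , (\ e -> inj₁ (u , e , p)) ]′ (dec w))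
   (+-monoʳ-≤ _ h)
   where
   dec : ∀ w -> Non x w ⊎ Adj x w
   dec w with Non? x w
   ... | yes n = inj₁ n
   ... | no e = inj₂ e

  Common? : ∀ L -> Decidable (\ w -> All (\ x -> Adj x w) L)
  Common? L w = all? (\ x -> Adj? x w) L

  -- More than a candidates contain an edge, so each part supplies two adjacent vertices. Each of
  -- these costs at most 2τ candidates in every other part, hence 4τ for the pair.
  greedy : a ≤ τ -> ∀ js -> AllPairs _≢_ js -> ∀ L -> Clique L -> All (_∈ S) L ->
   (∀ {i} -> i ∈ js -> a + length js * (4 * τ) < # (\ w -> U? i w ×? Common? L w) S) ->
   ∃ \ K -> Clique K × All (_∈ S) K × length K ≡ length L + 2 * length js
  greedy a≤τ [] _ L c L⊆ h = L , c , L⊆ , sym (+-identityʳ _)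
  greedy a≤τ (i ∷ js) (i∉ ∷ u) L c L⊆ h =
   let x , y , x∈ , y∈ , (ux , cx) , (uy , cy) , e = dense _ (≤-<-trans (m≤m+n a _) (h (here refl)))
       near : ∀ {x} -> x ∈ S -> U i x -> # (\ w -> Non? x w ×? ¬? (U? i w)) S ≤ 2 * τ
       near x∈ ux = (lin ((# (\ w -> Non? _ w ×? ¬? (U? i w)) S) ∷ τ ∷ a ∷ []) (v0 <: 2 :* v1) (v0 <: v1 :+ v2 by few-outside a i x∈ (sparse x∈ ux) & v2 <: v1 by a≤τ & □))
       rest : ∀ {j} -> j ∈ js -> a + length js * (4 * τ) < # (\ w -> U? j w ×? Common? (x ∷ y ∷ L) w) S
       rest {j} m = (lin (a ∷ τ ∷ (length js * (4 * τ)) ∷ (# (\ w -> U? j w ×? Common? L w) S) ∷ (# (\ w -> U? j w ×? (Adj? y w ×? Common? L w)) S) ∷ (# (\ w -> U? j w ×? (Adj? x w ×? (Adj? y w ×? Common? L w))) S) ∷ (# (\ w -> U? j w ×? Common? (x ∷ y ∷ L) w) S) ∷ []) (k 1 :+ (v0 :+ v2) <: v6) (k 1 :+ (v0 :+ (4 :* v1 :+ v2)) <: v3 by h (there m) & v3 <: v4 :+ 2 :* v1 by loss i (2 * τ) (near y∈ uy) (All.lookup i∉ m) (Common? L) & v4 <: v5 :+ 2 :* v1 by (loss i (2 * τ) (near x∈ ux) (All.lookup i∉ m) (\ w -> Adj? y w ×? Common? L w)) & v5 <: v6 by (#-mono _ (\ w -> U? j w ×? Common? (x ∷ y ∷ L)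 w) S (\ _ (u , p , q , s) -> u , p ∷ q ∷ s)) & □))
       K , ck , K⊆ , len = greedy a≤τ js u (x ∷ y ∷ L) ((e ∷ All.map Adj-sym cx) ∷ (All.map Adj-sym cy) ∷ c) (x∈ ∷ y∈ ∷ L⊆) rest
   in K , ck , K⊆ , trans len (shift (length L) (length js))
   where
   shift : ∀ l j -> 2 + l + 2 * j ≡ l + 2 * (1 + j)
   shift = solve-∀

 open Parts

 -- If S has no clique on 2r+1 vertices, then no vertex sees much of all r parts; put it into a part it hardly sees. No part contains a triangle, because a
 -- triangle of the i-th part would extend by two vertices from each of the others.
 clique-free-bound : ∀ {r τ} -> Parts (suc r) τ -> a ≤ τ -> 5 * (a + suc r * (4 * τ)) < μ ->
  (∀ K -> Clique K -> All (_∈ S) K -> length K ≤ 2 * suc r) ->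
  TuránBound (suc r) (length S * a)
 clique-free-bound {r} {τ} 𝒫 a≤τ big ω = turán-count part (length S * a) (∑-≤-const a S inside)
  where
  θ = a + suc r * (4 * τ)
  seen : V -> Fin (suc r) -> ℕ
  seen x i = # (\ w -> Adj? x w ×? U? 𝒫 i w) S
  pick : ∀ x -> Dec (∃ \ i -> i ∈ allFin (suc r) × seen x i ≤ θ)
  pick x = search (\ i -> seen x i ≤? θ) (allFin (suc r))
  part : V -> Fin (suc r)
  part x with pick x
  ... | yes (i , _) = i
  ... | no _ = zero
  all-fins : length (allFin (suc r)) ≡ suc r
  all-fins = length-tabulate {n = suc r} (\ i -> i)
  part-seen : ∀ {x} -> x ∈ S -> seen x (part x) ≤ θ
  part-seen {x} x∈ with pick x
  ... | yes (i , _ , p) = p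
  ... | no ¬p =
   let K , c , K⊆ , len = greedy 𝒫 a≤τ (allFin (suc r)) (allFin⁺ (suc r)) (x ∷ []) ([] ∷ []) (x∈ ∷ [])
         \ {i} _ -> subst (\ l -> a + l * (4 * τ) < # (\ w -> U? 𝒫 i w ×? Common? 𝒫 (x ∷ []) w) S) (sym all-fins)
           (<-≤-trans (≰⇒> (\ p -> ¬p (i , ∈-allFin i , p))) (#-mono _ _ S \ _ (e , u) -> u , e ∷ []))
   in absurd (ω K c K⊆)
    (<⇒≱ (subst (2 * suc r <_) (sym len) (subst (\ l -> 2 * suc r < 1 + 2 * l) (sym all-fins) ≤-refl)))
  no-triangle : ∀ {x y z} -> x ∈ S -> y ∈ S -> z ∈ S -> part x ≡ part y -> part x ≡ part z ->
   Adj x y -> Adj x z -> Adj y z -> ⊥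
  no-triangle {x} {y} {z} x∈ y∈ z∈ xy xz exy exz eyz =
   let K , c , K⊆ , len = greedy 𝒫 a≤τ js (AllPairs.filter⁺ (\ j -> ¬? (i Fin.≟ j)) (allFin⁺ (suc r)))
         (x ∷ y ∷ z ∷ []) ((exy ∷ exz ∷ []) ∷ (eyz ∷ []) ∷ [] ∷ []) (x∈ ∷ y∈ ∷ z∈ ∷ []) common
   in absurd (ω K c K⊆) (<⇒≱ (lin ((length js) ∷ (length K) ∷ (suc r) ∷ []) (k 1 :+ 2 :* v2 <: v1) (k 3 :+ 2 :* v0 <: v1 by≡ sym len & v2 <: k 1 :+ v0 by 2 · js-length & □)))
   where
   i = part x
   js = filter (\ j -> ¬? (i Fin.≟ j)) (allFin (suc r))
   few : ∀ {w} -> w ∈ S -> i ≡ part w -> # (\ v -> Non? w v ×? ¬? (U? 𝒫 i v)) S ≤ τ + θ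
   few {w} w∈ e = few-outside 𝒫 θ i w∈ (subst (\ j -> seen w j ≤ θ) (sym e) (part-seen w∈))
   js-length : suc r ≤ 1 + length js
   js-length = (lin ((# (\ j -> ¬? (i Fin.≟ j)) (allFin (suc r))) ∷ (length js) ∷ (length (allFin (suc r))) ∷ (# (i Fin.≟_) (allFin (suc r))) ∷ (suc r) ∷ []) (v4 <: k 1 :+ v1) (v0 <: v1 by≡ sym (#-length (\ j -> ¬? (i Fin.≟ j)) (allFin (suc r))) & v2 <: v3 :+ v0 by≡ sym (#+#¬ (i Fin.≟_) (allFin (suc r))) & v4 <: v2 by≡ sym all-fins & v3 <: k 1 by (#-exclusive (i Fin.≟_) (allFin (suc r)) (AllPairs.map (\ ne e f -> ne (trans (sym e) f)) (allFin⁺ (suc r)))) & □))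
   js-bound : length js * (4 * τ) ≤ suc r * (4 * τ)
   js-bound = *-monoˡ-≤ (4 * τ) (subst (length js ≤_) all-fins (≤-trans (≡⇒≤ (#-length (\ j -> ¬? (i Fin.≟ j)) (allFin (suc r)))) (#≤length _ (allFin (suc r)))))
   τ≤ : 4 * τ ≤ suc r * (4 * τ)
   τ≤ = m≤m+n (4 * τ) _
   common : ∀ {j} -> j ∈ js -> a + length js * (4 * τ) < # (\ w -> U? 𝒫 j w ×? Common? 𝒫 (x ∷ y ∷ z ∷ []) w) S
   -- The part may fall short of μ by τ and each of the three vertices costs `τ + θ`. This is
   -- `4τ + 3θ`, at most `4θ`, and since μ exceeds `5θ`, more than θ candidates remain.
   common {j} m = (lin (a ∷ (suc r * (4 * τ)) ∷ μ ∷ (length js * (4 * τ)) ∷ τ ∷ (# (U? 𝒫 j) S) ∷ (# (\ w -> U? 𝒫 j w ×? yes tt) S) ∷ (# (\ w -> U? 𝒫 j w ×? (Adj? x w ×? yes tt)) S) ∷ (# (\ w -> U? 𝒫 j w ×? (Adj? y w ×? (Adj? x w ×? yes tt))) S) ∷ (# (\ w -> U? 𝒫 j w ×? (Adj? z w ×? (Adj? y w ×? (Adj? x w ×? yes tt)))) S) ∷ (# (\ w -> U? 𝒫 j w ×? Common? 𝒫 (x ∷ y ∷ z ∷ []) w) S) ∷ []) (k 1 :+ (v0 :+ v3) <: v10) (k 1 :+ 5 :* (v0 :+ v1) <: v2 by big & v3 <: v1 by js-bound & 4 :* v4 <: v1 by τ≤ & v2 <: v5 :+ v4 by large 𝒫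 j & v5 <: v6 by (#-mono (U? 𝒫 j) (\ w -> U? 𝒫 j w ×? yes tt) S (\ _ u -> u , tt)) & v6 <: v7 :+ (v4 :+ (v0 :+ v1)) by (loss 𝒫 i _ (few x∈ refl) i≢j (\ _ -> yes tt)) & v7 <: v8 :+ (v4 :+ (v0 :+ v1)) by (loss 𝒫 i _ (few y∈ xy) i≢j (\ w -> Adj? x w ×? yes tt)) & v8 <: v9 :+ (v4 :+ (v0 :+ v1)) by (loss 𝒫 i _ (few z∈ xz) i≢j (\ w -> Adj? y w ×? (Adj? x w ×? yes tt))) & v9 <: v10 by (#-mono _ (\ w -> U? 𝒫 j w ×? Common? 𝒫 (x ∷ y ∷ z ∷ []) w) S (\ _ (u , p , q , s , _) -> u , s ∷ q ∷ p ∷ [])) & □))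
    where
    i≢j = proj₂ (∈-filter⁻ (\ j -> ¬? (i Fin.≟ j)) {xs = allFin (suc r)} m)
  inside : ∀ {x} -> x ∈ S -> # (\ y -> Adj? x y ×? (part x Fin.≟ part y)) S ≤ a
  inside {x} x∈ = independent-bound dense _ \ y∈ z∈ (exy , xy) (exz , xz) eyz -> no-triangle x∈ y∈ z∈ xy xz exy exz eyz

-- The error τ pays 20σ for each part and, in its second term, for choosing representatives among
-- `3 ^ (2 * suc r)` classes.
module PartsExist {V : Set} (𝒢 : ColouredGraph V) (S : List V) (a μ : ℕ)
 (dense : Graphs.Dense 𝒢 (Graphs.Adj 𝒢) S a) (low : Graphs.Low 𝒢 S μ)
 (r σ τ : ℕ) (rμ : suc r * μ ≤ length S + σ) (aσ : 3 ^ (2 * suc r) * a ≤ σ)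
 (hτ : suc r * (20 * σ) + 40 * (3 ^ (2 * suc r) * σ) ≤ τ) (τ<μ : τ < μ)
 (ω : ∀ K -> Graphs.Clique 𝒢 K -> All (_∈ S) K -> length K ≤ 2 * suc r) where
 open Graphs 𝒢
 open Structure 𝒢 S a μ dense low

 private
  N = length S
  C = 3 ^ (2 * suc r)

  C≥1 : 1 ≤ C
  C≥1 = >-nonZero⁻¹ C {{m^n≢0 3 (2 * suc r)}}

  a≤σ : a ≤ σ
  a≤σ = ≤-trans (subst (_≤ C * a) (*-identityˡ a) (*-monoˡ-≤ a C≥1)) aσ

  σ≤Cσ : σ ≤ C * σ
  σ≤Cσ = subst (_≤ C * σ) (*-identityˡ σ) (*-monoˡ-≤ σ C≥1)

 -- Almost every vertex misses exactly two vertices of a largest clique.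
 module _ {K} (c : Clique K) (K⊆ : All (_∈ S) K) (K-length : length K ≡ 2 * suc r) where

  few-misses : # (\ w -> misses K w ≤? 1) S ≤ σ
  few-misses = ≮⇒≥ \ σ< ->
   let u , w , u∈ , w∈ , few , _ , e , s = twins dense K (\ w -> misses K w ≤? 1)
         (≤-<-trans (subst (\ l -> 3 ^ l * a ≤ σ) (sym K-length) aσ) σ<)
   in absurd (ω _ (twin-clique c e s) (twin-all u∈ w∈ K⊆)) (<⇒≱ (
    (lin ((misses K u) ∷ (length K) ∷ (length (visible u K)) ∷ (suc r) ∷ []) (k 1 :+ 2 :* v3 <: k 2 :+ v2) (v0 <: k 1 by few & v1 <: v0 :+ v2 by≡ sym (visible-misses u K) & 2 :* v3 <: v1 by≡ sym K-length & □))))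

  -- The clique is missed at most `2 * suc r * μ` times in all, which is at most `2N + 2σ`. With at
  -- most σ vertices missing fewer than two, there is room for only 5σ that deviate from two.
  atypical : # (\ w -> ¬? (misses K w ≟ 2)) S ≤ 5 * σ
  atypical = (lin (N ∷ (# (\ w -> ¬? (misses K w ≟ 2)) S) ∷ (∑ (misses K) S) ∷ (# (\ w -> misses K w ≤? 1) S) ∷ σ ∷ (suc r * μ) ∷ []) (v1 <: 5 :* v4) (2 :* v0 :+ v1 <: v2 :+ 3 :* v3 by (∑-linear ((\ _ -> 2) ∷ (\ w -> 𝟙 (¬? (misses K w ≟ 2))) ∷ misses K ∷ (\ w -> 𝟙 (misses K w ≤? 1)) ∷ []) (k 2 :+ v1 <: v2 :+ 3 :* v3) S (\ {w} _ -> pointwise (misses K w))) & v3 <: v4 by 3 · few-misses & v2 <: 2 :* v5 by (subst (\ l -> ∑ (misses K) S ≤ l) (trans (cong (_* μ) K-length) (*-assoc 2 (suc r) μ)) (∑-misses-≤ K S (All.map low K⊆))) & v5 <: v0 :+ v4 by 2 · rμ & □))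
   where
   pointwise : ∀ t -> 2 + 𝟙 (¬? (t ≟ 2)) ≤ t + 3 * 𝟙 (t ≤? 1)
   pointwise 0 = ≤-refl
   pointwise 1 = n≤1+n _
   pointwise 2 = ≤-refl
   pointwise (suc (suc (suc t))) = s≤s (s≤s (s≤s z≤n))

 -- L is what remains of a largest clique when two vertices are removed; X sees all of L, and Y all but one vertex.
 module Core (L : List V) (L-clique : Clique L) (L⊆ : All (_∈ S) L) (L-length : 2 + length L ≡ 2 * suc r) where

  X Y : V -> Set
  X w = misses L w ≡ 0
  Y w = misses L w ≡ 1

  X? : ∀ w -> Dec (X w)
  X? w = misses L w ≟ 0

  Y? : ∀ w -> Dec (Y w)
  Y? w = misses L w ≟ 1

  sees : ∀ {w} -> X w -> ∀ {x} -> x ∈ L -> Adj x w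
  sees {w} z m n = absurd (subst (1 ≤_) z (#-∈ (\ x -> Non? x w) L m n)) \ ()

  in-front : ∀ {L w} -> All (\ x -> Adj x w) L -> Clique L -> Clique (w ∷ L)
  in-front h cl = All.map Adj-sym h ∷ cl

  edge-clique : ∀ {x y} -> X x -> X y -> Adj x y -> Clique (x ∷ y ∷ L)
  edge-clique xx xy e = in-front (Adj-sym e ∷ All.tabulate (sees xx)) (in-front (All.tabulate (sees xy)) L-clique)

  -- A triangle in X would form with L a clique on `2 * suc r + 1` vertices, so neighbourhoods
  -- inside X are independent.
  X-sparse : ∀ {w} -> w ∈ S -> X w -> # (\ x -> Adj? w x ×? X? x) S ≤ a
  X-sparse {w} w∈ xw = independent-bound dense _ \ {x} {y} x∈ y∈ (ex , xx) (ey , xy) e ->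
   absurd (ω (w ∷ x ∷ y ∷ L) (in-front (Adj-sym ex ∷ Adj-sym ey ∷ All.tabulate (sees xw)) (edge-clique xx xy e))
    (w∈ ∷ x∈ ∷ y∈ ∷ L⊆)) (<⇒≱ (s≤s (≡⇒≤ (sym L-length))))

  Unsplit? : ∀ x x' w -> Dec (Y w × ¬ 𝟙 (Non? x w) + 𝟙 (Non? x' w) ≡ 1)
  Unsplit? x x' w = Y? w ×? ¬? (𝟙 (Non? x w) + 𝟙 (Non? x' w) ≟ 1)

  -- An edge xy of X is seen by exactly one of its ends from almost all of Y.
  split : ∀ {x y} -> x ∈ S -> y ∈ S -> X x -> X y -> Adj x y ->
   # (Unsplit? x y) S ≤ 5 * σ
  split {x} {y} x∈ y∈ xx xy e = ≤-trans
   (#-mono _ (\ w -> ¬? (misses (x ∷ y ∷ L) w ≟ 2)) S \ {w} _ (yw , ne) t' -> ne (lemma (𝟙 (Non? x w)) (𝟙 (Non? y w)) yw t'))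
   (atypical (edge-clique xx xy e) (x∈ ∷ y∈ ∷ L⊆) L-length)
   where
   lemma : ∀ p q {d} -> d ≡ 1 -> p + (q + d) ≡ 2 -> p + q ≡ 1
   lemma p q refl h = suc-injective (trans (shift p q) h)
    where
    shift : ∀ p q -> suc (p + q) ≡ p + (q + 1)
    shift = solve-∀

  -- A vertex of Y seeing an edge xy of X gives a largest clique through x and y, which almost all of X misses in x and y.
  module ThroughEdge {w x y} (w∈ : w ∈ S) (yw : Y w) (x∈ : x ∈ S) (y∈ : y ∈ S) (xx : X x) (xy : X y)
   (e : Adj x y) (ex : Adj w x) (ey : Adj w y) where
   L″ : List V
   L″ = visible w L

   K″ : List V
   K″ = w ∷ x ∷ y ∷ L″

   L″⊆ : ∀ {z} -> z ∈ L″ -> z ∈ L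
   L″⊆ m = proj₁ (visible-∈ L m)

   K″-clique : Clique K″
   K″-clique = in-front (Adj-sym ex ∷ Adj-sym ey ∷ All.tabulate (\ m -> proj₂ (visible-∈ L m)))
    (in-front (Adj-sym e ∷ All.tabulate (\ m -> sees xx (L″⊆ m)))
    (in-front (All.tabulate (\ m -> sees xy (L″⊆ m))) (AllPairs.filter⁺ (\ z -> Adj? z w) L-clique)))

   K″-length : length K″ ≡ 2 * suc r
   K″-length = trans (cong (\ n -> 2 + n) (trans (cong (_+ length L″) (sym yw)) (visible-misses w L))) L-length

   gone : ∀ {z} -> X z -> misses L″ z ≡ 0
   gone {z} xz = #-none (\ q -> Non? q z) L″ \ m n -> sees xz (L″⊆ m) n

   case : ∀ {P Q R : Set} {d d'} (p : Dec P) (q : Dec Q) (s : Dec R) -> R -> d ≡ 0 -> d' ≡ 0 ->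
    ¬ 𝟙 p + (𝟙 q + d) ≡ 2 ⊎ ¬ 𝟙 s + (𝟙 p + (𝟙 q + d')) ≡ 2
   case (yes _) (yes _) (yes _) _ refl refl = inj₂ \ ()
   case (yes _) (no _) (yes _) _ refl refl = inj₁ \ ()
   case (no _) (yes _) (yes _) _ refl refl = inj₁ \ ()
   case (no _) (no _) (yes _) _ refl refl = inj₁ \ ()
   case _ _ (no ¬r) r = absurd r ¬r

   -- A vertex of X that misses w either does not miss both x and y, or misses all of w, x and y. In
   -- each case it is atypical for one of two largest cliques, whence 5σ + 5σ.
   near-all : # (\ z -> X? z ×? Non? w z) S ≤ 10 * σ
   near-all = ≤-trans (#-⊎ _ (\ z -> ¬? (misses (x ∷ y ∷ L) z ≟ 2)) (\ z -> ¬? (misses K″ z ≟ 2)) S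
     \ {z} _ (xz , n) -> case (Non? x z) (Non? y z) (Non? w z) n xz (gone xz))
    (≤-trans (+-mono-≤ (atypical (edge-clique xx xy e) (x∈ ∷ y∈ ∷ L⊆) L-length)
     (atypical K″-clique (w∈ ∷ x∈ ∷ y∈ ∷ All.filter⁺ (\ z -> Adj? z w) L⊆) K″-length))
     (≡⇒≤ (sym (*-distribʳ-+ σ 5 5))))

  all-or-few : ∀ {w} -> w ∈ S -> Y w -> a < # (\ x -> Adj? w x ×? X? x) S -> # (\ x -> X? x ×? Non? w x) S ≤ 10 * σ
  all-or-few {w} w∈ yw many with dense (\ x -> Adj? w x ×? X? x) many
  ... | x , y , x∈ , y∈ , (ex , xx) , (ey , xy) , e = ThroughEdge.near-all w∈ yw x∈ y∈ xx xy e ex ey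

  Heavy : V -> Set
  Heavy w = a < # (\ x -> Adj? w x ×? X? x) S

  Heavy? : ∀ w -> Dec (Heavy w)
  Heavy? w = a <? # (\ x -> Adj? w x ×? X? x) S

  -- A heavy w sees almost all of X and a light one almost nothing; these are the exceptional pairs,
  -- at most 10σ for each w.
  Odd : V -> V -> Set
  Odd x w = X x × Y w × (Heavy w × Non w x ⊎ ¬ Heavy w × Adj w x)

  Odd? : ∀ x w -> Dec (Odd x w)
  Odd? x w = X? x ×? (Y? w ×? ((Heavy? w ×? Non? w x) ⊎-dec (¬? (Heavy? w) ×? Adj? w x)))

  odd : V -> ℕ
  odd x = # (Odd? x) S

  y = # Y? S

  ∑-odd : ∑ odd S ≤ y * (10 * σ)
  ∑-odd = ≤-trans (≡⇒≤ (∑-swap (\ x w -> 𝟙 (Odd? x w)) S S))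
   (≤-trans (∑-mono S \ {w} w∈ -> row w∈ (Y? w))
   (≡⇒≤ (trans (∑-cong S \ {w} _ -> *-comm (𝟙 (Y? w)) (10 * σ)) (trans (∑-* (10 * σ) _ S) (*-comm (10 * σ) y)))))
   where
   light-row : ∀ {w} -> w ∈ S -> Y w -> ¬ Heavy w -> # (\ x -> Odd? x w) S ≤ 10 * σ
   light-row {w} w∈ yw light = ≤-trans (#-mono (\ x -> Odd? x w) (\ x -> Adj? w x ×? X? x) S
    \ { _ (_ , _ , inj₁ (heavy , _)) -> absurd heavy light ; _ (xx , _ , inj₂ (_ , e)) -> e , xx })
    (≤-trans (≮⇒≥ light) (≤-trans a≤σ (m≤m+n σ (9 * σ))))
   heavy-row : ∀ {w} -> w ∈ S -> Y w -> Heavy w -> # (\ x -> Odd? x w) S ≤ 10 * σ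
   heavy-row {w} w∈ yw heavy = ≤-trans (#-mono (\ x -> Odd? x w) (\ x -> X? x ×? Non? w x) S
    \ { _ (xx , _ , inj₁ (_ , n)) -> xx , n ; _ (_ , _ , inj₂ (light , _)) -> absurd heavy light })
    (all-or-few w∈ yw heavy)
   row : ∀ {w} -> w ∈ S -> (d : Dec (Y w)) -> # (\ x -> Odd? x w) S ≤ 𝟙 d * (10 * σ)
   row {w} w∈ (no ¬y) = ≡⇒≤ (#-none (\ x -> Odd? x w) S \ _ o -> ¬y (proj₁ (proj₂ o)))
   row {w} w∈ (yes yw) = ≤-trans (by-weight (Heavy? w)) (m≤m+n (10 * σ) 0)
    where
    by-weight : Dec (Heavy w) -> # (\ x -> Odd? x w) S ≤ 10 * σ
    by-weight (yes heavy) = heavy-row w∈ yw heavy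
    by-weight (no light) = light-row w∈ yw light

  Bad? : ∀ x -> Dec (X x × y ≤ 3 * odd x)
  Bad? x = X? x ×? (y ≤? 3 * odd x)

  bad-count : 0 < y -> # Bad? S ≤ 30 * σ
  bad-count pos = *-cancelˡ-≤ y {{>-nonZero pos}} (begin
   y * # Bad? S ≡⟨ ∑-* y _ S ⟨
   ∑ (\ x -> y * 𝟙 (Bad? x)) S ≤⟨ ∑-mono S (\ {x} _ -> bounded (Bad? x)) ⟩
   ∑ (\ x -> 3 * odd x) S ≡⟨ ∑-* 3 odd S ⟩
   3 * ∑ odd S ≤⟨ *-monoʳ-≤ 3 ∑-odd ⟩
   3 * (y * (10 * σ)) ≡⟨ arrange y σ ⟩
   y * (30 * σ) ∎)
   where
   bounded : ∀ {x} (d : Dec (X x × y ≤ 3 * odd x)) -> y * 𝟙 d ≤ 3 * odd x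
   bounded (yes (_ , h)) = ≤-trans (≡⇒≤ (*-identityʳ y)) h
   bounded (no _) = ≤-trans (≡⇒≤ (*-zeroʳ y)) z≤n
   arrange : ∀ y σ -> 3 * (y * (10 * σ)) ≡ y * (30 * σ)
   arrange = solve-∀

  -- A heavy w should see both x and x', a light one neither. Missing exactly one of them is
  -- therefore odd in either case.
  pointwise : ∀ {x x'} -> X x -> X x' -> ∀ w ->
   𝟙 (Y? w) ≤ 𝟙 (Odd? x w) + 𝟙 (Odd? x' w) + 𝟙 (Unsplit? x x' w)
  pointwise {x} {x'} xx xx' w = go (Y? w) (𝟙 (Non? x w) + 𝟙 (Non? x' w) ≟ 1)
   where
   go : (d : Dec (Y w)) (e : Dec (𝟙 (Non? x w) + 𝟙 (Non? x' w) ≡ 1)) -> 𝟙 d ≤ 𝟙 (Odd? x w) + 𝟙 (Odd? x' w) + 𝟙 (d ×? ¬? e)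
   go (no _) _ = z≤n
   go (yes yw) (no _) = m≤n+m 1 (𝟙 (Odd? x w) + 𝟙 (Odd? x' w))
   go (yes yw) (yes one) = ≤-trans (which (Heavy? w) (Non? x w) (Non? x' w) one) (m≤m+n _ 0)
    where
    left : ∀ {p q} -> p ≡ 1 -> 1 ≤ p + q
    left refl = s≤s z≤n
    right : ∀ {p q} -> q ≡ 1 -> 1 ≤ p + q
    right {p} refl = m≤n+m 1 p
    which : Dec (a < # (\ x -> Adj? w x ×? X? x) S) -> (p : Dec (Non x w)) (q : Dec (Non x' w)) -> 𝟙 p + 𝟙 q ≡ 1 -> 1 ≤ 𝟙 (Odd? x w) + 𝟙 (Odd? x' w)
    which (yes h) (yes p) _ _ = left (𝟙-yes (Odd? x w) (xx , yw , inj₁ (h , χ-flip p)))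
    which (yes h) (no _) (yes q) _ = right {𝟙 (Odd? x w)} (𝟙-yes (Odd? x' w) (xx' , yw , inj₁ (h , χ-flip q)))
    which (no l) (no p) _ _ = left (𝟙-yes (Odd? x w) (xx , yw , inj₂ (l , Adj-sym p)))
    which (no l) (yes _) (no q) _ = right {𝟙 (Odd? x w)} (𝟙-yes (Odd? x' w) (xx' , yw , inj₂ (l , Adj-sym q)))
    which (yes _) (no _) (no _) ()
    which (no _) (yes _) (yes _) ()

  covered : ∀ {x x'} -> X x -> X x' -> y ≤ odd x + odd x' + # (Unsplit? x x') S
  covered {x} {x'} xx xx' = ∑-linear ((\ w -> 𝟙 (Y? w)) ∷ (\ w -> 𝟙 (Odd? x w)) ∷ (\ w -> 𝟙 (Odd? x' w)) ∷ (\ w -> 𝟙 (Unsplit? x x' w)) ∷ [])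
   (v0 <: v1 :+ v2 :+ v3) S (\ {w} _ -> pointwise xx xx' w)

  Good? : ∀ x -> Dec (X x × ¬ y ≤ 3 * odd x)
  Good? x = X? x ×? ¬? (y ≤? 3 * odd x)

  -- Double counting leaves at most 30σ vertices of X that are odd with a third of Y. More than a
  -- others remain, so two of them are adjacent, and together they give `y < 2y/3 + 5σ`.
  cross-small : 31 * σ < # X? S -> y ≤ 15 * σ
  cross-small big = by-cases (y ≟ 0)
   where
   conclude : (∃₂ \ x x' -> x ∈ S × x' ∈ S × (X x × ¬ y ≤ 3 * odd x) × (X x' × ¬ y ≤ 3 * odd x') × Adj x x') -> y ≤ 15 * σ
   conclude (x , x' , x∈ , x'∈ , (xx , good) , (xx' , good') , e) =
    (lin (y ∷ (odd x) ∷ (odd x') ∷ (# (Unsplit? x x') S) ∷ σ ∷ []) (v0 <: 15 :* v4) (v0 <: v1 :+ v2 :+ v3 by 3 · covered xx xx' & v3 <: 5 :* v4 by 3 · split x∈ x'∈ xx xx' e & k 1 :+ 3 :* v1 <: v0 by ≰⇒> good & k 1 :+ 3 :* v2 <: v0 by ≰⇒> good' & □))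
   by-cases : Dec (y ≡ 0) -> y ≤ 15 * σ
   by-cases (yes e) = subst (_≤ 15 * σ) (sym e) z≤n
   by-cases (no ne) = conclude (dense Good?
    (lin ((# Bad? S) ∷ σ ∷ (# X? S) ∷ a ∷ (# Good? S) ∷ []) (k 1 :+ v3 <: v4) (v0 <: 30 :* v1 by bad-count (n≢0⇒n>0 ne) & k 1 :+ 31 :* v1 <: v2 by big & v3 <: v1 by a≤σ & v2 <: v0 :+ v4 by≡ (#-partition X? (\ x -> y ≤? 3 * odd x) S) & □)))

 largest : ∃ \ K -> Clique K × All (_∈ S) K × length K ≡ 2 * suc r
 largest =
  let K , m<K , c , K⊆ = grow dense low (r + suc (r + 0)) enough
  in K , c , K⊆ , ≤-antisym (ω K c K⊆) m<K
  where
  -- In this spelling of `2 * suc r - 1`, the successor of `m` is what `2 * suc r` reduces to.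
  m = r + suc (r + 0)
  smaller : 3 ^ m * a ≤ σ
  smaller = ≤-trans (*-monoˡ-≤ a (m≤m+n (3 ^ m) _)) aσ
  expand : (r + suc (r + 0)) * μ + μ ≡ 2 * (suc r * μ)
  expand = lemma r μ
   where
   lemma : ∀ r μ -> (r + suc (r + 0)) * μ + μ ≡ 2 * (suc r * μ)
   lemma = solve-∀
  enough : m * μ + 2 * (3 ^ m * a) < 2 * N
  enough = (lin-κ 9 ((3 ^ m * a) ∷ σ ∷ (m * μ) ∷ μ ∷ (suc r * μ) ∷ N ∷ τ ∷ (suc r * (20 * σ)) ∷ (C * σ) ∷ []) (k 1 :+ (v2 :+ 2 :* v0) <: 2 :* v5) (v0 <: v1 by 20 · smaller & v2 :+ v3 <: 2 :* v4 by≡ 10 · expand & v4 <: v5 :+ v1 by 20 · rμ & k 1 :+ v6 <: v3 by 10 · τ<μ & v7 :+ 40 :* v8 <: v6 by hτ & v1 <: v8 by 40 · σ≤Cσ & □))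

 module FromClique (K : List V) (c : Clique K) (K⊆ : All (_∈ S) K) (K-length : length K ≡ 2 * suc r) where

  -- For u missing two vertices of K, these w miss exactly the same two.
  Part : V -> V -> Set
  Part u w = misses (visible u K) w ≡ 0 × misses K w ≡ 2

  Part? : ∀ u w -> Dec (Part u w)
  Part? u w = (misses (visible u K) w ≟ 0) ×? (misses K w ≟ 2)

  Apart : V -> V -> Set
  Apart u w = All (\ x -> Non x u -> ¬ Non x w) K

  apart-sym : ∀ {u w} -> Apart u w -> Apart w u
  apart-sym = All.map (\ f p q -> f q p)

  record Rep (u : V) : Set where
   field
    rep∈ : u ∈ S
    rep-misses : misses K u ≡ 2
    rep-large : 31 * σ < # (Part? u) S
  open Rep

  module RepCore u (t : misses K u ≡ 2) = Core (visible u K)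
   (AllPairs.filter⁺ (\ x -> Adj? x u) c) (All.filter⁺ (\ x -> Adj? x u) K⊆)
   (trans (cong (_+ length (visible u K)) (sym t)) (trans (visible-misses u K) K-length))

  -- The pair missed by w is disjoint from the pairs of all representatives, as both its vertices
  -- are visible to each of them.
  Rest : List V -> V -> Set
  Rest us w = misses K w ≡ 2 × All (\ u -> 2 ≤ misses (visible u K) w) us

  Rest? : ∀ us w -> Dec (Rest us w)
  Rest? us w = (misses K w ≟ 2) ×? all? (\ u -> 2 ≤? misses (visible u K) w) us

  rest-apart : ∀ {u w} -> misses K w ≡ 2 -> 2 ≤ misses (visible u K) w -> Apart u w
  rest-apart {u} {w} t h = All.tabulate \ m nu nw -> proj₁ (#-subset-full (\ x -> Adj? x u ×? Non? x w) (\ x -> Non? x w) K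
   (\ _ -> proj₂) (≤-trans (≡⇒≤ t) (subst (2 ≤_) (#-filter (\ x -> Adj? x u) (\ x -> Non? x w) K) h)) m nw) nu

  rep-size : ∀ {u} -> Rep u -> # (Part? u) S ≤ μ + a
  rep-size {u} rp = (lin ((# (Part? u) S) ∷ (miss S u) ∷ (# (\ x -> Adj? u x ×? RC.X? x) S) ∷ μ ∷ a ∷ []) (v0 <: v3 :+ v4) (v0 <: v1 :+ v2 by (#-⊎ (Part? u) (Non? u) (\ x -> Adj? u x ×? RC.X? x) S \ {w} _ p -> either (Non? u w) p) & v1 <: v3 by low (rep∈ rp) & v2 <: v4 by RC.X-sparse (rep∈ rp) own & □))
   where
   module RC = RepCore u (rep-misses rp)
   own : misses (visible u K) u ≡ 0
   own = #-none (\ x -> Non? x u) (visible u K) \ m n -> proj₂ (visible-∈ K m) n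
   either : ∀ {w} -> Dec (Non u w) -> Part u w -> Non u w ⊎ (Adj u w × RC.X w)
   either (yes n) _ = inj₁ n
   either (no e) (z , _) = inj₂ (e , z)

  -- The pairs missed by w and u share two, one or no vertices. The first case is the part of u, the
  -- last remains in `Rest`, and `cross-small` makes the middle one rare.
  rest-step : ∀ {u} us -> Rep u -> # (Rest? us) S ≤ (# (Part? u) S + 15 * σ) + # (Rest? (u ∷ us)) S
  rest-step {u} us rp = (lin ((# (Rest? us) S) ∷ (# (Part? u) S) ∷ RC.y ∷ (# (Rest? (u ∷ us)) S) ∷ σ ∷ []) (v0 <: v1 :+ 15 :* v4 :+ v3) (v0 <: v1 :+ v2 :+ v3 by (∑-linear ((\ w -> 𝟙 (Rest? us w)) ∷ (\ w -> 𝟙 (Part? u w)) ∷ (\ w -> 𝟙 (RC.Y? w)) ∷ (\ w -> 𝟙 (Rest? (u ∷ us) w)) ∷ []) (v0 <: v1 :+ v2 :+ v3) S (\ {w} _ -> pointwise w)) & v2 <: 15 :* v4 by (RC.cross-small (<-≤-trans (rep-large rp) (#-mono (Part? u) RC.X? S (\ _ -> proj₁)))) & □))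
   where
   module RC = RepCore u (rep-misses rp)
   pointwise : ∀ w -> 𝟙 (Rest? us w) ≤ 𝟙 (Part? u w) + 𝟙 (RC.Y? w) + 𝟙 (Rest? (u ∷ us) w)
   pointwise w = go (Rest? us w) (misses (visible u K) w) refl
    where
    go : (d : Dec (Rest us w)) -> ∀ n -> misses (visible u K) w ≡ n -> 𝟙 d ≤ 𝟙 (Part? u w) + 𝟙 (RC.Y? w) + 𝟙 (Rest? (u ∷ us) w)
    go (no _) _ _ = z≤n
    go (yes (t , _)) 0 e = ≤-trans (≡⇒≤ (sym (𝟙-yes (Part? u w) (e , t)))) (≤-trans (m≤m+n _ _) (m≤m+n _ _))
    go (yes _) 1 e = ≤-trans (≡⇒≤ (sym (𝟙-yes (RC.Y? w) e))) (≤-trans (m≤n+m _ (𝟙 (Part? u w))) (m≤m+n _ _))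
    go (yes (t , h)) (suc (suc n)) e = ≤-trans
     (≡⇒≤ (sym (𝟙-yes (Rest? (u ∷ us) w) (t , subst (2 ≤_) (sym e) (s≤s (s≤s z≤n)) ∷ h)))) (m≤n+m _ (𝟙 (Part? u w) + 𝟙 (RC.Y? w)))

  size : V -> ℕ
  size u = # (Part? u) S + 15 * σ

  record Reps (j : ℕ) : Set where
   field
    us : List V
    us-length : length us ≡ j
    us-reps : All Rep us
    us-apart : AllPairs Apart us
    us-cover : N ≤ 5 * σ + ∑ size us + # (Rest? us) S
  open Reps

  size-bound : ∀ {u} -> Rep u -> size u ≤ μ + 16 * σ
  size-bound {u} rp = (lin ((# (Part? u) S) ∷ μ ∷ a ∷ σ ∷ []) (v0 :+ 15 :* v3 <: v1 :+ 16 :* v3) (v0 <: v1 :+ v2 by rep-size rp & v2 <: v3 by a≤σ & □))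

  -- A chosen pair accounts for at most `μ + 16σ` vertices. Before the last choice about μ vertices
  -- are thus still left, enough for one pair to be missed by more than 31σ of them, the size that
  -- `cross-small` requires.
  build : ∀ j -> j ≤ suc r -> Reps j
  build zero _ = record
   { us = [] ; us-length = refl ; us-reps = [] ; us-apart = []
   ; us-cover = (lin (N ∷ (# (\ w -> misses K w ≟ 2) S) ∷ (# (\ w -> ¬? (misses K w ≟ 2)) S) ∷ σ ∷ (# (Rest? []) S) ∷ []) (v0 <: 5 :* v3 :+ k 0 :+ v4) (v0 <: v1 :+ v2 by≡ sym (#+#¬ (\ w -> misses K w ≟ 2) S) & v2 <: 5 :* v3 by atypical c K⊆ K-length & v1 <: v4 by (#-mono (\ w -> misses K w ≟ 2) (Rest? []) S (\ _ t -> t , [])) & □)) }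
  build (suc j) j<r with build j (≤-trans (n≤1+n j) j<r)
  ... | R = extend-reps (pigeonhole K S (Rest? (us R)) (31 * σ) many)
   where
   total : ∑ size (us R) ≤ r * μ + r * (16 * σ)
   total = ≤-trans (∑-≤-const (μ + 16 * σ) (us R) \ m -> size-bound (All.lookup (us-reps R) m))
    (≤-trans (*-monoˡ-≤ (μ + 16 * σ) (subst (_≤ r) (sym (us-length R)) (≤-pred j<r))) (≡⇒≤ (*-distribˡ-+ r μ (16 * σ))))
   r16 : r * (16 * σ) ≤ suc r * (20 * σ)
   r16 = *-mono-≤ (n≤1+n r) (*-monoˡ-≤ σ (m≤m+n 16 4))
   scale : 3 ^ length K * (31 * σ) ≡ 31 * (C * σ)
   scale = trans (cong (\ l -> 3 ^ l * (31 * σ)) K-length) (swap C σ)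
    where
    swap : ∀ c s -> c * (31 * s) ≡ 31 * (c * s)
    swap = solve-∀
   many : 3 ^ length K * (31 * σ) < # (Rest? (us R)) S
   many = (lin ((∑ size (us R)) ∷ (r * μ) ∷ (r * (16 * σ)) ∷ (suc r * (20 * σ)) ∷ N ∷ σ ∷ (# (Rest? (us R)) S) ∷ (3 ^ length K * (31 * σ)) ∷ (C * σ) ∷ μ ∷ τ ∷ []) (k 1 :+ v7 <: v6) (v0 <: v1 :+ v2 by total & v2 <: v3 by r16 & v4 <: 5 :* v5 :+ v0 :+ v6 by us-cover R & v7 <: 31 :* v8 by≡ scale & v9 :+ v1 <: v4 :+ v5 by rμ & v3 :+ 40 :* v8 <: v10 by hτ & k 1 :+ v10 <: v9 by τ<μ & v5 <: v8 by 9 · σ≤Cσ & □))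
   extend-reps : (∃ \ u -> u ∈ S × Rest (us R) u × 31 * σ < # (\ w -> Rest? (us R) w ×? Same? K u w) S) -> Reps (suc j)
   extend-reps (u , u∈ , (t , h) , big) = record
    { us = u ∷ us R ; us-length = cong suc (us-length R) ; us-reps = rp ∷ us-reps R
    ; us-apart = All.map (\ h -> apart-sym (rest-apart t h)) h ∷ us-apart R
    ; us-cover = (lin (N ∷ σ ∷ (∑ size (us R)) ∷ (# (Rest? (us R)) S) ∷ (size u) ∷ (# (Rest? (u ∷ us R)) S) ∷ []) (v0 <: 5 :* v1 :+ (v4 :+ v2) :+ v5) (v0 <: 5 :* v1 :+ v2 :+ v3 by us-cover R & v3 <: v4 :+ v5 by rest-step (us R) rp & □)) }
    where
    seen : ∀ {w} -> Same K u w -> misses (visible u K) w ≡ 0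
    seen {w} s = #-none (\ x -> Non? x w) (visible u K) \ m n -> let x∈ , e = visible-∈ K m in same-adj s x∈ e n
    rp : Rep u
    rp = record { rep∈ = u∈ ; rep-misses = t
          ; rep-large = <-≤-trans big (#-mono _ (Part? u) S \ _ (q , s) -> seen s , proj₁ q) }

  misses-total : ∀ us -> All (\ u -> misses K u ≡ 2) us -> AllPairs Apart us -> 2 * length us ≤ length K
  misses-total us h ap = begin
   2 * length us ≡⟨ *-comm 2 (length us) ⟩
   length us * 2 ≡⟨ ∑-const 2 us ⟨
   ∑ (\ _ -> 2) us ≡⟨ ∑-cong us (\ m -> sym (All.lookup h m)) ⟩
   ∑ (misses K) us ≡⟨ ∑-swap (\ u x -> 𝟙 (Non? x u)) us K ⟩
   ∑ (\ x -> # (Non? x) us) K ≤⟨ ∑-≤-const 1 K (\ {x} m -> #-exclusive (Non? x) us (AllPairs.map (\ q -> All.lookup q m) ap)) ⟩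
   length K * 1 ≡⟨ *-identityʳ _ ⟩
   length K ∎

  -- The `suc r` disjoint pairs exhaust the `2 * suc r` vertices of K and leave no pair for a
  -- further vertex.
  complete : (R : Reps (suc r)) -> # (Rest? (us R)) S ≡ 0
  complete R = #-none (Rest? (us R)) S \ {w} _ (t , h) ->
   absurd (misses-total (w ∷ us R) (t ∷ All.map rep-misses (us-reps R)) (All.map (\ h -> apart-sym (rest-apart t h)) h ∷ us-apart R))
    (<⇒≱ (lin ((length K) ∷ (suc r) ∷ (length (us R)) ∷ []) (k 1 :+ v0 <: 2 :* (k 1 :+ v2)) (v0 <: 2 :* v1 by≡ K-length & v1 <: v2 by≡ 2 · sym (us-length R) & □)))

  lookup-pairs : ∀ {R : V -> V -> Set} -> (∀ {x y} -> R x y -> R y x) -> ∀ {xs} -> AllPairs R xs -> ∀ i j -> i ≢ j -> R (lookup xs i) (lookup xs j)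
  lookup-pairs s (h ∷ hs) zero zero ne = absurd refl ne
  lookup-pairs s (h ∷ hs) zero (suc j) ne = All.lookup h (∈-lookup j)
  lookup-pairs s (h ∷ hs) (suc i) zero ne = s (All.lookup h (∈-lookup i))
  lookup-pairs s (h ∷ hs) (suc i) (suc j) ne = lookup-pairs s hs i j (\ e -> ne (cong suc e))

  assemble : ∀ us -> All Rep us -> AllPairs Apart us -> All (\ u -> μ ≤ # (Part? u) S + τ) us -> Parts (length us) τ
  assemble us reps apart big = record
   { U = \ i -> Part (lookup us i)
   ; U? = \ i -> Part? (lookup us i)
   ; disjoint = \ {i} {j} {w} -> disj i j w (i Fin.≟ j)
   ; large = \ i -> All.lookup big (∈-lookup i)
   ; sparse = \ {i} {x} x∈ (z , _) -> ≤-trans (#-mono _ _ S \ _ (e , z' , _) -> e , z')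
     (RepCore.X-sparse (lookup us i) (rep-misses (All.lookup reps (∈-lookup i))) x∈ z) }
   where
   unseen : ∀ {u w x} -> Part u w -> x ∈ K -> Non x w -> Non x u
   unseen {u} {w} {x} (z , _) m n with Non? x u
   ... | yes p = p
   ... | no e = absurd (subst (1 ≤_) z (#-∈ (\ x -> Non? x w) (visible u K) (∈-filter⁺ (\ x -> Adj? x u) m e) n)) \ ()
   disj : ∀ i j w -> Dec (i ≡ j) -> Part (lookup us i) w -> Part (lookup us j) w -> i ≡ j
   disj i j w (yes e) _ _ = e
   disj i j w (no ne) p q =
    let x , m , n = #-witness (\ x -> Non? x w) K (subst (0 <_) (sym (proj₂ p)) (s≤s z≤n))
    in absurd (unseen q m n) (All.lookup (lookup-pairs apart-sym apart i j ne) m (unseen p m n))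

  parts : Parts (suc r) τ
  parts = subst (\ n -> Parts n τ) (us-length R) (assemble (us R) (us-reps R) (us-apart R) (All.tabulate big))
   where
   R = build (suc r) ≤-refl
   spread : length (us R) * (μ + 16 * σ) ≡ suc r * μ + suc r * (16 * σ)
   spread = trans (cong (_* (μ + 16 * σ)) (us-length R)) (*-distribˡ-+ (suc r) μ (16 * σ))
   r16 : suc r * (16 * σ) ≤ suc r * (20 * σ)
   r16 = *-monoʳ-≤ (suc r) (*-monoˡ-≤ σ (m≤m+n 16 4))
   -- The parts cover almost all of S, and the other ones have hardly more than μ vertices each.
   big : ∀ {u} -> u ∈ us R -> μ ≤ # (Part? u) S + τ
   big {u} m = (lin (N ∷ σ ∷ (∑ size (us R)) ∷ (# (Rest? (us R)) S) ∷ μ ∷ (# (Part? u) S) ∷ (length (us R) * (μ + 16 * σ)) ∷ (suc r * μ) ∷ (suc r * (16 * σ)) ∷ (suc r * (20 * σ)) ∷ (C * σ) ∷ τ ∷ []) (v4 <: v5 :+ v11) (v0 <: 5 :* v1 :+ v2 :+ v3 by us-cover R & v3 <: k 0 by≡ complete R & v2 :+ (v4 :+ 16 :* v1) <: v5 :+ 15 :* v1 :+ v6 by (∑-other size (μ + 16 * σ) (us R) (\ m -> size-bound (All.lookup (us-reps R) m)) m) & v6 <: v7 :+ v8 by≡ spread & v8 <: v9 by r16 & v7 <: v0 :+ v1 by rμ & v9 :+ 40 :* v10 <: v11 by hτ & v1 <: v10 by 5 · σ≤Cσ & □))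

 parts : Parts (suc r) τ
 parts = let K , c , K⊆ , K-length = largest in FromClique.parts K c K⊆ K-length

-- Deleting vertices of low degree

m<[1+m/n]*n : ∀ m n {{_ : NonZero n}} -> m < (1 + m / n) * n
m<[1+m/n]*n m n = begin-strict
 m ≡⟨ m≡m%n+[m/n]*n m n ⟩
 m % n + m / n * n <⟨ +-monoˡ-< (m / n * n) (m%n<n m n) ⟩
 n + m / n * n ∎

module Reduction {V : Set} (𝒢 : ColouredGraph V) (_≟V_ : DecidableEquality V) where
 open Graphs 𝒢
 open Partitions 𝒢 using (degrees)
 open DecMembership _≟V_ using (_∈?_)

 #-middle : ∀ {P : V -> Set} (P? : Decidable P) xs {z} ys -> # P? (xs ++ z ∷ ys) ≡ 𝟙 (P? z) + # P? (xs ++ ys)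
 #-middle P? xs {z} ys = trans (∑-++ _ xs (z ∷ ys)) (trans (shift (# P? xs) (𝟙 (P? z)) (# P? ys)) (cong (𝟙 (P? z) +_) (sym (∑-++ _ xs ys))))
  where
  shift : ∀ a b c -> a + (b + c) ≡ b + (a + c)
  shift = solve-∀

 degrees-middle : ∀ xs {z} ys -> degrees (xs ++ z ∷ ys) ≡ degrees (xs ++ ys) + 2 * degree (xs ++ z ∷ ys) z
 degrees-middle xs {z} ys = begin-equality
  ∑ (degree S) S ≡⟨ ∑-++ _ xs (z ∷ ys) ⟩
  ∑ (degree S) xs + (degree S z + ∑ (degree S) ys) ≡⟨ shift (∑ (degree S) xs) (degree S z) (∑ (degree S) ys) ⟩
  degree S z + (∑ (degree S) xs + ∑ (degree S) ys) ≡⟨ cong (degree S z +_) (∑-++ _ xs ys) ⟨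
  degree S z + ∑ (degree S) S' ≡⟨ cong (degree S z +_) (∑-cong S' \ {x} _ -> #-middle (Adj? x) xs ys) ⟩
  degree S z + ∑ (\ x -> 𝟙 (Adj? x z) + degree S' x) S' ≡⟨ cong (degree S z +_) (∑-+ _ _ S') ⟩
  degree S z + (# (\ x -> Adj? x z) S' + degrees S') ≡⟨ cong (\ d -> degree S z + (d + degrees S')) back ⟩
  degree S z + (degree S z + degrees S') ≡⟨ double (degree S z) (degrees S') ⟩
  degrees S' + 2 * degree S z ∎
  where
  S = xs ++ z ∷ ys
  S' = xs ++ ys
  shift : ∀ a b c -> a + (b + c) ≡ b + (a + c)
  shift = solve-∀
  double : ∀ a b -> a + (a + b) ≡ b + 2 * a
  double = solve-∀
  back : # (\ x -> Adj? x z) S' ≡ degree S z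
  back = trans (#-cong (\ x -> Adj? x z) (Adj? z) S' (\ _ -> Adj-sym) (\ _ -> Adj-sym))
   (sym (trans (#-middle (Adj? z) xs ys) (cong (_+ degree S' z) (𝟙-no (Adj? z z) (\ a -> a (χ-irrefl z))))))

 Independence : List V -> ℕ -> Set1
 Independence S a = ∀ {P : V -> Set} (P? : Decidable P) ->
  (∀ {x y} -> x ∈ S -> y ∈ S -> P x -> P y -> ¬ Adj x y) -> # P? S ≤ a

 independence-middle : ∀ {a} xs {z} ys -> Independence (xs ++ z ∷ ys) a -> Independence (xs ++ ys) a
 independence-middle xs {z} ys bound P? ind = ≤-trans
  (#-mono P? (\ w -> P? w ×? (w ∈? (xs ++ ys))) (xs ++ ys) (\ m p -> p , m))
  (≤-trans (m≤n+m _ _) (≤-trans (≡⇒≤ (sym (#-middle (\ w -> P? w ×? (w ∈? (xs ++ ys))) xs ys)))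
  (bound (\ w -> P? w ×? (w ∈? (xs ++ ys))) \ _ _ (px , mx) (py , my) -> ind mx my px py)))

 -- Deleting vertices of degree below (1 - 1/r - 1/G)|S| preserves the excess of S over the bound to be proved, and such deletions leave more than |S|/(G+1)
 -- vertices.
 module _ (r G a E n0 : ℕ) {{_ : NonZero r}} {{_ : NonZero G}} where

  -- The summand `r + 1` absorbs the rounding and the lower-order terms that arise when |S| drops by
  -- one.
  slack threshold : List V -> ℕ
  slack S = length S / G + (r + 1)
  threshold S = (length S + slack S) / r

  record Excess (S : List V) : Set1 where
   field
    independence : Independence S a
    excess : r * (length S * length S) + r * (length S * a) + E < r * degrees S + length S * length S
    -- A potential: G times the excess of `r * degrees` over `(r - 1)|S|²`, plus `|S|²`, never falls
    -- below n0². What a deletion takes from `|S|²` it gives to the first term.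
    spread : G * (r * (length S * length S)) + n0 * n0 ≤ G * (r * degrees S) + (1 + G) * (length S * length S)
  open Excess public

  Reduced : Set1
  Reduced = ∃ \ S -> Excess S × (∀ {x} -> x ∈ S -> miss S x ≤ threshold S)

  slack-lower : ∀ S -> length S + r * G ≤ G * slack S
  slack-lower S = begin
   N + r * G ≤⟨ +-monoˡ-≤ (r * G) (<⇒≤ (m<[1+m/n]*n N G)) ⟩
   (1 + N / G) * G + r * G ≡⟨ lemma (N / G) r G ⟩
   G * (N / G + (r + 1)) ∎
   where
   N = length S
   lemma : ∀ q r G -> (1 + q) * G + r * G ≡ G * (q + (r + 1))
   lemma = solve-∀

  threshold-upper : ∀ S -> r * threshold S ≤ length S + slack S
  threshold-upper S = ≤-trans (≡⇒≤ (*-comm r _)) (m/n*n≤m (length S + slack S) r)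

  above-threshold : ∀ S {m} -> threshold S < m -> length S + slack S < r * m
  above-threshold S h = <-≤-trans (m<[1+m/n]*n (length S + slack S) r) (≤-trans (*-monoˡ-≤ r h) (≡⇒≤ (*-comm _ r)))

  delete : ∀ xs {z} ys -> Excess (xs ++ z ∷ ys) -> threshold (xs ++ z ∷ ys) < miss (xs ++ z ∷ ys) z -> Excess (xs ++ ys)
  delete xs {z} ys ex low = record
   { independence = independence-middle xs ys (independence ex)
   ; excess = (lin ((r * d) ∷ M ∷ s ∷ (r * M) ∷ r ∷ (r * (M * M)) ∷ (r * (M * a)) ∷ (r * a) ∷ E ∷ (r * D') ∷ (M * M) ∷ []) (k 1 :+ (v5 :+ v6 :+ v8) <: v9 :+ v10) (2 :* v0 :+ 2 :* v1 :+ k 1 :+ 2 :* v2 :+ k 3 <: 2 :* v3 :+ 2 :* v4 by loss & v4 <: v2 by r≤s & k 1 :+ (v5 :+ 2 :* v3 :+ v4 :+ v6 :+ v7 :+ v8) <: v9 :+ 2 :* v0 :+ v10 :+ 2 :* v1 :+ k 1 by subst₂ _<_ (expand-left r M a E) (expand-right r D' d M) ex-excess & □))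
   ; spread = (lin ((G * (r * d)) ∷ (G * M) ∷ (G * s) ∷ G ∷ (G * (r * M)) ∷ (G * r) ∷ M ∷ (G * (r * (M * M))) ∷ (n0 * n0) ∷ (G * (r * D')) ∷ ((1 + G) * (M * M)) ∷ []) (v7 :+ v8 <: v9 :+ v10) (2 :* v0 :+ 2 :* v1 :+ 2 :* v2 :+ 4 :* v3 <: 2 :* v4 :+ 2 :* v5 by subst₂ _≤_ (distribute-left G (r * d) M s) (distribute-right G (r * M) r) (*-monoʳ-≤ G loss) & k 1 :+ v6 :+ v5 <: v2 by 2 · slack-M & v7 :+ 2 :* v4 :+ v5 :+ v8 <: v9 :+ 2 :* v0 :+ v10 :+ 2 :* v6 :+ k 1 :+ 2 :* v1 :+ v3 by subst₂ _≤_ (spread-left G r M (n0 * n0)) (spread-right G r D' d M) ex-spread & □))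
   }
   where
   S = xs ++ z ∷ ys
   S' = xs ++ ys
   M = length S'
   D' = degrees S'
   d = degree S z
   s = slack S
   N≡ : length S ≡ 1 + M
   N≡ = trans (sym (∑-ones S)) (trans (#-middle (\ _ -> yes tt) xs ys) (cong suc (∑-ones S')))
   ex-excess : r * ((1 + M) * (1 + M)) + r * ((1 + M) * a) + E < r * (D' + 2 * d) + (1 + M) * (1 + M)
   ex-excess = subst₂ (\ n D -> r * (n * n) + r * (n * a) + E < r * D + n * n) N≡ (degrees-middle xs ys) (excess ex)
   ex-spread : G * (r * ((1 + M) * (1 + M))) + n0 * n0 ≤ G * (r * (D' + 2 * d)) + (1 + G) * ((1 + M) * (1 + M))
   ex-spread = subst₂ (\ n D -> G * (r * (n * n)) + n0 * n0 ≤ G * (r * D) + (1 + G) * (n * n)) N≡ (degrees-middle xs ys) (spread ex)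
   r≤s : r ≤ s
   r≤s = ≤-trans (m≤m+n r 1) (m≤n+m (r + 1) (length S / G))
   slack-M : 1 + M + G * r ≤ G * s
   slack-M = subst₂ (\ n e -> n + e ≤ G * s) N≡ (*-comm r G) (slack-lower S)
   rm : r * miss S z + r * d ≡ r + r * M
   rm = trans (sym (*-distribˡ-+ r _ d)) (trans (cong (r *_) (trans (miss+degree S z) N≡)) (trans (*-comm r (1 + M)) (cong (r +_) (*-comm M r))))
   loss : 2 * (r * d) + 2 * M + 1 + 2 * s + 3 ≤ 2 * (r * M) + 2 * r
   loss = (lin ((r * miss S z) ∷ (r * d) ∷ r ∷ (r * M) ∷ M ∷ s ∷ []) (2 :* v1 :+ 2 :* v4 :+ k 1 :+ 2 :* v5 :+ k 3 <: 2 :* v3 :+ 2 :* v2) (v0 :+ v1 <: v2 :+ v3 by≡ 2 · rm & k 1 :+ (k 1 :+ v4 :+ v5) <: v0 by 2 · (subst (\ n -> n + s < r * miss S z) N≡ (above-threshold S low)) & □))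
   expand-left : ∀ r M a E -> r * ((1 + M) * (1 + M)) + r * ((1 + M) * a) + E ≡ r * (M * M) + 2 * (r * M) + r + r * (M * a) + r * a + E
   expand-left = solve-∀
   expand-right : ∀ r D d M -> r * (D + 2 * d) + (1 + M) * (1 + M) ≡ r * D + 2 * (r * d) + M * M + 2 * M + 1
   expand-right = solve-∀
   distribute-left : ∀ G x M s -> G * (2 * x + 2 * M + 1 + 2 * s + 3) ≡ 2 * (G * x) + 2 * (G * M) + 2 * (G * s) + 4 * G
   distribute-left = solve-∀
   distribute-right : ∀ G x r -> G * (2 * x + 2 * r) ≡ 2 * (G * x) + 2 * (G * r)
   distribute-right = solve-∀
   spread-left : ∀ G r M q -> G * (r * ((1 + M) * (1 + M))) + q ≡ G * (r * (M * M)) + 2 * (G * (r * M)) + G * r + q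
   spread-left = solve-∀
   spread-right : ∀ G r D d M -> G * (r * (D + 2 * d)) + (1 + G) * ((1 + M) * (1 + M)) ≡
    G * (r * D) + 2 * (G * (r * d)) + (1 + G) * (M * M) + 2 * M + 1 + 2 * (G * M) + G
   spread-right = solve-∀

  -- The bound m on the length carries the recursion, since removing a vertex from the middle of a
  -- list is not structural.
  reduce : ∀ m S -> length S ≤ m -> Excess S -> Reduced
  reduce-split : ∀ m {S} xs {z} ys -> S ≡ xs ++ z ∷ ys -> length S ≤ suc m -> Excess S -> threshold S < miss S z -> Reduced

  reduce m S len ex = go m len (search (\ x -> suc (threshold S) ≤? miss S x) S)
   where
   go : ∀ m -> length S ≤ m -> Dec (∃ \ x -> x ∈ S × threshold S < miss S x) -> Reduced
   go m len (no nowhere) = S , ex , \ x∈ -> ≮⇒≥ \ h -> nowhere (_ , x∈ , h)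
   go (suc m) len (yes (x , x∈ , h)) = let xs , ys , e = ∈-∃++ x∈ in reduce-split m xs ys e len ex h
   go zero len (yes (x , x∈ , h)) = absurd (≤-trans (nonempty x∈) len) \ ()
    where
    nonempty : ∀ {x} {S : List V} -> x ∈ S -> 1 ≤ length S
    nonempty (here _) = s≤s z≤n
    nonempty (there _) = s≤s z≤n

  reduce-split m xs {z} ys refl len ex h = reduce m (xs ++ ys)
   (≤-pred (subst (_≤ suc m) (trans (sym (∑-ones (xs ++ z ∷ ys)))
    (trans (#-middle (\ _ -> yes tt) xs ys) (cong suc (∑-ones (xs ++ ys))))) len))
   (delete xs ys ex h)

  degrees≤ : ∀ S -> degrees S ≤ length S * length S
  degrees≤ S = ∑-≤-const (length S) S \ {x} _ -> #≤length (Adj? x) S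

  -- As `degrees` is at most `|S|²`, the potential yields `n0² ≤ (1 + G)|S|²`, which is weakened
  -- further to make the right side a square.
  spread-size : ∀ {S} -> Excess S -> n0 ≤ (1 + G) * length S
  spread-size {S} ex = ≮⇒≥ \ big -> <⇒≱ (*-mono-< big big) (begin
   n0 * n0 ≤⟨ +-cancelˡ-≤ (G * (r * (N * N))) _ _ (≤-trans (spread ex)
                          (+-monoˡ-≤ _ (*-monoʳ-≤ G (*-monoʳ-≤ r (degrees≤ S))))) ⟩
   (1 + G) * (N * N) ≤⟨ m≤m+n _ _ ⟩
   (1 + G) * (N * N) + G * ((1 + G) * (N * N)) ≡⟨ square G N ⟩
   (1 + G) * N * ((1 + G) * N) ∎)
   where
   N = length S
   square : ∀ G N -> (1 + G) * (N * N) + G * ((1 + G) * (N * N)) ≡ (1 + G) * N * ((1 + G) * N)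
   square = solve-∀

  start : ∀ S -> length S ≡ n0 -> Independence S a ->
   r * (length S * length S) + r * (length S * a) + E < r * degrees S + length S * length S -> Excess S
  start S len ind ex = record
   { independence = ind ; excess = ex
   ; spread = begin
     G * (r * (N * N)) + n0 * n0 ≡⟨ cong (\ n -> G * (r * (N * N)) + n * n) len ⟨
     G * (r * (N * N)) + N * N ≤⟨ +-monoˡ-≤ (N * N) (*-monoʳ-≤ G (≤-trans (≤-trans (m≤m+n _ _) (m≤m+n _ E)) (<⇒≤ ex))) ⟩
     G * (r * degrees S + N * N) + N * N ≡⟨ lemma G (r * degrees S) (N * N) ⟩
     G * (r * degrees S) + (1 + G) * (N * N) ∎ }
   where
   N = length S
   lemma : ∀ G x q -> G * (x + q) + q ≡ G * x + (1 + G) * q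
   lemma = solve-∀

-- Red and blue neighbourhoods, and the bound for (K3, K3)

module Colours {V : Set} (𝒢 : ColouredGraph V)
 (red-free : Graphs.RedFree 𝒢) where
 open Graphs 𝒢
 open Partitions 𝒢 using (degrees)

 BlueClique : List V -> Set
 BlueClique = AllPairs Blue

 clique-∈ : ∀ {L x y} -> Clique L -> x ∈ L -> y ∈ L -> x ≡ y ⊎ Adj x y
 clique-∈ (h ∷ c) (here refl) (here refl) = inj₁ refl
 clique-∈ (h ∷ c) (here refl) (there m) = inj₂ (All.lookup h m)
 clique-∈ (h ∷ c) (there m) (here refl) = inj₂ (Adj-sym (All.lookup h m))
 clique-∈ (h ∷ c) (there m) (there m') = clique-∈ c m m'

 all-blue : ∀ {L} -> Clique L -> (∀ {x y} -> x ∈ L -> y ∈ L -> ¬ Red x y) -> BlueClique L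
 all-blue [] h = []
 all-blue (a ∷ c) h = All.tabulate (\ m -> [ (\ r -> absurd r (h (here refl) (there m))) , (\ b -> b) ]′ (colour (All.lookup a m)))
  ∷ all-blue c \ m m' -> h (there m) (there m')

 no-blue-edge : ∀ {L} -> Clique L -> (∀ {x y} -> x ∈ L -> y ∈ L -> ¬ Blue x y) -> length L ≤ 2
 no-blue-edge {[]} c h = z≤n
 no-blue-edge {x ∷ []} c h = s≤s z≤n
 no-blue-edge {x ∷ y ∷ []} c h = s≤s (s≤s z≤n)
 no-blue-edge {x ∷ y ∷ z ∷ L} ((xy ∷ xz ∷ _) ∷ (yz ∷ _) ∷ _) h =
  ⊥-elim (red-free (red! xy (here refl) (there (here refl))) (red! yz (there (here refl)) (there (there (here refl))))
   (red! xz (here refl) (there (there (here refl)))))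
  where
  red! : ∀ {p q} -> Adj p q -> p ∈ x ∷ y ∷ z ∷ L -> q ∈ x ∷ y ∷ z ∷ L -> Red p q
  red! e m m' = [ (\ r -> r) , (\ b -> absurd b (h m m')) ]′ (colour e)

 short : ∀ {L} -> BlueClique L -> (∀ {x y z} -> x ∈ L -> y ∈ L -> z ∈ L -> Blue x y -> Blue x z -> Blue y z -> ⊥) -> length L ≤ 2
 short {[]} c h = z≤n
 short {x ∷ []} c h = s≤s z≤n
 short {x ∷ y ∷ []} c h = s≤s (s≤s z≤n)
 short {x ∷ y ∷ z ∷ L} ((xy ∷ xz ∷ _) ∷ (yz ∷ _) ∷ _) h = ⊥-elim (h (here refl) (there (here refl)) (there (there (here refl))) xy xz yz)

 lonely : ∀ {L} -> Clique L -> (∀ {x y} -> x ∈ L -> y ∈ L -> ¬ Red x y) -> (∀ {x y} -> x ∈ L -> y ∈ L -> ¬ Blue x y) -> length L ≤ 1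
 lonely {[]} c h h' = z≤n
 lonely {x ∷ []} c h h' = s≤s z≤n
 lonely {x ∷ y ∷ L} ((a ∷ _) ∷ _) h h' = ⊥-elim ([ h (here refl) (there (here refl)) , h' (here refl) (there (here refl)) ]′ (colour a))

 NoBlueTriangle : List V -> Set
 NoBlueTriangle L = ∀ {x y z} -> x ∈ L -> y ∈ L -> z ∈ L -> Blue x y -> Blue x z -> Blue y z -> ⊥

 -- The red neighbours of a vertex span no red edge, and its blue neighbours in L span no blue edge.
 red-degree≤2 : ∀ {L} -> Clique L -> NoBlueTriangle L -> ∀ x -> # (Red? x) L ≤ 2
 red-degree≤2 {L} c h x = subst (_≤ 2) (#-length (Red? x) L) (short
  (all-blue (AllPairs.filter⁺ (Red? x) c) \ m m' r -> red-free (proj₂ (∈-filter⁻ (Red? x) {xs = L} m)) r (proj₂ (∈-filter⁻ (Red? x) {xs = L} m')))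
  \ m m' m″ -> h (proj₁ (∈-filter⁻ (Red? x) m)) (proj₁ (∈-filter⁻ (Red? x) m')) (proj₁ (∈-filter⁻ (Red? x) m″)))

 blue-degree≤2 : ∀ {L} -> Clique L -> NoBlueTriangle L -> ∀ {x} -> x ∈ L -> # (Blue? x) L ≤ 2
 blue-degree≤2 {L} c h {x} x∈ = subst (_≤ 2) (#-length (Blue? x) L) (no-blue-edge (AllPairs.filter⁺ (Blue? x) c)
  \ m m' b -> let p , q = ∈-filter⁻ (Blue? x) m ; p' , q' = ∈-filter⁻ (Blue? x) m' in h x∈ p p' q q' b)

 clique-degree : ∀ {L} -> Clique L -> ∀ {x} -> x ∈ L -> # (Red? x) L + # (Blue? x) L + 1 ≡ length L
 clique-degree {x ∷ L} (a ∷ c) (here refl) rewrite 𝟙-no (Red? x x) (\ r -> red-adj r (χ-irrefl x)) | 𝟙-no (Blue? x x) (\ b -> blue-adj b (χ-irrefl x)) =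
  trans (+-comm _ 1) (cong suc (trans (sym (∑-+ _ _ L)) (trans (∑-cong L \ m -> one (All.lookup a m)) (∑-ones L))))
  where
  one : ∀ {y} -> Adj x y -> 𝟙 (Red? x y) + 𝟙 (Blue? x y) ≡ 1
  one {y} a with χ x y
  ... | none = absurd refl a
  ... | red = refl
  ... | blue = refl
 clique-degree {y ∷ L} (a ∷ c) {x} (there m) = trans (shift (𝟙 (Red? x y)) (# (Red? x) L) (𝟙 (Blue? x y)) (# (Blue? x) L))
  (cong₂ _+_ (one (Adj-sym (All.lookup a m))) (clique-degree c m))
  where
  shift : ∀ a b c d -> a + b + (c + d) + 1 ≡ (a + c) + (b + d + 1)
  shift = solve-∀
  one : ∀ {y} -> Adj x y -> 𝟙 (Red? x y) + 𝟙 (Blue? x y) ≡ 1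
  one {y} a with χ x y
  ... | none = absurd refl a
  ... | red = refl
  ... | blue = refl

 -- This is R(3,3) = 6: a vertex has at most two red and two blue neighbours in L.
 ramsey33 : ∀ {L} -> Clique L -> NoBlueTriangle L -> length L ≤ 5
 ramsey33 {[]} c h = z≤n
 ramsey33 {x ∷ L} c h = (lin ((length (x ∷ L)) ∷ (# (Red? x) (x ∷ L)) ∷ (# (Blue? x) (x ∷ L)) ∷ []) (v0 <: k 5) (v0 <: v1 :+ v2 :+ k 1 by≡ sym (clique-degree c (here refl)) & v1 <: k 2 by red-degree≤2 c h x & v2 <: k 2 by blue-degree≤2 c h (here refl) & □))

 seen-red seen-blue : V -> List V -> List V
 seen-red u = filter (\ x -> Red? x u)
 seen-blue u = filter (\ x -> Blue? x u)

 seen-total : ∀ K u -> misses K u + length (seen-red u K) + length (seen-blue u K) ≡ length K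
 seen-total K u = trans (cong₂ (\ p q -> misses K u + p + q) (#-length (\ x -> Red? x u) K) (#-length (\ x -> Blue? x u) K)) (colours-total K u)

 seen-red-∈ : ∀ {u x} K -> x ∈ seen-red u K -> x ∈ K × Red x u
 seen-red-∈ {u} K = ∈-filter⁻ (\ x -> Red? x u)

 seen-blue-∈ : ∀ {u x} K -> x ∈ seen-blue u K -> x ∈ K × Blue x u
 seen-blue-∈ {u} K = ∈-filter⁻ (\ x -> Blue? x u)

 seen-red-blue : ∀ {K} u -> Clique K -> BlueClique (seen-red u K)
 seen-red-blue {K} u c = all-blue (AllPairs.filter⁺ (\ x -> Red? x u) c) \ m m' r ->
  red-free r (proj₂ (seen-red-∈ K m')) (proj₂ (seen-red-∈ K m))

 seen-blue-clique : ∀ {K} u -> Clique K -> Clique (seen-blue u K)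
 seen-blue-clique u = AllPairs.filter⁺ (\ x -> Blue? x u)

 -- A vertex seen by both twins in red would close a red triangle with them.
 red-twins : ∀ {K u w} -> Red u w -> Same K u w -> seen-red u K ≡ []
 red-twins {K} {u} {w} r s with seen-red u K in eq
 ... | [] = refl
 ... | x ∷ _ = let m , xu = seen-red-∈ K (subst (x ∈_) (sym eq) (here refl)) in ⊥-elim (red-free xu r (trans (sym (same s m)) xu))

 blue-twins : ∀ {K u w x} -> Same K u w -> x ∈ seen-blue u K -> Blue u x × Blue w x
 blue-twins {K} s m = let m' , b = seen-blue-∈ K m in χ-flip b , χ-flip (trans (sym (same s m')) b)

 blue-twins-clique : ∀ {K u w M} -> Blue u w -> Same K u w -> All (_∈ seen-blue u K) M -> BlueClique M -> BlueClique (u ∷ w ∷ M)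
 blue-twins-clique b s h c = (b ∷ All.map (\ m -> proj₁ (blue-twins s m)) h) ∷ All.map (\ m -> proj₂ (blue-twins s m)) h ∷ c

 take-clique : ∀ m {K} {S : List V} -> Clique K -> All (_∈ S) K -> m ≤ length K -> ∃ \ L -> Clique L × All (_∈ S) L × length L ≡ m
 take-clique m {K} c h le = take m K , AllPairs.take⁺ m c , All.take⁺ m h , trans (length-take m K) (m≤n⇒m⊓n≡m le)

 module Average (S : List V) (μ : ℕ) (low : Low S μ) where

  weighted-average : ∀ {K} -> All (_∈ S) K -> ∑ (misses K) S ≤ length K * μ
  weighted-average {K} h = ∑-misses-≤ K S (All.map low h)

  rare : ∀ {E a} -> Dense E S a -> ∀ K {P : V -> Set} (P? : Decidable P) ->
   (∀ {u w} -> u ∈ S -> w ∈ S -> P u -> E u w -> Same K u w -> ⊥) -> # P? S ≤ 3 ^ length K * a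
  rare dense K P? h = ≮⇒≥ \ big -> let u , w , u∈ , w∈ , pu , _ , e , s = twins dense K P? big in h u∈ w∈ pu e s

  -- Vertices missing fewer than m of K contain no adjacent twins and are therefore rare; nearly
  -- every vertex contributes m to the number of missed pairs, which is at most `length K * μ`.
  average : ∀ {E a} -> Dense E S a -> ∀ m {K} -> All (_∈ S) K ->
   (∀ {u w} -> u ∈ S -> w ∈ S -> E u w -> Same K u w -> m ≤ misses K u) ->
   m * length S ≤ length K * μ + m * (3 ^ length K * a)
  average {a = a} dense m {K} h typical = begin
   m * length S ≡⟨ trans (∑-const m S) (*-comm (length S) m) ⟨
   ∑ (\ _ -> m) S ≤⟨ ∑-mono S (\ {w} _ -> pointwise (misses K w <? m)) ⟩
   ∑ (\ w -> misses K w + m * 𝟙 (misses K w <? m)) S ≡⟨ trans (∑-+ _ _ S) (cong (∑ (misses K) S +_) (∑-* m _ S)) ⟩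
   ∑ (misses K) S + m * # (\ w -> misses K w <? m) S ≤⟨ +-mono-≤ (weighted-average h) (*-monoʳ-≤ m
    (rare dense K _ \ u∈ w∈ few e s -> <⇒≱ few (typical u∈ w∈ e s))) ⟩
   length K * μ + m * (3 ^ length K * a) ∎
   where
   pointwise : ∀ {t} (d : Dec (t < m)) -> m ≤ t + m * 𝟙 d
   pointwise {t} (yes _) = ≤-trans (≡⇒≤ (sym (*-identityʳ m))) (m≤n+m _ t)
   pointwise {t} (no p) = ≤-trans (≮⇒≥ p) (m≤m+n t _)

  -- A weight with average sufficiently below `m + 1` is at most m on many vertices, hence on a pair
  -- of twins joined by E.
  light-twins : ∀ {E b} -> Dense E S b -> ∀ K (f : V -> ℕ) m -> ∑ f S + suc m * (3 ^ length K * b) < suc m * length S ->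
   ∃₂ \ u w -> u ∈ S × w ∈ S × f u ≤ m × f w ≤ m × E u w × Same K u w
  light-twins {b = b} dense K f m h = twins dense K (\ w -> f w ≤? m) (≰⇒> \ few -> <⇒≱ h (begin
   suc m * length S ≡⟨ trans (∑-const (suc m) S) (*-comm (length S) (suc m)) ⟨
   ∑ (\ _ -> suc m) S ≤⟨ ∑-mono S (\ {w} _ -> pointwise (f w ≤? m)) ⟩
   ∑ (\ w -> f w + suc m * 𝟙 (f w ≤? m)) S ≡⟨ trans (∑-+ f _ S) (cong (∑ f S +_) (∑-* (suc m) _ S)) ⟩
   ∑ f S + suc m * # (\ w -> f w ≤? m) S ≤⟨ +-monoʳ-≤ (∑ f S) (*-monoʳ-≤ (suc m) few) ⟩
   ∑ f S + suc m * (3 ^ length K * b) ∎))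
   where
   pointwise : ∀ {t} (d : Dec (t ≤ m)) -> suc m ≤ t + suc m * 𝟙 d
   pointwise {t} (yes _) = ≤-trans (≡⇒≤ (sym (*-identityʳ (suc m)))) (m≤n+m _ t)
   pointwise {t} (no p) = ≤-trans (≰⇒> p) (m≤m+n t _)

 module Core33 (S : List V) (a μ σ : ℕ) (dense : Dense Adj S a) (low : Low S μ)
  (blue-free : NoBlueTriangle S) (upper : 2 * μ ≤ length S + σ) (small : 1000 * a ≤ σ) (tiny : 300000 * σ < μ) where
  open Average S μ low

  -- Red twins see nothing in red, and in blue a clique without blue edges; blue twins see nothing
  -- in blue, and in red a blue clique. Either clique has at most two vertices.
  typical33 : ∀ {K u w} -> Clique K -> All (_∈ S) K -> u ∈ S -> w ∈ S -> Adj u w -> Same K u w -> length K ≤ misses K u + 2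
  typical33 {K} {u} {w} c K⊆ u∈ w∈ e s = [ when-red , when-blue ]′ (colour e)
   where
   total = seen-total K u
   when-red : Red u w -> length K ≤ misses K u + 2
   when-red r = (lin ((length K) ∷ (misses K u) ∷ (length (seen-red u K)) ∷ (length (seen-blue u K)) ∷ []) (v0 <: v1 :+ k 2) (v0 <: v1 :+ v2 :+ v3 by≡ sym total & v2 <: k 0 by≡ cong length (red-twins r s) & v3 <: k 2 by (no-blue-edge (seen-blue-clique u c) \ m m' b -> blue-free u∈ (All.lookup K⊆ (proj₁ (seen-blue-∈ K m))) (All.lookup K⊆ (proj₁ (seen-blue-∈ K m'))) (proj₁ (blue-twins s m)) (proj₁ (blue-twins s m')) b) & □))
   none-blue : Blue u w -> length (seen-blue u K) ≤ 0
   none-blue b = go (seen-blue u K) (\ m -> m)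
    where
    go : ∀ M -> (∀ {x} -> x ∈ M -> x ∈ seen-blue u K) -> length M ≤ 0
    go [] _ = z≤n
    go (x ∷ _) h = ⊥-elim (blue-free u∈ w∈ (All.lookup K⊆ (proj₁ (seen-blue-∈ K (h (here refl))))) b
     (proj₁ (blue-twins s (h (here refl)))) (proj₂ (blue-twins s (h (here refl)))))
   when-blue : Blue u w -> length K ≤ misses K u + 2
   when-blue b = (lin ((length K) ∷ (misses K u) ∷ (length (seen-red u K)) ∷ (length (seen-blue u K)) ∷ []) (v0 <: v1 :+ k 2) (v0 <: v1 :+ v2 :+ v3 by≡ sym total & v3 <: k 0 by none-blue b & v2 <: k 2 by (short (seen-red-blue u c) \ m m' m″ -> blue-free (All.lookup K⊆ (proj₁ (seen-red-∈ K m))) (All.lookup K⊆ (proj₁ (seen-red-∈ K m'))) (All.lookup K⊆ (proj₁ (seen-red-∈ K m″)))) & □))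

  -- Twins miss at least three of five vertices, but `3N` exceeds `5μ`, which is about `5N/2`.
  ω≤4 : ∀ K -> Clique K -> All (_∈ S) K -> length K ≤ 4
  ω≤4 K c K⊆ = ≮⇒≥ \ big -> refute (take-clique 5 c K⊆ big)
   where
   refute : (∃ \ L -> Clique L × All (_∈ S) L × length L ≡ 5) -> ⊥
   refute (L , c , L⊆ , len) = <⇒≱ {5 * μ + 3 * (243 * a)} {3 * length S}
    (lin-κ 999 (μ ∷ (length S) ∷ σ ∷ a ∷ []) (k 1 :+ (5 :* v0 :+ 3 :* (243 :* v3)) <: 3 :* v1) (2 :* v0 <: v1 :+ v2 by 3000 · upper & 1000 :* v3 <: v2 by 729 · small & k 1 :+ 300000 :* v2 <: v0 by 1000 · tiny & □))
    (subst (\ l -> 3 * length S ≤ l * μ + 3 * (3 ^ l * a)) len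
     (average dense 3 L⊆ \ u∈ w∈ e s -> +-cancelʳ-≤ 2 3 _ (subst (_≤ misses L _ + 2) len (typical33 c L⊆ u∈ w∈ e s))))

  open Structure 𝒢 S a μ dense low

  parts33 : Parts 2 (4000 * σ)
  parts33 = PartsExist.parts 𝒢 S a μ dense low 1 σ (4000 * σ) upper
   (lin-κ 999 (a ∷ σ ∷ []) (81 :* v0 <: v1) (1000 :* v0 <: v1 by 81 · small & □))
   (lin (σ ∷ []) (20 :* v0 :+ (20 :* v0 :+ k 0) :+ 40 :* (81 :* v0) <: 4000 :* v0) (□))
   (lin (σ ∷ μ ∷ []) (k 1 :+ 4000 :* v0 <: v1) (k 1 :+ 300000 :* v0 <: v1 by tiny & □)) ω≤4

  bound33 : 2 * degrees S + length S * length S ≤ 2 * (length S * length S) + 2 * (length S * a)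
  bound33 = clique-free-bound parts33 (lin-κ 999 (a ∷ σ ∷ []) (v0 <: 4000 :* v1) (1000 :* v0 <: v1 by small & □))
   (lin-κ 199 (σ ∷ μ ∷ a ∷ []) (k 1 :+ 5 :* (v2 :+ (4 :* (4000 :* v0) :+ (4 :* (4000 :* v0) :+ k 0))) <: v1) (k 1 :+ 300000 :* v0 <: v1 by 200 · tiny & 1000 :* v2 <: v0 by small & □)) ω≤4

module RedDegrees {V : Set} (𝒢 : ColouredGraph V)
 (red-free : Graphs.RedFree 𝒢) where
 open Graphs 𝒢
 open Colours 𝒢 red-free

 BlueBounded : List V -> ℕ -> Set
 BlueBounded S s = ∀ {L} -> BlueClique L -> All (_∈ S) L -> length L ≤ s

 -- If every vertex has many red neighbours, then a set without blue edges is small: it meets each red neighbourhood in an independent set.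
 dense-blue : ∀ {S a} c -> Dense Adj S a -> 0 < length S -> (∀ {x} -> x ∈ S -> length S ≤ c * # (Red? x) S) -> Dense Blue S (c * a)
 dense-blue {S} {a} c dense pos many = dense-from-independent Blue? S (c * a) \ {P} P? ind ->
  *-cancelˡ-≤ (length S) {{>-nonZero pos}} (begin
   length S * # P? S ≡⟨ ∑-* (length S) _ S ⟨
   ∑ (\ x -> length S * 𝟙 (P? x)) S ≤⟨ ∑-mono S (\ {x} x∈ -> weigh x∈ (P? x)) ⟩
   ∑ (\ x -> c * # (\ y -> P? x ×? Red? y x) S) S ≡⟨ ∑-* c _ S ⟩
   c * ∑ (\ x -> # (\ y -> P? x ×? Red? y x) S) S ≡⟨ cong (c *_) (∑-swap (\ x y -> 𝟙 (P? x ×? Red? y x)) S S) ⟩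
   c * ∑ (\ y -> # (\ x -> P? x ×? Red? y x) S) S ≤⟨ *-monoʳ-≤ c (∑-≤-const a S \ {y} y∈ -> independent-bound dense
                                   (\ x -> P? x ×? Red? y x) \ x∈ x'∈ (p , r) (p' , r') e ->
                                   [ (\ r″ -> red-free r r″ r') , ind x∈ x'∈ p p' ]′ (colour e)) ⟩
   c * (length S * a) ≡⟨ arrange c (length S) a ⟩
   length S * (c * a) ∎)
  where
  arrange : ∀ c n a -> c * (n * a) ≡ n * (c * a)
  arrange = solve-∀
  weigh : ∀ {x} {P : Set} -> x ∈ S -> (d : Dec P) -> length S * 𝟙 d ≤ c * # (\ y -> d ×? Red? y x) S
  weigh x∈ (no _) = ≤-trans (≡⇒≤ (*-zeroʳ (length S))) z≤n
  weigh {x} x∈ (yes p) = ≤-trans (≡⇒≤ (*-identityʳ (length S))) (≤-trans (many x∈)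
   (*-monoʳ-≤ c (#-mono (Red? x) (\ y -> yes p ×? Red? y x) S \ _ r -> p , χ-flip r)))

 -- Red twins see nothing in red, and in blue a clique without blue triangles, at most five vertices
 -- by Ramsey. Blue twins see at most three vertices in red, as these form a blue clique, and at
 -- most two in blue.
 typical34 : ∀ {S} -> BlueBounded S 3 -> ∀ {K u w} -> Clique K -> All (_∈ S) K -> u ∈ S -> w ∈ S -> Adj u w -> Same K u w ->
  length K ≤ misses K u + 5
 typical34 {S} bounded {K} {u} {w} c K⊆ u∈ w∈ e s = [ when-red , when-blue ]′ (colour e)
  where
  total = seen-total K u
  ∈S : ∀ {x} -> x ∈ seen-blue u K -> x ∈ S
  ∈S m = All.lookup K⊆ (proj₁ (seen-blue-∈ K m))
  when-red : Red u w -> length K ≤ misses K u + 5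
  when-red r = (lin ((length K) ∷ (misses K u) ∷ (length (seen-red u K)) ∷ (length (seen-blue u K)) ∷ []) (v0 <: v1 :+ k 5) (v0 <: v1 :+ v2 :+ v3 by≡ sym total & v2 <: k 0 by≡ cong length (red-twins r s) & v3 <: k 5 by (ramsey33 (seen-blue-clique u c) \ m m' m″ b b' b″ -> <⇒≱ (s≤s (s≤s (s≤s (s≤s z≤n)))) (bounded ((proj₁ (blue-twins s m) ∷ proj₁ (blue-twins s m') ∷ proj₁ (blue-twins s m″) ∷ []) ∷ (b ∷ b' ∷ []) ∷ (b″ ∷ []) ∷ [] ∷ []) (u∈ ∷ ∈S m ∷ ∈S m' ∷ ∈S m″ ∷ []))) & □))
  when-blue : Blue u w -> length K ≤ misses K u + 5
  when-blue b = (lin ((length K) ∷ (misses K u) ∷ (length (seen-red u K)) ∷ (length (seen-blue u K)) ∷ []) (v0 <: v1 :+ k 5) (v0 <: v1 :+ v2 :+ v3 by≡ sym total & v2 <: k 3 by (bounded (seen-red-blue u c) (All.filter⁺ (\ x -> Red? x u) K⊆)) & v3 <: k 2 by (no-blue-edge (seen-blue-clique u c) \ m m' b' -> <⇒≱ (s≤s (s≤s (s≤s (s≤s z≤n)))) (bounded (blue-twins-clique b s (m ∷ m' ∷ []) ((b' ∷ []) ∷ [] ∷ [])) (u∈ ∷ w∈ ∷ ∈S m ∷ ∈S m' ∷ []))) & □))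

 -- A blue triangle seen in blue would form a blue K5 with the twins.
 typical35-blue : ∀ {S} -> BlueBounded S 4 -> ∀ {K u w} -> Clique K -> All (_∈ S) K -> u ∈ S -> w ∈ S -> Blue u w -> Same K u w ->
  length (seen-red u K) ≤ 4 × length (seen-blue u K) ≤ 5 × NoBlueTriangle (seen-blue u K)
 typical35-blue {S} bounded {K} {u} {w} c K⊆ u∈ w∈ b s =
  bounded (seen-red-blue u c) (All.filter⁺ (\ x -> Red? x u) K⊆) , ramsey33 (seen-blue-clique u c) no-triangle , no-triangle
  where
  ∈S : ∀ {x} -> x ∈ seen-blue u K -> x ∈ S
  ∈S m = All.lookup K⊆ (proj₁ (seen-blue-∈ K m))
  no-triangle : NoBlueTriangle (seen-blue u K)
  no-triangle m m' m″ b1 b2 b3 = <⇒≱ (s≤s (s≤s (s≤s (s≤s (s≤s z≤n))))) (bounded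
   (blue-twins-clique b s (m ∷ m' ∷ m″ ∷ []) ((b1 ∷ b2 ∷ []) ∷ (b3 ∷ []) ∷ [] ∷ [])) (u∈ ∷ w∈ ∷ ∈S m ∷ ∈S m' ∷ ∈S m″ ∷ []))

 -- Blue neighbourhoods in a graph without a red triangle and a blue K5: on eight vertices of a clique inside one of them, others see five at most.
 blue-degree-bound : ∀ S a μ σ -> Dense Adj S a -> Low S μ -> BlueBounded S 4 ->
  5 * μ ≤ length S + σ -> 100000 * a ≤ σ -> 1000 * σ < length S -> ∀ {x} -> x ∈ S -> 4 * # (Blue? x) S ≤ 3 * length S
 blue-degree-bound S a μ σ dense low bounded upper small tiny {x} x∈ = ≮⇒≥ \ big -> refute big (grow-H big)
  where
  H = filter (Blue? x) S
  H-length : length H ≡ # (Blue? x) S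
  H-length = #-length (Blue? x) S
  H⊆ : ∀ {y} -> y ∈ H -> y ∈ S × Blue x y
  H⊆ = ∈-filter⁻ (Blue? x)
  low-H : ∀ {y} -> y ∈ H -> miss H y ≤ μ
  low-H {y} m = ≤-trans (≡⇒≤ (#-filter (Blue? x) (Non? y) S)) (≤-trans (#-mono _ (Non? y) S \ _ -> proj₂) (low (proj₁ (H⊆ m))))
  dense-H : Dense Adj H a
  dense-H = dense-filter (Blue? x) dense
  bounded-H : BlueBounded H 3
  bounded-H c h = ≤-pred (bounded (All.map (\ m -> proj₂ (H⊆ m)) h ∷ c) (x∈ ∷ All.map (\ m -> proj₁ (H⊆ m)) h))
  open Average H μ low-H
  grow-H : 3 * length S < 4 * # (Blue? x) S -> ∃ \ K -> 7 < length K × Clique K × All (_∈ H) K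
  -- The seven vertices are missed at most `7μ` times, about `7N/5`, whereas `2|H|` exceeds `3N/2`.
  grow-H big = grow dense-H low-H 7 (lin-κ 49999 ((length S) ∷ (# (Blue? x) S) ∷ (length H) ∷ μ ∷ σ ∷ a ∷ []) (k 1 :+ (7 :* v3 :+ 2 :* (2187 :* v5)) <: 2 :* v2) (k 1 :+ 3 :* v0 <: 4 :* v1 by 25000 · big & v1 <: v2 by≡ 100000 · sym H-length & 5 :* v3 <: v0 :+ v4 by 70000 · upper & 100000 :* v5 <: v4 by 2187 · small & k 1 :+ 1000 :* v4 <: v0 by 5000 · tiny & □))
  refute : 3 * length S < 4 * # (Blue? x) S -> (∃ \ K -> 7 < length K × Clique K × All (_∈ H) K) -> ⊥
  refute big (K , 7< , c , K⊆) = eight (take-clique 8 c K⊆ 7<)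
   where
   eight : (∃ \ L -> Clique L × All (_∈ H) L × length L ≡ 8) -> ⊥
   eight (L , c , L⊆ , len) = <⇒≱ {8 * μ + 3 * (6561 * a)} {3 * length H}
    (lin-κ 99999 ((length S) ∷ (# (Blue? x) S) ∷ (length H) ∷ μ ∷ σ ∷ a ∷ []) (k 1 :+ (8 :* v3 :+ 3 :* (6561 :* v5)) <: 3 :* v2) (k 1 :+ 3 :* v0 <: 4 :* v1 by 75000 · big & v1 <: v2 by≡ 300000 · sym H-length & 5 :* v3 <: v0 :+ v4 by 200000 · upper & 100000 :* v5 <: v4 by 19683 · small & k 1 :+ 1000 :* v4 <: v0 by 25000 · tiny & □))
    (subst (\ l -> 3 * length H ≤ l * μ + 3 * (3 ^ l * a)) len
     (average dense-H 3 L⊆ \ u∈ w∈ e s -> +-cancelʳ-≤ 5 3 _ (subst (_≤ misses L _ + 5) len (typical34 bounded-H c L⊆ u∈ w∈ e s))))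

-- No clique on eleven vertices for (K3, K5)

module Eleven {V : Set} (𝒢 : ColouredGraph V)
 (red-free : Graphs.RedFree 𝒢)
 (S : List V) (b μ σ : ℕ) (dense : Graphs.Dense 𝒢 (Graphs.Blue 𝒢) S b) (low : Graphs.Low 𝒢 S μ)
 (bounded : RedDegrees.BlueBounded 𝒢 red-free S 4)
 (upper : 5 * μ ≤ length S + σ) (small : 10000000 * b ≤ σ) (tiny : 1000 * σ < length S) where
 open Graphs 𝒢
 open Colours 𝒢 red-free
 open RedDegrees 𝒢 red-free
 open Average S μ low

 -- Blue twins see at most four vertices of a clique in red and at most five in blue. If they miss
 -- only two of eleven, both bounds are attained, and replacing the missed vertices by the twins
 -- gives this form.
 record Configuration : Set where
  field
   u u' : V
   Q P : List V
   u∈ : u ∈ S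
   u'∈ : u' ∈ S
   Q⊆ : All (_∈ S) Q
   P⊆ : All (_∈ S) P
   uu' : Blue u u'
   Q-blue : BlueClique Q
   Q-length : length Q ≡ 4
   P-length : length P ≡ 5
   P-triangles : NoBlueTriangle P
   QP-clique : Clique (Q ++ P)
   uQ : ∀ {x} -> x ∈ Q -> Red u x
   u'Q : ∀ {x} -> x ∈ Q -> Red u' x
   uP : ∀ {x} -> x ∈ P -> Blue u x
   u'P : ∀ {x} -> x ∈ P -> Blue u' x

 module Refute (C : Configuration) where
  open Configuration C

  K : List V
  K = u ∷ u' ∷ Q ++ P

  K-length : length K ≡ 11
  K-length = cong (\ n -> 2 + n) (trans (length-++ Q) (cong₂ _+_ Q-length P-length))

  inQ : ∀ {x} -> x ∈ Q -> x ∈ K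
  inQ m = there (there (∈-++⁺ˡ m))

  inP : ∀ {x} -> x ∈ P -> x ∈ K
  inP m = there (there (∈-++⁺ʳ Q m))

  K⊆ : All (_∈ S) K
  K⊆ = u∈ ∷ u'∈ ∷ All.++⁺ Q⊆ P⊆

  P-clique : Clique P
  P-clique = suffix Q QP-clique
   where
   suffix : ∀ L {M} -> Clique (L ++ M) -> Clique M
   suffix [] c = c
   suffix (_ ∷ L) (_ ∷ c) = suffix L c

  -- A five-clique without monochromatic triangles is the union of a red and a blue five-cycle.
  P-reds : ∀ {x} -> x ∈ P -> # (Red? x) P ≡ 2
  P-reds {x} m = ≤-antisym (red-degree≤2 P-clique P-triangles x)
   (lin ((length P) ∷ (# (Red? x) P) ∷ (# (Blue? x) P) ∷ []) (k 2 <: v1) (v0 <: v1 :+ v2 :+ k 1 by≡ sym (clique-degree P-clique m) & k 5 <: v0 by≡ sym P-length & v2 <: k 2 by blue-degree≤2 P-clique P-triangles m & □))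

  F : V -> ℕ
  F p = # (Red? p) Q

  -- The red neighbours of p in Q and P form a blue clique, at most four vertices, and two of them
  -- lie in P.
  F≤2 : ∀ {p} -> p ∈ P -> F p ≤ 2
  F≤2 {p} m = (lin ((# (Red? p) P) ∷ (F p) ∷ (# (Red? p) (Q ++ P)) ∷ (length (filter (Red? p) (Q ++ P))) ∷ []) (v1 <: k 2) (k 2 <: v0 by≡ sym (P-reds m) & v1 :+ v0 <: v2 by≡ sym (∑-++ (\ x -> 𝟙 (Red? p x)) Q P) & v2 <: v3 by≡ sym (#-length (Red? p) (Q ++ P)) & v3 <: k 4 by (bounded (all-blue (AllPairs.filter⁺ (Red? p) QP-clique) \ m m' r -> red-free (proj₂ (∈-filter⁻ (Red? p) {xs = Q ++ P} m)) r (proj₂ (∈-filter⁻ (Red? p) {xs = Q ++ P} m'))) (All.filter⁺ (Red? p) (All.++⁺ Q⊆ P⊆))) & □))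

  Q-no-red : ∀ {x y} -> x ∈ Q -> y ∈ Q -> ¬ Red x y
  Q-no-red m m' r = red-free (uQ m) r (uQ m')

  module Typical {w w'} (w∈ : w ∈ S) (w'∈ : w' ∈ S) (ww' : Blue w w') (s : Same K w w') where

   mu mu' : ℕ
   mu = 𝟙 (Non? u w)
   mu' = 𝟙 (Non? u' w)

   two-reds : ∀ {x y} -> Red x w -> Red y w -> ¬ Red x y
   two-reds r r' r″ = red-free r″ r' r

   blues-triangle : ∀ {x y z} -> x ∈ K -> y ∈ K -> z ∈ K -> Blue x w -> Blue y w -> Blue z w -> Blue x y -> Blue x z -> Blue y z -> ⊥
   blues-triangle {x} {y} {z} mx my mz bx yb bz xy xz yz = <⇒≱ (s≤s (s≤s (s≤s (s≤s (s≤s z≤n))))) (bounded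
    ((ww' ∷ χ-flip bx ∷ χ-flip yb ∷ χ-flip bz ∷ []) ∷ (other mx bx ∷ other my yb ∷ other mz bz ∷ []) ∷ (xy ∷ xz ∷ []) ∷ (yz ∷ []) ∷ [] ∷ [])
    (w∈ ∷ w'∈ ∷ All.lookup K⊆ mx ∷ All.lookup K⊆ my ∷ All.lookup K⊆ mz ∷ []))
    where
    other : ∀ {x} -> x ∈ K -> Blue x w -> Blue w' x
    other m bl = χ-flip (trans (sym (same s m)) bl)

   sb : ∀ {x} M -> x ∈ seen-blue w M -> x ∈ M × Blue x w
   sb M = seen-blue-∈ M

   total-Q : misses Q w + reds Q w + blues Q w ≡ 4
   total-Q = trans (colours-total Q w) Q-length

   total-P : misses P w + reds P w + blues P w ≡ 5
   total-P = trans (colours-total P w) P-length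

   blues-Q≤2 : blues Q w ≤ 2
   blues-Q≤2 = subst (_≤ 2) (#-length (\ x -> Blue? x w) Q) (short (AllPairs.filter⁺ (\ x -> Blue? x w) Q-blue)
    \ m m' m″ -> blues-triangle (inQ (proj₁ (sb Q m))) (inQ (proj₁ (sb Q m'))) (inQ (proj₁ (sb Q m″)))
     (proj₂ (sb Q m)) (proj₂ (sb Q m')) (proj₂ (sb Q m″)))

   reds-P≤2 : reds P w ≤ 2
   reds-P≤2 = subst (_≤ 2) (#-length (\ x -> Red? x w) P) (short (seen-red-blue w P-clique)
    \ m m' m″ -> P-triangles (proj₁ (seen-red-∈ P m)) (proj₁ (seen-red-∈ P m')) (proj₁ (seen-red-∈ P m″)))

   KB-triangles : NoBlueTriangle (seen-blue w K)
   KB-triangles m m' m″ = blues-triangle (proj₁ (sb K m)) (proj₁ (sb K m')) (proj₁ (sb K m″)) (proj₂ (sb K m)) (proj₂ (sb K m')) (proj₂ (sb K m″))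

   -- Stated for both ends u and u' at once. Seeing an end in red excludes red towards Q; seeing it
   -- in blue excludes blue edges among the vertices of P seen in blue. Both force missed vertices.
   module End {ū} (ū∈ : ū ∈ K) (ūQ : ∀ {x} -> x ∈ Q -> Red ū x) (ūP : ∀ {x} -> x ∈ P -> Blue ū x) where

    red-end : Red ū w -> reds Q w ≡ 0
    red-end r = #-none (\ x -> Red? x w) Q \ m r' -> two-reds r r' (ūQ m)

    red-end-misses : Red ū w -> 2 ≤ misses Q w
    red-end-misses r = (lin ((reds Q w) ∷ (blues Q w) ∷ (misses Q w) ∷ []) (k 2 <: v2) (v0 <: k 0 by≡ red-end r & v1 <: k 2 by blues-Q≤2 & k 4 <: v2 :+ v0 :+ v1 by≡ sym total-Q & □))

    blue-P-no-edge : Blue ū w -> ∀ {x y} -> x ∈ P -> y ∈ P -> Blue x w -> Blue y w -> ¬ Blue x y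
    blue-P-no-edge bl m m' bx yb = blues-triangle ū∈ (inP m) (inP m') bl bx yb (ūP m) (ūP m')

    blue-end : Blue ū w -> blues P w ≤ 2
    blue-end bl = subst (_≤ 2) (#-length (\ x -> Blue? x w) P) (no-blue-edge (seen-blue-clique w P-clique)
     \ m m' -> blue-P-no-edge bl (proj₁ (sb P m)) (proj₁ (sb P m')) (proj₂ (sb P m)) (proj₂ (sb P m')))

    blue-end-misses : Blue ū w -> 1 ≤ misses P w
    blue-end-misses bl = (lin ((blues P w) ∷ (reds P w) ∷ (misses P w) ∷ []) (k 1 <: v2) (v0 <: k 2 by blue-end bl & v1 <: k 2 by reds-P≤2 & k 5 <: v2 :+ v1 :+ v0 by≡ sym total-P & □))

   module Eu = End {u} (here refl) uQ uP
   module Eu' = End {u'} (there (here refl)) u'Q u'P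

   both-blue : Blue u w -> Blue u' w -> 3 ≤ misses P w
   both-blue bu bu' = (lin ((blues P w) ∷ (reds P w) ∷ (misses P w) ∷ []) (k 3 <: v2) (v0 <: k 0 by≡ (#-none (\ x -> Blue? x w) P \ m bx -> blues-triangle (here refl) (there (here refl)) (inP m) bu bu' bx uu' (uP m) (u'P m)) & v1 <: k 2 by reds-P≤2 & k 5 <: v2 :+ v1 :+ v0 by≡ sym total-P & □))

   non-cost : ∀ {x} -> Non x w -> 1 ≤ 𝟙 (Non? x w)
   non-cost {x} n = ≡⇒≤ (sym (𝟙-yes (Non? x w) n))

   -- The weights sum to 14 over K, and `14μ` is about `14N/5`, less than `3N`, so twins of cost at
   -- most 2 exist. Every way of seeing the ends other than both in red costs at least 3.
   both-red : ∀ q -> 2 * (𝟙 (Non? u w) + 𝟙 (Non? u' w)) + misses Q w + 𝟙 (Non? q w) + misses P w ≤ 2 -> Red u w × Red u' w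
   both-red q h = go (χ u w) (χ u' w) refl refl
    where
    impossible : ∀ {n} -> 3 ≤ n -> n ≤ 2 -> ⊥
    impossible p p' = <⇒≱ p p'
    go : ∀ c c' -> χ u w ≡ c -> χ u' w ≡ c' -> Red u w × Red u' w
    go red red e e' = e , e'
    go none none e e' = ⊥-elim (impossible (lin (mu ∷ mu' ∷ (misses Q w) ∷ (𝟙 (Non? q w)) ∷ (misses P w) ∷ []) (k 3 <: 2 :* (v0 :+ v1) :+ v2 :+ v3 :+ v4) (k 1 <: v0 by 2 · non-cost {u} e & k 1 <: v1 by non-cost {u'} e' & □)) h)
    go none red e e' = ⊥-elim (impossible (lin-κ 1 (mu ∷ (misses Q w) ∷ mu' ∷ (𝟙 (Non? q w)) ∷ (misses P w) ∷ []) (k 3 <: 2 :* (v0 :+ v2) :+ v1 :+ v3 :+ v4) (k 1 <: v0 by 4 · non-cost {u} e & k 2 <: v1 by Eu'.red-end-misses e' & □)) h)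
    go red none e e' = ⊥-elim (impossible (lin-κ 1 (mu' ∷ (misses Q w) ∷ mu ∷ (𝟙 (Non? q w)) ∷ (misses P w) ∷ []) (k 3 <: 2 :* (v2 :+ v0) :+ v1 :+ v3 :+ v4) (k 1 <: v0 by 4 · non-cost {u'} e' & k 2 <: v1 by Eu.red-end-misses e & □)) h)
    go none blue e e' = ⊥-elim (impossible (lin (mu ∷ (misses P w) ∷ mu' ∷ (misses Q w) ∷ (𝟙 (Non? q w)) ∷ []) (k 3 <: 2 :* (v0 :+ v2) :+ v3 :+ v4 :+ v1) (k 1 <: v0 by 2 · non-cost {u} e & k 1 <: v1 by Eu'.blue-end-misses e' & □)) h)
    go blue none e e' = ⊥-elim (impossible (lin (mu' ∷ (misses P w) ∷ mu ∷ (misses Q w) ∷ (𝟙 (Non? q w)) ∷ []) (k 3 <: 2 :* (v2 :+ v0) :+ v3 :+ v4 :+ v1) (k 1 <: v0 by 2 · non-cost {u'} e' & k 1 <: v1 by Eu.blue-end-misses e & □)) h)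
    go blue blue e e' = ⊥-elim (impossible (lin ((misses P w) ∷ mu ∷ mu' ∷ (misses Q w) ∷ (𝟙 (Non? q w)) ∷ []) (k 3 <: 2 :* (v1 :+ v2) :+ v3 :+ v4 :+ v0) (k 3 <: v0 by both-blue e e' & □)) h)
    go red blue e e' = ⊥-elim (impossible (lin ((misses Q w) ∷ (misses P w) ∷ mu ∷ mu' ∷ (𝟙 (Non? q w)) ∷ []) (k 3 <: 2 :* (v2 :+ v3) :+ v0 :+ v4 :+ v1) (k 2 <: v0 by Eu.red-end-misses e & k 1 <: v1 by Eu'.blue-end-misses e' & □)) h)
    go blue red e e' = ⊥-elim (impossible (lin ((misses Q w) ∷ (misses P w) ∷ mu ∷ mu' ∷ (𝟙 (Non? q w)) ∷ []) (k 3 <: 2 :* (v2 :+ v3) :+ v0 :+ v4 :+ v1) (k 2 <: v0 by Eu'.red-end-misses e' & k 1 <: v1 by Eu.blue-end-misses e & □)) h)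

   -- w sees a blue five-cycle through q, hence two red neighbours of q in P.
   q-degree : ∀ {q} -> q ∈ Q -> 2 * (𝟙 (Non? u w) + 𝟙 (Non? u' w)) + misses Q w + 𝟙 (Non? q w) + misses P w ≤ 2 -> 2 ≤ # (Red? q) P
   q-degree {q} q∈ h = (lin ((length M) ∷ (# (Red? q) M) ∷ (# (Blue? q) M) ∷ (# (Red? q) P) ∷ []) (k 2 <: v3) (k 5 <: v0 by M-length & v0 <: v1 :+ v2 :+ k 1 by≡ sym (clique-degree M-clique q∈M) & v2 <: k 2 by blue-degree≤2 M-clique M-triangles q∈M & v1 <: v3 by M-red & □))
    where
    ru = proj₁ (both-red q h)
    M = seen-blue w (Q ++ P)
    M⊆ : ∀ {x} -> x ∈ M -> x ∈ seen-blue w K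
    M⊆ m = let m' , e = seen-blue-∈ (Q ++ P) m in ∈-filter⁺ (\ x -> Blue? x w) (there (there m')) e
    M-clique : Clique M
    M-clique = seen-blue-clique w QP-clique
    M-triangles : NoBlueTriangle M
    M-triangles m m' m″ = KB-triangles (M⊆ m) (M⊆ m') (M⊆ m″)
    M-count : length M ≡ blues Q w + blues P w
    M-count = trans (#-length (\ x -> Blue? x w) (Q ++ P)) (∑-++ (\ x -> 𝟙 (Blue? x w)) Q P)
    M-length : 5 ≤ length M
    M-length = (lin ((blues Q w) ∷ (blues P w) ∷ (length M) ∷ (reds P w) ∷ (reds Q w) ∷ (misses Q w) ∷ (misses P w) ∷ mu ∷ mu' ∷ (𝟙 (Non? q w)) ∷ []) (k 5 <: v2) (v0 :+ v1 <: v2 by≡ sym M-count & v3 <: k 2 by reds-P≤2 & v4 <: k 0 by≡ Eu.red-end ru & k 4 <: v5 :+ v4 :+ v0 by≡ sym total-Q & k 5 <: v6 :+ v3 :+ v1 by≡ sym total-P & 2 :* (v7 :+ v8) :+ v5 :+ v9 :+ v6 <: k 2 by h & □))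
    q-blue : Blue q w
    q-blue = [ (\ r -> ⊥-elim (two-reds ru r (uQ q∈))) , (\ bl -> bl) ]′ (colour \ n -> <⇒≱ {2} {3} ≤-refl (lin ((misses Q w) ∷ (𝟙 (Non? q w)) ∷ mu ∷ mu' ∷ (misses P w) ∷ []) (k 3 <: k 2) (k 2 <: v0 by Eu.red-end-misses ru & k 1 <: v1 by non-cost {q} n & 2 :* (v2 :+ v3) :+ v0 :+ v1 :+ v4 <: k 2 by h & □)))
    q∈M : q ∈ M
    q∈M = ∈-filter⁺ (\ x -> Blue? x w) (∈-++⁺ˡ q∈) q-blue
    M-red : # (Red? q) M ≤ # (Red? q) P
    M-red = begin
     # (Red? q) M ≡⟨ #-filter (\ x -> Blue? x w) (Red? q) (Q ++ P) ⟩
     # (\ x -> Blue? x w ×? Red? q x) (Q ++ P) ≤⟨ #-mono _ (Red? q) (Q ++ P) (\ _ -> proj₂) ⟩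
     # (Red? q) (Q ++ P) ≡⟨ ∑-++ (\ x -> 𝟙 (Red? q x)) Q P ⟩
     # (Red? q) Q + # (Red? q) P ≡⟨ cong (_+ # (Red? q) P) (#-none (Red? q) Q \ m -> Q-no-red q∈ m) ⟩
     # (Red? q) P ∎

   -- The only way of seeing all of K but one end and one vertex of P.
   record Beta : Set where
    field
     one-missed : misses P w ≡ 1
     two-red : reds P w ≡ 2
     two-blue : blues P w ≡ 2
     poor : ∀ {z} -> z ∈ P -> Red z w -> F z ≤ 1
     joined : ∀ {z p} -> z ∈ P -> p ∈ P -> Red z w -> Non p w -> Red z p
     no-blue : ∀ {x y} -> x ∈ P -> y ∈ P -> Blue x w -> Blue y w -> ¬ Blue x y

   module BetaFacts {ū} (ū∈ : ū ∈ K) (ūQ : ∀ {x} -> x ∈ Q -> Red ū x) (ūP : ∀ {x} -> x ∈ P -> Blue ū x)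
    (bl : Blue ū w) (tQ : misses Q w ≡ 0) (tP : misses P w ≡ 1) where
    module Eū = End {ū} ū∈ ūQ ūP

    redsP : reds P w ≡ 2
    redsP = ≤-antisym reds-P≤2 (lin ((blues P w) ∷ (misses P w) ∷ (reds P w) ∷ []) (k 2 <: v2) (v0 <: k 2 by Eū.blue-end bl & v1 <: k 1 by≡ tP & k 5 <: v1 :+ v2 :+ v0 by≡ sym total-P & □))

    bluesP : blues P w ≡ 2
    bluesP = ≤-antisym (Eū.blue-end bl) (lin ((reds P w) ∷ (misses P w) ∷ (blues P w) ∷ []) (k 2 <: v2) (v0 <: k 2 by reds-P≤2 & v1 <: k 1 by≡ tP & k 5 <: v1 :+ v0 :+ v2 by≡ sym total-P & □))

    redsQ≤2 : reds Q w ≤ 2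
    redsQ≤2 = (lin ((length (seen-red w (Q ++ P))) ∷ (reds (Q ++ P) w) ∷ (reds Q w) ∷ (reds P w) ∷ []) (v2 <: k 2) (v0 <: k 4 by (bounded (seen-red-blue w QP-clique) (All.filter⁺ (\ x -> Red? x w) (All.++⁺ Q⊆ P⊆))) & v1 <: v0 by≡ sym (#-length (\ x -> Red? x w) (Q ++ P)) & v2 :+ v3 <: v1 by≡ sym (∑-++ (\ x -> 𝟙 (Red? x w)) Q P) & k 2 <: v3 by≡ sym redsP & □))

    M' M : List V
    M' = seen-blue w (Q ++ P)
    M = ū ∷ M'

    M'⊆ : ∀ {x} -> x ∈ M' -> x ∈ Q ++ P × Blue x w
    M'⊆ = seen-blue-∈ (Q ++ P)

    M⊆ : ∀ {x} -> x ∈ M -> x ∈ K × Blue x w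
    M⊆ (here refl) = ū∈ , bl
    M⊆ (there m) = there (there (proj₁ (M'⊆ m))) , proj₂ (M'⊆ m)

    M-clique : Clique M
    M-clique = All.tabulate (\ m -> [ (\ m -> red-adj (ūQ m)) , (\ m -> blue-adj (ūP m)) ]′ (∈-++⁻ Q (proj₁ (M'⊆ m))))
     ∷ seen-blue-clique w QP-clique

    M-triangles : NoBlueTriangle M
    M-triangles m m' m″ = blues-triangle (proj₁ (M⊆ m)) (proj₁ (M⊆ m')) (proj₁ (M⊆ m″)) (proj₂ (M⊆ m)) (proj₂ (M⊆ m')) (proj₂ (M⊆ m″))

    M'-length : length M' ≡ blues Q w + blues P w
    M'-length = trans (#-length (\ x -> Blue? x w) (Q ++ P)) (∑-++ (\ x -> 𝟙 (Blue? x w)) Q P)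

    bluesQ : blues Q w ≡ 2
    bluesQ = ≤-antisym (lin ((length M') ∷ (blues Q w) ∷ (blues P w) ∷ []) (v1 <: k 2) (k 1 :+ v0 <: k 5 by ramsey33 M-clique M-triangles & v1 :+ v2 <: v0 by≡ sym M'-length & k 2 <: v2 by≡ sym bluesP & □))
     (lin ((misses Q w) ∷ (reds Q w) ∷ (blues Q w) ∷ []) (k 2 <: v2) (k 4 <: v0 :+ v1 :+ v2 by≡ sym total-Q & v0 <: k 0 by≡ tQ & v1 <: k 2 by redsQ≤2 & □))

    -- The end ū and the four vertices of Q and P seen in blue form a five-clique without blue
    -- triangles, hence carry a red five-cycle.
    M-reds : ∀ {x} -> x ∈ P -> Blue x w -> 2 ≤ # (Red? x) M
    M-reds {x} m bx = (lin ((length M') ∷ (# (Red? x) M) ∷ (# (Blue? x) M) ∷ (blues Q w) ∷ (blues P w) ∷ []) (k 2 <: v1) (k 1 :+ v0 <: v1 :+ v2 :+ k 1 by≡ sym (clique-degree M-clique x∈M) & v2 <: k 2 by blue-degree≤2 M-clique M-triangles x∈M & v3 :+ v4 <: v0 by≡ sym M'-length & k 2 <: v4 by≡ sym bluesP & k 2 <: v3 by≡ sym bluesQ & □))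
     where
     x∈M : x ∈ M
     x∈M = there (∈-filter⁺ (\ x -> Blue? x w) (∈-++⁺ʳ Q m) bx)

    seen-Q : ∀ {q} -> q ∈ Q -> Adj q w
    seen-Q {q} m n = absurd (subst (1 ≤_) tQ (#-∈ (\ x -> Non? x w) Q m n)) \ ()

    -- If z had two red neighbours in Q, these would be all vertices of Q that w sees in blue. A red
    -- neighbour x of z in P that w sees in blue needs two red neighbours in M; they can be neither
    -- ū nor in Q, and P offers only one.
    poor : ∀ {z} -> z ∈ P -> Red z w -> F z ≤ 1
    poor {z} z∈ rz = ≮⇒≥ \ 2≤ -> refute 2≤ (#-witness (\ x -> Red? z x ×? Blue? x w) P blue-neighbour)
     where
     blue-neighbour : 0 < # (\ x -> Red? z x ×? Blue? x w) P
     blue-neighbour = (lin ((# (Red? z) P) ∷ (# (\ x -> Red? z x ×? Blue? x w) P) ∷ (misses P w) ∷ []) (k 1 :+ k 0 <: v1) (v0 <: v1 :+ v2 by (#-⊎ (Red? z) (\ x -> Red? z x ×? Blue? x w) (\ x -> Non? x w) P \ {x} m r -> sort x r (χ x w) refl) & v2 <: k 1 by≡ tP & k 2 <: v0 by≡ sym (P-reds z∈) & □))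
      where
      sort : ∀ x -> Red z x -> ∀ c -> χ x w ≡ c -> (Red z x × Blue x w) ⊎ Non x w
      sort x r none e = inj₂ e
      sort x r red e = ⊥-elim (two-reds rz e r)
      sort x r blue e = inj₁ (r , e)
     all-red : 2 ≤ F z -> ∀ {q} -> q ∈ Q -> Blue q w -> Red z q
     all-red 2≤ m bq = proj₁ (#-subset-full (\ q -> Red? z q ×? Blue? q w) (\ q -> Blue? q w) Q (\ _ -> proj₂)
      (≤-trans (≡⇒≤ bluesQ) (≤-trans 2≤ (#-mono (Red? z) (\ q -> Red? z q ×? Blue? q w) Q \ m r ->
       r , [ (\ r' -> ⊥-elim (two-reds rz r' r)) , (\ b' -> b') ]′ (colour (seen-Q m))))) m bq)
     refute : 2 ≤ F z -> (∃ \ x -> x ∈ P × Red z x × Blue x w) -> ⊥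
     refute 2≤ (x , x∈ , zx , bx) = <⇒≱ {1} {2} ≤-refl (lin ((𝟙 (Red? x ū)) ∷ (# (Red? x) M') ∷ (# BR? (Q ++ P)) ∷ (# BR? Q) ∷ (# BR? P) ∷ (# (\ y -> Blue? y w ×? ¬? (Red? x y)) P) ∷ (blues P w) ∷ []) (k 2 <: k 1) (k 2 <: v0 :+ v1 by M-reds x∈ bx & v0 <: k 0 by≡ (𝟙-no (Red? x ū) (\ r -> red≢blue r (χ-flip (ūP x∈)))) & v1 <: v2 by≡ (#-filter (\ y -> Blue? y w) (Red? x) (Q ++ P)) & v2 <: v3 :+ v4 by≡ (∑-++ (\ y -> 𝟙 (BR? y)) Q P) & v3 <: k 0 by≡ (#-none BR? Q \ m (bq , r) -> red-free (all-red 2≤ m bq) (χ-flip r) zx) & v4 :+ v5 <: v6 by≡ sym (#-partition (\ y -> Blue? y w) (Red? x) P) & v6 <: k 2 by≡ bluesP & k 1 <: v5 by (#-∈ (\ y -> Blue? y w ×? ¬? (Red? x y)) P x∈ (bx , \ r -> red-adj r (χ-irrefl x))) & □))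
      where
      BR? : ∀ y -> Dec (Blue y w × Red x y)
      BR? y = Blue? y w ×? Red? x y

    -- Of the two red neighbours of z in P none is red to w, and at most one is blue to w, since two
    -- such would be joined neither in red nor in blue. The other one is the missed vertex.
    joined : ∀ {z p} -> z ∈ P -> p ∈ P -> Red z w -> Non p w -> Red z p
    joined {z} {p} z∈ p∈ rz np = proj₁ (#-subset-full RN? (\ x -> Non? x w) P (\ _ -> proj₂) (≤-trans (≡⇒≤ tP) (
     (lin ((# (Red? z) P) ∷ (# RB? P) ∷ (# RN? P) ∷ (length (filter RB? P)) ∷ []) (k 1 <: v2) (v0 <: v1 :+ v2 by (#-⊎ (Red? z) RB? RN? P \ {x} m r -> sort x r (χ x w) refl) & k 2 <: v0 by≡ sym (P-reds z∈) & v1 <: v3 by≡ sym (#-length RB? P) & v3 <: k 1 by (lonely (AllPairs.filter⁺ RB? P-clique) (\ m m' r -> red-free (proj₁ (proj₂ (RB-∈ m))) r (proj₁ (proj₂ (RB-∈ m')))) \ m m' -> Eū.blue-P-no-edge bl (proj₁ (RB-∈ m)) (proj₁ (RB-∈ m')) (proj₂ (proj₂ (RB-∈ m))) (proj₂ (proj₂ (RB-∈ m')))) & □)))) p∈ np)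
     where
     RB? : ∀ x -> Dec (Red z x × Blue x w)
     RB? x = Red? z x ×? Blue? x w
     RN? : ∀ x -> Dec (Red z x × Non x w)
     RN? x = Red? z x ×? Non? x w
     RB-∈ : ∀ {x} -> x ∈ filter RB? P -> x ∈ P × Red z x × Blue x w
     RB-∈ = ∈-filter⁻ RB?
     sort : ∀ x -> Red z x -> ∀ c -> χ x w ≡ c -> (Red z x × Blue x w) ⊎ (Red z x × Non x w)
     sort x r none e = inj₂ (r , e)
     sort x r red e = ⊥-elim (two-reds rz e r)
     sort x r blue e = inj₁ (r , e)

    beta : Beta
    beta = record { one-missed = tP ; two-red = redsP ; two-blue = bluesP ; poor = poor ; joined = joined ; no-blue = Eū.blue-P-no-edge bl }

   -- The weights sum to 28, and to 29 with a further charge e of total at most μ; as 29/5 is below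
   -- 6, twins of cost at most 5 exist. A missed end costs 3 and a missed vertex of P costs 2, which
   -- leaves nothing for e.
   beta-cost : ∀ {e} -> 3 * (𝟙 (Non? u w) + 𝟙 (Non? u' w)) + 3 * misses Q w + 2 * misses P w + e ≤ 5 -> Beta × e ≡ 0
   beta-cost {e} h = go (χ u w) (χ u' w) refl refl
    where
    too-much : ∀ {n} -> 6 ≤ n -> n ≤ 5 -> ⊥
    too-much p p' = <⇒≱ p p'
    module Exact (n : 1 ≤ 𝟙 (Non? u w) + 𝟙 (Non? u' w)) (m : 1 ≤ misses P w) where
     Q0 : misses Q w ≡ 0
     Q0 = n≤0⇒n≡0 (lin-κ 2 (mu ∷ mu' ∷ (misses P w) ∷ (misses Q w) ∷ e ∷ []) (v3 <: k 0) (k 1 <: v0 :+ v1 by 3 · n & k 1 <: v2 by 2 · m & 3 :* (v0 :+ v1) :+ 3 :* v3 :+ 2 :* v2 :+ v4 <: k 5 by h & □))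
     P1 : misses P w ≡ 1
     P1 = ≤-antisym (lin-κ 1 (mu ∷ mu' ∷ (misses Q w) ∷ (misses P w) ∷ e ∷ []) (v3 <: k 1) (k 1 <: v0 :+ v1 by 3 · n & 3 :* (v0 :+ v1) :+ 3 :* v2 :+ 2 :* v3 :+ v4 <: k 5 by h & □)) m
     e0 : e ≡ 0
     e0 = n≤0⇒n≡0 (lin (mu ∷ mu' ∷ (misses P w) ∷ (misses Q w) ∷ e ∷ []) (v4 <: k 0) (k 1 <: v0 :+ v1 by 3 · n & k 1 <: v2 by 2 · m & 3 :* (v0 :+ v1) :+ 3 :* v3 :+ 2 :* v2 :+ v4 <: k 5 by h & □))
    go : ∀ c c' -> χ u w ≡ c -> χ u' w ≡ c' -> Beta × e ≡ 0
    go none blue eu eu' = BetaFacts.beta {u'} (there (here refl)) u'Q u'P eu' X.Q0 X.P1 , X.e0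
     where module X = Exact (≤-trans (non-cost {u} eu) (m≤m+n _ _)) (Eu'.blue-end-misses eu')
    go blue none eu eu' = BetaFacts.beta {u} (here refl) uQ uP eu X.Q0 X.P1 , X.e0
     where module X = Exact (≤-trans (non-cost {u'} eu') (m≤n+m _ (𝟙 (Non? u w)))) (Eu.blue-end-misses eu)
    go none none eu eu' = ⊥-elim (too-much (lin (mu ∷ mu' ∷ (misses Q w) ∷ (misses P w) ∷ e ∷ []) (k 6 <: 3 :* (v0 :+ v1) :+ 3 :* v2 :+ 2 :* v3 :+ v4) (k 1 <: v0 by 3 · non-cost {u} eu & k 1 <: v1 by 3 · non-cost {u'} eu' & □)) h)
    go none red eu eu' = ⊥-elim (too-much (lin (mu ∷ (misses Q w) ∷ mu' ∷ (misses P w) ∷ e ∷ []) (k 6 <: 3 :* (v0 :+ v2) :+ 3 :* v1 :+ 2 :* v3 :+ v4) (k 1 <: v0 by 3 · non-cost {u} eu & k 2 <: v1 by 3 · Eu'.red-end-misses eu' & □)) h)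
    go red c' eu eu' = ⊥-elim (too-much (lin ((misses Q w) ∷ mu ∷ mu' ∷ (misses P w) ∷ e ∷ []) (k 6 <: 3 :* (v1 :+ v2) :+ 3 :* v0 :+ 2 :* v3 :+ v4) (k 2 <: v0 by 3 · Eu.red-end-misses eu & □)) h)
    go blue red eu eu' = ⊥-elim (too-much (lin ((misses Q w) ∷ mu ∷ mu' ∷ (misses P w) ∷ e ∷ []) (k 6 <: 3 :* (v1 :+ v2) :+ 3 :* v0 :+ 2 :* v3 :+ v4) (k 2 <: v0 by 3 · Eu'.red-end-misses eu' & □)) h)
    go blue blue eu eu' = ⊥-elim (too-much (lin ((misses P w) ∷ mu ∷ mu' ∷ (misses Q w) ∷ e ∷ []) (k 6 <: 3 :* (v1 :+ v2) :+ 3 :* v3 :+ 2 :* v0 :+ v4) (k 3 <: v0 by 2 · both-blue eu eu' & □)) h)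

  cost-A : V -> V -> ℕ
  cost-A q w = ⟦ 2 :* (v0 :+ v1) :+ v2 :+ v3 :+ v4 ⟧ (𝟙 (Non? u w) ∷ 𝟙 (Non? u' w) ∷ misses Q w ∷ 𝟙 (Non? q w) ∷ misses P w ∷ [])

  ∑-cost-A : ∀ {q} -> q ∈ Q -> ∑ (cost-A q) S ≤ 14 * μ
  ∑-cost-A {q} q∈ = ≤-trans (≡⇒≤ (∑-⟦⟧ ((\ w -> 𝟙 (Non? u w)) ∷ (\ w -> 𝟙 (Non? u' w)) ∷ misses Q ∷ (\ w -> 𝟙 (Non? q w)) ∷ misses P ∷ [])
    (2 :* (v0 :+ v1) :+ v2 :+ v3 :+ v4) S))
   (lin ((miss S u) ∷ μ ∷ (miss S u') ∷ (miss S q) ∷ (∑ (misses Q) S) ∷ (∑ (misses P) S) ∷ []) (2 :* (v0 :+ v2) :+ v4 :+ v3 :+ v5 <: 14 :* v1) (v0 <: v1 by 2 · low u∈ & v2 <: v1 by 2 · low u'∈ & v3 <: v1 by low (All.lookup Q⊆ q∈) & v4 <: 4 :* v1 by (subst (\ n -> ∑ (misses Q) S ≤ n * μ) Q-length (weighted-average Q⊆)) & v5 <: 5 :* v1 by (subst (\ n -> ∑ (misses P) S ≤ n * μ) P-length (weighted-average P⊆)) & □))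

  Q-degrees : ∀ {q} -> q ∈ Q -> 2 ≤ # (Red? q) P
  Q-degrees {q} q∈ =
   let w , w' , w∈ , w'∈ , h , _ , ww' , s = light-twins dense K (cost-A q) 2 (subst (\ n -> ∑ (cost-A q) S + 3 * (3 ^ n * b) < 3 * length S) (sym K-length)
         (lin-κ 9999999 ((∑ (cost-A q) S) ∷ μ ∷ (length S) ∷ σ ∷ b ∷ []) (k 1 :+ (v0 :+ 3 :* (177147 :* v4)) <: 3 :* v2) (v0 <: 14 :* v1 by 10000000 · ∑-cost-A q∈ & 5 :* v1 <: v2 :+ v3 by 28000000 · upper & 10000000 :* v4 <: v3 by 531441 · small & k 1 :+ 1000 :* v3 <: v2 by 2000000 · tiny & □)))
   in Typical.q-degree w∈ w'∈ ww' s q∈ h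

  F-total : 8 ≤ ∑ F P
  F-total = begin
   8 ≡⟨ cong (_* 2) Q-length ⟨
   length Q * 2 ≡⟨ ∑-const 2 Q ⟨
   ∑ (\ _ -> 2) Q ≤⟨ ∑-mono Q Q-degrees ⟩
   ∑ (\ q -> ∑ (\ p -> 𝟙 (Red? q p)) P) Q ≡⟨ ∑-swap (\ q p -> 𝟙 (Red? q p)) Q P ⟩
   ∑ (\ p -> # (\ q -> Red? q p) Q) P ≡⟨ ∑-cong P (\ {p} _ -> #-cong (\ q -> Red? q p) (Red? p) Q (\ _ -> χ-flip) (\ _ -> χ-flip)) ⟩
   ∑ F P ∎

  -- `F` is at most 2 on five vertices and sums to at least 8.
  poor≤2 : # (\ p -> F p ≤? 1) P ≤ 2
  poor≤2 = (lin ((∑ F P) ∷ (# (\ p -> F p ≤? 1) P) ∷ (length P) ∷ []) (v1 <: k 2) (v0 :+ v1 <: 2 :* v2 by (∑-linear (F ∷ (\ p -> 𝟙 (F p ≤? 1)) ∷ []) (v0 :+ v1 <: k 2) P (\ {p} m -> pointwise (F p) (F≤2 m))) & k 8 <: v0 by F-total & v2 <: k 5 by≡ 2 · P-length & □))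
   where
   pointwise : ∀ t -> t ≤ 2 -> t + 𝟙 (t ≤? 1) ≤ 2
   pointwise 0 _ = s≤s z≤n
   pointwise 1 _ = ≤-refl
   pointwise 2 _ = ≤-refl
   pointwise (suc (suc (suc t))) (s≤s (s≤s ()))

  open Typical using (Beta)

  cost-B : (V -> ℕ) -> V -> ℕ
  cost-B e w = ⟦ 3 :* (v0 :+ v1) :+ 3 :* v2 :+ 2 :* v3 :+ v4 ⟧ (𝟙 (Non? u w) ∷ 𝟙 (Non? u' w) ∷ misses Q w ∷ misses P w ∷ e w ∷ [])

  ∑-cost-B : ∀ e -> ∑ e S ≤ μ -> ∑ (cost-B e) S ≤ 29 * μ
  ∑-cost-B e he = ≤-trans (≡⇒≤ (∑-⟦⟧ ((\ w -> 𝟙 (Non? u w)) ∷ (\ w -> 𝟙 (Non? u' w)) ∷ misses Q ∷ misses P ∷ e ∷ [])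
    (3 :* (v0 :+ v1) :+ 3 :* v2 :+ 2 :* v3 :+ v4) S))
   (lin ((miss S u) ∷ μ ∷ (miss S u') ∷ (∑ e S) ∷ (∑ (misses Q) S) ∷ (∑ (misses P) S) ∷ []) (3 :* (v0 :+ v2) :+ 3 :* v4 :+ 2 :* v5 :+ v3 <: 29 :* v1) (v0 <: v1 by 3 · low u∈ & v2 <: v1 by 3 · low u'∈ & v3 <: v1 by he & v4 <: 4 :* v1 by 3 · (subst (\ n -> ∑ (misses Q) S ≤ n * μ) Q-length (weighted-average Q⊆)) & v5 <: 5 :* v1 by 2 · (subst (\ n -> ∑ (misses P) S ≤ n * μ) P-length (weighted-average P⊆)) & □))

  record BetaVertex : Set where
   field
    w w' : V
    w∈ : w ∈ S
    w'∈ : w' ∈ S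
    ww' : Blue w w'
    ws : Same K w w'
    beta : Beta w∈ w'∈ ww' ws

  -- The charge e makes it possible to demand that the new vertex see a prescribed vertex of P.
  beta-vertex : ∀ e -> ∑ e S ≤ μ -> ∃ \ (B : BetaVertex) -> e (BetaVertex.w B) ≡ 0
  beta-vertex e he = build (light-twins dense K (cost-B e) 5 (subst (\ n -> ∑ (cost-B e) S + 6 * (3 ^ n * b) < 6 * length S) (sym K-length)
    (lin-κ 4999999 ((∑ (cost-B e) S) ∷ μ ∷ (length S) ∷ σ ∷ b ∷ []) (k 1 :+ (v0 :+ 6 :* (177147 :* v4)) <: 6 :* v2) (v0 <: 29 :* v1 by 5000000 · ∑-cost-B e he & 5 :* v1 <: v2 :+ v3 by 29000000 · upper & 10000000 :* v4 <: v3 by 531441 · small & k 1 :+ 1000 :* v3 <: v2 by 1000000 · tiny & □))))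
   where
   build : (∃₂ \ w w' -> w ∈ S × w' ∈ S × cost-B e w ≤ 5 × cost-B e w' ≤ 5 × Blue w w' × Same K w w') -> ∃ \ (B : BetaVertex) -> e (BetaVertex.w B) ≡ 0
   build (w , w' , w∈ , w'∈ , h , _ , ww' , s) =
    record { w = w ; w' = w' ; w∈ = w∈ ; w'∈ = w'∈ ; ww' = ww' ; ws = s ; beta = proj₁ (Typical.beta-cost w∈ w'∈ ww' s h) }
    , proj₂ (Typical.beta-cost w∈ w'∈ ww' s h)

  -- Both vertices see two vertices of P in red, these are poor, and at most two vertices are poor;
  -- so the two red pairs coincide.
  module UniqueBeta (B1 B2 : BetaVertex) where
   open BetaVertex B1 using () renaming (w to w1; beta to β1)
   open BetaVertex B2 using () renaming (w to w2; beta to β2)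
   module β1 = Typical.Beta β1
   module β2 = Typical.Beta β2

   transfer : ∀ {z} -> z ∈ P -> Red z w2 -> Red z w1
   transfer z∈ r = #-subset-full (\ x -> Red? x w1) (\ p -> F p ≤? 1) P β1.poor (≤-trans poor≤2 (≡⇒≤ (sym β1.two-red))) z∈ (β2.poor z∈ r)

   back : ∀ {z} -> z ∈ P -> Red z w1 -> Red z w2
   back z∈ r = #-subset-full (\ x -> Red? x w2) (\ p -> F p ≤? 1) P β2.poor (≤-trans poor≤2 (≡⇒≤ (sym β2.two-red))) z∈ (β1.poor z∈ r)

   -- p would have three red neighbours in P: the two that w1 sees in red, and one that w2 sees in blue.
   clash : ∀ {p} -> p ∈ P -> Non p w1 -> ¬ Non p w2 -> ⊥
   clash {p} p∈ n1 a2 = <⇒≱ {2} {3} ≤-refl (lin ((# (Red? p) P) ∷ (reds P w1) ∷ (# RB? P) ∷ []) (k 3 <: k 2) (v0 <: k 2 by≡ P-reds p∈ & v1 :+ v2 <: v0 by (#-disjoint (\ x -> Red? x w1) RB? (Red? p) P (\ m r -> χ-flip (β1.joined m p∈ r n1)) (\ _ -> proj₁) \ m r (_ , bl) -> red≢blue (back m r) bl) & k 2 <: v1 by≡ sym β1.two-red & k 1 <: v2 by one-more & □))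
    where
    RB? : ∀ x -> Dec (Red p x × Blue x w2)
    RB? x = Red? p x ×? Blue? x w2
    p-blue : Blue p w2
    p-blue = [ (\ r -> absurd (trans (sym (transfer p∈ r)) n1) \ ()) , (\ bl -> bl) ]′ (colour a2)
    L = seen-blue w2 P
    p∈L : p ∈ L
    p∈L = ∈-filter⁺ (\ x -> Blue? x w2) p∈ p-blue
    one-more : 1 ≤ # RB? P
    one-more = (lin ((length L) ∷ (# (Red? p) L) ∷ (# (Blue? p) L) ∷ (blues P w2) ∷ (# (\ x -> Blue? x w2 ×? Red? p x) P) ∷ (# RB? P) ∷ []) (k 1 <: v5) (v0 <: v1 :+ v2 :+ k 1 by≡ sym (clique-degree (seen-blue-clique w2 P-clique) p∈L) & v3 <: v0 by≡ sym (#-length (\ x -> Blue? x w2) P) & k 2 <: v3 by≡ sym β2.two-blue & v2 <: k 0 by≡ (#-none (Blue? p) L \ m -> β2.no-blue p∈ (proj₁ (seen-blue-∈ P m)) p-blue (proj₂ (seen-blue-∈ P m))) & v1 <: v4 by≡ (#-filter (\ x -> Blue? x w2) (Red? p) P) & v4 <: v5 by (#-mono (\ x -> Blue? x w2 ×? Red? p x) RB? P \ _ (bl , r) -> r , bl) & □))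

  contradictory : ⊥
  contradictory = first (beta-vertex (\ _ -> 0) (≤-trans (≡⇒≤ (trans (∑-const 0 S) (*-zeroʳ (length S)))) z≤n))
   where
   first : (∃ \ (B : BetaVertex) -> 0 ≡ 0) -> ⊥
   first (B1 , _) = second (#-witness (\ x -> Non? x (BetaVertex.w B1)) P (≡⇒≤ (sym (Typical.Beta.one-missed (BetaVertex.beta B1)))))
    where
    second : (∃ \ p -> p ∈ P × Non p (BetaVertex.w B1)) -> ⊥
    second (p , p∈ , n) = third (beta-vertex (\ w -> 𝟙 (Non? p w)) (low (All.lookup P⊆ p∈)))
     where
     third : (∃ \ (B : BetaVertex) -> 𝟙 (Non? p (BetaVertex.w B)) ≡ 0) -> ⊥
     third (B2 , z) = UniqueBeta.clash B1 B2 p∈ n \ n2 -> absurd (trans (sym (𝟙-yes (Non? p (BetaVertex.w B2)) n2)) z) \ ()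

 no-configuration : Configuration -> ⊥
 no-configuration C = Refute.contradictory C

 module _ {K u w} (c : Clique K) (K⊆ : All (_∈ S) K) (len : length K ≡ 11) (u∈ : u ∈ S) (w∈ : w ∈ S)
  (few : misses K u ≤ 2) (uw : Blue u w) (s : Same K u w) where

  seen-apart : ∀ {x y} -> x ∈ seen-red u K -> y ∈ seen-blue u K -> Adj x y
  seen-apart {x} {y} m m' = [ (\ e -> ⊥-elim (red≢blue (proj₂ (seen-red-∈ K m)) (subst (\ z -> Blue z u) (sym e) (proj₂ (seen-blue-∈ K m'))))) , (\ e -> e) ]′
   (clique-∈ c (proj₁ (seen-red-∈ K m)) (proj₁ (seen-blue-∈ K m')))

  twin-configuration : length (seen-red u K) ≤ 4 × length (seen-blue u K) ≤ 5 × NoBlueTriangle (seen-blue u K) -> Configuration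
  twin-configuration (Q≤4 , P≤5 , P-triangles) = record
   { u = u ; u' = w ; Q = seen-red u K ; P = seen-blue u K ; u∈ = u∈ ; u'∈ = w∈
   ; Q⊆ = All.filter⁺ (\ x -> Red? x u) K⊆ ; P⊆ = All.filter⁺ (\ x -> Blue? x u) K⊆
   ; uu' = uw ; Q-blue = seen-red-blue u c
   ; Q-length = ≤-antisym Q≤4 (lin ((length K) ∷ (misses K u) ∷ (length (seen-red u K)) ∷ (length (seen-blue u K)) ∷ []) (k 4 <: v2) (v0 <: v1 :+ v2 :+ v3 by≡ sym (seen-total K u) & k 11 <: v0 by≡ sym len & v1 <: k 2 by few & v3 <: k 5 by P≤5 & □))
   ; P-length = ≤-antisym P≤5 (lin ((length K) ∷ (misses K u) ∷ (length (seen-red u K)) ∷ (length (seen-blue u K)) ∷ []) (k 5 <: v3) (v0 <: v1 :+ v2 :+ v3 by≡ sym (seen-total K u) & k 11 <: v0 by≡ sym len & v1 <: k 2 by few & v2 <: k 4 by Q≤4 & □))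
   ; P-triangles = P-triangles
   ; QP-clique = AllPairs.++⁺ (AllPairs.filter⁺ (\ x -> Red? x u) c) (seen-blue-clique u c)
     (All.tabulate \ m -> All.tabulate \ m' -> seen-apart m m')
   ; uQ = \ m -> χ-flip (proj₂ (seen-red-∈ K m))
   ; u'Q = \ m -> χ-flip (trans (sym (same s (proj₁ (seen-red-∈ K m)))) (proj₂ (seen-red-∈ K m)))
   ; uP = \ m -> proj₁ (blue-twins s m) ; u'P = \ m -> proj₂ (blue-twins s m) }

 -- About `11/5` vertices of K are missed on average, fewer than three.
 no-eleven : ∀ {K} -> Clique K -> All (_∈ S) K -> length K ≡ 11 -> ⊥
 no-eleven {K} c K⊆ len = refute (light-twins dense K (misses K) 2 (subst (\ n -> ∑ (misses K) S + 3 * (3 ^ n * b) < 3 * length S) (sym len)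
   (lin-κ 9999999 ((∑ (misses K) S) ∷ μ ∷ (length S) ∷ σ ∷ b ∷ []) (k 1 :+ (v0 :+ 3 :* (177147 :* v4)) <: 3 :* v2) (v0 <: 11 :* v1 by 10000000 · (subst (\ n -> ∑ (misses K) S ≤ n * μ) len (weighted-average K⊆)) & 5 :* v1 <: v2 :+ v3 by 22000000 · upper & 10000000 :* v4 <: v3 by 531441 · small & k 1 :+ 1000 :* v3 <: v2 by 8000000 · tiny & □))))
  where
  refute : (∃₂ \ u w -> u ∈ S × w ∈ S × misses K u ≤ 2 × misses K w ≤ 2 × Blue u w × Same K u w) -> ⊥
  refute (u , w , u∈ , w∈ , few , _ , uw , s) =
   no-configuration (twin-configuration c K⊆ len u∈ w∈ few uw s (typical35-blue bounded c K⊆ u∈ w∈ uw s))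

 ω≤10 : ∀ K -> Clique K -> All (_∈ S) K -> length K ≤ 10
 ω≤10 K c K⊆ = ≮⇒≥ \ big -> refute (take-clique 11 c K⊆ big)
  where
  refute : (∃ \ L -> Clique L × All (_∈ S) L × length L ≡ 11) -> ⊥
  refute (L , c , L⊆ , len) = no-eleven c L⊆ len

-- No clique on seven vertices for (K3, K4)

_is_ : Colour -> Colour -> Bool
none is none = true
red is red = true
blue is blue = true
_ is _ = false

is-sound : ∀ c d -> c is d ≡ true -> c ≡ d
is-sound none none _ = refl
is-sound red red _ = refl
is-sound blue blue _ = refl

true? : ∀ t -> Dec (t ≡ true)
true? true = yes refl
true? false = no \ ()

for-all : (Colour -> Bool) -> Bool
for-all f = f none ∧ (f red ∧ f blue)

for-all-sound : ∀ f -> for-all f ≡ true -> ∀ c -> f c ≡ true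
for-all-sound f h none = proj₁ (∧-true h)
for-all-sound f h red = proj₁ (∧-true (proj₂ (∧-true {f none} h)))
for-all-sound f h blue = proj₂ (∧-true {f red} (proj₂ (∧-true {f none} h)))

-- The arguments are the colours in which a vertex sees seven fixed ones; the `3 ^ 7` cases are few
-- enough to be checked by evaluation.
Pattern : Set -> Set
Pattern T = Colour -> Colour -> Colour -> Colour -> Colour -> Colour -> Colour -> T

for-all7 : Pattern Bool -> Bool
for-all7 f = for-all \ a -> for-all \ b -> for-all \ c -> for-all \ d -> for-all \ e -> for-all \ g -> for-all \ h -> f a b c d e g h

for-all7-sound : ∀ f -> for-all7 f ≡ true -> ∀ a b c d e g h -> f a b c d e g h ≡ true
for-all7-sound f p a b c d e g h = for-all-sound (f a b c d e g) (for-all-sound (\ g -> for-all (f a b c d e g))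
 (for-all-sound (\ e -> for-all \ g -> for-all (f a b c d e g)) (for-all-sound (\ d -> for-all \ e -> for-all \ g -> for-all (f a b c d e g))
 (for-all-sound (\ c -> for-all \ d -> for-all \ e -> for-all \ g -> for-all (f a b c d e g))
 (for-all-sound (\ b -> for-all \ c -> for-all \ d -> for-all \ e -> for-all \ g -> for-all (f a b c d e g))
 (for-all-sound (\ a -> for-all \ b -> for-all \ c -> for-all \ d -> for-all \ e -> for-all \ g -> for-all (f a b c d e g)) p a) b) c) d) e) g) h

-- The vertices u, u', p and q1, q2, q3 form blue triangles, joined in red except that p q3 is blue; p' is red to p and q3 and blue to the rest.
-- `allowed` says that the vertices seen in red span no red edge and those seen in blue no blue edge.
allowed : Pattern Bool
allowed u u' p q1 q2 q3 p' =
 clear red u q1 ∧ clear red u q2 ∧ clear red u q3 ∧ clear red u' q1 ∧ clear red u' q2 ∧ clear red u' q3 ∧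
 clear red p q1 ∧ clear red p q2 ∧ clear red p p' ∧ clear red q3 p' ∧
 clear blue u u' ∧ clear blue u p ∧ clear blue u' p ∧ clear blue q1 q2 ∧ clear blue q1 q3 ∧ clear blue q2 q3 ∧
 clear blue p q3 ∧ clear blue p' u ∧ clear blue p' u' ∧ clear blue p' q1 ∧ clear blue p' q2
 where
 clear : Colour -> Colour -> Colour -> Bool
 clear c x y = not ((x is c) ∧ (y is c))

sees-all : Colour -> Colour -> Colour -> Bool
sees-all a b c = not (a is none) ∧ not (b is none) ∧ not (c is none)

-- A and B will turn out to have no inner red edges, and D1 no red edges to D2, as p' is red to
-- both. This is the situation of `half-density`.
inA inB inD1 inD2 : Pattern Bool
inA u u' p q1 q2 q3 p' = allowed u u' p q1 q2 q3 p' ∧ sees-all q1 q2 q3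
inB u u' p q1 q2 q3 p' = allowed u u' p q1 q2 q3 p' ∧ sees-all u u' p
inD1 u u' p q1 q2 q3 p' = inA u u' p q1 q2 q3 p' ∧ (p' is red)
inD2 u u' p q1 q2 q3 p' = inB u u' p q1 q2 q3 p' ∧ (p' is red)

out : Colour -> ℕ
out c = 𝟙 (c ≟ᶜ none)

on : Bool -> ℕ
on t = 𝟙 (true? t)

implies : Bool -> Bool -> Bool
implies s t = not s ∨ t

implies-sound : ∀ {s t} -> implies s t ≡ true -> s ≡ true -> t ≡ true
implies-sound {true} {true} _ _ = refl

-- The coefficients of missed vertices sum to 31, 31 and 11. With μ about N/3, a cost of at least
-- 12, 12 or 4 at every vertex forces `d1 + d2 + a` and `d1 + d2 + c` to be at least about 5N/6, and
-- `d1 + d2` at least about N/3.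
cost1 cost2 cost3 : Pattern ℕ
cost1 u u' p q1 q2 q3 p' = 2 * (on (inD1 u u' p q1 q2 q3 p') + on (inD2 u u' p q1 q2 q3 p') + on (inA u u' p q1 q2 q3 p'))
 + 2 * (out p' + out u + out u' + out q1 + out q2) + (out q1 + out q2 + out q3)
 + 3 * (out u + out u' + out p + out q1 + out q2 + out q3)
cost2 u u' p q1 q2 q3 p' = 2 * (on (inD1 u u' p q1 q2 q3 p') + on (inD2 u u' p q1 q2 q3 p') + on (inB u u' p q1 q2 q3 p'))
 + 2 * (out p' + out u + out u' + out q1 + out q2) + (out u + out u' + out p)
 + 3 * (out u + out u' + out p + out q1 + out q2 + out q3)
cost3 u u' p q1 q2 q3 p' = on (inD1 u u' p q1 q2 q3 p') + on (inD2 u u' p q1 q2 q3 p') + (out p' + out u + out u' + out q1 + out q2)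
 + (out u + out u' + out p + out q1 + out q2 + out q3)

at-least : ℕ -> Pattern ℕ -> Pattern Bool
at-least n f a b c d e g h = implies (allowed a b c d e g h) (n ≤ᵇ f a b c d e g h)

cost1-check : for-all7 (at-least 12 cost1) ≡ true
cost1-check = refl

cost2-check : for-all7 (at-least 12 cost2) ≡ true
cost2-check = refl

cost3-check : for-all7 (at-least 4 cost3) ≡ true
cost3-check = refl

red-pairs : Colour -> Colour -> Colour -> Bool
red-pairs a b c = ((a is red) ∧ (b is red)) ∨ (((a is red) ∧ (c is red)) ∨ ((b is red) ∧ (c is red)))

A-claim B-claim D-claim : Pattern Bool
A-claim u u' p q1 q2 q3 p' = implies (inA u u' p q1 q2 q3 p') (red-pairs q1 q2 q3 ∧ not (inB u u' p q1 q2 q3 p'))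
B-claim u u' p q1 q2 q3 p' = implies (inB u u' p q1 q2 q3 p') (red-pairs u u' p)
D-claim u u' p q1 q2 q3 p' = implies (inD1 u u' p q1 q2 q3 p') (q3 is blue) ∧ implies (inD2 u u' p q1 q2 q3 p') (p is blue)

A-check : for-all7 A-claim ≡ true
A-check = refl

B-check : for-all7 B-claim ≡ true
B-check = refl

D-check : for-all7 D-claim ≡ true
D-check = refl

module SevenClique {V : Set} (𝒢 : ColouredGraph V)
 (red-free : Graphs.RedFree 𝒢)
 (S : List V) (b μ σ : ℕ) (dense : Graphs.Dense 𝒢 (Graphs.Blue 𝒢) S b) (low : Graphs.Low 𝒢 S μ)
 (bounded : RedDegrees.BlueBounded 𝒢 red-free S 3)
 (upper : 3 * μ ≤ length S + σ) (small : 100000 * b ≤ σ) (tiny : 1000 * σ < length S) where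
 open Graphs 𝒢
 open Colours 𝒢 red-free
 open RedDegrees 𝒢 red-free
 open Average S μ low

 no-K4 : ∀ {x y z w} -> x ∈ S -> y ∈ S -> z ∈ S -> w ∈ S ->
  Blue x y -> Blue x z -> Blue x w -> Blue y z -> Blue y w -> Blue z w -> ⊥
 no-K4 x∈ y∈ z∈ w∈ xy xz xw yz yw zw = <⇒≱ (s≤s (s≤s (s≤s (s≤s z≤n)))) (bounded
  ((xy ∷ xz ∷ xw ∷ []) ∷ (yz ∷ yw ∷ []) ∷ (zw ∷ []) ∷ [] ∷ []) (x∈ ∷ y∈ ∷ z∈ ∷ w∈ ∷ []))

 -- A blue edge between common blue neighbours of x and y would complete a blue K4.
 codegree : ∀ {x y} -> x ∈ S -> y ∈ S -> Blue x y -> # (\ z -> Blue? x z ×? Blue? y z) S ≤ b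
 codegree x∈ y∈ xy = independent-bound dense _ \ z∈ w∈ (xz , yz) (xw , yw) zw -> no-K4 x∈ y∈ z∈ w∈ xy xz xw yz yw zw

 -- All but b vertices of D have blue edges to at most half of A ∖ D and D'.
 half-density : ∀ {D A D' : V -> Set} (D? : Decidable D) (A? : Decidable A) (D'? : Decidable D') -> (∀ {x} -> D x -> A x) -> (∀ {x} -> A x -> ¬ D' x) ->
  ∀ {x0} -> x0 ∈ S -> (∀ {x} -> x ∈ S -> D x -> Blue x0 x) ->
  (∀ {x y} -> x ∈ S -> y ∈ S -> D x -> A y -> ¬ Red x y) -> (∀ {x y} -> x ∈ S -> y ∈ S -> D x -> D' y -> ¬ Red x y) ->
  b < # D? S -> # D? S + # A? S + # D'? S ≤ 2 * μ + 3 * b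
 half-density {D} {A} {D'} D? A? D'? D⊆A A∩D' {x0} x0∈ hub noA noD' big = at-light (#-witness light? S
   (lin ((# D? S) ∷ (# heavy? S) ∷ (# light? S) ∷ b ∷ []) (k 1 :+ k 0 <: v2) (v0 <: v1 :+ v2 by≡ (#-partition D? (\ x -> # Y? S + b <? 2 * BY x) S) & v1 <: v3 by heavy-few & k 1 :+ v3 <: v0 by big & □)))
  where
  Y? : ∀ y -> Dec ((A y × ¬ D y) ⊎ D' y)
  Y? y = (A? y ×? ¬? (D? y)) ⊎-dec D'? y
  BY : V -> ℕ
  BY x = # (\ y -> Blue? x y ×? Y? y) S
  heavy? : ∀ x -> Dec (D x × # Y? S + b < 2 * BY x)
  heavy? x = D? x ×? (# Y? S + b <? 2 * BY x)
  light? : ∀ x -> Dec (D x × ¬ # Y? S + b < 2 * BY x)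
  light? x = D? x ×? ¬? (# Y? S + b <? 2 * BY x)
  Y-size : # A? S + # D'? S ≤ # D? S + # Y? S
  Y-size = ∑-linear ((\ y -> 𝟙 (A? y)) ∷ (\ y -> 𝟙 (D'? y)) ∷ (\ y -> 𝟙 (D? y)) ∷ (\ y -> 𝟙 (Y? y)) ∷ []) (v0 :+ v1 <: v2 :+ v3) S
   (\ {y} _ -> pointwise (A? y) (D'? y) (D? y))
   where
   pointwise : ∀ {y} (d : Dec (A y)) (e : Dec (D' y)) (f : Dec (D y)) -> 𝟙 d + 𝟙 e ≤ 𝟙 f + 𝟙 ((d ×? ¬? f) ⊎-dec e)
   pointwise (yes p) (yes q) _ = absurd q (A∩D' p)
   pointwise (yes p) (no _) (yes _) = s≤s z≤n
   pointwise (yes p) (no _) (no _) = ≤-refl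
   pointwise (no _) (yes _) (yes _) = s≤s z≤n
   pointwise (no _) (yes _) (no _) = ≤-refl
   pointwise (no _) (no _) _ = z≤n
  not-both : ∀ {x y} -> x ∈ S -> y ∈ S -> Blue x y -> BY x + BY y ≤ # Y? S + b
  not-both {x} {y} x∈ y∈ xy = ≤-trans (∑-linear ((\ z -> 𝟙 (Blue? x z ×? Y? z)) ∷ (\ z -> 𝟙 (Blue? y z ×? Y? z)) ∷ (\ z -> 𝟙 (Y? z)) ∷
    (\ z -> 𝟙 (Blue? x z ×? Blue? y z)) ∷ []) (v0 :+ v1 <: v2 :+ v3) S (\ {z} _ -> pointwise (Blue? x z) (Blue? y z) (Y? z)))
   (+-monoʳ-≤ _ (codegree x∈ y∈ xy))
   where
   pointwise : ∀ {P Q R : Set} (d : Dec P) (e : Dec Q) (f : Dec R) -> 𝟙 (d ×? f) + 𝟙 (e ×? f) ≤ 𝟙 f + 𝟙 (d ×? e)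
   pointwise (yes _) (yes _) (yes _) = ≤-refl
   pointwise (yes _) (no _) (yes _) = ≤-refl
   pointwise (no _) (yes _) (yes _) = ≤-refl
   pointwise (no _) (no _) (yes _) = z≤n
   pointwise (yes _) (yes _) (no _) = z≤n
   pointwise (yes _) (no _) (no _) = z≤n
   pointwise (no _) e (no _) = ≤-trans (≡⇒≤ (no-both e)) z≤n
    where
    no-both : ∀ {Q R : Set} {n : ¬ R} (e : Dec Q) -> 𝟙 (e ×? no n) ≡ 0
    no-both (yes _) = refl
    no-both (no _) = refl
  heavy-few : # heavy? S ≤ b
  heavy-few = independent-bound dense heavy? \ {x} {y} x∈ y∈ (_ , hx) (_ , hy) xy -> <⇒≱ {# Y? S + b} {BY x + BY y}
   (lin-κ 1 ((# Y? S) ∷ b ∷ (BY x) ∷ (BY y) ∷ []) (k 1 :+ (v0 :+ v1) <: v2 :+ v3) (k 1 :+ (v0 :+ v1) <: 2 :* v2 by hx & k 1 :+ (v0 :+ v1) <: 2 :* v3 by hy & □)) (not-both x∈ y∈ xy)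
  at-light : (∃ \ x -> x ∈ S × D x × ¬ # Y? S + b < 2 * BY x) -> # D? S + # A? S + # D'? S ≤ 2 * μ + 3 * b
  -- All of D and Y is missed by x, or among the few common blue neighbours of x and x0, or blue to
  -- x inside Y, at most half of Y. So `2D + Y` is at most `2μ + 3b`, and `Y-size` replaces `D + Y`
  -- by `A + D'`.
  at-light (x , x∈ , dx , lx) = (lin ((# A? S) ∷ (# D'? S) ∷ (# D? S) ∷ (# Y? S) ∷ (BY x) ∷ b ∷ (miss S x) ∷ μ ∷ (# (\ z -> Blue? x0 z ×? Blue? x z) S) ∷ []) (v2 :+ v0 :+ v1 <: 2 :* v7 :+ 3 :* v5) (v0 :+ v1 <: v2 :+ v3 by Y-size & 2 :* v4 <: v3 :+ v5 by ≮⇒≥ lx & v6 <: v7 by 2 · low x∈ & v8 <: v5 by 2 · codegree x0∈ x∈ (hub x∈ dx) & v2 :+ v3 <: v6 :+ v8 :+ v4 by 2 · (∑-linear ((\ y -> 𝟙 (D? y)) ∷ (\ y -> 𝟙 (Y? y)) ∷ (\ y -> 𝟙 (Non? x y)) ∷ (\ y -> 𝟙 (Blue? x0 y ×? Blue? x y)) ∷ (\ y -> 𝟙 (Blue? x y ×? Y? y)) ∷ []) (v0 :+ v1 <: v2 :+ v3 :+ v4) S (\ {y} y∈ -> pointwise y∈ (D? y) (Y? y) (χ x y) refl)) & □))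
   where
   pointwise : ∀ {y} -> y ∈ S -> (d : Dec (D y)) (e : Dec ((A y × ¬ D y) ⊎ D' y)) -> ∀ c -> χ x y ≡ c ->
    𝟙 d + 𝟙 e ≤ 𝟙 (Non? x y) + 𝟙 (Blue? x0 y ×? Blue? x y) + 𝟙 (Blue? x y ×? e)
   pointwise y∈ (yes p) (yes (inj₁ (_ , ¬p))) _ _ = absurd p ¬p
   pointwise y∈ (yes p) (yes (inj₂ q)) _ _ = absurd q (A∩D' (D⊆A p))
   pointwise y∈ (no _) (no _) _ _ = z≤n
   pointwise {y} y∈ (yes p) (no _) none c = ≤-trans (≡⇒≤ (sym (𝟙-yes (Non? x y) c))) (≤-trans (m≤m+n _ _) (m≤m+n _ _))
   pointwise {y} y∈ (yes p) (no _) red c = absurd c (noA x∈ y∈ dx (D⊆A p))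
   pointwise {y} y∈ (yes p) (no _) blue c = ≤-trans (≡⇒≤ (sym (𝟙-yes (Blue? x0 y ×? Blue? x y) (hub y∈ p , c))))
    (≤-trans (m≤n+m _ (𝟙 (Non? x y))) (m≤m+n _ _))
   pointwise {y} y∈ (no _) (yes q) none c = ≤-trans (≡⇒≤ (sym (𝟙-yes (Non? x y) c))) (≤-trans (m≤m+n _ _) (m≤m+n _ _))
   pointwise {y} y∈ (no _) (yes (inj₁ (q , _))) red c = absurd c (noA x∈ y∈ dx q)
   pointwise {y} y∈ (no _) (yes (inj₂ q)) red c = absurd c (noD' x∈ y∈ dx q)
   pointwise {y} y∈ (no _) e@(yes q) blue c = ≤-trans (≡⇒≤ (sym (𝟙-yes (Blue? x y ×? e) (c , q)))) (m≤n+m _ (𝟙 (Non? x y) + 𝟙 (Blue? x0 y ×? Blue? x y)))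

 record Seven : Set where
  field
   u u' p q1 q2 q3 p' : V
   all∈ : All (_∈ S) (u ∷ u' ∷ p ∷ q1 ∷ q2 ∷ q3 ∷ p' ∷ [])
   uq1 : Red u q1
   uq2 : Red u q2
   uq3 : Red u q3
   u'q1 : Red u' q1
   u'q2 : Red u' q2
   u'q3 : Red u' q3
   pq1 : Red p q1
   pq2 : Red p q2
   pp' : Red p p'
   q3p' : Red q3 p'
   uu' : Blue u u'
   up : Blue u p
   u'p : Blue u' p
   q1q2 : Blue q1 q2
   q1q3 : Blue q1 q3
   q2q3 : Blue q2 q3
   pq3 : Blue p q3
   p'u : Blue p' u
   p'u' : Blue p' u'
   p'q1 : Blue p' q1
   p'q2 : Blue p' q2

 module RefuteSeven (X : Seven) where
  open Seven X

  K : List V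
  K = u ∷ u' ∷ p ∷ q1 ∷ q2 ∷ q3 ∷ p' ∷ []

  at : ∀ {T : Set} -> Pattern T -> V -> T
  at f w = f (χ u w) (χ u' w) (χ p w) (χ q1 w) (χ q2 w) (χ q3 w) (χ p' w)

  use : ∀ f -> for-all7 f ≡ true -> ∀ w -> at f w ≡ true
  use f h w = for-all7-sound f h (χ u w) (χ u' w) (χ p w) (χ q1 w) (χ q2 w) (χ q3 w) (χ p' w)

  Bad? : ∀ w -> Dec (¬ at allowed w ≡ true)
  Bad? w = ¬? (true? (at allowed w))

  two-reds : ∀ {x y w} -> Red x y -> Red x w -> Red y w -> ⊥
  two-reds xy xw yw = red-free xy yw xw

  module _ {w w'} (w∈ : w ∈ S) (w'∈ : w' ∈ S) (ww' : Blue w w') (s : Same K w w') where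
   two-blues : ∀ {x y} -> x ∈ K -> y ∈ K -> Blue x y -> Blue x w -> Blue y w -> ⊥
   two-blues mx my xy xw yw = no-K4 (All.lookup all∈ mx) (All.lookup all∈ my) w∈ w'∈ xy xw (trans (sym (same s mx)) xw) yw (trans (sym (same s my)) yw) ww'

   clear! : ∀ c x y -> (χ x w ≡ c -> χ y w ≡ c -> ⊥) -> not ((χ x w is c) ∧ (χ y w is c)) ≡ true
   clear! c x y h = go (χ x w is c) (χ y w is c) refl refl
    where
    go : ∀ s t -> (χ x w is c) ≡ s -> (χ y w is c) ≡ t -> not (s ∧ t) ≡ true
    go false _ _ _ = refl
    go true false _ _ = refl
    go true true e e' = ⊥-elim (h (is-sound _ c e) (is-sound _ c e'))

   infixr 5 _∧ᵗ_
   _∧ᵗ_ : ∀ {s t} -> s ≡ true -> t ≡ true -> s ∧ t ≡ true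
   refl ∧ᵗ e = e

   twins-allowed : at allowed w ≡ true
   twins-allowed = clear! red u q1 (two-reds uq1) ∧ᵗ clear! red u q2 (two-reds uq2) ∧ᵗ clear! red u q3 (two-reds uq3)
    ∧ᵗ clear! red u' q1 (two-reds u'q1) ∧ᵗ clear! red u' q2 (two-reds u'q2) ∧ᵗ clear! red u' q3 (two-reds u'q3)
    ∧ᵗ clear! red p q1 (two-reds pq1) ∧ᵗ clear! red p q2 (two-reds pq2) ∧ᵗ clear! red p p' (two-reds pp') ∧ᵗ clear! red q3 p' (two-reds q3p')
    ∧ᵗ clear! blue u u' (two-blues m0 m1 uu') ∧ᵗ clear! blue u p (two-blues m0 m2 up) ∧ᵗ clear! blue u' p (two-blues m1 m2 u'p)
    ∧ᵗ clear! blue q1 q2 (two-blues m3 m4 q1q2) ∧ᵗ clear! blue q1 q3 (two-blues m3 m5 q1q3) ∧ᵗ clear! blue q2 q3 (two-blues m4 m5 q2q3)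
    ∧ᵗ clear! blue p q3 (two-blues m2 m5 pq3) ∧ᵗ clear! blue p' u (two-blues m6 m0 p'u) ∧ᵗ clear! blue p' u' (two-blues m6 m1 p'u')
    ∧ᵗ clear! blue p' q1 (two-blues m6 m3 p'q1) ∧ᵗ clear! blue p' q2 (two-blues m6 m4 p'q2)
    where
    m0 : u ∈ K
    m0 = here refl
    m1 : u' ∈ K
    m1 = there (here refl)
    m2 : p ∈ K
    m2 = there (there (here refl))
    m3 : q1 ∈ K
    m3 = there (there (there (here refl)))
    m4 : q2 ∈ K
    m4 = there (there (there (there (here refl))))
    m5 : q3 ∈ K
    m5 = there (there (there (there (there (here refl)))))
    m6 : p' ∈ K
    m6 = there (there (there (there (there (there (here refl))))))

  bad-few : # Bad? S ≤ 2187 * b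
  bad-few = rare dense K Bad? \ w∈ w'∈ bad e s -> bad (twins-allowed w∈ w'∈ e s)

  A? B? D1? D2? : ∀ w -> Dec _
  A? w = true? (at inA w)
  B? w = true? (at inB w)
  D1? w = true? (at inD1 w)
  D2? w = true? (at inD2 w)

  guarded : ∀ n f -> for-all7 (at-least n f) ≡ true -> ∀ w -> n ≤ at f w + n * 𝟙 (Bad? w)
  guarded n f h w = go (at allowed w) refl
   where
   go : ∀ t -> at allowed w ≡ t -> n ≤ at f w + n * 𝟙 (Bad? w)
   go true e = ≤-trans (≤ᵇ-sound n (at f w) (implies-sound (use (at-least n f) h w) e)) (m≤m+n _ _)
   go false e = ≤-trans (≡⇒≤ (trans (sym (*-identityʳ n)) (cong (n *_) (sym (𝟙-yes (Bad? w) \ t -> absurd (trans (sym t) e) \ ())))))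
    (m≤n+m _ (at f w))

  fields : List (V -> ℕ)
  fields = (\ w -> 𝟙 (D1? w)) ∷ (\ w -> 𝟙 (D2? w)) ∷ (\ w -> 𝟙 (A? w)) ∷ (\ w -> 𝟙 (B? w)) ∷ (\ w -> 𝟙 (Non? u w)) ∷ (\ w -> 𝟙 (Non? u' w)) ∷
   (\ w -> 𝟙 (Non? p w)) ∷ (\ w -> 𝟙 (Non? q1 w)) ∷ (\ w -> 𝟙 (Non? q2 w)) ∷ (\ w -> 𝟙 (Non? q3 w)) ∷ (\ w -> 𝟙 (Non? p' w)) ∷ (\ w -> 𝟙 (Bad? w)) ∷ []

  a = # A? S
  c = # B? S
  d1 = # D1? S
  d2 = # D2? S
  N = length S

  ∈u : u ∈ S
  ∈u = All.lookup all∈ (here refl)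
  ∈u' : u' ∈ S
  ∈u' = All.lookup all∈ (there (here refl))
  ∈p : p ∈ S
  ∈p = All.lookup all∈ (there (there (here refl)))
  ∈q1 : q1 ∈ S
  ∈q1 = All.lookup all∈ (there (there (there (here refl))))
  ∈q2 : q2 ∈ S
  ∈q2 = All.lookup all∈ (there (there (there (there (here refl)))))
  ∈q3 : q3 ∈ S
  ∈q3 = All.lookup all∈ (there (there (there (there (there (here refl))))))
  ∈p' : p' ∈ S
  ∈p' = All.lookup all∈ (there (there (there (there (there (there (here refl)))))))

  total1 : 12 * N ≤ 2 * (d1 + d2 + a) + 31 * μ + 12 * (2187 * b)
  total1 = (lin (N ∷ d1 ∷ d2 ∷ a ∷ (miss S p') ∷ (miss S u) ∷ (miss S u') ∷ (miss S q1) ∷ (miss S q2) ∷ (miss S q3) ∷ (miss S p) ∷ (# Bad? S) ∷ b ∷ μ ∷ []) (12 :* v0 <: 2 :* (v1 :+ v2 :+ v3) :+ 31 :* v13 :+ 12 :* (2187 :* v12)) (12 :* v0 <: 2 :* (v1 :+ v2 :+ v3) :+ 2 :* (v4 :+ v5 :+ v6 :+ v7 :+ v8) :+ (v7 :+ v8 :+ v9) :+ 3 :* (v5 :+ v6 :+ v10 :+ v7 :+ v8 :+ v9) :+ 12 :* v11 by (∑-linear fields (k 12 <: 2 :* (v0 :+ v1 :+ v2) :+ 2 :* (v10 :+ v4 :+ v5 :+ v7 :+ v8) :+ (v7 :+ v8 :+ v9) :+ 3 :* (v4 :+ v5 :+ v6 :+ v7 :+ v8 :+ v9) :+ 12 :*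 v11) S (\ {w} _ -> guarded 12 cost1 cost1-check w)) & v11 <: 2187 :* v12 by 12 · bad-few & v5 <: v13 by 5 · low ∈u & v6 <: v13 by 5 · low ∈u' & v10 <: v13 by 3 · low ∈p & v7 <: v13 by 6 · low ∈q1 & v8 <: v13 by 6 · low ∈q2 & v9 <: v13 by 4 · low ∈q3 & v4 <: v13 by 2 · low ∈p' & □))

  total2 : 12 * N ≤ 2 * (d1 + d2 + c) + 31 * μ + 12 * (2187 * b)
  total2 = (lin (N ∷ d1 ∷ d2 ∷ c ∷ (miss S p') ∷ (miss S u) ∷ (miss S u') ∷ (miss S q1) ∷ (miss S q2) ∷ (miss S p) ∷ (miss S q3) ∷ (# Bad? S) ∷ b ∷ μ ∷ []) (12 :* v0 <: 2 :* (v1 :+ v2 :+ v3) :+ 31 :* v13 :+ 12 :* (2187 :* v12)) (12 :* v0 <: 2 :* (v1 :+ v2 :+ v3) :+ 2 :* (v4 :+ v5 :+ v6 :+ v7 :+ v8) :+ (v5 :+ v6 :+ v9) :+ 3 :* (v5 :+ v6 :+ v9 :+ v7 :+ v8 :+ v10) :+ 12 :* v11 by (∑-linear fields (k 12 <: 2 :* (v0 :+ v1 :+ v3) :+ 2 :* (v10 :+ v4 :+ v5 :+ v7 :+ v8) :+ (v4 :+ v5 :+ v6) :+ 3 :* (v4 :+ v5 :+ v6 :+ v7 :+ v8 :+ v9) :+ 12 :* v11) S (\ {w} _ -> guarded 12 cost2 cost2-check w)) & v11 <: 2187 :* v12 by 12 · bad-few & v5 <: v13 by 6 · low ∈u & v6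 <: v13 by 6 · low ∈u' & v9 <: v13 by 4 · low ∈p & v7 <: v13 by 5 · low ∈q1 & v8 <: v13 by 5 · low ∈q2 & v10 <: v13 by 3 · low ∈q3 & v4 <: v13 by 2 · low ∈p' & □))

  total3 : 4 * N ≤ d1 + d2 + 11 * μ + 4 * (2187 * b)
  total3 = (lin (N ∷ d1 ∷ d2 ∷ (miss S p') ∷ (miss S u) ∷ (miss S u') ∷ (miss S q1) ∷ (miss S q2) ∷ (miss S p) ∷ (miss S q3) ∷ (# Bad? S) ∷ b ∷ μ ∷ []) (4 :* v0 <: v1 :+ v2 :+ 11 :* v12 :+ 4 :* (2187 :* v11)) (4 :* v0 <: v1 :+ v2 :+ (v3 :+ v4 :+ v5 :+ v6 :+ v7) :+ (v4 :+ v5 :+ v8 :+ v6 :+ v7 :+ v9) :+ 4 :* v10 by (∑-linear fields (k 4 <: v0 :+ v1 :+ (v10 :+ v4 :+ v5 :+ v7 :+ v8) :+ (v4 :+ v5 :+ v6 :+ v7 :+ v8 :+ v9) :+ 4 :* v11) S (\ {w} _ -> guarded 4 cost3 cost3-check w)) & v10 <: 2187 :* v11 by 4 · bad-few & v4 <: v12 by 2 · low ∈u & v5 <: v12 by 2 · low ∈u' & v8 <: v12 by low ∈p & v6 <: v12 by 2 · low ∈q1 & v7 <: v12 by 2 · low ∈q2 & v9 <: v12 by low ∈q3 & v3 <: v12 by low ∈p' & □))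

  A = \ w -> at inA w ≡ true
  B = \ w -> at inB w ≡ true
  D1 = \ w -> at inD1 w ≡ true
  D2 = \ w -> at inD2 w ≡ true

  D1⊆A : ∀ {w} -> D1 w -> A w
  D1⊆A h = proj₁ (∧-true h)

  D2⊆B : ∀ {w} -> D2 w -> B w
  D2⊆B h = proj₁ (∧-true h)

  D1-red : ∀ {w} -> D1 w -> Red p' w
  D1-red {w} h = is-sound (χ p' w) red (proj₂ (∧-true {at inA w} h))

  D2-red : ∀ {w} -> D2 w -> Red p' w
  D2-red {w} h = is-sound (χ p' w) red (proj₂ (∧-true {at inB w} h))

  D1-blue : ∀ {w} -> D1 w -> Blue q3 w
  D1-blue {w} h = is-sound (χ q3 w) blue (implies-sound (proj₁ (∧-true {implies (at inD1 w) (χ q3 w is blue)} {implies (at inD2 w) (χ p w is blue)} (use D-claim D-check w))) h)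

  D2-blue : ∀ {w} -> D2 w -> Blue p w
  D2-blue {w} h = is-sound (χ p w) blue (implies-sound (proj₂ (∧-true {implies (at inD1 w) (χ q3 w is blue)} {implies (at inD2 w) (χ p w is blue)} (use D-claim D-check w))) h)

  A-reds : ∀ {w} -> A w -> red-pairs (χ q1 w) (χ q2 w) (χ q3 w) ≡ true
  A-reds {w} h = proj₁ (∧-true {red-pairs (χ q1 w) (χ q2 w) (χ q3 w)} {not (at inB w)} (implies-sound (use A-claim A-check w) h))

  A∩B : ∀ {w} -> A w -> ¬ B w
  A∩B {w} h h' = absurd (trans (sym (cong not h')) (proj₂ (∧-true {red-pairs (χ q1 w) (χ q2 w) (χ q3 w)} {not (at inB w)} (implies-sound (use A-claim A-check w) h)))) \ ()

  B-reds : ∀ {w} -> B w -> red-pairs (χ u w) (χ u' w) (χ p w) ≡ true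
  B-reds {w} h = implies-sound (use B-claim B-check w) h

  Pairs : V -> V -> V -> V -> Set
  Pairs x y z w = (Red x w × Red y w) ⊎ (Red x w × Red z w) ⊎ (Red y w × Red z w)

  red-pairs-sound : ∀ x y z w -> red-pairs (χ x w) (χ y w) (χ z w) ≡ true -> Pairs x y z w
  red-pairs-sound x y z w h = go (χ x w) (χ y w) (χ z w) refl refl refl h
   where
   go : ∀ i j l -> χ x w ≡ i -> χ y w ≡ j -> χ z w ≡ l -> red-pairs i j l ≡ true -> Pairs x y z w
   go red red _ e e' _ _ = inj₁ (e , e')
   go red none red e _ e″ _ = inj₂ (inj₁ (e , e″))
   go red blue red e _ e″ _ = inj₂ (inj₁ (e , e″))
   go none red red _ e' e″ _ = inj₂ (inj₂ (e' , e″))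
   go blue red red _ e' e″ _ = inj₂ (inj₂ (e' , e″))
   go red none none _ _ _ ()
   go red none blue _ _ _ ()
   go red blue none _ _ _ ()
   go red blue blue _ _ _ ()
   go none none _ _ _ _ ()
   go none blue _ _ _ _ ()
   go none red none _ _ _ ()
   go none red blue _ _ _ ()
   go blue none _ _ _ _ ()
   go blue blue _ _ _ _ ()
   go blue red none _ _ _ ()
   go blue red blue _ _ _ ()

  shared : ∀ {x y z w w'} -> Pairs x y z w -> Pairs x y z w' -> ¬ Red w w'
  shared (inj₁ (a , b)) (inj₁ (c , d)) r = red-free a r c
  shared (inj₁ (a , b)) (inj₂ (inj₁ (c , d))) r = red-free a r c
  shared (inj₁ (a , b)) (inj₂ (inj₂ (c , d))) r = red-free b r c
  shared (inj₂ (inj₁ (a , b))) (inj₁ (c , d)) r = red-free a r c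
  shared (inj₂ (inj₁ (a , b))) (inj₂ (inj₁ (c , d))) r = red-free a r c
  shared (inj₂ (inj₁ (a , b))) (inj₂ (inj₂ (c , d))) r = red-free b r d
  shared (inj₂ (inj₂ (a , b))) (inj₁ (c , d)) r = red-free a r d
  shared (inj₂ (inj₂ (a , b))) (inj₂ (inj₁ (c , d))) r = red-free b r d
  shared (inj₂ (inj₂ (a , b))) (inj₂ (inj₂ (c , d))) r = red-free a r c

  -- Each of the two vertices is red to two of q1, q2 and q3, so they have a common red neighbour.
  A-no-red : ∀ {w w'} -> A w -> A w' -> ¬ Red w w'
  A-no-red {w} {w'} h h' = shared (red-pairs-sound q1 q2 q3 w (A-reds h)) (red-pairs-sound q1 q2 q3 w' (A-reds h'))

  B-no-red : ∀ {w w'} -> B w -> B w' -> ¬ Red w w'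
  B-no-red {w} {w'} h h' = shared (red-pairs-sound u u' p w (B-reds h)) (red-pairs-sound u u' p w' (B-reds h'))

  -- The hub is q3, blue to all of D1. Red edges from D1 are excluded towards A by common red
  -- neighbours among the q's, and towards D2 by p'.
  half1 : b < d1 -> d1 + a + d2 ≤ 2 * μ + 3 * b
  half1 = half-density D1? A? D2? D1⊆A (\ h h' -> A∩B h (D2⊆B h')) ∈q3 (\ _ -> D1-blue)
   (\ _ _ h h' -> A-no-red (D1⊆A h) h') (\ _ _ h h' r -> red-free (D1-red h) r (D2-red h'))

  half2 : b < d2 -> d2 + c + d1 ≤ 2 * μ + 3 * b
  half2 = half-density D2? B? D1? D2⊆B (\ h h' -> A∩B (D1⊆A h') h) ∈p (\ _ -> D2-blue)
   (\ _ _ h h' -> B-no-red (D2⊆B h) h') (\ _ _ h h' r -> red-free (D2-red h) r (D1-red h'))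

  -- By `total3` one of d1 and d2 exceeds b. Then `half1` or `half2` bounds a sum by about 2N/3 that
  -- `total1` or `total2` puts above 5N/6, up to the error terms.
  contradictory : ⊥
  contradictory = by-size (b <? d1) (b <? d2)
   where
   overfull : 1 ≤ 0 -> ⊥
   overfull ()
   by-size : Dec (b < d1) -> Dec (b < d2) -> ⊥
   by-size (yes h) _ = overfull (lin-κ 79 (N ∷ d1 ∷ d2 ∷ a ∷ μ ∷ b ∷ σ ∷ []) (k 1 <: k 0) (12 :* v0 <: 2 :* (v1 :+ v2 :+ v3) :+ 31 :* v4 :+ 12 :* (2187 :* v5) by 240 · total1 & v1 :+ v3 :+ v2 <: 2 :* v4 :+ 3 :* v5 by 480 · half1 h & 3 :* v4 <: v0 :+ v6 by 2800 · upper & 100000 :* v5 <: v6 by 63 · small & k 1 :+ 1000 :* v6 <: v0 by 80 · tiny & □))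
   by-size (no _) (yes h) = overfull (lin-κ 79 (N ∷ d1 ∷ d2 ∷ c ∷ μ ∷ b ∷ σ ∷ []) (k 1 <: k 0) (12 :* v0 <: 2 :* (v1 :+ v2 :+ v3) :+ 31 :* v4 :+ 12 :* (2187 :* v5) by 240 · total2 & v2 :+ v3 :+ v1 <: 2 :* v4 :+ 3 :* v5 by 480 · half2 h & 3 :* v4 <: v0 :+ v6 by 2800 · upper & 100000 :* v5 <: v6 by 63 · small & k 1 :+ 1000 :* v6 <: v0 by 80 · tiny & □))
   by-size (no h) (no h') = overfull (lin-κ 79 (N ∷ d1 ∷ d2 ∷ μ ∷ b ∷ σ ∷ []) (k 1 <: k 0) (4 :* v0 <: v1 :+ v2 :+ 11 :* v3 :+ 4 :* (2187 :* v4) by 240 · total3 & v1 <: v4 by 240 · ≮⇒≥ h & v2 <: v4 by 240 · ≮⇒≥ h' & 3 :* v3 <: v0 :+ v5 by 880 · upper & 100000 :* v4 <: v5 by 21 · small & k 1 :+ 1000 :* v5 <: v0 by 80 · tiny & □))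

 -- Blue twins see at most three vertices in red and two in blue; missing only two of a seven-clique
 -- they attain both, and they replace the missed vertices.
 record Configuration : Set where
  field
   u u' : V
   Q P : List V
   u∈ : u ∈ S
   u'∈ : u' ∈ S
   Q⊆ : All (_∈ S) Q
   P⊆ : All (_∈ S) P
   uu' : Blue u u'
   Q-length : length Q ≡ 3
   P-length : length P ≡ 2
   P-no-blue : ∀ {x y} -> x ∈ P -> y ∈ P -> ¬ Blue x y
   QP-clique : Clique (Q ++ P)
   uQ : ∀ {x} -> x ∈ Q -> Red u x
   u'Q : ∀ {x} -> x ∈ Q -> Red u' x
   uP : ∀ {x} -> x ∈ P -> Blue u x
   u'P : ∀ {x} -> x ∈ P -> Blue u' x

 module FindSeven (C : Configuration) where
  open Configuration C

  K : List V
  K = u ∷ u' ∷ Q ++ P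

  K-length : length K ≡ 7
  K-length = cong (\ n -> 2 + n) (trans (length-++ Q) (cong₂ _+_ Q-length P-length))

  inQ : ∀ {x} -> x ∈ Q -> x ∈ K
  inQ m = there (there (∈-++⁺ˡ m))

  inP : ∀ {x} -> x ∈ P -> x ∈ K
  inP m = there (there (∈-++⁺ʳ Q m))

  ∈Q : ∀ {x} -> x ∈ Q -> x ∈ S
  ∈Q m = All.lookup Q⊆ m

  ∈P : ∀ {x} -> x ∈ P -> x ∈ S
  ∈P m = All.lookup P⊆ m

  K⊆ : All (_∈ S) K
  K⊆ = u∈ ∷ u'∈ ∷ All.++⁺ Q⊆ P⊆

  Q-no-red : ∀ {x y} -> x ∈ Q -> y ∈ Q -> ¬ Red x y
  Q-no-red m m' r = red-free (uQ m) r (uQ m')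

  split : ∀ L {M} -> Clique (L ++ M) -> Clique L × Clique M × (∀ {x y} -> x ∈ L -> y ∈ M -> Adj x y)
  split [] c = [] , c , \ ()
  split (x ∷ L) (h ∷ c) = let cL , cM , cross = split L c in
   All.tabulate (\ m -> All.lookup h (∈-++⁺ˡ m)) ∷ cL , cM , \ { (here refl) m' -> All.lookup h (∈-++⁺ʳ L m') ; (there m) m' -> cross m m' }

  Q-clique : Clique Q
  Q-clique = proj₁ (split Q QP-clique)

  P-clique : Clique P
  P-clique = proj₁ (proj₂ (split Q QP-clique))

  Q–P : ∀ {x y} -> x ∈ Q -> y ∈ P -> Adj x y
  Q–P = proj₂ (proj₂ (split Q QP-clique))

  module Typical {w w'} (w∈ : w ∈ S) (w'∈ : w' ∈ S) (ww' : Blue w w') (s : Same K w w') where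

   two-reds : ∀ {x y} -> Red x w -> Red y w -> ¬ Red x y
   two-reds r r' r″ = red-free r″ r' r

   twin : ∀ {x c} -> x ∈ K -> χ x w ≡ c -> χ x w' ≡ c
   twin m e = trans (sym (same s m)) e

   two-blues : ∀ {x y} -> x ∈ K -> y ∈ K -> Blue x w -> Blue y w -> ¬ Blue x y
   two-blues mx my bx yb xy = no-K4 (All.lookup K⊆ mx) (All.lookup K⊆ my) w∈ w'∈ xy bx (twin mx bx) yb (twin my yb) ww'

   total-Q : misses Q w + reds Q w + blues Q w ≡ 3
   total-Q = trans (colours-total Q w) Q-length

   total-P : misses P w + reds P w + blues P w ≡ 2
   total-P = trans (colours-total P w) P-length

   sr : ∀ {x} M -> x ∈ seen-red w M -> x ∈ M × Red x w
   sr M = seen-red-∈ M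

   sb : ∀ {x} M -> x ∈ seen-blue w M -> x ∈ M × Blue x w
   sb M = seen-blue-∈ M

   blues-Q≤1 : blues Q w ≤ 1
   blues-Q≤1 = subst (_≤ 1) (#-length (\ x -> Blue? x w) Q) (lonely (seen-blue-clique w Q-clique)
    (\ m m' -> Q-no-red (proj₁ (sb Q m)) (proj₁ (sb Q m')))
    \ m m' -> two-blues (inQ (proj₁ (sb Q m))) (inQ (proj₁ (sb Q m'))) (proj₂ (sb Q m)) (proj₂ (sb Q m')))

   reds-P≤1 : reds P w ≤ 1
   reds-P≤1 = subst (_≤ 1) (#-length (\ x -> Red? x w) P) (lonely (AllPairs.filter⁺ (\ x -> Red? x w) P-clique)
    (\ m m' -> two-reds (proj₂ (sr P m)) (proj₂ (sr P m')))
    \ m m' -> P-no-blue (proj₁ (sr P m)) (proj₁ (sr P m')))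

   -- x sees y ∈ P in red when both are seen by w in blue
   red-join : ∀ {x y} -> x ∈ Q -> y ∈ P -> Blue x w -> Blue y w -> Red x y
   red-join mx my bx yb = [ (\ r -> r) , (\ xy -> ⊥-elim (two-blues (inQ mx) (inP my) bx yb xy)) ]′ (colour (Q–P mx my))

   module End {ū} (ū∈ : ū ∈ K) (ūQ : ∀ {x} -> x ∈ Q -> Red ū x) (ūP : ∀ {x} -> x ∈ P -> Blue ū x) where

    red-end : Red ū w -> reds Q w ≡ 0
    red-end r = #-none (\ x -> Red? x w) Q \ m r' -> two-reds r r' (ūQ m)

    red-end-misses : Red ū w -> 2 ≤ misses Q w
    red-end-misses r = (lin ((reds Q w) ∷ (blues Q w) ∷ (misses Q w) ∷ []) (k 2 <: v2) (v0 <: k 0 by≡ red-end r & v1 <: k 1 by blues-Q≤1 & k 3 <: v2 :+ v0 :+ v1 by≡ sym total-Q & □))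

    blue-end : Blue ū w -> blues P w ≡ 0
    blue-end bl = #-none (\ x -> Blue? x w) P \ m bx -> two-blues ū∈ (inP m) bl bx (ūP m)

    blue-end-misses : Blue ū w -> 1 ≤ misses P w
    blue-end-misses bl = (lin ((blues P w) ∷ (reds P w) ∷ (misses P w) ∷ []) (k 1 <: v2) (v0 <: k 0 by≡ blue-end bl & v1 <: k 1 by reds-P≤1 & k 2 <: v2 :+ v1 :+ v0 by≡ sym total-P & □))

   module Eu = End {u} (here refl) uQ uP
   module Eu' = End {u'} (there (here refl)) u'Q u'P

   non-cost : ∀ {x} -> Non x w -> 1 ≤ 𝟙 (Non? x w)
   non-cost {x} n = ≡⇒≤ (sym (𝟙-yes (Non? x w) n))

   -- With both ends red, w sees one vertex q of Q in blue, and in P it sees x in red and y in blue.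
   -- The two blue triangles of the pattern are w w' q and u u' x, and y serves as p'.
   alpha : Red u w -> Red u' w -> 2 * misses Q w + 2 * misses P w ≤ 5 -> Seven
   alpha ru ru' h = build (#-witness (\ x -> Blue? x w) Q (≡⇒≤ (sym bluesQ)))
    where
    bluesQ : blues Q w ≡ 1
    bluesQ = ≤-antisym blues-Q≤1 (lin-κ 1 ((reds Q w) ∷ (misses Q w) ∷ (blues Q w) ∷ (misses P w) ∷ []) (k 1 <: v2) (v0 <: k 0 by≡ 2 · Eu.red-end ru & k 3 <: v1 :+ v0 :+ v2 by≡ 2 · sym total-Q & 2 :* v1 :+ 2 :* v3 <: k 5 by h & □))
    P-seen : misses P w ≤ 0
    P-seen = (lin-κ 1 ((misses Q w) ∷ (misses P w) ∷ []) (v1 <: k 0) (2 :* v0 :+ 2 :* v1 <: k 5 by h & k 2 <: v0 by 2 · Eu.red-end-misses ru & □))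
    build : (∃ \ q -> q ∈ Q × Blue q w) -> Seven
    build (q , q∈ , bq) = finish (#-witness (\ x -> Red? x w) P (lin ((misses P w) ∷ (reds P w) ∷ (blues P w) ∷ []) (k 1 :+ k 0 <: v1) (k 2 <: v0 :+ v1 :+ v2 by≡ sym total-P & v0 <: k 0 by P-seen & v2 <: k 1 by bluesP≤1 & □)))
      (#-witness (\ x -> Blue? x w) P (lin ((misses P w) ∷ (reds P w) ∷ (blues P w) ∷ []) (k 1 :+ k 0 <: v2) (k 2 <: v0 :+ v1 :+ v2 by≡ sym total-P & v0 <: k 0 by P-seen & v1 <: k 1 by reds-P≤1 & □)))
     where
     bluesP≤1 : blues P w ≤ 1
     bluesP≤1 = subst (_≤ 1) (#-length (\ x -> Blue? x w) P) (lonely (seen-blue-clique w P-clique)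
      (\ m m' r -> red-free (red-join q∈ (proj₁ (sb P m)) bq (proj₂ (sb P m))) r (red-join q∈ (proj₁ (sb P m')) bq (proj₂ (sb P m'))))
      \ m m' -> P-no-blue (proj₁ (sb P m)) (proj₁ (sb P m')))
     finish : (∃ \ x -> x ∈ P × Red x w) -> (∃ \ y -> y ∈ P × Blue y w) -> Seven
     finish (x , x∈ , rx) (y , y∈ , yb) = record
      { u = w ; u' = w' ; p = q ; q1 = u ; q2 = u' ; q3 = x ; p' = y
      ; all∈ = w∈ ∷ w'∈ ∷ ∈Q q∈ ∷ u∈ ∷ u'∈ ∷ ∈P x∈ ∷ ∈P y∈ ∷ []
      ; uq1 = χ-flip ru ; uq2 = χ-flip ru' ; uq3 = χ-flip rx
      ; u'q1 = χ-flip (twin (here refl) ru) ; u'q2 = χ-flip (twin (there (here refl)) ru') ; u'q3 = χ-flip (twin (inP x∈) rx)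
      ; pq1 = χ-flip (uQ q∈) ; pq2 = χ-flip (u'Q q∈) ; pp' = qy ; q3p' = xy
      ; uu' = ww' ; up = χ-flip bq ; u'p = χ-flip (twin (inQ q∈) bq)
      ; q1q2 = uu' ; q1q3 = uP x∈ ; q2q3 = u'P x∈
      ; pq3 = [ (\ r -> ⊥-elim (red-free r xy qy)) , (\ bl -> bl) ]′ (colour (Q–P q∈ x∈))
      ; p'u = yb ; p'u' = twin (inP y∈) yb ; p'q1 = χ-flip (uP y∈) ; p'q2 = χ-flip (u'P y∈) }
      where
      qy : Red q y
      qy = red-join q∈ y∈ bq yb
      xy : Red x y
      xy = [ (\ e -> ⊥-elim (red≢blue rx (subst (\ z -> Blue z w) (sym e) yb))) ,
       (\ a -> [ (\ r -> r) , (\ bl -> ⊥-elim (P-no-blue x∈ y∈ bl)) ]′ (colour a)) ]′ (clique-∈ P-clique x∈ y∈)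

   -- One end is missed and the other, ū, is blue. The blue triangles are w w' ū and y z x, where y
   -- and z in Q and x in P are seen in red; the vertex q of Q seen in blue serves as p'.
   beta : ∀ {ū} -> ū ∈ S -> (ū∈ : ū ∈ K) (ūQ : ∀ {x} -> x ∈ Q -> Red ū x) (ūP : ∀ {x} -> x ∈ P -> Blue ū x) -> Blue ū w ->
    2 * misses Q w + 2 * misses P w ≤ 2 -> Seven
   beta {ū} ū∈S ū∈ ūQ ūP bl h = finish (#-witness (\ x -> Blue? x w) Q (≡⇒≤ (sym bluesQ)))
     (#-witness (\ x -> Red? x w) P (≡⇒≤ (sym redsP))) (seen-red w Q) (\ m -> m) (AllPairs.filter⁺ (\ x -> Red? x w) Q-clique)
     (trans (#-length (\ x -> Red? x w) Q) redsQ)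
    where
    module Eū = End {ū} ū∈ ūQ ūP
    redsP : reds P w ≡ 1
    redsP = ≤-antisym reds-P≤1 (lin-κ 1 ((blues P w) ∷ (misses P w) ∷ (reds P w) ∷ (misses Q w) ∷ []) (k 1 <: v2) (v0 <: k 0 by≡ 2 · Eū.blue-end bl & k 2 <: v1 :+ v2 :+ v0 by≡ 2 · sym total-P & 2 :* v3 :+ 2 :* v1 <: k 2 by h & □))
    redsQ≤2 : reds Q w ≤ 2
    redsQ≤2 = (lin ((length (seen-red w (Q ++ P))) ∷ (reds (Q ++ P) w) ∷ (reds Q w) ∷ (reds P w) ∷ []) (v2 <: k 2) (v0 <: k 3 by (bounded (seen-red-blue w QP-clique) (All.filter⁺ (\ x -> Red? x w) (All.++⁺ Q⊆ P⊆))) & v1 <: v0 by≡ sym (#-length (\ x -> Red? x w) (Q ++ P)) & v2 :+ v3 <: v1 by≡ sym (∑-++ (\ x -> 𝟙 (Red? x w)) Q P) & k 1 <: v3 by≡ sym redsP & □))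
    Q-seen : misses Q w ≤ 0
    Q-seen = (lin-κ 1 ((misses Q w) ∷ (misses P w) ∷ []) (v0 <: k 0) (2 :* v0 :+ 2 :* v1 <: k 2 by h & k 1 <: v1 by 2 · Eū.blue-end-misses bl & □))
    bluesQ : blues Q w ≡ 1
    bluesQ = ≤-antisym blues-Q≤1 (lin ((misses Q w) ∷ (reds Q w) ∷ (blues Q w) ∷ []) (k 1 <: v2) (k 3 <: v0 :+ v1 :+ v2 by≡ sym total-Q & v0 <: k 0 by Q-seen & v1 <: k 2 by redsQ≤2 & □))
    redsQ : reds Q w ≡ 2
    redsQ = ≤-antisym redsQ≤2 (lin ((misses Q w) ∷ (reds Q w) ∷ (blues Q w) ∷ []) (k 2 <: v1) (k 3 <: v0 :+ v1 :+ v2 by≡ sym total-Q & v0 <: k 0 by Q-seen & v2 <: k 1 by blues-Q≤1 & □))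
    finish : (∃ \ q -> q ∈ Q × Blue q w) -> (∃ \ x -> x ∈ P × Red x w) -> ∀ L -> (∀ {y} -> y ∈ L -> y ∈ seen-red w Q) -> Clique L -> length L ≡ 2 -> Seven
    finish (q , q∈ , bq) (x , x∈ , rx) (y ∷ z ∷ []) sub ((yz ∷ []) ∷ _) refl = record
      { u = w ; u' = w' ; p = ū ; q1 = y ; q2 = z ; q3 = x ; p' = q
      ; all∈ = w∈ ∷ w'∈ ∷ ū∈S ∷ ∈Q y∈ ∷ ∈Q z∈ ∷ ∈P x∈ ∷ ∈Q q∈ ∷ []
      ; uq1 = χ-flip ry ; uq2 = χ-flip rz ; uq3 = χ-flip rx
      ; u'q1 = χ-flip (twin (inQ y∈) ry) ; u'q2 = χ-flip (twin (inQ z∈) rz) ; u'q3 = χ-flip (twin (inP x∈) rx)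
      ; pq1 = ūQ y∈ ; pq2 = ūQ z∈ ; pp' = ūQ q∈ ; q3p' = xq
      ; uu' = ww' ; up = χ-flip bl ; u'p = χ-flip (twin ū∈ bl)
      ; q1q2 = blue-Q y∈ z∈ yz ; q1q3 = yx ; q2q3 = zx
      ; pq3 = ūP x∈ ; p'u = bq ; p'u' = twin (inQ q∈) bq ; p'q1 = qy ; p'q2 = qz }
     where
     y∈ = proj₁ (sr Q (sub (here refl)))
     z∈ = proj₁ (sr Q (sub (there (here refl))))
     ry = proj₂ (sr Q (sub (here refl)))
     rz = proj₂ (sr Q (sub (there (here refl))))
     blue-Q : ∀ {i j} -> i ∈ Q -> j ∈ Q -> Adj i j -> Blue i j
     blue-Q m m' a = [ (\ r -> ⊥-elim (Q-no-red m m' r)) , (\ e -> e) ]′ (colour a)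
     distinct : ∀ {i} -> i ∈ Q -> Red i w -> Blue q i
     distinct m r = blue-Q q∈ m ([ (\ e -> ⊥-elim (red≢blue r (subst (\ z -> Blue z w) e bq))) , (\ a -> a) ]′ (clique-∈ Q-clique q∈ m))
     qy = distinct y∈ ry
     qz = distinct z∈ rz
     to-x : ∀ {i} -> i ∈ Q -> Red i w -> Blue i x
     to-x m r = [ (\ r' -> ⊥-elim (two-reds r rx r')) , (\ e -> e) ]′ (colour (Q–P m x∈))
     yx = to-x y∈ ry
     zx = to-x z∈ rz
     xq : Red x q
     xq = χ-flip ([ (\ r -> r) , (\ e -> ⊥-elim (no-K4 (∈Q q∈) (∈Q y∈) (∈Q z∈) (∈P x∈) qy qz e (blue-Q y∈ z∈ yz) yx zx)) ]′ (colour (Q–P q∈ x∈)))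

   -- The weights sum to 16, and 16/3 is below 6, so twins of cost at most 5 exist. Seeing the ends
   -- other than in the two useful ways costs 6 or gives a blue K4.
   seven : 3 * (𝟙 (Non? u w) + 𝟙 (Non? u' w)) + 2 * misses Q w + 2 * misses P w ≤ 5 -> Seven
   seven h = go (χ u w) (χ u' w) refl refl
    where
    too-much : ∀ {n} {T : Set} -> 6 ≤ n -> n ≤ 5 -> T
    too-much p p' = ⊥-elim (<⇒≱ p p')
    rest : 1 ≤ 𝟙 (Non? u w) + 𝟙 (Non? u' w) -> 2 * misses Q w + 2 * misses P w ≤ 2
    rest n = (lin ((𝟙 (Non? u w)) ∷ (𝟙 (Non? u' w)) ∷ (misses Q w) ∷ (misses P w) ∷ []) (2 :* v2 :+ 2 :* v3 <: k 2) (k 1 <: v0 :+ v1 by 3 · n & 3 :* (v0 :+ v1) :+ 2 :* v2 :+ 2 :* v3 <: k 5 by h & □))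
    go : ∀ c c' -> χ u w ≡ c -> χ u' w ≡ c' -> Seven
    go red red e e' = alpha e e' (lin ((𝟙 (Non? u w)) ∷ (𝟙 (Non? u' w)) ∷ (misses Q w) ∷ (misses P w) ∷ []) (2 :* v2 :+ 2 :* v3 <: k 5) (3 :* (v0 :+ v1) :+ 2 :* v2 :+ 2 :* v3 <: k 5 by h & □))
    go none blue e e' = beta {u'} u'∈ (there (here refl)) u'Q u'P e' (rest (≤-trans (non-cost {u} e) (m≤m+n _ _)))
    go blue none e e' = beta {u} u∈ (here refl) uQ uP e (rest (≤-trans (non-cost {u'} e') (m≤n+m _ (𝟙 (Non? u w)))))
    go none none e e' = too-much (lin ((𝟙 (Non? u w)) ∷ (𝟙 (Non? u' w)) ∷ (misses Q w) ∷ (misses P w) ∷ []) (k 6 <: 3 :* (v0 :+ v1) :+ 2 :* v2 :+ 2 :* v3) (k 1 <: v0 by 3 · non-cost {u} e & k 1 <: v1 by 3 · non-cost {u'} e' & □)) h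
    go none red e e' = too-much (lin ((𝟙 (Non? u w)) ∷ (misses Q w) ∷ (𝟙 (Non? u' w)) ∷ (misses P w) ∷ []) (k 6 <: 3 :* (v0 :+ v2) :+ 2 :* v1 :+ 2 :* v3) (k 1 <: v0 by 3 · non-cost {u} e & k 2 <: v1 by 2 · Eu'.red-end-misses e' & □)) h
    go red none e e' = too-much (lin ((𝟙 (Non? u' w)) ∷ (misses Q w) ∷ (𝟙 (Non? u w)) ∷ (misses P w) ∷ []) (k 6 <: 3 :* (v2 :+ v0) :+ 2 :* v1 :+ 2 :* v3) (k 1 <: v0 by 3 · non-cost {u'} e' & k 2 <: v1 by 2 · Eu.red-end-misses e & □)) h
    go red blue e e' = too-much (lin ((misses Q w) ∷ (misses P w) ∷ (𝟙 (Non? u w)) ∷ (𝟙 (Non? u' w)) ∷ []) (k 6 <: 3 :* (v2 :+ v3) :+ 2 :* v0 :+ 2 :* v1) (k 2 <: v0 by 2 · Eu.red-end-misses e & k 1 <: v1 by 2 · Eu'.blue-end-misses e' & □)) h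
    go blue red e e' = too-much (lin ((misses Q w) ∷ (misses P w) ∷ (𝟙 (Non? u w)) ∷ (𝟙 (Non? u' w)) ∷ []) (k 6 <: 3 :* (v2 :+ v3) :+ 2 :* v0 :+ 2 :* v1) (k 2 <: v0 by 2 · Eu'.red-end-misses e' & k 1 <: v1 by 2 · Eu.blue-end-misses e & □)) h
    go blue blue e e' = ⊥-elim (two-blues (here refl) (there (here refl)) e e' uu')

  cost : V -> ℕ
  cost w = ⟦ 3 :* (v0 :+ v1) :+ 2 :* v2 :+ 2 :* v3 ⟧ (𝟙 (Non? u w) ∷ 𝟙 (Non? u' w) ∷ misses Q w ∷ misses P w ∷ [])

  ∑-cost : ∑ cost S ≤ 16 * μ
  ∑-cost = ≤-trans (≡⇒≤ (∑-⟦⟧ ((\ w -> 𝟙 (Non? u w)) ∷ (\ w -> 𝟙 (Non? u' w)) ∷ misses Q ∷ misses P ∷ [])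
    (3 :* (v0 :+ v1) :+ 2 :* v2 :+ 2 :* v3) S))
   (lin ((miss S u) ∷ μ ∷ (miss S u') ∷ (∑ (misses Q) S) ∷ (∑ (misses P) S) ∷ []) (3 :* (v0 :+ v2) :+ 2 :* v3 :+ 2 :* v4 <: 16 :* v1) (v0 <: v1 by 3 · low u∈ & v2 <: v1 by 3 · low u'∈ & v3 <: 3 :* v1 by 2 · (subst (\ n -> ∑ (misses Q) S ≤ n * μ) Q-length (weighted-average Q⊆)) & v4 <: 2 :* v1 by 2 · (subst (\ n -> ∑ (misses P) S ≤ n * μ) P-length (weighted-average P⊆)) & □))

  found : Seven
  found = build (light-twins dense K cost 5 (subst (\ n -> ∑ cost S + 6 * (3 ^ n * b) < 6 * length S) (sym K-length)
    (lin-κ 149999 ((∑ cost S) ∷ μ ∷ (length S) ∷ σ ∷ b ∷ []) (k 1 :+ (v0 :+ 6 :* (2187 :* v4)) <: 6 :* v2) (v0 <: 16 :* v1 by 150000 · ∑-cost & 3 :* v1 <: v2 :+ v3 by 800000 · upper & 100000 :* v4 <: v3 by 19683 · small & k 1 :+ 1000 :* v3 <: v2 by 100000 · tiny & □))))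
   where
   build : (∃₂ \ w w' -> w ∈ S × w' ∈ S × cost w ≤ 5 × cost w' ≤ 5 × Blue w w' × Same K w w') -> Seven
   build (w , w' , w∈ , w'∈ , h , _ , ww' , s) = Typical.seven w∈ w'∈ ww' s h

 refute-seven : Seven -> ⊥
 refute-seven X = RefuteSeven.contradictory X

 refute-configuration : Configuration -> ⊥
 refute-configuration C = refute-seven (FindSeven.found C)

 module _ {K u w} (c : Clique K) (K⊆ : All (_∈ S) K) (len : length K ≡ 7) (u∈ : u ∈ S) (w∈ : w ∈ S)
  (few : misses K u ≤ 2) (uw : Blue u w) (s : Same K u w) where

  seen-apart : ∀ {x y} -> x ∈ seen-red u K -> y ∈ seen-blue u K -> Adj x y
  seen-apart {x} {y} m m' = [ (\ e -> ⊥-elim (red≢blue (proj₂ (seen-red-∈ K m)) (subst (\ z -> Blue z u) (sym e) (proj₂ (seen-blue-∈ K m'))))) , (\ e -> e) ]′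
   (clique-∈ c (proj₁ (seen-red-∈ K m)) (proj₁ (seen-blue-∈ K m')))

  Q≤3 : length (seen-red u K) ≤ 3
  Q≤3 = bounded (seen-red-blue u c) (All.filter⁺ (\ x -> Red? x u) K⊆)

  P-edge : ∀ {x y} -> x ∈ seen-blue u K -> y ∈ seen-blue u K -> ¬ Blue x y
  P-edge m m' xy = no-K4 u∈ w∈ (All.lookup K⊆ (proj₁ (seen-blue-∈ K m))) (All.lookup K⊆ (proj₁ (seen-blue-∈ K m'))) uw
   (proj₁ (blue-twins s m)) (proj₁ (blue-twins s m')) (proj₂ (blue-twins s m)) (proj₂ (blue-twins s m')) xy

  P≤2 : length (seen-blue u K) ≤ 2
  P≤2 = no-blue-edge (seen-blue-clique u c) P-edge

  twin-configuration : Configuration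
  twin-configuration = record
   { u = u ; u' = w ; Q = seen-red u K ; P = seen-blue u K ; u∈ = u∈ ; u'∈ = w∈
   ; Q⊆ = All.filter⁺ (\ x -> Red? x u) K⊆ ; P⊆ = All.filter⁺ (\ x -> Blue? x u) K⊆
   ; uu' = uw
   ; Q-length = ≤-antisym Q≤3 (lin ((length K) ∷ (misses K u) ∷ (length (seen-red u K)) ∷ (length (seen-blue u K)) ∷ []) (k 3 <: v2) (v0 <: v1 :+ v2 :+ v3 by≡ sym (seen-total K u) & k 7 <: v0 by≡ sym len & v1 <: k 2 by few & v3 <: k 2 by P≤2 & □))
   ; P-length = ≤-antisym P≤2 (lin ((length K) ∷ (misses K u) ∷ (length (seen-red u K)) ∷ (length (seen-blue u K)) ∷ []) (k 2 <: v3) (v0 <: v1 :+ v2 :+ v3 by≡ sym (seen-total K u) & k 7 <: v0 by≡ sym len & v1 <: k 2 by few & v2 <: k 3 by Q≤3 & □))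
   ; P-no-blue = P-edge
   ; QP-clique = AllPairs.++⁺ (AllPairs.filter⁺ (\ x -> Red? x u) c) (seen-blue-clique u c)
     (All.tabulate \ m -> All.tabulate \ m' -> seen-apart m m')
   ; uQ = \ m -> χ-flip (proj₂ (seen-red-∈ K m))
   ; u'Q = \ m -> χ-flip (trans (sym (same s (proj₁ (seen-red-∈ K m)))) (proj₂ (seen-red-∈ K m)))
   ; uP = \ m -> proj₁ (blue-twins s m) ; u'P = \ m -> proj₂ (blue-twins s m) }

 no-seven : ∀ {K} -> Clique K -> All (_∈ S) K -> length K ≡ 7 -> ⊥
 no-seven {K} c K⊆ len = refute (light-twins dense K (misses K) 2 (subst (\ n -> ∑ (misses K) S + 3 * (3 ^ n * b) < 3 * length S) (sym len)
   (lin-κ 299999 ((∑ (misses K) S) ∷ μ ∷ (length S) ∷ σ ∷ b ∷ []) (k 1 :+ (v0 :+ 3 :* (2187 :* v4)) <: 3 :* v2) (v0 <: 7 :* v1 by 300000 · (subst (\ n -> ∑ (misses K) S ≤ n * μ) len (weighted-average K⊆)) & 3 :* v1 <: v2 :+ v3 by 700000 · upper & 100000 :* v4 <: v3 by 19683 · small & k 1 :+ 1000 :* v3 <: v2 by 200000 · tiny & □))))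
  where
  refute : (∃₂ \ u w -> u ∈ S × w ∈ S × misses K u ≤ 2 × misses K w ≤ 2 × Blue u w × Same K u w) -> ⊥
  refute (u , w , u∈ , w∈ , few , _ , uw , s) = refute-configuration (twin-configuration c K⊆ len u∈ w∈ few uw s)

 ω≤6 : ∀ K -> Clique K -> All (_∈ S) K -> length K ≤ 6
 ω≤6 K c K⊆ = ≮⇒≥ \ big -> refute (take-clique 7 c K⊆ big)
  where
  refute : (∃ \ L -> Clique L × All (_∈ S) L × length L ≡ 7) -> ⊥
  refute (L , c , L⊆ , len) = no-seven c L⊆ len

-- (K3, K4) with a large blue neighbourhood

#-overlap : ∀ {A : Set} {P F G : A -> Set} (P? : Decidable P) (F? : Decidable F) (G? : Decidable G) xs ->
 # (\ x -> P? x ×? F? x) xs + # (\ x -> P? x ×? G? x) xs ≤ # P? xs + # (\ x -> P? x ×? (F? x ×? G? x)) xs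
#-overlap P? F? G? xs = ∑-linear ((\ x -> 𝟙 (P? x ×? F? x)) ∷ (\ x -> 𝟙 (P? x ×? G? x)) ∷ (\ x -> 𝟙 (P? x)) ∷ (\ x -> 𝟙 (P? x ×? (F? x ×? G? x))) ∷ [])
 (v0 :+ v1 <: v2 :+ v3) xs (\ {x} _ -> pointwise (P? x) (F? x) (G? x))
 where
 pointwise : ∀ {P F G : Set} (p : Dec P) (f : Dec F) (g : Dec G) -> 𝟙 (p ×? f) + 𝟙 (p ×? g) ≤ 𝟙 p + 𝟙 (p ×? (f ×? g))
 pointwise (no _) _ _ = z≤n
 pointwise (yes _) (yes _) (yes _) = ≤-refl
 pointwise (yes _) (yes _) (no _) = ≤-refl
 pointwise (yes _) (no _) (yes _) = ≤-refl
 pointwise (yes _) (no _) (no _) = z≤n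

module ThreeParts {V : Set} (𝒢 : ColouredGraph V)
 (red-free : Graphs.RedFree 𝒢)
 (S : List V) (a μ : ℕ) (dense : Graphs.Dense 𝒢 (Graphs.Adj 𝒢) S a) (low : Graphs.Low 𝒢 S μ)
 (bounded : RedDegrees.BlueBounded 𝒢 red-free S 3) where
 open Graphs 𝒢
 open Colours 𝒢 red-free
 open Partitions 𝒢 S
 open Structure 𝒢 S a μ dense low public
 open Parts public

 no-K4 : ∀ {x y z w} -> x ∈ S -> y ∈ S -> z ∈ S -> w ∈ S ->
  Blue x y -> Blue x z -> Blue x w -> Blue y z -> Blue y w -> Blue z w -> ⊥
 no-K4 x∈ y∈ z∈ w∈ xy xz xw yz yw zw = <⇒≱ (s≤s (s≤s (s≤s (s≤s z≤n)))) (bounded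
  ((xy ∷ xz ∷ xw ∷ []) ∷ (yz ∷ yw ∷ []) ∷ (zw ∷ []) ∷ [] ∷ []) (x∈ ∷ y∈ ∷ z∈ ∷ w∈ ∷ []))

 Χ? : ∀ c x y -> Dec (χ x y ≡ c)
 Χ? c x y = χ x y ≟ᶜ c

 Full : Colour -> V -> {P : V -> Set} -> Decidable P -> ℕ -> Set
 Full c x P? ε = # (\ w -> P? w ×? ¬? (Χ? c x w)) S ≤ ε

 shrink : ∀ c {x ε} {P G : V -> Set} (P? : Decidable P) (G? : Decidable G) -> Full c x P? ε ->
  # (\ w -> P? w ×? G? w) S ≤ # (\ w -> P? w ×? (Χ? c x w ×? G? w)) S + ε
 shrink c {x} {ε} P? G? full = ≤-trans (#-⊎ _ _ (\ w -> P? w ×? ¬? (Χ? c x w)) S \ {w} _ (p , g) -> sort p g (Χ? c x w)) (+-monoʳ-≤ _ full)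
  where
  sort : ∀ {w P G} -> P -> G -> Dec (χ x w ≡ c) -> (P × χ x w ≡ c × G) ⊎ (P × ¬ χ x w ≡ c)
  sort p g (yes e) = inj₁ (p , e , g)
  sort p g (no ¬e) = inj₂ (p , ¬e)

 other : Colour -> Colour
 other none = none
 other red = blue
 other blue = red

 -- Few vertices outside part i are missed by x, and part j avoids part i; as the other colour is
 -- rare in part j, the rest of it is seen in colour c.
 full : ∀ {r τ} (𝒬 : Parts r τ) c -> c ≢ none -> ∀ {i j x ε} -> i ≢ j -> # (\ w -> Non? x w ×? ¬? (U? 𝒬 i w)) S ≤ ε ->
  # (\ w -> U? 𝒬 j w ×? Χ? (other c) x w) S ≤ a -> Full c x (U? 𝒬 j) (ε + a)
 full 𝒬 c c≢ {i} {j} {x} i≢j outside few = ≤-trans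
  (#-⊎ (\ w -> U? 𝒬 j w ×? ¬? (Χ? c x w)) (\ w -> Non? x w ×? ¬? (U? 𝒬 i w)) (\ w -> U? 𝒬 j w ×? Χ? (other c) x w) S
   \ {w} _ (u , ne) -> sort c c≢ (χ x w) u ne refl) (+-mono-≤ outside few)
  where
  sort : ∀ c -> c ≢ none -> ∀ d {w} -> U 𝒬 j w -> χ x w ≢ c -> χ x w ≡ d -> (Non x w × ¬ U 𝒬 i w) ⊎ (U 𝒬 j w × χ x w ≡ other c)
  sort none c≢ _ _ _ _ = absurd refl c≢
  sort _ _ none u ne e = inj₁ (e , \ u' -> i≢j (disjoint 𝒬 u' u))
  sort red _ red u ne e = absurd e ne
  sort red _ blue u ne e = inj₂ (u , e)
  sort blue _ red u ne e = inj₂ (u , e)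
  sort blue _ blue u ne e = absurd e ne

 seen : ∀ {r τ} -> Parts r τ -> V -> Fin r -> ℕ
 seen 𝒬 x i = # (\ w -> Adj? x w ×? U? 𝒬 i w) S

 module Placement {r τ} (𝒬 : Parts (suc r) τ) (θ : ℕ) (some : ∀ {x} -> x ∈ S -> ∃ \ i -> seen 𝒬 x i ≤ θ) where

  pick : ∀ x -> Dec (∃ \ i -> i ∈ allFin (suc r) × seen 𝒬 x i ≤ θ)
  pick x = search (\ i -> seen 𝒬 x i ≤? θ) (allFin (suc r))

  choose : ∀ {x} -> Dec (∃ \ i -> i ∈ allFin (suc r) × seen 𝒬 x i ≤ θ) -> Fin (suc r)
  choose (yes (i , _)) = i
  choose (no _) = zero

  part : V -> Fin (suc r)
  part x = choose {x} (pick x)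

  part-seen : ∀ {x} -> x ∈ S -> seen 𝒬 x (part x) ≤ θ
  part-seen {x} x∈ = go (pick x)
   where
   go : (d : Dec (∃ \ i -> i ∈ allFin (suc r) × seen 𝒬 x i ≤ θ)) -> seen 𝒬 x (choose {x} d) ≤ θ
   go (yes (_ , _ , h)) = h
   go (no none-small) = let i , h = some x∈ in absurd (i , ∈-allFin i , h) none-small

  part-outside : ∀ {x i} -> x ∈ S -> part x ≡ i -> # (\ w -> Non? x w ×? ¬? (U? 𝒬 i w)) S ≤ τ + θ
  part-outside {x} {i} x∈ e = few-outside 𝒬 θ i x∈ (subst (\ j -> seen 𝒬 x j ≤ θ) e (part-seen x∈))

 next1 next2 : Fin 3 -> Fin 3
 next1 zero = suc zero
 next1 1F = zero
 next1 2F = zero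
 next2 zero = suc 1F
 next2 1F = suc 1F
 next2 2F = suc zero

 next1≢ : ∀ i -> i ≢ next1 i
 next1≢ zero ()
 next1≢ 1F ()
 next1≢ 2F ()

 next2≢ : ∀ i -> i ≢ next2 i
 next2≢ zero ()
 next2≢ 1F ()
 next2≢ 2F ()

 next1≢next2 : ∀ i -> next1 i ≢ next2 i
 next1≢next2 zero ()
 next1≢next2 1F ()
 next1≢next2 2F ()

 blue≢none : blue ≢ none
 blue≢none ()

 red≢none : red ≢ none
 red≢none ()

 -- Three parts all joined in blue: then no part contains a blue edge.
 module AllBlue {τ} (𝒬 : Parts 3 τ) (a≤τ : a ≤ τ) (big : 100 * τ < μ)
  (redless : ∀ {x} i -> x ∈ S -> # (\ w -> U? 𝒬 i w ×? Red? x w) S ≤ a) where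

  B? : ∀ x w -> Dec (Blue x w)
  B? = Χ? blue

  inner : ∀ {i j x} -> x ∈ S -> U 𝒬 i x -> i ≢ j -> Full blue x (U? 𝒬 j) (3 * τ)
  inner {i} {j} {x} x∈ ux i≢j = ≤-trans (full 𝒬 blue blue≢none i≢j (few-outside 𝒬 a i x∈ (sparse 𝒬 x∈ ux)) (redless j x∈))
   (lin (a ∷ τ ∷ []) (v1 :+ v0 :+ v0 <: 3 :* v1) (v0 <: v1 by 2 · a≤τ & □))

  extend : ∀ {x i j ε} {G : V -> Set} (G? : Decidable G) -> i ≢ j -> ∀ {y} -> y ∈ S -> U 𝒬 i y -> x ∈ S ->
   ε + 3 * τ < # (\ w -> U? 𝒬 j w ×? G? w) S -> ε < # (\ w -> U? 𝒬 j w ×? (B? y w ×? G? w)) S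
  extend {j = j} {ε} G? i≢j {y} y∈ uy x∈ h = (lin (ε ∷ τ ∷ (# (\ w -> U? 𝒬 j w ×? G? w) S) ∷ (# (\ w -> U? 𝒬 j w ×? (B? y w ×? G? w)) S) ∷ []) (k 1 :+ v0 <: v3) (k 1 :+ (v0 :+ 3 :* v1) <: v2 by h & v2 <: v3 :+ 3 :* v1 by shrink blue (U? 𝒬 j) G? (inner y∈ uy i≢j) & □))

  -- A vertex with many blue neighbours in each of the three parts would extend a blue triangle
  -- across them to a blue K4.
  some : ∀ {x} -> x ∈ S -> ∃ \ i -> seen 𝒬 x i ≤ 10 * τ
  some {x} x∈ = go (search (\ i -> seen 𝒬 x i ≤? 10 * τ) (allFin 3))
   where
   blues-in : ∀ i -> 10 * τ < seen 𝒬 x i -> 9 * τ < # (\ w -> U? 𝒬 i w ×? B? x w) S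
   blues-in i h = (lin (τ ∷ (seen 𝒬 x i) ∷ (# (\ w -> U? 𝒬 i w ×? Red? x w) S) ∷ a ∷ (# (\ w -> U? 𝒬 i w ×? B? x w) S) ∷ []) (k 1 :+ 9 :* v0 <: v4) (k 1 :+ 10 :* v0 <: v1 by h & v2 <: v3 by redless i x∈ & v3 <: v0 by a≤τ & v1 <: v2 :+ v4 by (#-⊎ (\ w -> Adj? x w ×? U? 𝒬 i w) (\ w -> U? 𝒬 i w ×? Red? x w) (\ w -> U? 𝒬 i w ×? B? x w) S \ _ (e , u) -> [ (\ r -> inj₁ (u , r)) , (\ b -> inj₂ (u , b)) ]′ (colour e)) & □))
   go : Dec (∃ \ i -> i ∈ allFin 3 × seen 𝒬 x i ≤ 10 * τ) -> ∃ \ i -> seen 𝒬 x i ≤ 10 * τ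
   go (yes (i , _ , h)) = i , h
   go (no all-large) = ⊥-elim (first (#-witness _ S (≤-<-trans z≤n (large-in zero))))
    where
    large-in : ∀ i -> 9 * τ < # (\ w -> U? 𝒬 i w ×? B? x w) S
    large-in i = blues-in i (≰⇒> \ h -> all-large (i , ∈-allFin i , h))
    first : (∃ \ y -> y ∈ S × U 𝒬 zero y × Blue x y) -> ⊥
    first (y , y∈ , uy , xy) = second (#-witness _ S (≤-<-trans z≤n (extend {ε = 6 * τ} (B? x) (next1≢ zero) y∈ uy x∈
      (lin (τ ∷ (# (\ w -> U? 𝒬 1F w ×? B? x w) S) ∷ []) (k 1 :+ (6 :* v0 :+ 3 :* v0) <: v1) (k 1 :+ 9 :* v0 <: v1 by large-in 1F & □)))))
     where
     second : (∃ \ z -> z ∈ S × U 𝒬 1F z × Blue y z × Blue x z) -> ⊥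
     second (z , z∈ , uz , yz , xz) = third (#-witness _ S (≤-<-trans z≤n (extend {ε = 3 * τ} (\ w -> B? y w ×? B? x w) (next2≢ 1F) z∈ uz x∈
       (extend {ε = 3 * τ + 3 * τ} (B? x) (next2≢ zero) y∈ uy x∈
       (lin (τ ∷ (# (\ w -> U? 𝒬 2F w ×? B? x w) S) ∷ []) (k 1 :+ (3 :* v0 :+ 3 :* v0 :+ 3 :* v0) <: v1) (k 1 :+ 9 :* v0 <: v1 by large-in 2F & □))))))
      where
      third : (∃ \ t -> t ∈ S × U 𝒬 2F t × Blue z t × Blue y t × Blue x t) -> ⊥
      third (t , t∈ , _ , zt , yt , xt) = no-K4 x∈ y∈ z∈ t∈ xy xz xt yz yt zt

  open Placement 𝒬 (10 * τ) some

  part-full : ∀ {x i j} -> x ∈ S -> part x ≡ i -> i ≢ j -> Full blue x (U? 𝒬 j) (12 * τ)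
  part-full {x} {i} {j} x∈ e i≢j = ≤-trans (full 𝒬 blue blue≢none i≢j (part-outside x∈ e) (redless j x∈))
   (lin (a ∷ τ ∷ []) (v1 :+ 10 :* v1 :+ v0 <: 12 :* v1) (v0 <: v1 by a≤τ & □))

  -- In the two other parts x and y have common blue neighbours, among which there is a blue edge.
  no-blue : ∀ {x y} -> x ∈ S -> y ∈ S -> part x ≡ part y -> ¬ Blue x y
  no-blue {x} {y} x∈ y∈ e xy = first (#-witness _ S (≤-<-trans z≤n (common (next1≢ i))))
   where
   i = part x
   common : ∀ {j} -> i ≢ j -> 70 * τ < # (\ w -> U? 𝒬 j w ×? (B? y w ×? (B? x w ×? yes tt))) S
   common {j} i≢j = (lin (τ ∷ μ ∷ (# (U? 𝒬 j) S) ∷ (# (\ w -> U? 𝒬 j w ×? yes tt) S) ∷ (# (\ w -> U? 𝒬 j w ×? (B? x w ×? yes tt)) S) ∷ (# (\ w -> U? 𝒬 j w ×? (B? y w ×? (B? x w ×? yes tt))) S) ∷ []) (k 1 :+ 70 :* v0 <: v5) (k 1 :+ 100 :* v0 <: v1 by big & v1 <: v2 :+ v0 by large 𝒬 j & v2 <: v3 by (#-mono (U? 𝒬 j) (\ w -> U? 𝒬 j w ×? yes tt) S (\ _ u -> u , tt)) & v3 <: v4 :+ 12 :* v0 by (shrink blue (U? 𝒬 j) (\ _ -> yes tt) (part-full x∈ refl i≢j)) & v4 <: v5 :+ 12 :* v0 by (shrink blue (U? 𝒬 j) (\ w -> B? x w ×? yes tt) (part-full y∈ (sym e) i≢j)) &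 □))
   first : (∃ \ z -> z ∈ S × U 𝒬 (next1 i) z × Blue y z × Blue x z × ⊤) -> ⊥
   first (z , z∈ , uz , yz , xz , _) = second (#-witness _ S (≤-<-trans z≤n (extend {ε = τ} (\ w -> B? y w ×? (B? x w ×? yes tt)) (next1≢next2 i) z∈ uz x∈
     (lin (τ ∷ (# (\ w -> U? 𝒬 (next2 i) w ×? (B? y w ×? (B? x w ×? yes tt))) S) ∷ []) (k 1 :+ (v0 :+ 3 :* v0) <: v1) (k 1 :+ 70 :* v0 <: v1 by common (next2≢ i) & □)))))
    where
    second : (∃ \ t -> t ∈ S × U 𝒬 (next2 i) t × Blue z t × Blue y t × Blue x t × ⊤) -> ⊥
    second (t , t∈ , _ , zt , yt , xt , _) = no-K4 x∈ y∈ z∈ t∈ xy xz xt yz yt zt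

  all-blue-bound : TuránBound 3 (length S * a)
  all-blue-bound = turán-count part (length S * a) (∑-≤-const a S \ {x} x∈ -> independent-bound dense _
   \ y∈ z∈ (exy , xy) (exz , xz) eyz -> red-free (red! x∈ y∈ exy xy) (red! y∈ z∈ eyz (trans (sym xy) xz)) (red! x∈ z∈ exz xz))
   where
   red! : ∀ {x y} -> x ∈ S -> y ∈ S -> Adj x y -> part x ≡ part y -> Red x y
   red! x∈ y∈ a e = [ (\ r -> r) , (\ b -> ⊥-elim (no-blue x∈ y∈ e b)) ]′ (colour a)

flip : Fin 2 -> Fin 2
flip zero = suc zero
flip 1F = zero

lift : Fin 2 -> Fin 3
lift zero = zero
lift 1F = suc zero

module TopPart {V : Set} (𝒢 : ColouredGraph V)
 (red-free : Graphs.RedFree 𝒢)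
 (S : List V) (a : ℕ) (dense : Graphs.Dense 𝒢 (Graphs.Adj 𝒢) S a) (part : V -> Fin 3) where
 open Graphs 𝒢
 open Colours 𝒢 red-free
 open Partitions 𝒢 S

 top : Fin 3
 top = suc 1F

 within : V -> ℕ
 within x = # (\ y -> Adj? x y ×? (part x Fin.≟ part y)) S

 -- At most a rows of F are non-empty and each has at most a entries.
 rows : ∀ {J : V -> Set} {F : V -> V -> Set} (J? : Decidable J) (F? : ∀ x y -> Dec (F x y)) -> # J? S ≤ a ->
  (∀ {x y} -> F x y -> J x) -> (∀ {x} -> x ∈ S -> J x -> # (F? x) S ≤ a) -> ∑ (\ x -> # (F? x) S) S ≤ a * a
 rows J? F? few sub row = ≤-trans (∑-mono S \ {x} x∈ -> bounded-row x∈ (J? x))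
  (≤-trans (≡⇒≤ (trans (∑-cong S \ {x} _ -> *-comm (𝟙 (J? x)) a) (∑-* a _ S))) (*-monoʳ-≤ a few))
  where
  bounded-row : ∀ {x} -> x ∈ S -> (d : Dec _) -> # (F? x) S ≤ 𝟙 d * a
  bounded-row x∈ (yes j) = ≤-trans (row x∈ j) (m≤m+n a 0)
  bounded-row {x} x∈ (no ¬j) = ≡⇒≤ (#-none (F? x) S \ _ f -> ¬j (sub f))

 module Crossing (I : Fin 2 -> V -> Set) (I? : ∀ i -> Decidable (I i)) (I-top : ∀ i {x} -> I i x -> part x ≡ top)
  (I-independent : ∀ i {x y} -> x ∈ S -> y ∈ S -> I i x -> I i y -> ¬ Adj x y)
  (I-exclusive : ∀ {x} -> x ∈ S -> I zero x -> ¬ I 1F x)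
  (blue-crosses : ∀ {x y} -> x ∈ S -> y ∈ S -> part x ≡ top -> part y ≡ top -> Blue x y -> (I zero x × I 1F y) ⊎ (I 1F x × I zero y))
  (side-within : ∀ i {x} -> x ∈ S -> part x ≡ lift i -> within x ≤ a) where

  I-few : ∀ i -> # (I? i) S ≤ a
  I-few i = independent-bound dense (I? i) (I-independent i)

  Plain? : ∀ x -> Dec (part x ≡ top × ¬ I zero x × ¬ I 1F x)
  Plain? x = (part x Fin.≟ top) ×? (¬? (I? zero x) ×? ¬? (I? 1F x))

  plain-to : ∀ i x y -> Dec ((part x ≡ top × ¬ I zero x × ¬ I 1F x) × I i y × Red x y)
  plain-to i x y = Plain? x ×? (I? i y ×? Red? x y)

  across-I : ∀ i x y -> Dec (I i x × I (flip i) y × Blue x y)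
  across-I i x y = I? i x ×? (I? (flip i) y ×? Blue? x y)

  -- A bound for twice `within x - a`. At vertices outside both sets I, each of the first two terms
  -- bounds the surplus by itself, so their sum pays for doubling. The total `(1 + 1 + 2 + 2) a²` is
  -- halved to `3a²`.
  excess : V -> ℕ
  excess x = # (plain-to zero x) S + # (plain-to 1F x) S + 2 * # (across-I zero x) S + 2 * # (across-I 1F x) S

  -- A blue edge among the red neighbours of x in the third part joins the two sets I, and one of
  -- its ends lies in the same independent set as x.
  red-in-top : ∀ i {x} -> x ∈ S -> I i x -> # (\ y -> (part y Fin.≟ top) ×? Red? x y) S ≤ a
  red-in-top i {x} x∈ ix = independent-bound dense _ \ y∈ z∈ (ey , xy) (ez , xz) e ->
   [ (\ r -> red-free xy r xz) , (\ b -> [ (\ (iy , iz) -> meets i y∈ z∈ ix iy iz xy xz) , (\ (iy , iz) -> meets' i y∈ z∈ ix iy iz xy xz) ]′ (blue-crosses y∈ z∈ ey ez b)) ]′ (colour e)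
   where
   meets : ∀ i {y z} -> y ∈ S -> z ∈ S -> I i x -> I zero y -> I 1F z -> Red x y -> Red x z -> ⊥
   meets zero y∈ z∈ ix iy iz xy xz = I-independent zero x∈ y∈ ix iy (red-adj xy)
   meets 1F y∈ z∈ ix iy iz xy xz = I-independent 1F x∈ z∈ ix iz (red-adj xz)
   meets' : ∀ i {y z} -> y ∈ S -> z ∈ S -> I i x -> I 1F y -> I zero z -> Red x y -> Red x z -> ⊥
   meets' i y∈ z∈ ix iy iz xy xz = meets i z∈ y∈ ix iz iy xz xy

  plain-bound : ∀ i -> ∑ (\ x -> # (plain-to i x) S) S ≤ a * a
  plain-bound i = ≤-trans (≡⇒≤ (∑-swap (\ x y -> 𝟙 (plain-to i x y)) S S))
   (rows (I? i) (\ y x -> plain-to i x y) (I-few i) (\ h -> proj₁ (proj₂ h))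
    \ {y} y∈ iy -> ≤-trans (#-mono (\ x -> plain-to i x y) (\ x -> (part x Fin.≟ top) ×? Red? y x) S \ _ (pl , _ , r) -> proj₁ pl , χ-flip r) (red-in-top i y∈ iy))

  across-bound : ∀ i -> ∑ (\ x -> # (across-I i x) S) S ≤ a * a
  across-bound i = rows (I? i) (across-I i) (I-few i) proj₁ \ {x} x∈ _ ->
   ≤-trans (#-mono (across-I i x) (I? (flip i)) S \ _ h -> proj₁ (proj₂ h)) (I-few (flip i))

  excess-total : ∑ excess S ≤ 6 * (a * a)
  excess-total = (lin ((∑ excess S) ∷ (∑ (\ x -> # (plain-to zero x) S) S) ∷ (∑ (\ x -> # (plain-to 1F x) S) S) ∷ (∑ (\ x -> # (across-I zero x) S) S) ∷ (∑ (\ x -> # (across-I 1F x) S) S) ∷ (a * a) ∷ []) (v0 <: 6 :* v5) (v0 <: v1 :+ v2 :+ 2 :* v3 :+ 2 :* v4 by (≡⇒≤ (∑-⟦⟧ ((\ x -> # (plain-to zero x) S) ∷ (\ x -> # (plain-to 1F x) S) ∷ (\ x -> # (across-I zero x) S) ∷ (\ x -> # (across-I 1F x) S) ∷ []) (v0 :+ v1 :+ 2 :* v2 :+ 2 :* v3) S)) & v1 <: v5 by plain-bound zero & v2 <: v5 by plain-bound 1F & v3 <: v5 by 2 · across-bound zero & v4 <: v5 by 2 · across-bound 1F & □))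

  -- Every blue edge of the third part has an end in I i; hence the red neighbours of x outside I i
  -- are independent.
  plain-within : ∀ i {x} -> x ∈ S -> part x ≡ top -> ¬ I zero x -> ¬ I 1F x -> within x ≤ a + # (plain-to i x) S
  plain-within i {x} x∈ ex n0 n1 = ≤-trans
   (#-⊎ (\ y -> Adj? x y ×? (part x Fin.≟ part y)) K? (plain-to i x) S \ {y} y∈ (e , p) -> sort y∈ (red! y∈ (trans (sym p) ex) e) (trans (sym p) ex) (I? i y))
   (+-monoˡ-≤ _ (independent-bound dense K? \ y∈ z∈ (xy , py , ny) (xz , pz , nz) e ->
    [ (\ r -> red-free xy r xz) , (\ b -> excluded i ny nz (blue-crosses y∈ z∈ py pz b)) ]′ (colour e)))
   where
   K? : ∀ y -> Dec (Red x y × part y ≡ top × ¬ I i y)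
   K? y = Red? x y ×? ((part y Fin.≟ top) ×? ¬? (I? i y))
   red! : ∀ {y} -> y ∈ S -> part y ≡ top -> Adj x y -> Red x y
   red! y∈ ey e = [ (\ r -> r) , (\ b -> ⊥-elim ([ (\ h -> n0 (proj₁ h)) , (\ h -> n1 (proj₁ h)) ]′ (blue-crosses x∈ y∈ ex ey b))) ]′ (colour e)
   sort : ∀ {y} -> y ∈ S -> Red x y -> part y ≡ top -> Dec (I i y) ->
    (Red x y × part y ≡ top × ¬ I i y) ⊎ ((part x ≡ top × ¬ I zero x × ¬ I 1F x) × I i y × Red x y)
   sort y∈ r ey (yes iy) = inj₂ ((ex , n0 , n1) , iy , r)
   sort y∈ r ey (no ¬iy) = inj₁ (r , ey , ¬iy)
   excluded : ∀ i {y z} -> ¬ I i y -> ¬ I i z -> (I zero y × I 1F z) ⊎ (I 1F y × I zero z) -> ⊥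
   excluded zero ny nz = [ (\ h -> ny (proj₁ h)) , (\ h -> nz (proj₂ h)) ]′
   excluded 1F ny nz = [ (\ h -> nz (proj₂ h)) , (\ h -> ny (proj₁ h)) ]′

  half-within : ∀ i {x} -> x ∈ S -> I i x -> within x ≤ a + # (across-I i x) S
  half-within i {x} x∈ ix = ≤-trans
   (#-⊎ (\ y -> Adj? x y ×? (part x Fin.≟ part y)) (\ y -> (part y Fin.≟ top) ×? Red? x y) (across-I i x) S
    \ {y} y∈ (e , p) -> [ (\ r -> inj₁ (trans (sym p) (I-top _ ix) , r)) , (\ b -> inj₂ (ix , opposite i y∈ ix (trans (sym p) (I-top _ ix)) b , b)) ]′ (colour e))
   (+-monoˡ-≤ _ (red-in-top i x∈ ix))
   where
   opposite : ∀ i {y} -> y ∈ S -> I i x -> part y ≡ top -> Blue x y -> I (flip i) y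
   opposite zero y∈ ix ey b = [ proj₂ , (\ h -> ⊥-elim (I-exclusive x∈ ix (proj₁ h))) ]′ (blue-crosses x∈ y∈ (I-top _ ix) ey b)
   opposite 1F y∈ ix ey b = [ (\ h -> ⊥-elim (I-exclusive x∈ (proj₁ h) ix)) , proj₂ ]′ (blue-crosses x∈ y∈ (I-top _ ix) ey b)

  vertex : ∀ {x} -> x ∈ S -> 2 * within x ≤ 2 * a + excess x
  vertex {x} x∈ = go (part x) refl (I? zero x) (I? 1F x)
   where
   A0 = # (plain-to zero x) S
   A1 = # (plain-to 1F x) S
   B0 = # (across-I zero x) S
   B1 = # (across-I 1F x) S
   go : ∀ i -> part x ≡ i -> Dec (I zero x) -> Dec (I 1F x) -> 2 * within x ≤ 2 * a + excess x
   go zero e _ _ = (lin ((within x) ∷ a ∷ A0 ∷ A1 ∷ B0 ∷ B1 ∷ []) (2 :* v0 <: 2 :* v1 :+ (v2 :+ v3 :+ 2 :* v4 :+ 2 :* v5)) (v0 <: v1 by 2 · side-within zero x∈ e & □))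
   go 1F e _ _ = (lin ((within x) ∷ a ∷ A0 ∷ A1 ∷ B0 ∷ B1 ∷ []) (2 :* v0 <: 2 :* v1 :+ (v2 :+ v3 :+ 2 :* v4 :+ 2 :* v5)) (v0 <: v1 by 2 · side-within 1F x∈ e & □))
   go 2F e (yes i0) _ = (lin ((within x) ∷ a ∷ B0 ∷ A0 ∷ A1 ∷ B1 ∷ []) (2 :* v0 <: 2 :* v1 :+ (v3 :+ v4 :+ 2 :* v2 :+ 2 :* v5)) (v0 <: v1 :+ v2 by 2 · half-within zero x∈ i0 & □))
   go 2F e (no _) (yes i1) = (lin ((within x) ∷ a ∷ B1 ∷ A0 ∷ A1 ∷ B0 ∷ []) (2 :* v0 <: 2 :* v1 :+ (v3 :+ v4 :+ 2 :* v5 :+ 2 :* v2)) (v0 <: v1 :+ v2 by 2 · half-within 1F x∈ i1 & □))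
   go 2F e (no n0) (no n1) = (lin ((within x) ∷ a ∷ A0 ∷ A1 ∷ B0 ∷ B1 ∷ []) (2 :* v0 <: 2 :* v1 :+ (v2 :+ v3 :+ 2 :* v4 :+ 2 :* v5)) (v0 <: v1 :+ v2 by plain-within zero x∈ e n0 n1 & v0 <: v1 :+ v3 by plain-within 1F x∈ e n0 n1 & □))

  red-bound : TuránBound 3 (length S * a + 3 * (a * a))
  red-bound = turán-count part (length S * a + 3 * (a * a)) (*-cancelˡ-≤ 2 (
   (lin ((∑ within S) ∷ (length S * a) ∷ (∑ excess S) ∷ (a * a) ∷ []) (2 :* v0 <: 2 :* (v1 :+ 3 :* v3)) (2 :* v0 <: 2 :* v1 :+ v2 by (subst₂ _≤_ (∑-* 2 within S) (trans (∑-+ (\ _ -> 2 * a) excess S) (cong (_+ ∑ excess S) (trans (∑-const (2 * a) S) (double (length S) a)))) (∑-mono S \ x∈ -> vertex x∈)) & v2 <: 6 :* v3 by excess-total & □))))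
   where
   double : ∀ n a -> n * (2 * a) ≡ 2 * (n * a)
   double = solve-∀

module ThirdPart {V : Set} (𝒢 : ColouredGraph V)
 (red-free : Graphs.RedFree 𝒢)
 (S : List V) (a μ : ℕ) (dense : Graphs.Dense 𝒢 (Graphs.Adj 𝒢) S a) (low : Graphs.Low 𝒢 S μ)
 (bounded : RedDegrees.BlueBounded 𝒢 red-free S 3)
 (τ : ℕ) (𝒫 : Structure.Parts 𝒢 S a μ dense low 2 τ) (a≤τ : a ≤ τ) (big : 1000 * τ < μ) (upper : 3 * μ ≤ length S + τ) where
 open Graphs 𝒢
 open Colours 𝒢 red-free
 open Partitions 𝒢 S
 open ThreeParts 𝒢 red-free S a μ dense low bounded

 P : Fin 2 -> V -> Set
 P = U 𝒫

 P? : ∀ i w -> Dec (P i w)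
 P? = U? 𝒫

 q : Fin 2 -> ℕ
 q i = # (P? i) S

 q-lower : ∀ i -> μ ≤ q i + τ
 q-lower = large 𝒫

 q-upper : ∀ i -> q i ≤ μ + a
 q-upper i = at (#-witness (P? i) S (lin (τ ∷ μ ∷ (q i) ∷ []) (k 1 :+ k 0 <: v2) (k 1 :+ 1000 :* v0 <: v1 by big & v1 <: v2 :+ v0 by q-lower i & □)))
  where
  at : (∃ \ x -> x ∈ S × P i x) -> q i ≤ μ + a
  at (x , x∈ , px) = ≤-trans (#-⊎ (P? i) (Non? x) (\ w -> Adj? x w ×? P? i w) S \ {w} _ p -> sort p (Non? x w))
    (+-mono-≤ (low x∈) (sparse 𝒫 x∈ px))
   where
   sort : ∀ {w} -> P i w -> Dec (Non x w) -> Non x w ⊎ (Adj x w × P i w)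
   sort p (yes n) = inj₁ n
   sort p (no e) = inj₂ (e , p)

 far bl rd : Fin 2 -> V -> ℕ
 far i w = # (\ x -> P? i x ×? Non? w x) S
 bl i w = # (\ x -> P? i x ×? Blue? w x) S
 rd i w = # (\ x -> P? i x ×? Red? w x) S

 q-split : ∀ i w -> q i ≤ far i w + rd i w + bl i w
 q-split i w = ∑-linear ((\ x -> 𝟙 (P? i x)) ∷ (\ x -> 𝟙 (P? i x ×? Non? w x)) ∷ (\ x -> 𝟙 (P? i x ×? Red? w x)) ∷ (\ x -> 𝟙 (P? i x ×? Blue? w x)) ∷ [])
  (v0 <: v1 :+ v2 :+ v3) S (\ {x} _ -> pointwise (P? i x) (χ w x))
  where
  pointwise : ∀ {P : Set} (d : Dec P) c -> 𝟙 d ≤ 𝟙 (d ×? (c ≟ᶜ none)) + 𝟙 (d ×? (c ≟ᶜ red)) + 𝟙 (d ×? (c ≟ᶜ blue))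
  pointwise (no _) c = z≤n
  pointwise (yes _) none = ≤-refl
  pointwise (yes _) red = ≤-refl
  pointwise (yes _) blue = ≤-refl

 Rest : V -> Set
 Rest w = ¬ P zero w × ¬ P 1F w

 Rest? : ∀ w -> Dec (Rest w)
 Rest? w = ¬? (P? zero w) ×? ¬? (P? 1F w)

 -- A tenth is small enough for later overlaps: the blue shares 8/10 and 8/10, or 8/10 and 4/10, of
 -- one part always intersect.
 Far? : ∀ i w -> Dec (Rest w × q i < 10 * far i w)
 Far? i w = Rest? w ×? (q i <? 10 * far i w)

 rest-outside : ∀ i {w} -> Rest w -> ¬ P i w
 rest-outside zero = proj₁
 rest-outside 1F = proj₂

 -- Double counting of missed pairs: members of part i miss at most 2τ vertices outside it, while
 -- each far vertex misses over a tenth of the part.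
 far-few : ∀ i -> # (Far? i) S ≤ 20 * τ
 far-few i = *-cancelˡ-≤ (q i) {{>-nonZero (lin (τ ∷ μ ∷ (q i) ∷ []) (k 1 :+ k 0 <: v2) (k 1 :+ 1000 :* v0 <: v1 by big & v1 <: v2 :+ v0 by q-lower i & □))}} (begin
  q i * # (Far? i) S ≡⟨ ∑-* (q i) _ S ⟨
  ∑ (\ w -> q i * 𝟙 (Far? i w)) S ≤⟨ ∑-mono S (\ {w} _ -> weigh (Rest? w) (q i <? 10 * far i w)) ⟩
  ∑ (\ w -> 10 * # (\ x -> F? w x) S) S ≡⟨ ∑-* 10 _ S ⟩
  10 * ∑ (\ w -> # (\ x -> F? w x) S) S ≡⟨ cong (10 *_) (∑-swap (\ w x -> 𝟙 (F? w x)) S S) ⟩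
  10 * ∑ (\ x -> # (\ w -> F? w x) S) S ≤⟨ *-monoʳ-≤ 10 (∑-mono S \ {x} x∈ -> column x∈ (P? i x)) ⟩
  10 * ∑ (\ x -> 2 * τ * 𝟙 (P? i x)) S ≡⟨ cong (10 *_) (∑-* (2 * τ) _ S) ⟩
  10 * (2 * τ * q i) ≡⟨ arrange τ (q i) ⟩
  q i * (20 * τ) ∎)
  where
  F? : ∀ w x -> Dec (Rest w × P i x × Non w x)
  F? w x = Rest? w ×? (P? i x ×? Non? w x)
  weigh : ∀ {w} {Q : Set} (d : Dec Q) (e : Dec (q i < 10 * far i w)) -> q i * 𝟙 (d ×? e) ≤ 10 * # (\ x -> d ×? (P? i x ×? Non? w x)) S
  weigh (no _) e = ≤-trans (≡⇒≤ (*-zeroʳ (q i))) z≤n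
  weigh (yes _) (no _) = ≤-trans (≡⇒≤ (*-zeroʳ (q i))) z≤n
  weigh {w} (yes p) (yes h) = ≤-trans (≡⇒≤ (*-identityʳ (q i))) (≤-trans (<⇒≤ h)
   (*-monoʳ-≤ 10 (#-mono (\ x -> P? i x ×? Non? w x) (\ x -> yes p ×? (P? i x ×? Non? w x)) S \ _ h -> p , h)))
  column : ∀ {x} -> x ∈ S -> (d : Dec (P i x)) -> # (\ w -> Rest? w ×? (d ×? Non? w x)) S ≤ 2 * τ * 𝟙 d
  column {x} x∈ (no ¬p) = ≡⇒≤ (trans (#-none (\ w -> Rest? w ×? (no ¬p ×? Non? w x)) S \ _ h -> ¬p (proj₁ (proj₂ h))) (sym (*-zeroʳ (2 * τ))))
  column {x} x∈ (yes p) = ≤-trans (#-mono (\ w -> Rest? w ×? (yes p ×? Non? w x)) (\ w -> Non? x w ×? ¬? (P? i w)) S \ _ (r , _ , n) -> χ-flip n , rest-outside i r)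
   (≤-trans (few-outside 𝒫 a i x∈ (sparse 𝒫 x∈ p)) ((lin (a ∷ τ ∷ []) (v1 :+ v0 <: 2 :* v1) (v0 <: v1 by a≤τ & □)) ▹))
   where
   infix 10 _▹
   _▹ : τ + a ≤ 2 * τ -> τ + a ≤ 2 * τ * 1
   h ▹ = subst (τ + a ≤_) (sym (*-identityʳ (2 * τ))) h
  arrange : ∀ t q -> 10 * (2 * t * q) ≡ q * (20 * t)
  arrange = solve-∀

 Near : Fin 2 -> V -> Set
 Near i w = ¬ q i < 10 * far i w

 Third : V -> Set
 Third w = Rest w × Near zero w × Near 1F w

 Third? : ∀ w -> Dec (Third w)
 Third? w = Rest? w ×? (¬? (q zero <? 10 * far zero w) ×? ¬? (q 1F <? 10 * far 1F w))

 -- Out of at least `3μ - τ` vertices, the two parts take at most `μ + a` each and the far vertices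
 -- at most 40τ.
 third-size : μ ≤ # Third? S + 43 * τ
 third-size = (lin ((length S) ∷ (q zero) ∷ (q 1F) ∷ (# (Far? zero) S) ∷ (# (Far? 1F) S) ∷ (# Third? S) ∷ μ ∷ a ∷ τ ∷ []) (v6 <: v5 :+ 43 :* v8) (1 :* v0 <: v1 :+ v2 :+ v3 :+ v4 :+ v5 by (∑-linear ((\ w -> 𝟙 (P? zero w)) ∷ (\ w -> 𝟙 (P? 1F w)) ∷ (\ w -> 𝟙 (Far? zero w)) ∷ (\ w -> 𝟙 (Far? 1F w)) ∷ (\ w -> 𝟙 (Third? w)) ∷ []) (k 1 <: v0 :+ v1 :+ v2 :+ v3 :+ v4) S (\ {w} _ -> pointwise (P? zero w) (P? 1F w) (q zero <? 10 * far zero w) (q 1F <? 10 * far 1F w))) & v1 <: v6 :+ v7 by q-upper zero & v2 <: v6 :+ v7 by q-upper 1F & v3 <: 20 :* v8 by far-few zero & v4 <: 20 :* v8 by far-few 1F & 3 :* v6 <: v0 :+ v8 by upper & v7 <: v8 by 2 · a≤τ & □))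
  where
  pointwise : ∀ {P Q F G : Set} (p : Dec P) (q : Dec Q) (f : Dec F) (g : Dec G) ->
   1 ≤ 𝟙 p + 𝟙 q + 𝟙 ((¬? p ×? ¬? q) ×? f) + 𝟙 ((¬? p ×? ¬? q) ×? g) + 𝟙 ((¬? p ×? ¬? q) ×? (¬? f ×? ¬? g))
  pointwise (yes _) q f g = s≤s z≤n
  pointwise (no _) (yes _) f g = s≤s z≤n
  pointwise (no _) (no _) (yes _) g = s≤s z≤n
  pointwise (no _) (no _) (no _) (yes _) = s≤s z≤n
  pointwise (no _) (no _) (no _) (no _) = s≤s z≤n

 add-part : ∀ {T : V -> Set} (T? : Decidable T) -> (∀ {w} -> T w -> Rest w) -> μ ≤ # T? S + 50 * τ ->
  (∀ {x} -> x ∈ S -> T x -> # (\ w -> Adj? x w ×? T? w) S ≤ a) -> Parts 3 (50 * τ)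
 add-part {T} T? T⊆ T-large T-sparse = record
  { U = W ; U? = W? ; disjoint = \ {i} {j} -> disj i j
  ; large = \ { zero -> weaken (q-lower zero) ; 1F -> weaken (q-lower 1F) ; 2F -> T-large }
  ; sparse = \ { {zero} -> sparse 𝒫 ; {suc zero} -> sparse 𝒫 ; {suc 1F} -> T-sparse } }
  where
  W : Fin 3 -> V -> Set
  W zero = P zero
  W 1F = P 1F
  W 2F = T
  W? : ∀ i w -> Dec (W i w)
  W? zero = P? zero
  W? 1F = P? 1F
  W? 2F = T?
  weaken : ∀ {n} -> μ ≤ n + τ -> μ ≤ n + 50 * τ
  weaken {n} h = (lin (μ ∷ n ∷ τ ∷ []) (v0 <: v1 :+ 50 :* v2) (v0 <: v1 :+ v2 by h & □))
  disj : ∀ i j {w} -> W i w -> W j w -> i ≡ j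
  disj zero zero _ _ = refl
  disj zero 1F p p' = absurd (disjoint 𝒫 p p') \ ()
  disj zero 2F p t = absurd p (proj₁ (T⊆ t))
  disj 1F zero p p' = absurd (disjoint 𝒫 p p') \ ()
  disj 1F 1F _ _ = refl
  disj 1F 2F p t = absurd p (proj₂ (T⊆ t))
  disj 2F zero t p = absurd p (proj₁ (T⊆ t))
  disj 2F 1F t p = absurd p (proj₂ (T⊆ t))
  disj 2F 2F _ _ = refl

 -- The two parts are joined in blue: the third part has no blue edge either.
 module BlueAcross (redless : ∀ {x} i -> x ∈ S -> rd i x ≤ a) where

  inner : ∀ {i j x} -> x ∈ S -> P i x -> i ≢ j -> Full blue x (P? j) (3 * τ)
  inner {i} {j} {x} x∈ px i≢j = ≤-trans (full 𝒫 blue blue≢none i≢j (few-outside 𝒫 a i x∈ (sparse 𝒫 x∈ px)) (redless j x∈))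
   (lin (a ∷ τ ∷ []) (v1 :+ v0 :+ v0 <: 3 :* v1) (v0 <: v1 by 2 · a≤τ & □))

  bl-lower : ∀ i {w} -> w ∈ S -> Near i w -> 8 * q i ≤ 10 * bl i w
  bl-lower i {w} w∈ n = (lin-κ 8980 ((q i) ∷ (far i w) ∷ (rd i w) ∷ (bl i w) ∷ a ∷ τ ∷ μ ∷ []) (8 :* v0 <: 10 :* v3) (v0 <: v1 :+ v2 :+ v3 by 79920 · q-split i w & 10 :* v1 <: v0 by 7992 · ≮⇒≥ n & v2 <: v4 by 79920 · redless i w∈ & v4 <: v5 by 79920 · a≤τ & k 1 :+ 1000 :* v5 <: v6 by 80 · big & v6 <: v0 :+ v5 by 80 · q-lower i & □))

  common : ∀ i {w w'} -> w ∈ S -> w' ∈ S -> Near i w -> Near i w' -> 6 * q i ≤ 10 * # (\ x -> P? i x ×? (Blue? w x ×? Blue? w' x)) S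
  common i {w} {w'} w∈ w'∈ n n' = (lin ((bl i w) ∷ (bl i w') ∷ (q i) ∷ (# (\ x -> P? i x ×? (Blue? w x ×? Blue? w' x)) S) ∷ []) (6 :* v2 <: 10 :* v3) (v0 :+ v1 <: v2 :+ v3 by 10 · #-overlap (P? i) (Blue? w) (Blue? w') S & 8 :* v2 <: 10 :* v0 by bl-lower i w∈ n & 8 :* v2 <: 10 :* v1 by bl-lower i w'∈ n' & □))

  -- Each of the two vertices sees 8/10 of either part in blue, so they share 6/10 of it. Common
  -- neighbours in the two parts are joined in blue and would complete a blue K4.
  no-blue : ∀ {w w'} -> w ∈ S -> w' ∈ S -> Third w -> Third w' -> ¬ Blue w w'
  no-blue {w} {w'} w∈ w'∈ (_ , n0 , n1) (_ , n0' , n1') ww' = first (#-witness (\ x -> P? zero x ×? (Blue? w x ×? Blue? w' x)) S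
    (lin-κ 9 ((q zero) ∷ (# (\ x -> P? zero x ×? (Blue? w x ×? Blue? w' x)) S) ∷ τ ∷ μ ∷ []) (k 1 :+ k 0 <: v1) (6 :* v0 <: 10 :* v1 by common zero w∈ w'∈ n0 n0' & k 1 :+ 1000 :* v2 <: v3 by 6 · big & v3 <: v0 :+ v2 by 6 · q-lower zero & □)))
   where
   first : (∃ \ y -> y ∈ S × P zero y × Blue w y × Blue w' y) -> ⊥
   first (y , y∈ , py , wy , w'y) = second (#-witness (\ x -> P? 1F x ×? (Χ? blue y x ×? (Blue? w x ×? Blue? w' x))) S
     (lin-κ 9 ((# (\ x -> P? 1F x ×? (Blue? w x ×? Blue? w' x)) S) ∷ (# (\ x -> P? 1F x ×? (Χ? blue y x ×? (Blue? w x ×? Blue? w' x))) S) ∷ τ ∷ (q 1F) ∷ μ ∷ []) (k 1 :+ k 0 <: v1) (v0 <: v1 :+ 3 :* v2 by 10 · (shrink blue (P? 1F) (\ x -> Blue? w x ×? Blue? w' x) (inner {zero} {suc zero} y∈ py \ ())) & 6 :* v3 <: 10 :* v0 by common 1F w∈ w'∈ n1 n1' & k 1 :+ 1000 :* v2 <: v4 by 6 · big & v4 <: v3 :+ v2 by 6 · q-lower 1F & □)))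
    where
    second : (∃ \ z -> z ∈ S × P 1F z × Blue y z × Blue w z × Blue w' z) -> ⊥
    second (z , z∈ , _ , yz , wz , w'z) = no-K4 w∈ w'∈ y∈ z∈ ww' wy wz w'y w'z yz

  T-redless : ∀ {x} -> x ∈ S -> # (\ w -> Third? w ×? Red? x w) S ≤ a
  T-redless x∈ = independent-bound dense _ \ y∈ z∈ (ty , xy) (tz , xz) e -> [ (\ r -> red-free xy r xz) , no-blue y∈ z∈ ty tz ]′ (colour e)

  three : Parts 3 (50 * τ)
  three = add-part Third? proj₁ (lin (μ ∷ (# Third? S) ∷ τ ∷ []) (v0 <: v1 :+ 50 :* v2) (v0 <: v1 :+ 43 :* v2 by third-size & □))
   \ {x} x∈ tx -> ≤-trans (#-mono (\ w -> Adj? x w ×? Third? w) (\ w -> Third? w ×? Red? x w) S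
    \ w∈ (e , tw) -> tw , [ (\ r -> r) , (\ b -> ⊥-elim (no-blue x∈ w∈ tx tw b)) ]′ (colour e)) (T-redless x∈)

  blue-bound : 100 * (50 * τ) < μ -> TuránBound 3 (length S * a)
  blue-bound huge = AllBlue.all-blue-bound three (lin (a ∷ τ ∷ []) (v0 <: 50 :* v1) (v0 <: v1 by a≤τ & □)) huge
   \ { zero -> redless zero ; 1F -> redless 1F ; 2F -> T-redless }

 -- The two parts are joined in red. Then the third part may contain blue edges, but only between the vertices that see most of the first part in red and those
 -- that see most of the second part in red; each of these two sets is independent.
 module RedAcross (across : ∀ {i j x} -> i ≢ j -> x ∈ S -> P i x -> bl j x ≤ a) (huge : 10000 * τ < μ) where

  flip≢ : ∀ i -> i ≢ flip i
  flip≢ zero ()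
  flip≢ 1F ()

  inner : ∀ {i j x} -> x ∈ S -> P i x -> i ≢ j -> Full red x (P? j) (3 * τ)
  inner {i} {j} {x} x∈ px i≢j = ≤-trans (full 𝒫 red red≢none i≢j (few-outside 𝒫 a i x∈ (sparse 𝒫 x∈ px)) (across i≢j x∈ px))
   (lin (a ∷ τ ∷ []) (v1 :+ v0 :+ v0 <: 3 :* v1) (v0 <: v1 by 2 · a≤τ & □))

  q-big : ∀ i -> 9999 * τ < q i
  q-big i = (lin (τ ∷ μ ∷ (q i) ∷ []) (k 1 :+ 9999 :* v0 <: v2) (k 1 :+ 10000 :* v0 <: v1 by huge & v1 <: v2 :+ v0 by q-lower i & □))

  common-red : ∀ i {x y ε} -> ε + ε < q i -> Full red x (P? i) ε -> Full red y (P? i) ε -> ¬ Red x y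
  common-red i {x} {y} {ε} big full-x full-y xy = at (#-witness (\ w -> P? i w ×? (Χ? red y w ×? (Χ? red x w ×? yes tt))) S
    (lin (ε ∷ (q i) ∷ (# (\ w -> P? i w ×? yes tt) S) ∷ (# (\ w -> P? i w ×? (Χ? red x w ×? yes tt)) S) ∷ (# (\ w -> P? i w ×? (Χ? red y w ×? (Χ? red x w ×? yes tt))) S) ∷ []) (k 1 :+ k 0 <: v4) (k 1 :+ (v0 :+ v0) <: v1 by big & v1 <: v2 by (#-mono (P? i) (\ w -> P? i w ×? yes tt) S (\ _ p -> p , tt)) & v2 <: v3 :+ v0 by (shrink red (P? i) (\ _ -> yes tt) full-x) & v3 <: v4 :+ v0 by (shrink red (P? i) (\ w -> Χ? red x w ×? yes tt) full-y) & □)))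
   where
   at : (∃ \ w -> w ∈ S × P i w × Red y w × Red x w × ⊤) -> ⊥
   at (w , _ , _ , yw , xw , _) = red-free xy yw xw

  -- Almost all red edges between the parts are present, so two vertices of one part have a common
  -- red neighbour in the other.
  inside-blue : ∀ {i x y} -> x ∈ S -> y ∈ S -> P i x -> P i y -> Adj x y -> Blue x y
  inside-blue {i} x∈ y∈ px py e = [ (\ r -> ⊥-elim (common-red (flip i) (lin (τ ∷ (q (flip i)) ∷ []) (k 1 :+ (3 :* v0 :+ 3 :* v0) <: v1) (k 1 :+ 9999 :* v0 <: v1 by q-big (flip i) & □))
   (inner x∈ px (flip≢ i)) (inner y∈ py (flip≢ i)) r)) , (\ b -> b) ]′ (colour e)

  -- A red neighbour in part i is red to almost all of the other part, which x can then hardly see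
  -- in red.
  red-one-side : ∀ i {x} -> x ∈ S -> 0 < rd i x -> rd (flip i) x ≤ 3 * τ
  red-one-side i {x} x∈ pos = at (#-witness (\ w -> P? i w ×? Red? x w) S pos)
   where
   at : (∃ \ y -> y ∈ S × P i y × Red x y) -> rd (flip i) x ≤ 3 * τ
   at (y , y∈ , py , xy) = (lin ((rd (flip i) x) ∷ (# (\ w -> P? (flip i) w ×? (Χ? red y w ×? Red? x w)) S) ∷ τ ∷ []) (v0 <: 3 :* v2) (v0 <: v1 :+ 3 :* v2 by shrink red (P? (flip i)) (Red? x) (inner y∈ py (flip≢ i)) & v1 <: k 0 by≡ (#-none (\ w -> P? (flip i) w ×? (Χ? red y w ×? Red? x w)) S \ _ (_ , yw , xw) -> red-free xy yw xw) & □))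

  -- Edges inside a part are blue, so an edge among these common blue neighbours would give a blue
  -- K4.
  blue-pair : ∀ i {x y} -> x ∈ S -> y ∈ S -> Blue x y -> # (\ w -> P? i w ×? (Blue? x w ×? Blue? y w)) S ≤ a
  blue-pair i x∈ y∈ xy = independent-bound dense _ \ w∈ z∈ (pw , xw , yw) (pz , xz , yz) e ->
   no-K4 x∈ y∈ w∈ z∈ xy xw xz yw yz (inside-blue w∈ z∈ pw pz e)

  blue-sum : ∀ i {x y} -> x ∈ S -> y ∈ S -> Blue x y -> bl i x + bl i y ≤ q i + a
  blue-sum i {x} {y} x∈ y∈ xy = ≤-trans (#-overlap (P? i) (Blue? x) (Blue? y) S) (+-monoʳ-≤ (q i) (blue-pair i x∈ y∈ xy))

  Mostly : Fin 2 -> V -> Set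
  Mostly i x = 8 * q i ≤ 10 * bl i x

  mostly-no-blue : ∀ i {x y} -> x ∈ S -> y ∈ S -> Mostly i x -> Mostly i y -> ¬ Blue x y
  mostly-no-blue i {x} {y} x∈ y∈ mx my xy = <⇒≱ {0} {1} (s≤s z≤n) (lin-κ 5 ((q i) ∷ (bl i x) ∷ (bl i y) ∷ a ∷ τ ∷ []) (k 1 <: k 0) (8 :* v0 <: 10 :* v1 by mx & 8 :* v0 <: 10 :* v2 by my & v1 :+ v2 <: v0 :+ v3 by 10 · blue-sum i x∈ y∈ xy & v3 <: v4 by 10 · a≤τ & k 1 :+ 9999 :* v4 <: v0 by 6 · q-big i & □))

  Half : Fin 2 -> V -> Set
  Half i x = q i < 2 * rd i x

  half? : ∀ i x -> Dec (Half i x)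
  half? i x = q i <? 2 * rd i x

  half-pos : ∀ i {x} -> Half i x -> 0 < rd i x
  half-pos i {x} h = (lin-κ 1 ((q i) ∷ (rd i x) ∷ []) (k 1 :+ k 0 <: v1) (k 1 :+ v0 <: 2 :* v1 by h & □))

  mostly-blue : ∀ i {x} -> rd i x ≤ 3 * τ -> Near i x -> Mostly i x
  mostly-blue i {x} r n = (lin-κ 29986 ((q i) ∷ (far i x) ∷ (rd i x) ∷ (bl i x) ∷ τ ∷ []) (8 :* v0 <: 10 :* v3) (v0 <: v1 :+ v2 :+ v3 by 266640 · q-split i x & 10 :* v1 <: v0 by 26664 · ≮⇒≥ n & v2 <: 3 :* v4 by 266640 · r & k 1 :+ 9999 :* v4 <: v0 by 80 · q-big i & □))

  half-mostly : ∀ i {x} -> x ∈ S -> Half i x -> Near (flip i) x -> Mostly (flip i) x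
  half-mostly i x∈ h n = mostly-blue (flip i) (red-one-side i x∈ (half-pos i h)) n

  -- In one of the parts x has almost no red neighbours, and being near to it x sees most of it in
  -- blue.
  mostly-some : ∀ {x} -> x ∈ S -> Near zero x -> Near 1F x -> Mostly zero x ⊎ Mostly 1F x
  mostly-some {x} x∈ n0 n1 = go (0 <? rd zero x)
   where
   go : Dec (0 < rd zero x) -> Mostly zero x ⊎ Mostly 1F x
   go (yes pos) = inj₂ (mostly-blue 1F (red-one-side zero x∈ pos) n1)
   go (no none-red) = inj₁ (mostly-blue zero (≤-trans (≮⇒≥ none-red) z≤n) n0)

  half-red : ∀ i {x y} -> Half i x -> Half i y -> ¬ Red x y
  half-red i {x} {y} hx hy xy = at (#-witness (\ w -> P? i w ×? (Red? x w ×? Red? y w)) S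
    (lin-κ 1 ((rd i x) ∷ (rd i y) ∷ (q i) ∷ (# (\ w -> P? i w ×? (Red? x w ×? Red? y w)) S) ∷ []) (k 1 :+ k 0 <: v3) (v0 :+ v1 <: v2 :+ v3 by 2 · #-overlap (P? i) (Red? x) (Red? y) S & k 1 :+ v2 <: 2 :* v0 by hx & k 1 :+ v2 <: 2 :* v1 by hy & □)))
   where
   at : (∃ \ w -> w ∈ S × P i w × Red x w × Red y w) -> ⊥
   at (w , _ , _ , xw , yw) = red-free xy yw xw

  half-independent : ∀ i {x y} -> x ∈ S -> y ∈ S -> Near (flip i) x -> Near (flip i) y -> Half i x -> Half i y -> ¬ Adj x y
  half-independent i x∈ y∈ nx ny hx hy e = [ half-red i hx hy , mostly-no-blue (flip i) x∈ y∈ (half-mostly i x∈ hx nx) (half-mostly i y∈ hy ny) ]′ (colour e)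

  -- The third part without the two sets that are red to more than half of a part. At most 2a
  -- vertices are removed, as both sets are independent, and no blue edge survives.
  Inside : V -> Set
  Inside w = Third w × ¬ Half zero w × ¬ Half 1F w

  Inside? : ∀ w -> Dec (Inside w)
  Inside? w = Third? w ×? (¬? (half? zero w) ×? ¬? (half? 1F w))

  inside-size : μ ≤ # Inside? S + 50 * τ
  inside-size = (lin (μ ∷ (# Third? S) ∷ τ ∷ a ∷ (# T0? S) ∷ (# T1? S) ∷ (# Inside? S) ∷ []) (v0 <: v6 :+ 50 :* v2) (v0 <: v1 :+ 43 :* v2 by third-size & v3 <: v2 by 2 · a≤τ & v1 <: v4 :+ v5 :+ v6 by (∑-linear ((\ w -> 𝟙 (Third? w)) ∷ (\ w -> 𝟙 (T0? w)) ∷ (\ w -> 𝟙 (T1? w)) ∷ (\ w -> 𝟙 (Inside? w)) ∷ []) (v0 <: v1 :+ v2 :+ v3) S (\ {w} _ -> pointwise (Third? w) (half? zero w) (half? 1F w))) & v4 <: v3 by (independent-bound dense T0? \ x∈ y∈ ((_ , _ , nx) , hx) ((_ , _ , ny) , hy) -> half-independent zero x∈ y∈ nx ny hx hy) & v5 <: v3 by (independent-bound dense T1? \ x∈ y∈ ((_ , nx , _) , hx) ((_ , ny , _) , hy) -> half-independent 1F x∈ y∈ nx ny hx hy) & □))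
   where
   T0? : ∀ w -> Dec (Third w × Half zero w)
   T0? w = Third? w ×? half? zero w
   T1? : ∀ w -> Dec (Third w × Half 1F w)
   T1? w = Third? w ×? half? 1F w
   pointwise : ∀ {T F G : Set} (t : Dec T) (f : Dec F) (g : Dec G) -> 𝟙 t ≤ 𝟙 (t ×? f) + 𝟙 (t ×? g) + 𝟙 (t ×? (¬? f ×? ¬? g))
   pointwise (no _) f g = z≤n
   pointwise (yes _) (yes _) g = s≤s z≤n
   pointwise (yes _) (no _) (yes _) = s≤s z≤n
   pointwise (yes _) (no _) (no _) = s≤s z≤n

  inside-bl : ∀ i {x} -> Near i x -> ¬ Half i x -> 4 * q i ≤ 10 * bl i x
  inside-bl i {x} n h = (lin ((q i) ∷ (far i x) ∷ (rd i x) ∷ (bl i x) ∷ []) (4 :* v0 <: 10 :* v3) (v0 <: v1 :+ v2 :+ v3 by 10 · q-split i x & 10 :* v1 <: v0 by ≮⇒≥ n & 2 :* v2 <: v0 by 5 · ≮⇒≥ h & □))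

  mixed-no-blue : ∀ i {x y} -> x ∈ S -> y ∈ S -> Mostly i x -> 4 * q i ≤ 10 * bl i y -> ¬ Blue x y
  mixed-no-blue i {x} {y} x∈ y∈ mx my xy = <⇒≱ {0} {1} (s≤s z≤n) (lin-κ 1 ((q i) ∷ (bl i x) ∷ (bl i y) ∷ a ∷ τ ∷ []) (k 1 <: k 0) (8 :* v0 <: 10 :* v1 by mx & 4 :* v0 <: 10 :* v2 by my & v1 :+ v2 <: v0 :+ v3 by 10 · blue-sum i x∈ y∈ xy & v3 <: v4 by 10 · a≤τ & k 1 :+ 9999 :* v4 <: v0 by 2 · q-big i & □))

  inside-no-blue : ∀ {x y} -> x ∈ S -> y ∈ S -> Inside x -> Inside y -> ¬ Blue x y
  inside-no-blue {x} {y} x∈ y∈ ((_ , nx0 , nx1) , hx0 , hx1) ((_ , ny0 , ny1) , hy0 , hy1) =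
   [ (\ m -> mixed-no-blue zero x∈ y∈ m (inside-bl zero ny0 hy0)) , (\ m -> mixed-no-blue 1F x∈ y∈ m (inside-bl 1F ny1 hy1)) ]′ (mostly-some x∈ nx0 nx1)

  inside-redless : ∀ {x} -> x ∈ S -> # (\ w -> Inside? w ×? Red? x w) S ≤ a
  inside-redless x∈ = independent-bound dense _ \ y∈ z∈ (iy , xy) (iz , xz) e -> [ (\ r -> red-free xy r xz) , inside-no-blue y∈ z∈ iy iz ]′ (colour e)

  𝒬 : Parts 3 (50 * τ)
  𝒬 = add-part Inside? (\ w -> proj₁ (proj₁ w)) inside-size
   \ {x} x∈ ix -> ≤-trans (#-mono (\ w -> Adj? x w ×? Inside? w) (\ w -> Inside? w ×? Red? x w) S
    \ w∈ (e , iw) -> iw , [ (\ r -> r) , (\ b -> ⊥-elim (inside-no-blue x∈ w∈ ix iw b)) ]′ (colour e)) (inside-redless x∈)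

  blI : V -> ℕ
  blI x = # (\ w -> Inside? w ×? Blue? x w) S

  to-inside : ∀ i {x} -> x ∈ S -> P i x -> Full blue x Inside? (3 * τ)
  to-inside zero {x} x∈ px = ≤-trans (full 𝒬 blue blue≢none {zero} {suc 1F} (\ ()) (few-outside 𝒫 a zero x∈ (sparse 𝒫 x∈ px)) (inside-redless x∈))
   (lin (a ∷ τ ∷ []) (v1 :+ v0 :+ v0 <: 3 :* v1) (v0 <: v1 by 2 · a≤τ & □))
  to-inside 1F {x} x∈ px = ≤-trans (full 𝒬 blue blue≢none {suc zero} {suc 1F} (\ ()) (few-outside 𝒫 a 1F x∈ (sparse 𝒫 x∈ px)) (inside-redless x∈))
   (lin (a ∷ τ ∷ []) (v1 :+ v0 :+ v0 <: 3 :* v1) (v0 <: v1 by 2 · a≤τ & □))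

  -- An edge yz among the blue neighbours of x in part i is blue, and y and z are blue to almost all
  -- of `Inside`; a blue neighbour of x there completes a blue K4.
  blue-inside : ∀ i {x} -> x ∈ S -> 6 * τ < blI x -> bl i x ≤ a
  blue-inside i {x} x∈ many = independent-bound dense _ \ {y} {z} y∈ z∈ (py , xy) (pz , xz) e -> at y∈ z∈ xy xz (inside-blue y∈ z∈ py pz e)
   (#-witness (\ w -> Inside? w ×? (Χ? blue z w ×? (Χ? blue y w ×? Blue? x w))) S
   (lin (τ ∷ (blI x) ∷ (# (\ w -> Inside? w ×? (Χ? blue y w ×? Blue? x w)) S) ∷ (# (\ w -> Inside? w ×? (Χ? blue z w ×? (Χ? blue y w ×? Blue? x w))) S) ∷ []) (k 1 :+ k 0 <: v3) (k 1 :+ 6 :* v0 <: v1 by many & v1 <: v2 :+ 3 :* v0 by shrink blue Inside? (Blue? x) (to-inside i y∈ py) & v2 <: v3 :+ 3 :* v0 by (shrink blue Inside? (\ w -> Χ? blue y w ×? Blue? x w) (to-inside i z∈ pz)) & □)))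
   where
   at : ∀ {y z} -> y ∈ S -> z ∈ S -> Blue x y -> Blue x z -> Blue y z -> (∃ \ w -> w ∈ S × Inside w × Blue z w × Blue y w × Blue x w) -> ⊥
   at y∈ z∈ xy xz yz (w , w∈ , _ , zw , yw , xw) = no-K4 x∈ y∈ z∈ w∈ xy xz xw yz yw zw

  seen-P : ∀ i x -> # (\ w -> Adj? x w ×? P? i w) S ≤ rd i x + bl i x
  seen-P i x = #-⊎ (\ w -> Adj? x w ×? P? i w) (\ w -> P? i w ×? Red? x w) (\ w -> P? i w ×? Blue? x w) S
   \ _ (e , p) -> [ (\ r -> inj₁ (p , r)) , (\ b -> inj₂ (p , b)) ]′ (colour e)

  seen-inside : ∀ x -> x ∈ S -> seen 𝒬 x 2F ≤ a + blI x
  seen-inside x x∈ = ≤-trans (#-⊎ (\ w -> Adj? x w ×? Inside? w) (\ w -> Inside? w ×? Red? x w) (\ w -> Inside? w ×? Blue? x w) S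
   \ _ (e , p) -> [ (\ r -> inj₁ (p , r)) , (\ b -> inj₂ (p , b)) ]′ (colour e)) (+-monoˡ-≤ (blI x) (inside-redless x∈))

  -- A vertex that sees much of `Inside` sees most of that in blue, so it has few blue neighbours in
  -- the two parts; and in one of them it has few red ones.
  some : ∀ {x} -> x ∈ S -> ∃ \ i -> seen 𝒬 x i ≤ 20 * τ
  some {x} x∈ = go (seen 𝒬 x 2F ≤? 20 * τ) (0 <? rd zero x)
   where
   go : Dec (seen 𝒬 x 2F ≤ 20 * τ) -> Dec (0 < rd zero x) -> ∃ \ i -> seen 𝒬 x i ≤ 20 * τ
   go (yes h) _ = suc 1F , h
   go (no h) d = small d
    where
    many : 6 * τ < blI x
    many = (lin (τ ∷ (seen 𝒬 x 2F) ∷ a ∷ (blI x) ∷ []) (k 1 :+ 6 :* v0 <: v3) (k 1 :+ 20 :* v0 <: v1 by ≰⇒> h & v1 <: v2 :+ v3 by seen-inside x x∈ & v2 <: v0 by a≤τ & □))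
    small : Dec (0 < rd zero x) -> ∃ \ i -> seen 𝒬 x i ≤ 20 * τ
    small (no none-red) = zero , (lin ((seen 𝒬 x zero) ∷ (rd zero x) ∷ (bl zero x) ∷ a ∷ τ ∷ []) (v0 <: 20 :* v4) (v0 <: v1 :+ v2 by seen-P zero x & v1 <: k 0 by ≮⇒≥ none-red & v2 <: v3 by blue-inside zero x∈ many & v3 <: v4 by a≤τ & □))
    small (yes pos) = suc zero , (lin ((seen 𝒬 x 1F) ∷ (rd 1F x) ∷ (bl 1F x) ∷ τ ∷ a ∷ []) (v0 <: 20 :* v3) (v0 <: v1 :+ v2 by seen-P 1F x & v1 <: 3 :* v3 by red-one-side zero x∈ pos & v2 <: v4 by blue-inside 1F x∈ many & v4 <: v3 by a≤τ & □))

  open Placement 𝒬 (20 * τ) some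

  outside-inside : ∀ i {x} -> x ∈ S -> part x ≡ lift i -> Full blue x Inside? (80 * τ)
  outside-inside i {x} x∈ e = ≤-trans (full 𝒬 blue blue≢none {lift i} {suc 1F} (lift≢ i) (part-outside x∈ e) (inside-redless x∈))
   (lin (a ∷ τ ∷ []) (50 :* v1 :+ 20 :* v1 :+ v0 <: 80 :* v1) (v0 <: v1 by a≤τ & □))
   where
   lift≢ : ∀ i -> lift i ≢ suc 1F
   lift≢ zero ()
   lift≢ 1F ()

  inside-large : ∀ {x ε} -> Full blue x Inside? ε -> μ ≤ blI x + (50 * τ + ε)
  inside-large {x} {ε} f = (lin (μ ∷ (# Inside? S) ∷ τ ∷ (blI x) ∷ (# (\ w -> Inside? w ×? ¬? (Χ? blue x w)) S) ∷ ε ∷ []) (v0 <: v3 :+ (50 :* v2 :+ v5)) (v0 <: v1 :+ 50 :* v2 by inside-size & v1 <: v3 :+ v4 by≡ #-partition Inside? (Χ? blue x) S & v4 <: v5 by f & □))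

  outside-red : ∀ i {x} -> x ∈ S -> part x ≡ lift i -> Full red x (P? (flip i)) (80 * τ)
  outside-red i {x} x∈ e = ≤-trans (cross i e) (lin (a ∷ τ ∷ []) (50 :* v1 :+ 20 :* v1 :+ v0 <: 80 :* v1) (v0 <: v1 by a≤τ & □))
   where
   few : ∀ j -> bl j x ≤ a
   few j = blue-inside j x∈ (lin (μ ∷ (blI x) ∷ τ ∷ []) (k 1 :+ 6 :* v2 <: v1) (v0 <: v1 :+ (50 :* v2 :+ 80 :* v2) by inside-large (outside-inside i x∈ e) & k 1 :+ 10000 :* v2 <: v0 by huge & □))
   cross : ∀ i -> part x ≡ lift i -> Full red x (P? (flip i)) (50 * τ + 20 * τ + a)
   cross zero e = full 𝒬 red red≢none {zero} {suc zero} (\ ()) (part-outside x∈ e) (few 1F)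
   cross 1F e = full 𝒬 red red≢none {suc zero} {zero} (\ ()) (part-outside x∈ e) (few zero)

  side-no-red : ∀ i {x y} -> x ∈ S -> y ∈ S -> part x ≡ lift i -> part y ≡ lift i -> ¬ Red x y
  side-no-red i x∈ y∈ ex ey = common-red (flip i) (lin (τ ∷ (q (flip i)) ∷ []) (k 1 :+ (80 :* v0 :+ 80 :* v0) <: v1) (k 1 :+ 9999 :* v0 <: v1 by q-big (flip i) & □))
   (outside-red i x∈ ex) (outside-red i y∈ ey)

  -- The triangle is blue, and its three vertices are blue to almost all of `Inside`.
  side-no-triangle : ∀ i {x y z} -> x ∈ S -> y ∈ S -> z ∈ S -> part x ≡ lift i -> part y ≡ lift i -> part z ≡ lift i -> Adj x y -> Adj x z -> Adj y z -> ⊥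
  side-no-triangle i {x} {y} {z} x∈ y∈ z∈ ex ey ez xy xz yz = at (#-witness (\ w -> Inside? w ×? (Χ? blue z w ×? (Χ? blue y w ×? Blue? x w))) S
    (lin (μ ∷ (blI x) ∷ τ ∷ (# (\ w -> Inside? w ×? (Χ? blue y w ×? Blue? x w)) S) ∷ (# (\ w -> Inside? w ×? (Χ? blue z w ×? (Χ? blue y w ×? Blue? x w))) S) ∷ []) (k 1 :+ k 0 <: v4) (v0 <: v1 :+ (50 :* v2 :+ 80 :* v2) by inside-large (outside-inside i x∈ ex) & k 1 :+ 10000 :* v2 <: v0 by huge & v1 <: v3 :+ 80 :* v2 by shrink blue Inside? (Blue? x) (outside-inside i y∈ ey) & v3 <: v4 :+ 80 :* v2 by (shrink blue Inside? (\ w -> Χ? blue y w ×? Blue? x w) (outside-inside i z∈ ez)) & □)))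
   where
   blue! : ∀ {x y} -> x ∈ S -> y ∈ S -> part x ≡ lift i -> part y ≡ lift i -> Adj x y -> Blue x y
   blue! x∈ y∈ ex ey e = [ (\ r -> ⊥-elim (side-no-red i x∈ y∈ ex ey r)) , (\ b -> b) ]′ (colour e)
   at : (∃ \ w -> w ∈ S × Inside w × Blue z w × Blue y w × Blue x w) -> ⊥
   at (w , w∈ , _ , zw , yw , xw) = no-K4 x∈ y∈ z∈ w∈ (blue! x∈ y∈ ex ey xy) (blue! x∈ z∈ ex ez xz) xw (blue! y∈ z∈ ey ez yz) yw zw

  open TopPart 𝒢 red-free S a dense part

  side-within : ∀ i {x} -> x ∈ S -> part x ≡ lift i -> within x ≤ a
  side-within i x∈ e = independent-bound dense _ \ y∈ z∈ (xy , py) (xz , pz) yz ->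
   side-no-triangle i x∈ y∈ z∈ e (trans (sym py) e) (trans (sym pz) e) xy xz yz

  top-near : ∀ i {x} -> x ∈ S -> part x ≡ top -> Near i x
  top-near i {x} x∈ e = ≤⇒≯ (lin-κ 9998 ((far i x) ∷ τ ∷ (q i) ∷ []) (10 :* v0 <: v2) (v0 <: 50 :* v1 :+ 20 :* v1 by 99990 · (≤-trans (#-mono (\ w -> P? i w ×? Non? x w) (\ w -> Non? x w ×? ¬? (U? 𝒬 top w)) S \ _ (p , n) -> n , \ w -> rest-outside i (proj₁ (proj₁ w)) p) (part-outside x∈ e)) & k 1 :+ 9999 :* v1 <: v2 by 700 · q-big i & □))

  top-far : ∀ i {x} -> x ∈ S -> part x ≡ top -> far i x ≤ 70 * τ
  top-far i {x} x∈ e = ≤-trans (#-mono (\ w -> P? i w ×? Non? x w) (\ w -> Non? x w ×? ¬? (U? 𝒬 top w)) S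
   \ _ (p , n) -> n , \ w -> rest-outside i (proj₁ (proj₁ w)) p) (≤-trans (part-outside x∈ e) (≡⇒≤ (sym (*-distribʳ-+ τ 50 20))))

  I : Fin 2 -> V -> Set
  I i x = part x ≡ top × Half i x

  I? : ∀ i x -> Dec (I i x)
  I? i x = (part x Fin.≟ top) ×? half? i x

  I-independent : ∀ i {x y} -> x ∈ S -> y ∈ S -> I i x -> I i y -> ¬ Adj x y
  I-independent i x∈ y∈ (ex , hx) (ey , hy) = half-independent i x∈ y∈ (top-near (flip i) x∈ ex) (top-near (flip i) y∈ ey) hx hy

  I-exclusive : ∀ {x} -> x ∈ S -> I zero x -> ¬ I 1F x
  I-exclusive {x} x∈ (_ , h0) (_ , h1) = <⇒≱ {0} {1} (s≤s z≤n) (lin-κ 3334 ((rd 1F x) ∷ τ ∷ (q 1F) ∷ []) (k 1 <: k 0) (v0 <: 3 :* v1 by 6666 · red-one-side zero x∈ (half-pos zero h0) & k 1 :+ v2 <: 2 :* v0 by 3333 · h1 & k 1 :+ 9999 :* v1 <: v2 by 2 · q-big 1F & □))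

  -- By `blue-sum`, y leaves at most about a fifth of part i for the blue neighbours of x, and x
  -- misses at most 70τ of the part; the remaining four fifths are nearly all red.
  opposite-half : ∀ i {x y} -> x ∈ S -> y ∈ S -> part x ≡ top -> Mostly i y -> Blue x y -> Half i x
  opposite-half i {x} {y} x∈ y∈ e m xy = (lin-κ 349 ((q i) ∷ (far i x) ∷ (rd i x) ∷ (bl i x) ∷ τ ∷ (bl i y) ∷ a ∷ []) (k 1 :+ v0 <: 2 :* v2) (v0 <: v1 :+ v2 :+ v3 by 700 · q-split i x & v1 <: 70 :* v4 by 29987 · top-far i x∈ e & v3 :+ v5 <: v0 :+ v6 by 700 · blue-sum i x∈ y∈ xy & 8 :* v0 <: 10 :* v5 by 70 · m & v6 <: v4 by 700 · a≤τ & k 1 :+ 9999 :* v4 <: v0 by 210 · q-big i & □))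

  blue-crosses : ∀ {x y} -> x ∈ S -> y ∈ S -> part x ≡ top -> part y ≡ top -> Blue x y -> (I zero x × I 1F y) ⊎ (I 1F x × I zero y)
  blue-crosses {x} {y} x∈ y∈ ex ey xy = go (mostly-some x∈ (top-near zero x∈ ex) (top-near 1F x∈ ex)) (mostly-some y∈ (top-near zero y∈ ey) (top-near 1F y∈ ey))
   where
   go : Mostly zero x ⊎ Mostly 1F x -> Mostly zero y ⊎ Mostly 1F y -> (I zero x × I 1F y) ⊎ (I 1F x × I zero y)
   go (inj₁ mx) (inj₁ my) = ⊥-elim (mostly-no-blue zero x∈ y∈ mx my xy)
   go (inj₂ mx) (inj₂ my) = ⊥-elim (mostly-no-blue 1F x∈ y∈ mx my xy)
   go (inj₁ mx) (inj₂ my) = inj₂ ((ex , opposite-half 1F x∈ y∈ ex my xy) , ey , opposite-half zero y∈ x∈ ey mx (χ-flip xy))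
   go (inj₂ mx) (inj₁ my) = inj₁ ((ex , opposite-half zero x∈ y∈ ex my xy) , ey , opposite-half 1F y∈ x∈ ey mx (χ-flip xy))

  open Crossing I I? (\ _ -> proj₁) I-independent I-exclusive blue-crosses side-within public using (red-bound)

-- The blue neighbourhood H of a vertex contains no blue triangle; this transports a pair of parts of H to S.
module BlueNeighbourhood {V : Set} (𝒢 : ColouredGraph V)
 (red-free : Graphs.RedFree 𝒢)
 (S : List V) (a μ σ : ℕ) (dense : Graphs.Dense 𝒢 (Graphs.Adj 𝒢) S a) (low : Graphs.Low 𝒢 S μ)
 (bounded : RedDegrees.BlueBounded 𝒢 red-free S 3) {o : V} (o∈ : o ∈ S) (rich : 2 * μ ≤ # (Graphs.Blue? 𝒢 o) S + σ)
 (small : 1000 * a ≤ σ) (tiny : 300000 * σ < μ) where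
 open Graphs 𝒢
 open Colours 𝒢 red-free
 open ThreeParts 𝒢 red-free S a μ dense low bounded

 H : List V
 H = filter (Blue? o) S

 H⁻ : ∀ {x} -> x ∈ H -> x ∈ S × Blue o x
 H⁻ = ∈-filter⁻ (Blue? o)

 dense-H : Dense Adj H a
 dense-H = dense-filter (Blue? o) dense

 low-H : ∀ {x} -> x ∈ H -> miss H x ≤ μ
 low-H {x} m = ≤-trans (≡⇒≤ (#-filter (Blue? o) (Non? x) S)) (≤-trans (#-mono _ (Non? x) S \ _ -> proj₂) (low (proj₁ (H⁻ m))))

 blue-free : ∀ {x y z} -> x ∈ S -> y ∈ S -> z ∈ S -> Blue o x -> Blue o y -> Blue o z -> Blue x y -> Blue x z -> Blue y z -> ⊥
 blue-free x∈ y∈ z∈ ox oy oz = no-K4 o∈ x∈ y∈ z∈ ox oy oz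

 parts-H : Structure.Parts 𝒢 H a μ dense-H low-H 2 (4000 * σ)
 parts-H = Core33.parts33 H a μ σ dense-H low-H
  (\ x∈ y∈ z∈ -> blue-free (proj₁ (H⁻ x∈)) (proj₁ (H⁻ y∈)) (proj₁ (H⁻ z∈)) (proj₂ (H⁻ x∈)) (proj₂ (H⁻ y∈)) (proj₂ (H⁻ z∈)))
  (subst (\ n -> 2 * μ ≤ n + σ) (sym (#-length (Blue? o) S)) rich) small tiny

 module Lift {τ : ℕ} (parts-H : Structure.Parts 𝒢 H a μ dense-H low-H 2 τ) where

  two-parts : Parts 2 τ
  two-parts = record
   { U = \ i w -> Blue o w × U parts-H i w
   ; U? = \ i w -> Blue? o w ×? U? parts-H i w
   ; disjoint = \ u u' -> disjoint parts-H (proj₂ u) (proj₂ u')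
   ; large = \ i -> subst (\ n -> μ ≤ n + τ) (#-filter (Blue? o) (U? parts-H i) S) (large parts-H i)
   ; sparse = \ {i} {x} x∈ (b , u) -> ≤-trans (#-mono (\ w -> Adj? x w ×? (Blue? o w ×? U? parts-H i w)) (\ w -> Blue? o w ×? (Adj? x w ×? U? parts-H i w)) S
     \ _ (e , c , u') -> c , e , u')
     (subst (_≤ a) (#-filter (Blue? o) (\ w -> Adj? x w ×? U? parts-H i w) S) (sparse parts-H (∈-filter⁺ (Blue? o) x∈ b) u))
   }
   where open Structure.Parts

  two-parts-blue : ∀ {i x} -> U two-parts i x -> Blue o x
  two-parts-blue = proj₁

module Dichotomy {V : Set} (𝒢 : ColouredGraph V)
 (red-free : Graphs.RedFree 𝒢)
 (S : List V) (a μ : ℕ) (dense : Graphs.Dense 𝒢 (Graphs.Adj 𝒢) S a) (low : Graphs.Low 𝒢 S μ)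
 (bounded : RedDegrees.BlueBounded 𝒢 red-free S 3) (τ : ℕ) (𝒫 : Structure.Parts 𝒢 S a μ dense low 2 τ)
 (no-triangle : ∀ {i j l x y z} -> x ∈ S -> y ∈ S -> z ∈ S -> Structure.Parts.U 𝒫 i x -> Structure.Parts.U 𝒫 j y -> Structure.Parts.U 𝒫 l z ->
  Graphs.Blue 𝒢 x y -> Graphs.Blue 𝒢 x z -> Graphs.Blue 𝒢 y z -> ⊥)
 (a≤τ : a ≤ τ) (huge : 10000 * τ < μ) (upper : 3 * μ ≤ length S + τ) where
 open Graphs 𝒢
 open Colours 𝒢 red-free
 open Partitions 𝒢 S
 open ThreeParts 𝒢 red-free S a μ dense low bounded

 Edge : Colour -> Fin 2 -> Set
 Edge c i = ∃₂ \ x y -> x ∈ S × y ∈ S × U 𝒫 i x × U 𝒫 i y × χ x y ≡ c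

 near : ∀ {i x} -> x ∈ S -> U 𝒫 i x -> # (\ w -> Non? x w ×? ¬? (U? 𝒫 i w)) S ≤ 2 * τ
 near {i} {x} x∈ u = (lin ((# (\ w -> Non? x w ×? ¬? (U? 𝒫 i w)) S) ∷ τ ∷ a ∷ []) (v0 <: 2 :* v1) (v0 <: v1 :+ v2 by few-outside 𝒫 a i x∈ (sparse 𝒫 x∈ u) & v2 <: v1 by a≤τ & □))

 common : ∀ {i j} -> i ≢ j -> ∀ K -> All (\ x -> x ∈ S × U 𝒫 i x) K -> μ ≤ # (\ w -> U? 𝒫 j w ×? Common? 𝒫 K w) S + (τ + length K * (2 * τ))
 common {j = j} i≢j [] [] = (lin (μ ∷ (# (U? 𝒫 j) S) ∷ τ ∷ (# (\ w -> U? 𝒫 j w ×? Common? 𝒫 [] w) S) ∷ []) (v0 <: v3 :+ (v2 :+ k 0)) (v0 <: v1 :+ v2 by large 𝒫 j & v1 <: v3 by (#-mono (U? 𝒫 j) (\ w -> U? 𝒫 j w ×? Common? 𝒫 [] w) S (\ _ u -> u , [])) & □))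
 common {i} {j} i≢j (x ∷ K) ((x∈ , u) ∷ h) = (lin (μ ∷ (# (\ w -> U? 𝒫 j w ×? Common? 𝒫 K w) S) ∷ τ ∷ (length K * (2 * τ)) ∷ (# (\ w -> U? 𝒫 j w ×? (Adj? x w ×? Common? 𝒫 K w)) S) ∷ (# (\ w -> U? 𝒫 j w ×? Common? 𝒫 (x ∷ K) w) S) ∷ []) (v0 <: v5 :+ (v2 :+ (2 :* v2 :+ v3))) (v0 <: v1 :+ (v2 :+ v3) by common i≢j K h & v1 <: v4 :+ 2 :* v2 by loss 𝒫 i (2 * τ) (near x∈ u) i≢j (Common? 𝒫 K) & v4 <: v5 by (#-mono (\ w -> U? 𝒫 j w ×? (Adj? x w ×? Common? 𝒫 K w)) (\ w -> U? 𝒫 j w ×? Common? 𝒫 (x ∷ K) w) S (\ _ (u , e , c) -> u , e ∷ c)) & □))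

 common-twins : ∀ {i j} -> i ≢ j -> ∀ K -> All (\ x -> x ∈ S × U 𝒫 i x) K -> length K ≤ 4 ->
  ∃₂ \ u w -> u ∈ S × w ∈ S × (U 𝒫 j u × All (\ x -> Adj x u) K) × (U 𝒫 j w × All (\ x -> Adj x w) K) × Adj u w × Same K u w
 common-twins {j = j} i≢j K h len = twins dense K (\ w -> U? 𝒫 j w ×? Common? 𝒫 K w)
  (lin (μ ∷ (# (\ w -> U? 𝒫 j w ×? Common? 𝒫 K w) S) ∷ τ ∷ (length K * (2 * τ)) ∷ (3 ^ length K * a) ∷ a ∷ []) (k 1 :+ v4 <: v1) (v0 <: v1 :+ (v2 :+ v3) by common i≢j K h & v3 <: 4 :* (2 :* v2) by *-monoˡ-≤ (2 * τ) len & v4 <: 81 :* v5 by *-monoˡ-≤ a (^-monoʳ-≤ 3 len) & v5 <: v2 by 81 · a≤τ & k 1 :+ 10000 :* v2 <: v0 by huge & □))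

 -- Adjacent twins joined to an edge are joined to it in the other colour, hence have the colour of the edge.
 twin-colour : ∀ {i j x y u w} -> x ∈ S -> y ∈ S -> u ∈ S -> w ∈ S -> U 𝒫 i x -> U 𝒫 i y -> U 𝒫 j u -> U 𝒫 j w ->
  Adj x u -> Adj y u -> χ x u ≡ χ x w -> χ y u ≡ χ y w -> (Blue x y -> Red u w -> ⊥) × (Red x y -> Blue u w -> ⊥)
 twin-colour x∈ y∈ u∈ w∈ ux uy uu uw xu yu sx sy =
  (\ xy r -> [ (\ xr -> red-free xr r (trans (sym sx) xr)) , (\ xb -> [ (\ yr -> red-free yr r (trans (sym sy) yr)) , (\ yb -> no-triangle x∈ y∈ u∈ ux uy uu xy xb yb) ]′ (colour yu)) ]′ (colour xu)) ,
  (\ xy b -> [ (\ xr -> [ (\ yr -> red-free xy yr xr) , (\ yb -> no-triangle y∈ u∈ w∈ uy uu uw yb (trans (sym sy) yb) b) ]′ (colour yu)) , (\ xb -> no-triangle x∈ u∈ w∈ ux uu uw xb (trans (sym sx) xb) b) ]′ (colour xu))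

 -- Twins in the other part, joined to a red and to a blue edge of this part, would have to take
 -- both colours.
 one-colour : ∀ {i j} -> i ≢ j -> Edge red i -> Edge blue i -> ⊥
 one-colour {i} {j} i≢j (x , y , x∈ , y∈ , ux , uy , xy) (z , t , z∈ , t∈ , uz , ut , zt) =
  refute (common-twins {i} {j} i≢j (x ∷ y ∷ z ∷ t ∷ []) ((x∈ , ux) ∷ (y∈ , uy) ∷ (z∈ , uz) ∷ (t∈ , ut) ∷ []) ≤-refl)
  where
  refute : (∃₂ \ u w -> u ∈ S × w ∈ S × (U 𝒫 j u × All (\ p -> Adj p u) (x ∷ y ∷ z ∷ t ∷ [])) × (U 𝒫 j w × All (\ p -> Adj p w) (x ∷ y ∷ z ∷ t ∷ [])) × Adj u w × Same (x ∷ y ∷ z ∷ t ∷ []) u w) -> ⊥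
  refute (u , w , u∈ , w∈ , (uu , xu ∷ yu ∷ zu ∷ tu ∷ []) , (uw , _) , e , sx ∷ sy ∷ sz ∷ st ∷ []) =
   [ proj₁ (twin-colour z∈ t∈ u∈ w∈ uz ut uu uw zu tu sz st) zt , proj₂ (twin-colour x∈ y∈ u∈ w∈ ux uy uu uw xu yu sx sy) xy ]′ (colour e)

 transfer : ∀ c -> c ≢ none -> ∀ {i j} -> i ≢ j -> Edge c i -> Edge c j
 transfer c c≢ {i} {j} i≢j (x , y , x∈ , y∈ , ux , uy , xy) = go (common-twins {i} {j} i≢j (x ∷ y ∷ []) ((x∈ , ux) ∷ (y∈ , uy) ∷ []) (s≤s (s≤s z≤n)))
  where
  go : (∃₂ \ u w -> u ∈ S × w ∈ S × (U 𝒫 j u × All (\ p -> Adj p u) (x ∷ y ∷ [])) × (U 𝒫 j w × All (\ p -> Adj p w) (x ∷ y ∷ [])) × Adj u w × Same (x ∷ y ∷ []) u w) -> Edge c j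
  go (u , w , u∈ , w∈ , (uu , xu ∷ yu ∷ []) , (uw , _) , e , sx ∷ sy ∷ []) = u , w , u∈ , w∈ , uu , uw , same-colour c c≢ xy (colour e)
   where
   tc = twin-colour x∈ y∈ u∈ w∈ ux uy uu uw xu yu sx sy
   same-colour : ∀ c -> c ≢ none -> χ x y ≡ c -> Red u w ⊎ Blue u w -> χ u w ≡ c
   same-colour none c≢ _ _ = absurd refl c≢
   same-colour red _ _ (inj₁ r) = r
   same-colour red _ xy (inj₂ b) = ⊥-elim (proj₂ tc xy b)
   same-colour blue _ xy (inj₁ r) = ⊥-elim (proj₁ tc xy r)
   same-colour blue _ _ (inj₂ b) = b

 some-edge : Edge red zero ⊎ Edge blue zero
 some-edge = go (dense (U? 𝒫 zero) (lin (μ ∷ (# (U? 𝒫 zero) S) ∷ τ ∷ a ∷ []) (k 1 :+ v3 <: v1) (v0 <: v1 :+ v2 by large 𝒫 zero & k 1 :+ 10000 :* v2 <: v0 by huge & v3 <: v2 by a≤τ & □)))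
  where
  go : (∃₂ \ x y -> x ∈ S × y ∈ S × U 𝒫 zero x × U 𝒫 zero y × Adj x y) -> Edge red zero ⊎ Edge blue zero
  go (x , y , x∈ , y∈ , ux , uy , e) = [ (\ r -> inj₁ (x , y , x∈ , y∈ , ux , uy , r)) , (\ b -> inj₂ (x , y , x∈ , y∈ , ux , uy , b)) ]′ (colour e)

 flip-edge : ∀ c -> c ≢ none -> Edge c zero -> ∀ i -> Edge c i
 flip-edge c c≢ e zero = e
 flip-edge c c≢ e 1F = transfer c c≢ (\ ()) e

 one : (i : Fin 2) -> Edge red i -> Edge blue i -> ⊥
 one zero = one-colour {zero} {suc zero} \ ()
 one 1F = one-colour {suc zero} {zero} \ ()

 big : 1000 * τ < μ
 big = (lin (τ ∷ μ ∷ []) (k 1 :+ 1000 :* v0 <: v1) (k 1 :+ 10000 :* v0 <: v1 by huge & □))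

 -- All edges inside the two parts have one colour. If it is red, red neighbourhoods in the parts
 -- are independent, so the parts are joined in blue. If it is blue, the absence of blue triangles
 -- makes blue neighbourhoods across the parts independent, so they are joined in red.
 two-parts-bound : TuránBound 3 (length S * a + 3 * (a * a))
 two-parts-bound = go some-edge
  where
  open ThirdPart 𝒢 red-free S a μ dense low bounded τ 𝒫 a≤τ big upper
  go : Edge red zero ⊎ Edge blue zero -> TuránBound 3 (length S * a + 3 * (a * a))
  go (inj₁ r) = ≤-trans (BlueAcross.blue-bound
   (\ {x} i x∈ -> independent-bound dense _ \ {y} {z} y∈ z∈ (uy , xy) (uz , xz) e ->
    [ (\ yz -> red-free xy yz xz) , (\ yz -> one i (flip-edge red red≢none r i) (y , z , y∈ , z∈ , uy , uz , yz)) ]′ (colour e))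
   (lin (τ ∷ μ ∷ []) (k 1 :+ 100 :* (50 :* v0) <: v1) (k 1 :+ 10000 :* v0 <: v1 by huge & □))) (+-monoʳ-≤ (3 * (length S * length S)) (*-monoʳ-≤ 3 (m≤m+n (length S * a) (3 * (a * a)))))
  go (inj₂ b) = RedAcross.red-bound (\ {i} {j} {x} i≢j x∈ ux -> independent-bound dense _ \ {y} {z} y∈ z∈ (uy , xy) (uz , xz) e ->
    [ (\ yz -> one j (y , z , y∈ , z∈ , uy , uz , yz) (flip-edge blue blue≢none b j)) , (\ yz -> no-triangle x∈ y∈ z∈ ux uy uz xy xz yz) ]′ (colour e)) huge

-- The bounds for (K3, K4) and (K3, K5) inside S

module Bound34 {V : Set} (𝒢 : ColouredGraph V)
 (red-free : Graphs.RedFree 𝒢)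
 (S : List V) (a μ σ : ℕ) (dense : Graphs.Dense 𝒢 (Graphs.Adj 𝒢) S a) (low : Graphs.Low 𝒢 S μ)
 (bounded : RedDegrees.BlueBounded 𝒢 red-free S 3) (upper : 2 * (3 * μ) ≤ 2 * length S + σ) (lower : length S ≤ 3 * μ)
 (tiny : 300000000 * σ < length S)
 (c : ℕ) (fine : ∀ x -> σ ≤ 2 * x -> length S ≤ c * x) (small : 1000 * a ≤ σ) (c-small : 100000 * (c * a) ≤ σ) where
 open Graphs 𝒢
 open Colours 𝒢 red-free
 open RedDegrees 𝒢 red-free
 open Partitions 𝒢 S
 open Structure 𝒢 S a μ dense low

 Conclusion : Set
 Conclusion = TuránBound 3 (length S * a + 3 * (a * a))

 rich-bound : ∀ {o} -> o ∈ S -> 2 * μ ≤ # (Blue? o) S + σ -> Conclusion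
 rich-bound {o} o∈ rich = conclude parts-H
  where
  tiny' : 300000 * σ < μ
  tiny' = (lin-κ 2 (σ ∷ (length S) ∷ μ ∷ []) (k 1 :+ 300000 :* v0 <: v2) (k 1 :+ 300000000 :* v0 <: v1 by tiny & v1 <: 3 :* v2 by lower & □))
  open BlueNeighbourhood 𝒢 red-free S a μ σ dense low bounded o∈ rich small tiny'
  a≤τ : a ≤ 4000 * σ
  a≤τ = (lin-κ 999 (a ∷ σ ∷ []) (v0 <: 4000 :* v1) (1000 :* v0 <: v1 by small & □))
  huge : 10000 * (4000 * σ) < μ
  huge = (lin-κ 2 (σ ∷ (length S) ∷ μ ∷ []) (k 1 :+ 10000 :* (4000 :* v0) <: v2) (k 1 :+ 300000000 :* v0 <: v1 by tiny & v1 <: 3 :* v2 by lower & □))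
  upper' : 3 * μ ≤ length S + 4000 * σ
  upper' = (lin-κ 1 (μ ∷ (length S) ∷ σ ∷ []) (3 :* v0 <: v1 :+ 4000 :* v2) (2 :* (3 :* v0) <: 2 :* v1 :+ v2 by upper & □))
  conclude : Structure.Parts 𝒢 H a μ dense-H low-H 2 (4000 * σ) -> Conclusion
  conclude 𝒬 = Dichotomy.two-parts-bound 𝒢 red-free S a μ dense low bounded (4000 * σ) two-parts
   (\ {i} {j} {l} x∈ y∈ z∈ ux uy uz -> blue-free x∈ y∈ z∈ (two-parts-blue {i} ux) (two-parts-blue {j} uy) (two-parts-blue {l} uz)) a≤τ huge upper'
   where open Lift 𝒬

 module Poor (poor : ∀ {x} -> x ∈ S -> # (Blue? x) S + σ < 2 * μ) where

  -- At most μ vertices are missed and fewer than `2μ - σ` are blue. As `upper` exceeds `3μ ≤ |S|`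
  -- by only σ/2, more than σ/2 red neighbours remain, which `fine` turns into a proportion 1/c of
  -- S.
  many-red : ∀ {x} -> x ∈ S -> length S ≤ c * # (Red? x) S
  many-red {x} x∈ = fine (# (Red? x) S) (lin ((# (Blue? x) S) ∷ σ ∷ μ ∷ (length S) ∷ (miss S x) ∷ (degree S x) ∷ (# (Red? x) S) ∷ []) (v1 <: 2 :* v6) (k 1 :+ (v0 :+ v1) <: 2 :* v2 by 2 · poor x∈ & v3 <: v4 :+ v5 by≡ 2 · sym (miss+degree S x) & v4 <: v2 by 2 · low x∈ & 2 :* (3 :* v2) <: 2 :* v3 :+ v1 by upper & v5 <: v6 :+ v0 by 2 · (#-⊎ (Adj? x) (Red? x) (Blue? x) S (\ _ -> colour)) & □))

  upper' : 3 * μ ≤ length S + σ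
  upper' = (lin-κ 1 (μ ∷ (length S) ∷ σ ∷ []) (3 :* v0 <: v1 :+ v2) (2 :* (3 :* v0) <: 2 :* v1 :+ v2 by upper & □))

  ω≤6 : ∀ K -> Clique K -> All (_∈ S) K -> length K ≤ 6
  ω≤6 = SevenClique.ω≤6 𝒢 red-free S (c * a) μ σ (dense-blue c dense (≤-<-trans z≤n tiny) many-red) low bounded upper'
   c-small (lin (σ ∷ (length S) ∷ []) (k 1 :+ 1000 :* v0 <: v1) (k 1 :+ 300000000 :* v0 <: v1 by tiny & □))

  three-parts : Parts 3 (30000 * σ)
  three-parts = PartsExist.parts 𝒢 S a μ dense low 2 σ (30000 * σ) upper' (lin-κ 999 (a ∷ σ ∷ []) (729 :* v0 <: v1) (1000 :* v0 <: v1 by 729 · small & □))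
   (lin (σ ∷ []) (3 :* (20 :* v0) :+ 40 :* (729 :* v0) <: 30000 :* v0) (□)) (lin-κ 2 (σ ∷ (length S) ∷ μ ∷ []) (k 1 :+ 30000 :* v0 <: v2) (k 1 :+ 300000000 :* v0 <: v1 by tiny & v1 <: 3 :* v2 by lower & □)) ω≤6

  poor-bound : Conclusion
  poor-bound = ≤-trans (clique-free-bound three-parts (lin-κ 999 (a ∷ σ ∷ []) (v0 <: 30000 :* v1) (1000 :* v0 <: v1 by small & □))
   (lin-κ 2 (a ∷ σ ∷ (length S) ∷ μ ∷ []) (k 1 :+ 5 :* (v0 :+ 3 :* (4 :* (30000 :* v1))) <: v3) (1000 :* v0 <: v1 by 294600000 · small & k 1 :+ 300000000 :* v1 <: v2 by tiny & v2 <: 3 :* v3 by lower & □)) ω≤6)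
   (+-monoʳ-≤ (3 * (length S * length S)) (*-monoʳ-≤ 3 (m≤m+n (length S * a) (3 * (a * a)))))

 bound34 : TuránBound 3 (length S * a + 3 * (a * a))
 bound34 = go (search (\ o -> 2 * μ ≤? # (Blue? o) S + σ) S)
  where
  go : Dec (∃ \ o -> o ∈ S × 2 * μ ≤ # (Blue? o) S + σ) -> Conclusion
  go (yes (o , o∈ , rich)) = rich-bound o∈ rich
  go (no nowhere) = Poor.poor-bound \ x∈ -> ≰⇒> \ h -> nowhere (_ , x∈ , h)

module Bound35 {V : Set} (𝒢 : ColouredGraph V)
 (red-free : Graphs.RedFree 𝒢)
 (S : List V) (a μ σ : ℕ) (dense : Graphs.Dense 𝒢 (Graphs.Adj 𝒢) S a) (low : Graphs.Low 𝒢 S μ)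
 (bounded : RedDegrees.BlueBounded 𝒢 red-free S 4) (upper : 5 * μ ≤ length S + σ) (lower : length S ≤ 5 * μ)
 (small : 1000000000 * a ≤ σ) (tiny : 2000000000 * σ < length S) where
 open Graphs 𝒢
 open Colours 𝒢 red-free
 open RedDegrees 𝒢 red-free
 open Partitions 𝒢 S
 open Structure 𝒢 S a μ dense low

 blue-few : ∀ {x} -> x ∈ S -> 4 * # (Blue? x) S ≤ 3 * length S
 blue-few = blue-degree-bound S a μ σ dense low bounded upper (lin-κ 9999 (a ∷ σ ∷ []) (100000 :* v0 <: v1) (1000000000 :* v0 <: v1 by small & □))
  (lin (σ ∷ (length S) ∷ []) (k 1 :+ 1000 :* v0 <: v1) (k 1 :+ 2000000000 :* v0 <: v1 by tiny & □))

 -- About a fifth of S is missed and at most three quarters are blue, which leaves about 1/20; the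
 -- factor 25 makes room for the errors.
 many-red : ∀ {x} -> x ∈ S -> length S ≤ 25 * # (Red? x) S
 many-red {x} x∈ = (lin-κ 499999998 ((# (Blue? x) S) ∷ (length S) ∷ (miss S x) ∷ (degree S x) ∷ μ ∷ σ ∷ (# (Red? x) S) ∷ []) (v1 <: 25 :* v6) (4 :* v0 <: 3 :* v1 by 2500000000 · blue-few x∈ & v1 <: v2 :+ v3 by≡ 10000000000 · sym (miss+degree S x) & v2 <: v4 by 10000000000 · low x∈ & 5 :* v4 <: v1 :+ v5 by 2000000000 · upper & k 1 :+ 2000000000 :* v5 <: v1 by tiny & v3 <: v6 :+ v0 by 10000000000 · (#-⊎ (Adj? x) (Red? x) (Blue? x) S (\ _ -> colour)) & □))

 ω≤10 : ∀ K -> Clique K -> All (_∈ S) K -> length K ≤ 10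
 ω≤10 = Eleven.ω≤10 𝒢 red-free S (25 * a) μ σ (dense-blue 25 dense (≤-<-trans z≤n tiny) many-red) low bounded upper
  (lin-κ 3 (a ∷ σ ∷ []) (10000000 :* (25 :* v0) <: v1) (1000000000 :* v0 <: v1 by small & □)) (lin (σ ∷ (length S) ∷ []) (k 1 :+ 1000 :* v0 <: v1) (k 1 :+ 2000000000 :* v0 <: v1 by tiny & □))

 five-parts : Parts 5 (2500000 * σ)
 five-parts = PartsExist.parts 𝒢 S a μ dense low 4 σ (2500000 * σ) upper (lin-κ 999999999 (a ∷ σ ∷ []) (59049 :* v0 <: v1) (1000000000 :* v0 <: v1 by 59049 · small & □))
  (lin (σ ∷ []) (5 :* (20 :* v0) :+ 40 :* (59049 :* v0) <: 2500000 :* v0) (□)) (lin-κ 4 (σ ∷ (length S) ∷ μ ∷ []) (k 1 :+ 2500000 :* v0 <: v2) (k 1 :+ 2000000000 :* v0 <: v1 by tiny & v1 <: 5 :* v2 by lower & □)) ω≤10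

 bound35 : TuránBound 5 (length S * a)
 bound35 = clique-free-bound five-parts (lin-κ 999999999 (a ∷ σ ∷ []) (v0 <: 2500000 :* v1) (1000000000 :* v0 <: v1 by small & □))
  (lin-κ 4 (a ∷ σ ∷ (length S) ∷ μ ∷ []) (k 1 :+ 5 :* (v0 :+ 5 :* (4 :* (2500000 :* v1))) <: v3) (1000000000 :* v0 <: v1 by 750000000 · small & k 1 :+ 2000000000 :* v1 <: v2 by tiny & v2 <: 5 :* v3 by lower & □)) ω≤10

-- Upper bounds for graphs on n vertices

AllPairs-lookup : ∀ {A : Set} {R : A -> A -> Set} -> (∀ {x y} -> R x y -> R y x) -> ∀ {L} -> AllPairs R L -> ∀ i j -> i ≢ j -> R (lookup L i) (lookup L j)
AllPairs-lookup sym-R (h ∷ c) zero zero i≢j = absurd refl i≢j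
AllPairs-lookup sym-R {_ ∷ L} (h ∷ c) zero (suc j) i≢j = All.lookup h (∈-lookup j)
AllPairs-lookup sym-R {_ ∷ L} (h ∷ c) (suc i) zero i≢j = sym-R (All.lookup h (∈-lookup i))
AllPairs-lookup sym-R (h ∷ c) (suc i) (suc j) i≢j = AllPairs-lookup sym-R c i j \ e -> i≢j (cong suc e)

sum-map : ∀ {A : Set} (f : A -> ℕ) xs -> sum (map f xs) ≡ ∑ f xs
sum-map f [] = refl
sum-map f (x ∷ xs) = cong (f x +_) (sum-map f xs)

indicator : Bool -> ℕ
indicator b = if b then 1 else 0

edgeCount-degrees : ∀ {n} (G : Graph n) -> 2 * edgeCount G ≡ ∑ (\ i -> ∑ (\ j -> indicator (adj G i j)) (allFin n)) (allFin n)
edgeCount-degrees {n} G = begin-equality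
 2 * edgeCount G ≡⟨ cong (edgeCount G +_) (+-identityʳ _) ⟩
 edgeCount G + edgeCount G ≡⟨ cong₂ _+_ as-sum (trans as-sum (∑-swap w (allFin n) (allFin n))) ⟩
 ∑ (\ i -> ∑ (w i) (allFin n)) (allFin n) + ∑ (\ j -> ∑ (\ i -> w i j) (allFin n)) (allFin n) ≡⟨ ∑-+ _ _ (allFin n) ⟨
 ∑ (\ i -> ∑ (w i) (allFin n) + ∑ (\ j -> w j i) (allFin n)) (allFin n) ≡⟨ ∑-cong (allFin n) (\ {i} _ -> trans (sym (∑-+ _ _ (allFin n))) (∑-cong (allFin n) \ {j} _ -> once i j)) ⟩
 ∑ (\ i -> ∑ (\ j -> indicator (adj G i j)) (allFin n)) (allFin n) ∎
 where
 w : Fin n -> Fin n -> ℕ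
 w i j = if (Fin.toℕ i <ᵇ Fin.toℕ j) ∧ adj G i j then 1 else 0
 as-sum : edgeCount G ≡ ∑ (\ i -> ∑ (w i) (allFin n)) (allFin n)
 as-sum = trans (sum-map _ (allFin n)) (∑-cong (allFin n) \ {i} _ -> sum-map (w i) (allFin n))
 yes-<ᵇ : ∀ {m n} -> m < n -> (m <ᵇ n) ≡ true
 yes-<ᵇ h = Equivalence.to T-≡ (<⇒<ᵇ h)
 no-<ᵇ : ∀ m n -> ¬ m < n -> (m <ᵇ n) ≡ false
 no-<ᵇ m n h with m <ᵇ n in eq
 ... | true = absurd (<ᵇ⇒< m n (Equivalence.from T-≡ eq)) h
 ... | false = refl
 once : ∀ i j -> w i j + w j i ≡ indicator (adj G i j)
 once i j with <-cmp (Fin.toℕ i) (Fin.toℕ j)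
 ... | tri< lt _ ngt rewrite yes-<ᵇ lt | no-<ᵇ (Fin.toℕ j) (Fin.toℕ i) ngt = +-identityʳ _
 ... | tri> nlt _ gt rewrite yes-<ᵇ gt | no-<ᵇ (Fin.toℕ i) (Fin.toℕ j) nlt | adj-sym G j i = refl
 ... | tri≈ nlt e ngt rewrite no-<ᵇ (Fin.toℕ i) (Fin.toℕ j) nlt | no-<ᵇ (Fin.toℕ j) (Fin.toℕ i) ngt | toℕ-injective e | irrefl G j = refl

module FromColouring {n : ℕ} (G : Graph n) (φ : Colouring 2 G) where

 paint : Fin 2 -> Colour
 paint zero = red
 paint 1F = blue

 shade : Bool -> Fin 2 -> Colour
 shade false _ = none
 shade true c = paint c

 𝒢 : ColouredGraph (Fin n)
 𝒢 = record
  { χ = \ i j -> shade (adj G i j) (col φ i j)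
  ; χ-sym = \ i j -> cong₂ shade (adj-sym G i j) (col-sym φ i j)
  ; χ-irrefl = \ i -> cong (\ b -> shade b (col φ i i)) (irrefl G i)
  }

 open Graphs 𝒢
 open Partitions 𝒢 using (degrees)

 shade-paint : ∀ b c d -> shade b c ≡ paint d -> b ≡ true × c ≡ d
 shade-paint false c zero ()
 shade-paint false c 1F ()
 shade-paint true zero zero _ = refl , refl
 shade-paint true zero 1F ()
 shade-paint true 1F zero ()
 shade-paint true 1F 1F _ = refl , refl

 shade-none : ∀ b c -> shade b c ≡ none -> b ≡ false
 shade-none false c _ = refl
 shade-none true zero ()
 shade-none true 1F ()

 shade-indicator : ∀ b c -> 𝟙 (¬? (shade b c ≟ᶜ none)) ≡ indicator b
 shade-indicator false c = refl
 shade-indicator true zero = refl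
 shade-indicator true 1F = refl

 paint≢none : ∀ c -> paint c ≢ none
 paint≢none zero ()
 paint≢none 1F ()

 mono-clique : ∀ c L -> AllPairs (\ x y -> χ x y ≡ paint c) L -> MonoClique G φ c (length L)
 mono-clique c L h = lookup L , injective , \ i j i≢j -> shade-paint _ _ c (pairs i j i≢j)
  where
  pairs : ∀ i j -> i ≢ j -> χ (lookup L i) (lookup L j) ≡ paint c
  pairs = AllPairs-lookup χ-flip h
  injective : Injective _≡_ _≡_ (lookup L)
  injective {i} {j} e with i Fin.≟ j
  ... | yes p = p
  ... | no p = absurd (trans (sym (pairs i j p)) (trans (cong (χ (lookup L i)) (sym e)) (χ-irrefl _))) (paint≢none c)

 no-clique : ∀ c s -> ¬ MonoClique G φ c (suc s) -> ∀ {L} -> AllPairs (\ x y -> χ x y ≡ paint c) L -> length L ≤ s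
 no-clique c s free {L} h = ≮⇒≥ \ big -> free (subst (MonoClique G φ c) (trans (length-take (suc s) L) (m≤n⇒m⊓n≡m big))
  (mono-clique c (take (suc s) L) (AllPairs.take⁺ (suc s) h)))
  where open import Data.List.Properties using (length-take)

 independent : ∀ {a} -> (∀ t -> IndepSet G t -> t ≤ a) -> ∀ {P : Fin n -> Set} (P? : Decidable P) ->
  (∀ {x y} -> x ∈ allFin n -> y ∈ allFin n -> P x -> P y -> ¬ Adj x y) -> # P? (allFin n) ≤ a
 independent bound {P} P? ind = subst (_≤ _) (#-length P? (allFin n)) (bound _ (lookup L ,
  (\ {i} {j} e -> injective i j e) , \ i j _ -> non-adjacent i j))
  where
  L = filter P? (allFin n)
  L-unique : Unique L
  L-unique = Unique.filter⁺ P? (allFin⁺ n)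
  injective : ∀ i j -> lookup L i ≡ lookup L j -> i ≡ j
  injective i j e with i Fin.≟ j
  ... | yes p = p
  ... | no p = absurd e (AllPairs-lookup (\ ne e -> ne (sym e)) L-unique i j p)
  P-lookup : ∀ i -> P (lookup L i)
  P-lookup i = proj₂ (∈-filter⁻ P? {xs = allFin n} (∈-lookup {xs = L} i))
  non-adjacent : ∀ i j -> adj G (lookup L i) (lookup L j) ≡ false
  non-adjacent i j with χ (lookup L i) (lookup L j) ≟ᶜ none
  ... | yes e = shade-none _ _ e
  ... | no e = ⊥-elim (ind (∈-allFin _) (∈-allFin _) (P-lookup i) (P-lookup j) e)

 degrees-all : degrees (allFin n) ≡ 2 * edgeCount G
 degrees-all = trans (∑-cong (allFin n) \ {i} _ -> ∑-cong (allFin n) \ {j} _ -> shade-indicator (adj G i j) (col φ i j)) (sym (edgeCount-degrees G))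

 open Reduction 𝒢 Fin._≟_

 -- Too many edges would survive the deletions down to a set S of vertices missing few others, where
 -- `core` refutes them.
 module Excessive (a : ℕ) (bound : ∀ t -> IndepSet G t -> t ≤ a) (r gap E : ℕ) {{_ : NonZero r}} {{_ : NonZero gap}}
  (core : ∀ S -> Dense Adj S a -> n ≤ (1 + gap) * length S -> (∀ {x} -> x ∈ S -> miss S x ≤ threshold r gap a E n S) ->
   r * degrees S + length S * length S ≤ r * (length S * length S) + r * (length S * a) + E) where

  edge-bound : r * (2 * edgeCount G) + n * n ≤ r * (n * n) + r * (n * a) + E
  edge-bound = ≮⇒≥ \ h -> refute (reduce r gap a E n n (allFin n) (≡⇒≤ size) (start r gap a E n (allFin n) size (independent bound) (resized h)))
   where
   size : length (allFin n) ≡ n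
   size = length-tabulate {n = n} (\ i -> i)
   resized : r * (n * n) + r * (n * a) + E < r * (2 * edgeCount G) + n * n ->
    r * (length (allFin n) * length (allFin n)) + r * (length (allFin n) * a) + E < r * degrees (allFin n) + length (allFin n) * length (allFin n)
   resized = subst₂ (\ N D -> r * (N * N) + r * (N * a) + E < r * D + N * N) (sym size) (sym degrees-all)
   refute : Reduced r gap a E n -> ⊥
   refute (S , ex , low) = <⇒≱ (excess ex) (core S (dense-from-independent Adj? S a (independence ex)) (spread-size r gap a E n ex) low)

module Sizes (r gap a E n : ℕ) {{_ : NonZero r}} {{_ : NonZero gap}} {V : Set} (𝒢 : ColouredGraph V) (_≟V_ : ∀ (x y : V) -> Dec (x ≡ y)) (S : List V) where
 open Reduction 𝒢 _≟V_

 s μ : ℕ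
 s = slack r gap a E n S
 μ = threshold r gap a E n S

 s-lower : length S ≤ gap * s
 s-lower = ≤-trans (m≤m+n _ _) (slack-lower r gap a E n S)

 s-positive : 1 + r ≤ s
 s-positive = ≤-trans (≡⇒≤ (+-comm 1 r)) (m≤n+m (r + 1) (length S / gap))

 s-upper : gap * s ≤ length S + gap * (r + 1)
 s-upper = ≤-trans (≡⇒≤ (*-distribˡ-+ gap (length S / gap) (r + 1))) (+-monoˡ-≤ (gap * (r + 1))
  (≤-trans (≡⇒≤ (*-comm gap _)) (m/n*n≤m (length S) gap)))

 μ-upper : r * μ ≤ length S + s
 μ-upper = threshold-upper r gap a E n S

 μ-lower : length S + s < r + r * μ
 μ-lower = <-≤-trans (m<[1+m/n]*n (length S + s) r) (≡⇒≤ (trans (*-comm (1 + μ) r) (*-suc r μ)))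

-- Generous thresholds: n will be at least `many`, and at least `huge` times the bound a on
-- independent sets.
many huge : ℕ
many = 1000000000000000000000000000000
huge = 10000000000000000000000000000000000000000

-- The slack s is about `N / gap`. The gap places it between two scales: above 1000a, as the
-- proportion of a is tiny, and with 300000s still below μ, about N/2.
module Sizes33 (N s μ n a gap : ℕ) (gap≡ : gap ≡ 1000000) (s-lower : N ≤ gap * s) (s-upper : gap * s ≤ N + gap * 3) (s-positive : 3 ≤ s) (μ-upper : 2 * μ ≤ N + s)
 (μ-lower : N + s < 2 + 2 * μ) (spread : n ≤ (1 + gap) * N) (large : 1000000000000000000000000000000 ≤ n) (a-small : 10000000000000000000000000000000000000000 * a ≤ n) where

 s-lower' : N ≤ 1000000 * s
 s-lower' = subst (\ g -> N ≤ g * s) gap≡ s-lower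
 s-upper' : 1000000 * s ≤ N + 3000000
 s-upper' = subst (\ g -> g * s ≤ N + g * 3) gap≡ s-upper
 spread' : n ≤ 1000001 * N
 spread' = subst (\ g -> n ≤ (1 + g) * N) gap≡ spread
 small : 1000 * a ≤ s
 small = (lin-κ 9999999999999999999999999999999999999 (a ∷ n ∷ N ∷ s ∷ []) (1000 :* v0 <: v3) (10000000000000000000000000000000000000000 :* v0 <: v1 by a-small & v1 <: 1000001 :* v2 by spread' & v2 <: 1000000 :* v3 by 1000001 · s-lower' & □))
 tiny : 300000 * s < μ
 tiny = (lin-κ 2000001999999 (s ∷ N ∷ μ ∷ n ∷ []) (k 1 :+ 300000 :* v0 <: v2) (1000000 :* v0 <: v1 :+ k 3000000 by 599999599999 · s-upper' & k 1 :+ (v1 :+ v0) <: k 2 :+ 2 :* v2 by 1000001000000 · μ-lower & v3 <: 1000001 :* v1 by 400001 · spread' & k 1000000000000000000000000000000 <: v3 by 400001 · large & □))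

module Sizes35 (N s μ n a gap : ℕ) (gap≡ : gap ≡ 10000000000) (s-lower : N ≤ gap * s) (s-upper : gap * s ≤ N + gap * 6) (s-positive : 6 ≤ s) (μ-upper : 5 * μ ≤ N + s)
 (μ-lower : N + s < 5 + 5 * μ) (spread : n ≤ (1 + gap) * N) (large : 1000000000000000000000000000000 ≤ n) (a-small : 10000000000000000000000000000000000000000 * a ≤ n) where

 s-lower' : N ≤ 10000000000 * s
 s-lower' = subst (\ g -> N ≤ g * s) gap≡ s-lower
 s-upper' : 10000000000 * s ≤ N + 60000000000
 s-upper' = subst (\ g -> g * s ≤ N + g * 6) gap≡ s-upper
 spread' : n ≤ 10000000001 * N
 spread' = subst (\ g -> n ≤ (1 + g) * N) gap≡ spread
 lower : N ≤ 5 * μ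
 lower = (lin (s ∷ N ∷ μ ∷ []) (v1 <: 5 :* v2) (k 6 <: v0 by s-positive & k 1 :+ (v1 :+ v0) <: k 5 :+ 5 :* v2 by μ-lower & □))
 small : 1000000000 * a ≤ s
 small = (lin-κ 9999999999999999999999999999999 (a ∷ n ∷ N ∷ s ∷ []) (1000000000 :* v0 <: v3) (10000000000000000000000000000000000000000 :* v0 <: v1 by a-small & v1 <: 10000000001 :* v2 by spread' & v2 <: 10000000000 :* v3 by 10000000001 · s-lower' & □))
 tiny : 2000000000 * s < N
 tiny = (lin-κ 50000000004 (s ∷ N ∷ n ∷ []) (k 1 :+ 2000000000 :* v0 <: v1) (10000000000 :* v0 <: v1 :+ k 60000000000 by 10000000001 · s-upper' & v2 <: 10000000001 :* v1 by 4 · spread' & k 1000000000000000000000000000000 <: v2 by 4 · large & □))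

-- The error σ is taken to be 2s: then the surplus of `upper` is s, half of σ, and a red degree of
-- at least s is the proportion `1 / gap` of S.
module Sizes34 (N s μ n a gap : ℕ) (gap≡ : gap ≡ 2000000000) (s-lower : N ≤ gap * s) (s-upper : gap * s ≤ N + gap * 4) (s-positive : 4 ≤ s) (μ-upper : 3 * μ ≤ N + s)
 (μ-lower : N + s < 3 + 3 * μ) (spread : n ≤ (1 + gap) * N) (large : 1000000000000000000000000000000 ≤ n) (a-small : 10000000000000000000000000000000000000000 * a ≤ n) where

 s-lower' : N ≤ 2000000000 * s
 s-lower' = subst (\ g -> N ≤ g * s) gap≡ s-lower
 s-upper' : 2000000000 * s ≤ N + 8000000000
 s-upper' = subst (\ g -> g * s ≤ N + g * 4) gap≡ s-upper
 spread' : n ≤ 2000000001 * N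
 spread' = subst (\ g -> n ≤ (1 + g) * N) gap≡ spread
 upper : 2 * (3 * μ) ≤ 2 * N + 2 * s
 upper = (lin (μ ∷ N ∷ s ∷ []) (2 :* (3 :* v0) <: 2 :* v1 :+ 2 :* v2) (3 :* v0 <: v1 :+ v2 by 2 · μ-upper & □))
 lower : N ≤ 3 * μ
 lower = (lin (s ∷ N ∷ μ ∷ []) (v1 <: 3 :* v2) (k 4 <: v0 by s-positive & k 1 :+ (v1 :+ v0) <: k 3 :+ 3 :* v2 by μ-lower & □))
 small : 1000 * a ≤ 2 * s
 small = (lin-κ 9999999999999999999999999999999999999 (a ∷ n ∷ N ∷ s ∷ []) (1000 :* v0 <: 2 :* v3) (10000000000000000000000000000000000000000 :* v0 <: v1 by a-small & v1 <: 2000000001 :* v2 by spread' & v2 <: 2000000000 :* v3 by 2000000001 · s-lower' & □))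
 gap-small : 100000 * (gap * a) ≤ 2 * s
 gap-small = (lin-κ 49999999999999999999999999 ((gap * a) ∷ a ∷ n ∷ N ∷ s ∷ []) (100000 :* v0 <: 2 :* v4) (v0 <: 2000000000 :* v1 by≡ 5000000000000000000000000000000 · cong (_* a) gap≡ & 10000000000000000000000000000000000000000 :* v1 <: v2 by a-small & v2 <: 2000000001 :* v3 by spread' & v3 <: 2000000000 :* v4 by 2000000001 · s-lower' & □))
 tiny : 300000000 * (2 * s) < N
 tiny = (lin-κ 20000000009 (s ∷ N ∷ n ∷ []) (k 1 :+ 300000000 :* (2 :* v0) <: v1) (2000000000 :* v0 <: v1 :+ k 8000000000 by 6000000003 · s-upper' & v2 <: 2000000001 :* v1 by 7 · spread' & k 1000000000000000000000000000000 <: v2 by 7 · large & □))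
 fine : ∀ x -> 2 * s ≤ 2 * x -> N ≤ gap * x
 fine x h = ≤-trans s-lower (*-monoʳ-≤ gap (*-cancelˡ-≤ 2 h))

module EdgeBounds {n a : ℕ} (G : Graph n) (bound : ∀ t -> IndepSet G t -> t ≤ a) (large : many ≤ n) (a-small : huge * a ≤ n) where

 module _ (t : ℕ) (free : CliquesFree (3 Vec.∷ suc t Vec.∷ Vec.[]) G) where
  open FromColouring G (proj₁ free) public
  open Graphs 𝒢 public

  red-free : ∀ {x y z} -> Red x y -> Red y z -> Red x z -> ⊥
  red-free xy yz xz = <⇒≱ (s≤s (s≤s (s≤s z≤n))) (no-clique zero 2 (proj₂ free zero) ((xy ∷ xz ∷ []) ∷ (yz ∷ []) ∷ [] ∷ []))

  blue-bounded : ∀ S -> RedDegrees.BlueBounded 𝒢 red-free S t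
  blue-bounded S c _ = no-clique 1F t (proj₂ free 1F) c

 module _ (free : CliquesFree (3 Vec.∷ 3 Vec.∷ Vec.[]) G) (gap : ℕ) {{_ : NonZero gap}} (gap≡ : gap ≡ 1000000) where
  upper33' : 2 * (2 * edgeCount G) + n * n ≤ 2 * (n * n) + 2 * (n * a) + 0
  upper33' = Excessive.edge-bound 2 free a bound 2 gap 0 \ S dense spread low ->
   let module Z = Sizes 2 gap a 0 n (𝒢 2 free) Fin._≟_ S
       module A = Sizes33 (length S) Z.s Z.μ n a gap gap≡ Z.s-lower Z.s-upper Z.s-positive Z.μ-upper Z.μ-lower spread large a-small
   in ≤-trans (Colours.Core33.bound33 (𝒢 2 free) (red-free 2 free) S a Z.μ Z.s dense low
    (\ x∈ y∈ z∈ xy xz yz -> <⇒≱ (s≤s (s≤s (s≤s z≤n))) (blue-bounded 2 free S ((xy ∷ xz ∷ []) ∷ (yz ∷ []) ∷ [] ∷ []) (x∈ ∷ y∈ ∷ z∈ ∷ [])))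
    Z.μ-upper A.small A.tiny) (m≤m+n _ 0)

 upper33 : CliquesFree (3 Vec.∷ 3 Vec.∷ Vec.[]) G -> 2 * (2 * edgeCount G) + n * n ≤ 2 * (n * n) + 2 * (n * a) + 0
 upper33 free = upper33' free 1000000 refl

 module _ (free : CliquesFree (3 Vec.∷ 4 Vec.∷ Vec.[]) G) (gap : ℕ) {{_ : NonZero gap}} (gap≡ : gap ≡ 2000000000) where
  upper34' : 3 * (2 * edgeCount G) + n * n ≤ 3 * (n * n) + 3 * (n * a) + 9 * (a * a)
  upper34' = Excessive.edge-bound 3 free a bound 3 gap (9 * (a * a)) \ S dense spread low ->
   let module Z = Sizes 3 gap a (9 * (a * a)) n (𝒢 3 free) Fin._≟_ S
       module A = Sizes34 (length S) Z.s Z.μ n a gap gap≡ Z.s-lower Z.s-upper Z.s-positive Z.μ-upper Z.μ-lower spread large a-small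
   in ≤-trans (Bound34.bound34 (𝒢 3 free) (red-free 3 free) S a Z.μ (2 * Z.s) dense low (blue-bounded 3 free S)
    A.upper A.lower A.tiny gap A.fine A.small A.gap-small) (≡⇒≤ (expand (length S) a))
   where
   expand : ∀ N a -> 3 * (N * N) + 3 * (N * a + 3 * (a * a)) ≡ 3 * (N * N) + 3 * (N * a) + 9 * (a * a)
   expand = solve-∀

 upper34 : CliquesFree (3 Vec.∷ 4 Vec.∷ Vec.[]) G -> 3 * (2 * edgeCount G) + n * n ≤ 3 * (n * n) + 3 * (n * a) + 9 * (a * a)
 upper34 free = upper34' free 2000000000 refl

 module _ (free : CliquesFree (3 Vec.∷ 5 Vec.∷ Vec.[]) G) (gap : ℕ) {{_ : NonZero gap}} (gap≡ : gap ≡ 10000000000) where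
  upper35' : 5 * (2 * edgeCount G) + n * n ≤ 5 * (n * n) + 5 * (n * a) + 0
  upper35' = Excessive.edge-bound 4 free a bound 5 gap 0 \ S dense spread low ->
   let module Z = Sizes 5 gap a 0 n (𝒢 4 free) Fin._≟_ S
       module A = Sizes35 (length S) Z.s Z.μ n a gap gap≡ Z.s-lower Z.s-upper Z.s-positive Z.μ-upper Z.μ-lower spread large a-small
   in ≤-trans (Bound35.bound35 (𝒢 4 free) (red-free 4 free) S a Z.μ Z.s dense low (blue-bounded 4 free S)
    Z.μ-upper A.lower A.small A.tiny) (m≤m+n _ 0)

 upper35 : CliquesFree (3 Vec.∷ 5 Vec.∷ Vec.[]) G -> 5 * (2 * edgeCount G) + n * n ≤ 5 * (n * n) + 5 * (n * a) + 0
 upper35 free = upper35' free 10000000000 refl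

-- Weighted triangle-free graphs with dense ratios

module _ {A : Set} where

 copies : ℕ -> List A -> List A
 copies zero xs = []
 copies (suc c) xs = xs ++ copies c xs

 ∑-copies : ∀ (f : A -> ℕ) c xs -> ∑ f (copies c xs) ≡ c * ∑ f xs
 ∑-copies f zero xs = refl
 ∑-copies f (suc c) xs = trans (∑-++ f xs (copies c xs)) (cong (∑ f xs +_) (∑-copies f c xs))

 length-copies : ∀ c xs -> length (copies c xs) ≡ c * length xs
 length-copies zero xs = refl
 length-copies (suc c) xs = trans (length-++ xs) (cong (length xs +_) (length-copies c xs))

 ∈-copies⁻ : ∀ c xs {x} -> x ∈ copies c xs -> x ∈ xs
 ∈-copies⁻ (suc c) xs m = [ (\ h -> h) , ∈-copies⁻ c xs ]′ (∈-++⁻ xs m)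

 ∈-copies⁺ : ∀ {c xs x} -> 0 < c -> x ∈ xs -> x ∈ copies c xs
 ∈-copies⁺ {suc c} _ m = ∈-++⁺ˡ m

∑-map : ∀ {A B : Set} (f : B -> ℕ) (g : A -> B) xs -> ∑ f (map g xs) ≡ ∑ (\ x -> f (g x)) xs
∑-map f g [] = refl
∑-map f g (x ∷ xs) = cong (f (g x) +_) (∑-map f g xs)

-- A vertex listed several times stands for as many non-adjacent twins.
record Sys (N d : ℕ) : Set1 where
 field
  T : Set
  _≟T_ : ∀ (x y : T) -> Dec (x ≡ y)
  E : T -> T -> Set
  E? : ∀ x y -> Dec (E x y)
  E-sym : ∀ {x y} -> E x y -> E y x
  triangle-free : ∀ {x y z} -> E x y -> E y z -> E x z -> ⊥
  L : List T
  size : length L ≡ N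
  degree : ∀ {x} -> x ∈ L -> d ≤ # (E? x) L
  independent : ∀ {P : T -> Set} (P? : Decidable P) -> (∀ {x y} -> x ∈ L -> y ∈ L -> P x -> P y -> ¬ E x y) -> # P? L ≤ d

data Myc (T : Set) : Set where
 base shadow : T -> Myc T
 apex : Myc T

module Mycielski {c d : ℕ} (𝒮 : Sys (c + d) d) (0<c : 0 < c) (0<d : 0 < d) where
 open Sys 𝒮

 E' : Myc T -> Myc T -> Set
 E' (base x) (base y) = E x y
 E' (base x) (shadow y) = E x y
 E' (shadow x) (base y) = E x y
 E' (shadow x) apex = ⊤
 E' apex (shadow y) = ⊤
 E' _ _ = ⊥

 E'? : ∀ p q -> Dec (E' p q)
 E'? (base x) (base y) = E? x y
 E'? (base x) (shadow y) = E? x y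
 E'? (base x) apex = no \ ()
 E'? (shadow x) (base y) = E? x y
 E'? (shadow x) (shadow y) = no \ ()
 E'? (shadow x) apex = yes tt
 E'? apex (base y) = no \ ()
 E'? apex (shadow y) = yes tt
 E'? apex apex = no \ ()

 E'-sym : ∀ {p q} -> E' p q -> E' q p
 E'-sym {base x} {base y} h = E-sym h
 E'-sym {base x} {shadow y} h = E-sym h
 E'-sym {shadow x} {base y} h = E-sym h
 E'-sym {shadow x} {apex} h = tt
 E'-sym {apex} {shadow y} h = tt

 E'-triangle-free : ∀ {p q r} -> E' p q -> E' q r -> E' p r -> ⊥
 E'-triangle-free {base _} {base _} {base _} = triangle-free
 E'-triangle-free {base _} {base _} {shadow _} = triangle-free
 E'-triangle-free {base _} {shadow _} {base _} = triangle-free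
 E'-triangle-free {shadow _} {base _} {base _} = triangle-free
 E'-triangle-free {base _} {_} {apex} _ _ ()
 E'-triangle-free {base _} {apex} ()
 E'-triangle-free {base _} {shadow _} {shadow _} _ ()
 E'-triangle-free {shadow _} {_} {shadow _} _ _ ()
 E'-triangle-free {shadow _} {shadow _} ()
 E'-triangle-free {shadow _} {base _} {apex} _ ()
 E'-triangle-free {shadow _} {apex} {base _} _ ()
 E'-triangle-free {shadow _} {apex} {apex} _ ()
 E'-triangle-free {apex} {_} {base _} _ _ ()
 E'-triangle-free {apex} {_} {apex} _ _ ()
 E'-triangle-free {apex} {base _} ()
 E'-triangle-free {apex} {apex} ()
 E'-triangle-free {apex} {shadow _} {shadow _} _ ()

 _≟'_ : ∀ (p q : Myc T) -> Dec (p ≡ q)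
 base x ≟' base y = map′ (cong base) (\ { refl -> refl }) (x ≟T y)
 base x ≟' shadow y = no \ ()
 base x ≟' apex = no \ ()
 shadow x ≟' base y = no \ ()
 shadow x ≟' shadow y = map′ (cong shadow) (\ { refl -> refl }) (x ≟T y)
 shadow x ≟' apex = no \ ()
 apex ≟' base y = no \ ()
 apex ≟' shadow y = no \ ()
 apex ≟' apex = yes refl

 N : ℕ
 N = c + d

 -- With `N = c + d`, the weights c, d and d² make the degrees equal: `cd + d²` at base vertices and
 -- at shadows, and `dN` at the apex.
 L' : List (Myc T)
 L' = copies c (map base L) ++ copies d (map shadow L) ++ copies (d * d) (apex ∷ [])

 ∑-L' : ∀ f -> ∑ f L' ≡ c * ∑ (\ x -> f (base x)) L + (d * ∑ (\ x -> f (shadow x)) L + d * d * f apex)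
 ∑-L' f = trans (∑-++ f (copies c (map base L)) _) (cong₂ _+_ (part c base) (trans (∑-++ f (copies d (map shadow L)) _)
  (cong₂ _+_ (part d shadow) (trans (∑-copies f (d * d) (apex ∷ [])) (cong (d * d *_) (+-identityʳ (f apex)))))))
  where
  part : ∀ c (g : T -> Myc T) -> ∑ f (copies c (map g L)) ≡ c * ∑ (\ x -> f (g x)) L
  part c g = trans (∑-copies f c (map g L)) (cong (c *_) (∑-map f g L))

 size' : length L' ≡ N * N + d * d
 size' = trans (sym (∑-ones L')) (trans (∑-L' (\ _ -> 1))
  (trans (cong (\ n -> c * n + (d * n + d * d * 1)) (trans (∑-ones L) (size))) (lemma c d)))
  where
  lemma : ∀ c d -> c * (c + d) + (d * (c + d) + d * d * 1) ≡ (c + d) * (c + d) + d * d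
  lemma = solve-∀

 base∈ : ∀ {x} -> x ∈ L -> base x ∈ L'
 base∈ m = ∈-++⁺ˡ (∈-copies⁺ 0<c (∈-map⁺ base m))

 shadow∈ : ∀ {x} -> x ∈ L -> shadow x ∈ L'
 shadow∈ m = ∈-++⁺ʳ (copies c (map base L)) (∈-++⁺ˡ (∈-copies⁺ 0<d (∈-map⁺ shadow m)))

 apex∈ : apex ∈ L'
 apex∈ = ∈-++⁺ʳ (copies c (map base L)) (∈-++⁺ʳ (copies d (map shadow L)) (∈-copies⁺ (*-mono-< 0<d 0<d) (here refl)))

 under : ∀ c (g : T -> Myc T) {p} -> p ∈ copies c (map g L) -> ∃ \ x -> x ∈ L × p ≡ g x
 under c g m = ∈-map⁻ g (∈-copies⁻ c (map g L) m)

 degree' : ∀ {p} -> p ∈ L' -> d * N ≤ # (E'? p) L'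
 degree' {p} m = [ (\ h -> at-base (under c base h)) , (\ h -> [ (\ h -> at-shadow (under d shadow h)) , (\ h -> at-apex (∈-copies⁻ (d * d) _ h)) ]′ (∈-++⁻ (copies d (map shadow L)) h)) ]′
  (∈-++⁻ (copies c (map base L)) m)
  where
  at-base : (∃ \ x -> x ∈ L × p ≡ base x) -> d * N ≤ # (E'? p) L'
  at-base (x , x∈ , refl) = begin
   d * (c + d) ≡⟨ lemma c d ⟩
   c * d + (d * d + d * d * 0) ≤⟨ +-mono-≤ (*-monoʳ-≤ c (degree x∈)) (+-monoˡ-≤ _ (*-monoʳ-≤ d (degree x∈))) ⟩
   c * # (E? x) L + (d * # (E? x) L + d * d * 0) ≡⟨ ∑-L' (\ q -> 𝟙 (E'? (base x) q)) ⟨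
   # (E'? (base x)) L' ∎
   where
   lemma : ∀ c d -> d * (c + d) ≡ c * d + (d * d + d * d * 0)
   lemma = solve-∀
  at-shadow : (∃ \ x -> x ∈ L × p ≡ shadow x) -> d * N ≤ # (E'? p) L'
  at-shadow (x , x∈ , refl) = begin
   d * (c + d) ≡⟨ lemma c d ⟩
   c * d + (0 + d * d * 1) ≤⟨ +-mono-≤ (*-monoʳ-≤ c (degree x∈)) (+-monoˡ-≤ (d * d * 1) z≤n) ⟩
   c * # (E? x) L + (d * ∑ (\ _ -> 0) L + d * d * 1) ≡⟨ ∑-L' (\ q -> 𝟙 (E'? (shadow x) q)) ⟨
   # (E'? (shadow x)) L' ∎
   where
   lemma : ∀ c d -> d * (c + d) ≡ c * d + (0 + d * d * 1)
   lemma = solve-∀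
  at-apex : p ∈ apex ∷ [] -> d * N ≤ # (E'? p) L'
  at-apex (here refl) = begin
   d * N ≡⟨ cong (d *_) (sym (trans (∑-ones L) (size))) ⟩
   d * ∑ (\ _ -> 1) L ≤⟨ ≤-trans (m≤m+n _ (d * d * 0)) (m≤n+m _ (c * ∑ (\ _ -> 0) L)) ⟩
   c * ∑ (\ _ -> 0) L + (d * ∑ (\ _ -> 1) L + d * d * 0) ≡⟨ ∑-L' (\ q -> 𝟙 (E'? apex q)) ⟨
   # (E'? apex) L' ∎

 independent' : ∀ {P : Myc T -> Set} (P? : Decidable P) -> (∀ {p q} -> p ∈ L' -> q ∈ L' -> P p -> P q -> ¬ E' p q) -> # P? L' ≤ d * N
 independent' {P} P? ind = ≤-trans (≡⇒≤ (∑-L' (\ p -> 𝟙 (P? p)))) (go (P? apex))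
  where
  A? : Decidable (\ x -> P (base x))
  A? x = P? (base x)
  B? : Decidable (\ x -> P (shadow x))
  B? x = P? (shadow x)
  C? : Decidable (\ x -> P (shadow x) × ¬ P (base x))
  C? x = B? x ×? ¬? (A? x)
  A-independent : # A? L ≤ d
  A-independent = independent A? \ x∈ y∈ -> ind (base∈ x∈) (base∈ y∈)
  B≤ : # B? L ≤ # A? L + # C? L
  B≤ = #-⊎ B? A? C? L \ {x} _ b -> sort (A? x) b
   where
   sort : ∀ {x} -> Dec (P (base x)) -> P (shadow x) -> P (base x) ⊎ (P (shadow x) × ¬ P (base x))
   sort (yes a) b = inj₁ a
   sort (no ¬a) b = inj₂ (b , ¬a)
  -- A together with the neighbours of x in B is independent.
  row : ∀ {x} -> x ∈ L -> # A? L + # (\ y -> C? y ×? E? x y) L ≤ d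
  row {x} x∈ = ≤-trans (#-disjoint A? (\ y -> C? y ×? E? x y) R? L (\ _ -> inj₁) (\ _ ((b , _) , e) -> inj₂ (b , e)) (\ _ a ((_ , ¬a) , _) -> ¬a a))
   (independent R? \ y∈ z∈ -> apart y∈ z∈)
   where
   R? : ∀ y -> Dec (P (base y) ⊎ (P (shadow y) × E x y))
   R? y = A? y ⊎-dec (B? y ×? E? x y)
   apart : ∀ {y z} -> y ∈ L -> z ∈ L -> P (base y) ⊎ (P (shadow y) × E x y) -> P (base z) ⊎ (P (shadow z) × E x z) -> ¬ E y z
   apart y∈ z∈ (inj₁ a) (inj₁ a') = ind (base∈ y∈) (base∈ z∈) a a'
   apart y∈ z∈ (inj₁ a) (inj₂ (b , _)) = ind (base∈ y∈) (shadow∈ z∈) a b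
   apart y∈ z∈ (inj₂ (b , _)) (inj₁ a) = ind (shadow∈ y∈) (base∈ z∈) b a
   apart y∈ z∈ (inj₂ (_ , xy)) (inj₂ (_ , xz)) yz = triangle-free xy yz xz
  -- Summed over x, `row` counts A in full N times and every vertex of C at least d times. The left
  -- side dominates the weight of an independent set without the apex.
  rows : N * # A? L + d * # C? L ≤ N * d
  rows = begin
   N * # A? L + d * # C? L ≡⟨ cong₂ _+_ (sym (trans (∑-const (# A? L) L) (cong (_* # A? L) size))) (sym (∑-* d _ L)) ⟩
   ∑ (\ _ -> # A? L) L + ∑ (\ y -> d * 𝟙 (C? y)) L ≤⟨ +-monoʳ-≤ _ (∑-mono L \ {y} y∈ -> weigh y∈ (C? y)) ⟩
   ∑ (\ _ -> # A? L) L + ∑ (\ y -> ∑ (\ x -> 𝟙 (C? y ×? E? x y)) L) L ≡⟨ cong (∑ (\ _ -> # A? L) L +_) (∑-swap (\ y x -> 𝟙 (C? y ×? E? x y)) L L) ⟩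
   ∑ (\ _ -> # A? L) L + ∑ (\ x -> # (\ y -> C? y ×? E? x y) L) L ≡⟨ ∑-+ _ _ L ⟨
   ∑ (\ x -> # A? L + # (\ y -> C? y ×? E? x y) L) L ≤⟨ ∑-≤-const d L row ⟩
   length L * d ≡⟨ cong (_* d) size ⟩
   N * d ∎
   where
   weigh : ∀ {y Q} -> y ∈ L -> (D : Dec Q) -> d * 𝟙 D ≤ ∑ (\ x -> 𝟙 (D ×? E? x y)) L
   weigh {y} y∈ (yes q) = ≤-trans (≡⇒≤ (*-identityʳ d)) (≤-trans (degree y∈)
    (#-mono (E? y) (\ x -> yes q ×? E? x y) L \ _ e -> q , E-sym e))
   weigh y∈ (no _) = ≤-trans (≡⇒≤ (*-zeroʳ d)) z≤n
  go : (D : Dec (P apex)) -> c * # A? L + (d * # B? L + d * d * 𝟙 D) ≤ d * N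
  go (yes p) = begin
   c * # A? L + (d * # B? L + d * d * 1) ≤⟨ +-mono-≤ (*-monoʳ-≤ c A-independent) (+-monoˡ-≤ _ (≡⇒≤ (cong (d *_)
    (#-none B? L \ x∈ b -> ind (shadow∈ x∈) apex∈ b p tt)))) ⟩
   c * d + (d * 0 + d * d * 1) ≡⟨ lemma c d ⟩
   d * (c + d) ∎
   where
   lemma : ∀ c d -> c * d + (d * 0 + d * d * 1) ≡ d * (c + d)
   lemma = solve-∀
  go (no _) = begin
   c * # A? L + (d * # B? L + d * d * 0) ≤⟨ +-monoʳ-≤ (c * # A? L) (+-monoˡ-≤ (d * d * 0) (*-monoʳ-≤ d B≤)) ⟩
   c * # A? L + (d * (# A? L + # C? L) + d * d * 0) ≡⟨ lemma c d (# A? L) (# C? L) ⟩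
   N * # A? L + d * # C? L ≤⟨ rows ⟩
   N * d ≡⟨ *-comm N d ⟩
   d * N ∎
   where
   lemma : ∀ c d a b -> c * a + (d * (a + b) + d * d * 0) ≡ (c + d) * a + d * b
   lemma = solve-∀

 mycielski : Sys (N * N + d * d) (d * N)
 mycielski = record
  { T = Myc T ; _≟T_ = _≟'_ ; E = E' ; E? = E'? ; E-sym = \ {p} {q} -> E'-sym {p} {q} ; triangle-free = \ {p} {q} {r} -> E'-triangle-free {p} {q} {r}
  ; L = L' ; size = size' ; degree = degree' ; independent = independent' }

range : ℕ -> ℕ -> List ℕ
range a zero = []
range a (suc n) = a ∷ range (suc a) n

length-range : ∀ a n -> length (range a n) ≡ n
length-range a zero = refl
length-range a (suc n) = cong suc (length-range (suc a) n)

∈-range⁻ : ∀ a n {x} -> x ∈ range a n -> a ≤ x × x < a + n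
∈-range⁻ a (suc n) (here refl) = ≤-refl , m<m+n a (s≤s z≤n)
∈-range⁻ a (suc n) {x} (there m) = let p , q = ∈-range⁻ (suc a) n m in <⇒≤ p , subst (x <_) {suc (a + n)} {a + suc n} (sym (+-suc a n)) q

∈-range⁺ : ∀ a n {x} -> a ≤ x -> x < a + n -> x ∈ range a n
∈-range⁺ a zero p q = absurd (subst (_ <_) (+-identityʳ a) q) (≤⇒≯ p)
∈-range⁺ a (suc n) {x} p q with a ≟ x
... | yes refl = here refl
... | no a≢x = there (∈-range⁺ (suc a) n (≤∧≢⇒< p a≢x) (subst (x <_) (+-suc a n) q))

range-++ : ∀ a p q -> range a (p + q) ≡ range a p ++ range (a + p) q
range-++ a zero q = cong (\ b -> range b q) (sym (+-identityʳ a))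
range-++ a (suc p) q = cong (a ∷_) (trans (range-++ (suc a) p q) (cong (\ b -> range (suc a) p ++ range b q) (sym (+-suc a p))))

range-map : ∀ a c n -> range (a + c) n ≡ map (_+ c) (range a n)
range-map a c zero = refl
range-map a c (suc n) = cong (a + c ∷_) (range-map (suc a) c n)

∑-range-++ : ∀ f a p q -> ∑ f (range a (p + q)) ≡ ∑ f (range a p) + ∑ f (range (a + p) q)
∑-range-++ f a p q = trans (cong (∑ f) (range-++ a p q)) (∑-++ f (range a p) _)

module _ {P : ℕ -> Set} (P? : Decidable P) where

 interval-count : ∀ a n lo len -> a ≤ lo -> lo + len ≤ a + n -> (∀ {t} -> lo ≤ t -> t < lo + len -> P t) -> len ≤ # P? (range a n)
 interval-count a n lo len a≤ ≤n h = begin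
  len ≡⟨ length-range lo len ⟨
  length (range lo len) ≡⟨ #-all P? (range lo len) (\ m -> let p , q = ∈-range⁻ lo len m in h p q) ⟨
  # P? (range lo len) ≤⟨ ≤-trans (m≤m+n _ (# P? (range (lo + len) g))) (m≤n+m _ (# P? (range a f))) ⟩
  # P? (range a f) + (# P? (range lo len) + # P? (range (lo + len) g)) ≡⟨ cong (# P? (range a f) +_) (∑-range-++ _ lo len g) ⟨
  # P? (range a f) + # P? (range lo (len + g)) ≡⟨ cong (\ b -> # P? (range a f) + # P? (range b (len + g))) lo≡ ⟩
  # P? (range a f) + # P? (range (a + f) (len + g)) ≡⟨ ∑-range-++ _ a f (len + g) ⟨
  # P? (range a (f + (len + g))) ≡⟨ cong (\ n -> # P? (range a n)) n≡ ⟨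
  # P? (range a n) ∎
  where
  f = lo ∸ a
  lo≡ : lo ≡ a + f
  lo≡ = sym (m+[n∸m]≡n a≤)
  g = a + n ∸ (lo + len)
  n≡ : n ≡ f + (len + g)
  n≡ = +-cancelˡ-≡ a n (f + (len + g)) (trans (sym (m+[n∸m]≡n ≤n)) (trans (cong (\ b -> b + len + g) lo≡) (lemma a f len g)))
   where
   lemma : ∀ a f l g -> a + f + l + g ≡ a + (f + (l + g))
   lemma = solve-∀

 two-intervals : ∀ m len1 lo2 len2 -> len1 ≤ lo2 -> lo2 + len2 ≤ m -> (∀ {t} -> t < len1 -> P t) -> (∀ {t} -> lo2 ≤ t -> t < lo2 + len2 -> P t) ->
  len1 + len2 ≤ # P? (range 0 m)
 two-intervals m len1 lo2 len2 h h' p1 p2 = ≤-trans (+-mono-≤ (interval-count 0 len1 0 len1 z≤n ≤-refl \ _ -> p1)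
  (interval-count len1 g lo2 len2 h (≤-trans h' (≡⇒≤ m≡)) p2)) (≡⇒≤ (trans (sym (∑-range-++ _ 0 len1 g)) (cong (\ n -> # P? (range 0 n)) (sym m≡))))
  where
  g = m ∸ len1
  m≡ : m ≡ len1 + g
  m≡ = sym (m+[n∸m]≡n (≤-trans h (≤-trans (m≤m+n lo2 len2) h')))

 last-below : ∀ n -> (∃ \ p -> p < n × P p × ∀ {t} -> p < t -> t < n -> ¬ P t) ⊎ (∀ {t} -> t < n -> ¬ P t)
 last-below zero = inj₂ \ ()
 last-below (suc n) with P? n
 ... | yes p = inj₁ (n , ≤-refl , p , \ n<t t<sn _ -> <⇒≱ n<t (≤-pred t<sn))
 ... | no ¬p = [ (\ (p , p<n , pp , h) -> inj₁ (p , <-trans p<n ≤-refl , pp , \ {t} p<t t<sn -> below (t ≟ n) t<sn \ t<n -> h p<t t<n)) ,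
         (\ (h : ∀ {t} -> t < n -> ¬ P t) -> inj₂ \ {t} t<sn -> below (t ≟ n) t<sn h) ]′ (last-below n)
  where
  below : ∀ {t} -> Dec (t ≡ n) -> t < suc n -> (t < n -> ¬ P t) -> ¬ P t
  below (yes refl) _ _ = ¬p
  below (no t≢n) t<sn h = h (≤∧≢⇒< (≤-pred t<sn) t≢n)

#-point : ∀ p a n -> # (_≟ p) (range a n) ≤ 1
#-point p a zero = z≤n
#-point p a (suc n) with a ≟ p
... | yes refl = s≤s (≡⇒≤ (#-none (_≟ p) (range (suc a) n) \ m e -> <⇒≢ (proj₁ (∈-range⁻ (suc a) n m)) (sym e)))
... | no _ = #-point p (suc a) n

-- Two copies of ℤ/m, m = 2w + e. Points of the same copy are joined if their distance is at least w; s in the first copy is joined to s, …, s + w − 1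
-- in the second.
module Circular (w e : ℕ) (0<w : 0 < w) (e<w : e < w) where

 m : ℕ
 m = w + w + e

 -- Conditions on the circle expressed by representatives below m. `Gap s t` bounds both arcs
 -- between s and t from below by w; the second case of `Cross` is an interval that wraps around.
 Gap Far Cross : ℕ -> ℕ -> Set
 Gap s t = s + w ≤ t × t + w ≤ s + m
 Far s t = Gap s t ⊎ Gap t s
 Cross s t = (s ≤ t × t < s + w) ⊎ (t + m < s + w)

 Far? : ∀ s t -> Dec (Far s t)
 Far? s t = (s + w ≤? t ×? t + w ≤? s + m) ⊎-dec (t + w ≤? s ×? s + w ≤? t + m)

 Cross? : ∀ s t -> Dec (Cross s t)
 Cross? s t = (s ≤? t ×? t <? s + w) ⊎-dec (t + m <? s + w)

 far-sym : ∀ {s t} -> Far s t -> Far t s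
 far-sym (inj₁ h) = inj₂ h
 far-sym (inj₂ h) = inj₁ h

 impossible : ¬ 1 ≤ 0
 impossible ()

 -- Three arcs of length at least w do not fit on a circle of length less than 3w, which is where
 -- `e < w` enters.
 no-path : ∀ {x y z} -> Gap x y -> Gap y z -> Far x z -> ⊥
 no-path {x} {y} {z} (f1 , f2) (g1 , g2) (inj₁ (h1 , h2)) = impossible (lin (x ∷ w ∷ y ∷ z ∷ e ∷ []) (k 1 <: k 0) (v0 :+ v1 <: v2 by f1 & v2 :+ v1 <: v3 by g1 & v3 :+ v1 <: v0 :+ (v1 :+ v1 :+ v4) by h2 & k 1 :+ v4 <: v1 by e<w & □))
 no-path {x} {y} {z} (f1 , f2) (g1 , g2) (inj₂ (h1 , h2)) = impossible (lin-κ 2 (x ∷ w ∷ y ∷ z ∷ e ∷ []) (k 1 <: k 0) (v0 :+ v1 <: v2 by f1 & v2 :+ v1 <: v3 by g1 & v3 :+ v1 <: v0 by h1 & k 1 :+ v4 <: v1 by 3 · e<w & □))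

 far-triangle : ∀ {x y z} -> Far x y -> Far y z -> Far x z -> ⊥
 far-triangle (inj₁ f) (inj₁ g) h = no-path f g h
 far-triangle (inj₂ f) (inj₂ g) h = no-path g f (far-sym h)
 far-triangle (inj₁ f) (inj₂ g) (inj₁ h) = no-path h g (inj₁ f)
 far-triangle (inj₁ f) (inj₂ g) (inj₂ h) = no-path h f (inj₁ g)
 far-triangle (inj₂ f) (inj₁ g) (inj₁ h) = no-path f h (inj₁ g)
 far-triangle (inj₂ f) (inj₁ g) (inj₂ h) = no-path g h (inj₁ f)

 gap-cross : ∀ {x y z} -> x < m -> y < m -> Gap x y -> Cross x z -> Cross y z -> ⊥
 gap-cross {x} {y} {z} x< y< (f1 , f2) (inj₁ (g1 , g2)) (inj₁ (h1 , h2)) = impossible (lin (x ∷ w ∷ y ∷ z ∷ []) (k 1 <: k 0) (v0 :+ v1 <: v2 by f1 & k 1 :+ v3 <: v0 :+ v1 by g2 & v2 <: v3 by h1 & □))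
 gap-cross {x} {y} {z} x< y< (f1 , f2) (inj₁ (g1 , g2)) (inj₂ h1) = impossible (lin (y ∷ w ∷ x ∷ e ∷ z ∷ []) (k 1 <: k 0) (v0 :+ v1 <: v2 :+ (v1 :+ v1 :+ v3) by f2 & v2 <: v4 by g1 & k 1 :+ (v4 :+ (v1 :+ v1 :+ v3)) <: v0 :+ v1 by h1 & □))
 gap-cross {x} {y} {z} x< y< (f1 , f2) (inj₂ g1) (inj₁ (h1 , h2)) = impossible (lin-κ 1 (y ∷ w ∷ e ∷ x ∷ z ∷ []) (k 1 <: k 0) (k 1 :+ v0 <: v1 :+ v1 :+ v2 by y< & v3 :+ v1 <: v0 by f1 & k 1 :+ (v4 :+ (v1 :+ v1 :+ v2)) <: v3 :+ v1 by g1 & □))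
 gap-cross {x} {y} {z} x< y< (f1 , f2) (inj₂ g1) (inj₂ h1) = impossible (lin-κ 1 (y ∷ w ∷ e ∷ x ∷ z ∷ []) (k 1 <: k 0) (k 1 :+ v0 <: v1 :+ v1 :+ v2 by y< & v3 :+ v1 <: v0 by f1 & k 1 :+ (v4 :+ (v1 :+ v1 :+ v2)) <: v3 :+ v1 by g1 & □))

 far-cross : ∀ {x y z} -> x < m -> y < m -> Far x y -> Cross x z -> Cross y z -> ⊥
 far-cross x< y< (inj₁ f) g h = gap-cross x< y< f g h
 far-cross x< y< (inj₂ f) g h = gap-cross y< x< f h g

 cross-gap : ∀ {x y z} -> z < m -> Gap x y -> Cross z x -> Cross z y -> ⊥
 cross-gap {x} {y} {z} z< (f1 , f2) (inj₁ (g1 , g2)) (inj₁ (h1 , h2)) = impossible (lin (x ∷ w ∷ y ∷ z ∷ []) (k 1 <: k 0) (v0 :+ v1 <: v2 by f1 & v3 <: v0 by g1 & k 1 :+ v2 <: v3 :+ v1 by h2 & □))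
 cross-gap {x} {y} {z} z< (f1 , f2) (inj₁ (g1 , g2)) (inj₂ h1) = impossible (lin-κ 2 (x ∷ w ∷ y ∷ e ∷ z ∷ []) (k 1 <: k 0) (v0 :+ v1 <: v2 by 2 · f1 & v2 :+ v1 <: v0 :+ (v1 :+ v1 :+ v3) by f2 & v4 <: v0 by 3 · g1 & k 1 :+ v0 <: v4 :+ v1 by 2 · g2 & k 1 :+ (v2 :+ (v1 :+ v1 :+ v3)) <: v4 :+ v1 by h1 & □))
 cross-gap {x} {y} {z} z< (f1 , f2) (inj₂ g1) (inj₁ (h1 , h2)) = impossible (lin (y ∷ w ∷ x ∷ e ∷ z ∷ []) (k 1 <: k 0) (v0 :+ v1 <: v2 :+ (v1 :+ v1 :+ v3) by f2 & k 1 :+ (v2 :+ (v1 :+ v1 :+ v3)) <: v4 :+ v1 by g1 & v4 <: v0 by h1 & □))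
 cross-gap {x} {y} {z} z< (f1 , f2) (inj₂ g1) (inj₂ h1) = impossible (lin-κ 1 (z ∷ w ∷ e ∷ x ∷ y ∷ []) (k 1 <: k 0) (k 1 :+ v0 <: v1 :+ v1 :+ v2 by z< & v3 :+ v1 <: v4 by f1 & k 1 :+ (v4 :+ (v1 :+ v1 :+ v2)) <: v0 :+ v1 by h1 & □))

 cross-far : ∀ {x y z} -> z < m -> Far x y -> Cross z x -> Cross z y -> ⊥
 cross-far z< (inj₁ f) g h = cross-gap z< f g h
 cross-far z< (inj₂ f) g h = cross-gap z< f h g

 -- The far points form an arc of e + 1 points opposite to s. Depending on s, it is an interval
 -- above s, two pieces, or an interval below s.
 far-degree : ∀ {s} -> s < m -> e + 1 ≤ # (Far? s) (range 0 m)
 far-degree {s} s< = go (s <? w) (s + w ≤? m)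
  where
  go : Dec (s < w) -> Dec (s + w ≤ m) -> e + 1 ≤ # (Far? s) (range 0 m)
  go (yes s<w) _ = interval-count (Far? s) 0 m (s + w) (e + 1) z≤n (lin (s ∷ w ∷ e ∷ []) (v0 :+ v1 :+ (v2 :+ k 1) <: v1 :+ v1 :+ v2) (k 1 :+ v0 <: v1 by s<w & □))
   \ {t} lo hi -> inj₁ (lo , (lin (t ∷ s ∷ w ∷ e ∷ []) (v0 :+ v2 <: v1 :+ (v2 :+ v2 :+ v3)) (k 1 :+ v0 <: v1 :+ v2 :+ (v3 :+ k 1) by hi & □)))
  go (no w≤s) (yes s+w≤m) = ≤-trans (lin (s ∷ w ∷ j ∷ e ∷ g ∷ []) (v3 :+ k 1 <: v2 :+ k 1 :+ v4) (v0 <: v1 :+ v2 by≡ sym s≡ & v1 :+ v1 :+ v3 <: v0 :+ v1 :+ v4 by≡ sym g≡ & □))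
   (two-intervals (Far? s) m (j + 1) (s + w) g (lin (w ∷ j ∷ s ∷ []) (v1 :+ k 1 <: v2 :+ v0) (v0 :+ v1 <: v2 by≡ s≡ & k 1 :+ k 0 <: v0 by 0<w & □)) (lin (s ∷ w ∷ g ∷ e ∷ []) (v0 :+ v1 :+ v2 <: v1 :+ v1 :+ v3) (v0 :+ v1 :+ v2 <: v1 :+ v1 :+ v3 by≡ g≡ & □))
    (\ {t} hi -> inj₂ ((lin (t ∷ j ∷ w ∷ s ∷ []) (v0 :+ v2 <: v3) (k 1 :+ v0 <: v1 :+ k 1 by hi & v2 :+ v1 <: v3 by≡ s≡ & □)) , ≤-trans s+w≤m (m≤n+m m t)))
    (\ {t} lo hi -> inj₁ (lo , (lin (t ∷ s ∷ w ∷ g ∷ e ∷ []) (v0 :+ v2 <: v1 :+ (v2 :+ v2 :+ v4)) (k 1 :+ v0 <: v1 :+ v2 :+ v3 by hi & v1 :+ v2 :+ v3 <: v2 :+ v2 :+ v4 by≡ g≡ & v2 <: v1 by ≮⇒≥ w≤s & □)))))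
   where
   j = s ∸ w
   s≡ : w + j ≡ s
   s≡ = m+[n∸m]≡n (≮⇒≥ w≤s)
   g = m ∸ (s + w)
   g≡ : s + w + g ≡ m
   g≡ = m+[n∸m]≡n s+w≤m
  go (no w≤s) (no m<s+w) = interval-count (Far? s) 0 m j (e + 1) z≤n (lin (w ∷ e ∷ j ∷ s ∷ []) (v2 :+ (v1 :+ k 1) <: v0 :+ v0 :+ v1) (v0 :+ v0 :+ v1 :+ v2 <: v3 :+ v0 by≡ j≡ & k 1 :+ v3 <: v0 :+ v0 :+ v1 by s< & □))
   \ {t} lo hi -> inj₂ ((lin (t ∷ j ∷ e ∷ w ∷ s ∷ []) (v0 :+ v3 <: v4) (k 1 :+ v0 <: v1 :+ (v2 :+ k 1) by hi & v3 :+ v3 :+ v2 :+ v1 <: v4 :+ v3 by≡ j≡ & □)) , (lin (j ∷ t ∷ s ∷ w ∷ e ∷ []) (v2 :+ v3 <: v1 :+ (v3 :+ v3 :+ v4)) (v0 <: v1 by lo & v2 :+ v3 <: v3 :+ v3 :+ v4 :+ v0 by≡ sym j≡ & □)))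
   where
   j = s + w ∸ m
   j≡ : m + j ≡ s + w
   j≡ = m+[n∸m]≡n (<⇒≤ (≰⇒> m<s+w))

 cross-degree : ∀ {s} -> s < m -> w ≤ # (Cross? s) (range 0 m)
 cross-degree {s} s< = go (s + w ≤? m)
  where
  go : Dec (s + w ≤ m) -> w ≤ # (Cross? s) (range 0 m)
  go (yes h) = interval-count (Cross? s) 0 m s w z≤n h \ lo hi -> inj₁ (lo , hi)
  go (no h) = ≤-trans (lin (s ∷ w ∷ e ∷ j ∷ r ∷ []) (v1 <: v3 :+ v4) (v0 :+ v1 <: v1 :+ v1 :+ v2 :+ v3 by≡ sym j≡ & v1 :+ v1 :+ v2 <: v0 :+ v4 by≡ sym r≡ & □))
   (two-intervals (Cross? s) m j s r (lin (w ∷ e ∷ j ∷ s ∷ []) (v2 <: v3) (v0 :+ v0 :+ v1 :+ v2 <: v3 :+ v0 by≡ j≡ & □)) (≡⇒≤ r≡)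
    (\ {t} hi -> inj₂ (lin (t ∷ j ∷ w ∷ e ∷ s ∷ []) (k 1 :+ (v0 :+ (v2 :+ v2 :+ v3)) <: v4 :+ v2) (k 1 :+ v0 <: v1 by hi & v2 :+ v2 :+ v3 :+ v1 <: v4 :+ v2 by≡ j≡ & □)))
    (\ {t} lo hi -> inj₁ (lo , (lin (t ∷ s ∷ r ∷ w ∷ e ∷ []) (k 1 :+ v0 <: v1 :+ v3) (k 1 :+ v0 <: v1 :+ v2 by hi & v1 :+ v2 <: v3 :+ v3 :+ v4 by≡ r≡ & k 1 :+ (v3 :+ v3 :+ v4) <: v1 :+ v3 by ≰⇒> h & □)))))
   where
   j = s + w ∸ m
   j≡ : m + j ≡ s + w
   j≡ = m+[n∸m]≡n (<⇒≤ (≰⇒> h))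
   r = m ∸ s
   r≡ : s + r ≡ m
   r≡ = m+[n∸m]≡n (<⇒≤ s<)

 cross-codegree : ∀ {t} -> t < m -> w ≤ # (\ s -> Cross? s t) (range 0 m)
 cross-codegree {t} t< = go (w ≤? t + 1)
  where
  go : Dec (w ≤ t + 1) -> w ≤ # (\ s -> Cross? s t) (range 0 m)
  go (yes h) = interval-count (\ s -> Cross? s t) 0 m j w z≤n (lin (w ∷ j ∷ t ∷ e ∷ []) (v1 :+ v0 <: v0 :+ v0 :+ v3) (v0 :+ v1 <: v2 :+ k 1 by≡ j≡ & k 1 :+ v2 <: v0 :+ v0 :+ v3 by t< & □))
   \ {s} lo hi -> inj₁ ((lin (s ∷ j ∷ w ∷ t ∷ []) (v0 <: v3) (k 1 :+ v0 <: v1 :+ v2 by hi & v2 :+ v1 <: v3 :+ k 1 by≡ j≡ & □)) , (lin (j ∷ s ∷ t ∷ w ∷ []) (k 1 :+ v2 <: v1 :+ v3) (v0 <: v1 by lo & v2 :+ k 1 <: v3 :+ v0 by≡ sym j≡ & □)))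
   where
   j = t + 1 ∸ w
   j≡ : w + j ≡ t + 1
   j≡ = m+[n∸m]≡n h
  go (no h) = ≤-trans (≡⇒≤ (sym j≡)) (two-intervals (\ s -> Cross? s t) m (t + 1) (w + e + (t + 1)) j (m≤n+m (t + 1) (w + e))
    (lin (t ∷ j ∷ w ∷ e ∷ []) (v2 :+ v3 :+ (v0 :+ k 1) :+ v1 <: v2 :+ v2 :+ v3) (v0 :+ k 1 :+ v1 <: v2 by≡ j≡ & □))
    (\ {s} hi -> inj₁ ((lin (s ∷ t ∷ []) (v0 <: v1) (k 1 :+ v0 <: v1 :+ k 1 by hi & □)) , (lin (t ∷ w ∷ s ∷ []) (k 1 :+ v0 <: v2 :+ v1) (k 1 :+ (v0 :+ k 1) <: v1 by ≰⇒> h & □))))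
    (\ {s} lo hi -> inj₂ (lin (w ∷ e ∷ t ∷ s ∷ []) (k 1 :+ (v2 :+ (v0 :+ v0 :+ v1)) <: v3 :+ v0) (v0 :+ v1 :+ (v2 :+ k 1) <: v3 by lo & □))))
   where
   j = w ∸ (t + 1)
   j≡ : t + 1 + j ≡ w
   j≡ = m+[n∸m]≡n (<⇒≤ (≰⇒> h))

 module _ {P : ℕ -> Set} (P? : Decidable P) where

  -- x and x + w are never both in P, so P fills at most half of ℤ/m.
  far-free : (∀ {s t} -> s < m -> t < m -> P s -> P t -> ¬ Far s t) -> # P? (range 0 m) ≤ w + e + 1
  far-free ind = *-cancelˡ-≤ 2 (lin ((# P? (range 0 (w + e))) ∷ (# P? (range w (w + e))) ∷ w ∷ e ∷ (# P? (range 0 w)) ∷ (# P? (range (w + e) w)) ∷ (# P? (range 0 m)) ∷ []) (2 :* v6 <: 2 :* (v2 :+ v3 :+ k 1)) (v0 :+ v1 <: v2 :+ v3 by first & v4 :+ v5 <: v2 by second & v6 <: v4 :+ v1 by≡ split1 & v6 <: v0 :+ v5 by≡ split2 & □))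
   where
   split1 : # P? (range 0 m) ≡ # P? (range 0 w) + # P? (range w (w + e))
   split1 = trans (cong (\ n -> # P? (range 0 n)) (+-assoc w w e)) (∑-range-++ _ 0 w (w + e))
   split2 : # P? (range 0 m) ≡ # P? (range 0 (w + e)) + # P? (range (w + e) w)
   split2 = trans (cong (\ n -> # P? (range 0 n)) (trans (+-assoc w w e) (+-comm w (w + e)))) (∑-range-++ _ 0 (w + e) w)
   paired : ∀ c n -> (∀ {t} -> t < n -> P t -> P (t + c) -> ⊥) -> # P? (range 0 n) + # P? (range c n) ≤ n
   paired c n h = ≤-trans (≡⇒≤ (trans (cong (# P? (range 0 n) +_) (trans (cong (# P?) (range-map 0 c n)) (∑-map _ (_+ c) (range 0 n)))) (sym (∑-+ _ _ (range 0 n)))))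
    (≤-trans (∑-≤-const 1 (range 0 n) \ {t} m -> one (P? t) (P? (t + c)) (h (proj₂ (∈-range⁻ 0 n m)))) (≡⇒≤ (trans (*-identityʳ _) (length-range 0 n))))
    where
    one : ∀ {A B : Set} (a : Dec A) (b : Dec B) -> (A -> B -> ⊥) -> 𝟙 a + 𝟙 b ≤ 1
    one (yes a) (yes b) h = ⊥-elim (h a b)
    one (yes _) (no _) h = ≤-refl
    one (no _) b h = 𝟙≤1 b
   first : # P? (range 0 (w + e)) + # P? (range w (w + e)) ≤ w + e
   first = paired w (w + e) \ {t} t< p q -> ind (lin (t ∷ w ∷ e ∷ []) (k 1 :+ v0 <: v1 :+ v1 :+ v2) (k 1 :+ v0 <: v1 :+ v2 by t< & □)) (lin (t ∷ w ∷ e ∷ []) (k 1 :+ (v0 :+ v1) <: v1 :+ v1 :+ v2) (k 1 :+ v0 <: v1 :+ v2 by t< & □)) p q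
    (inj₁ (≤-refl , (lin (t ∷ w ∷ e ∷ []) (v0 :+ v1 :+ v1 <: v0 :+ (v1 :+ v1 :+ v2)) (□))))
   second : # P? (range 0 w) + # P? (range (w + e) w) ≤ w
   second = paired (w + e) w \ {t} t< p q -> ind (lin (t ∷ w ∷ e ∷ []) (k 1 :+ v0 <: v1 :+ v1 :+ v2) (k 1 :+ v0 <: v1 by t< & □)) (lin (t ∷ w ∷ e ∷ []) (k 1 :+ (v0 :+ (v1 :+ v2)) <: v1 :+ v1 :+ v2) (k 1 :+ v0 <: v1 by t< & □)) p q
    (inj₁ ((lin (t ∷ w ∷ e ∷ []) (v0 :+ v1 <: v0 :+ (v1 :+ v2)) (□)) , (lin (t ∷ w ∷ e ∷ []) (v0 :+ (v1 :+ v2) :+ v1 <: v0 :+ (v1 :+ v1 :+ v2)) (□))))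

  module _ {Q : ℕ -> Set} (Q? : Decidable Q) (ind : ∀ {s t} -> s < m -> t < m -> P s -> Q t -> ¬ Cross s t) where

   -- For the last p in P before some q in Q, the w - 1 points after p belong neither to P nor to Q.
   last-before : ∀ {p0 q} -> p0 < m -> P p0 -> q < m -> Q q -> ∃ \ p -> p < m × P p × (∀ {t} -> t < m -> P t -> Cross p t -> t ≡ p)
   last-before {p0} {q} p0< pp0 q< qq = [ before , wrapped ]′ (last-below P? q)
    where
    unless : ∀ {p t} -> ¬ p < t -> p ≤ t -> t ≡ p
    unless h le = ≤-antisym (≮⇒≥ h) le
    before : (∃ \ p -> p < q × P p × ∀ {t} -> p < t -> t < q -> ¬ P t) -> ∃ \ p -> p < m × P p × (∀ {t} -> t < m -> P t -> Cross p t -> t ≡ p)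
    before (p , p<q , pp , h) = p , <-trans p<q q< , pp , \ { {t} t< pt (inj₁ (p≤t , t<p+w)) -> unless (\ p<t -> h p<t (<-≤-trans t<p+w beyond) pt) p≤t
                                ; {t} t< pt (inj₂ c) -> ⊥-elim (impossible (lin-κ 1 (t ∷ w ∷ e ∷ p ∷ q ∷ []) (k 1 <: k 0) (k 1 :+ (v0 :+ (v1 :+ v1 :+ v2)) <: v3 :+ v1 by c & v3 :+ v1 <: v4 by beyond & k 1 :+ v4 <: v1 :+ v1 :+ v2 by q< & □))) }
     where
     beyond : p + w ≤ q
     beyond = ≮⇒≥ \ q<p+w -> ind (<-trans p<q q<) q< pp qq (inj₁ (<⇒≤ p<q , q<p+w))
    wrapped : (∀ {t} -> t < q -> ¬ P t) -> ∃ \ p -> p < m × P p × (∀ {t} -> t < m -> P t -> Cross p t -> t ≡ p)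
    wrapped none-before = [ at , (\ (h : ∀ {t} -> t < m -> ¬ P t) -> absurd pp0 (h p0<)) ]′ (last-below P? m)
     where
     at : (∃ \ p -> p < m × P p × ∀ {t} -> p < t -> t < m -> ¬ P t) -> ∃ \ p -> p < m × P p × (∀ {t} -> t < m -> P t -> Cross p t -> t ≡ p)
     at (p , p< , pp , h) = p , p< , pp , \ { {t} t< pt (inj₁ (p≤t , _)) -> unless (\ p<t -> h p<t t< pt) p≤t
                        ; {t} t< pt (inj₂ c) -> ⊥-elim (none-before (lin (t ∷ w ∷ e ∷ p ∷ q ∷ []) (k 1 :+ v0 <: v4) (k 1 :+ (v0 :+ (v1 :+ v1 :+ v2)) <: v3 :+ v1 by c & v3 :+ v1 <: v4 :+ (v1 :+ v1 :+ v2) by beyond & □)) pt) }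
      where
      beyond : p + w ≤ q + m
      beyond = ≮⇒≥ \ c -> ind p< q< pp qq (inj₂ c)

   -- The w points from p on contain no point of Q and none of P except p, and P and Q are disjoint;
   -- hence `|P| + |Q| + w ≤ m + 1`.
   cross-free : ∀ {p0 q} -> p0 < m -> P p0 -> q < m -> Q q -> # P? (range 0 m) + # Q? (range 0 m) ≤ w + e + 1
   cross-free p0< pp0 q< qq = go (last-before p0< pp0 q< qq)
    where
    go : (∃ \ p -> p < m × P p × (∀ {t} -> t < m -> P t -> Cross p t -> t ≡ p)) -> # P? (range 0 m) + # Q? (range 0 m) ≤ w + e + 1
    go (p , p< , pp , only) = (lin (w ∷ (# (Cross? p) (range 0 m)) ∷ (# (_≟ p) (range 0 m)) ∷ (# P? (range 0 m)) ∷ (# Q? (range 0 m)) ∷ (1 * length (range 0 m)) ∷ e ∷ []) (v3 :+ v4 <: v0 :+ v6 :+ k 1) (v0 <: v1 by cross-degree p< & v2 <: k 1 by #-point p 0 m & v3 :+ v4 :+ v1 <: v5 :+ v2 by (∑-linear ((\ t -> 𝟙 (P? t)) ∷ (\ t -> 𝟙 (Q? t)) ∷ (\ t -> 𝟙 (Cross? p t)) ∷ (\ t -> 𝟙 (t ≟ p)) ∷ []) (v0 :+ v1 :+ v2 <: k 1 :+ v3) (range 0 m) \ {t} t∈ -> pointwise (proj₂ (∈-range⁻ 0 m t∈)) (P? t) (Q? t) (Cross? p t) (t ≟ p)) & v5 <: v0 :+ v0 :+ v6 by≡ trans (*-identityˡ _) (length-range 0 m) & □))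
     where
     pointwise : ∀ {t} -> t < m -> (a : Dec (P t)) (b : Dec (Q t)) (c : Dec (Cross p t)) (d : Dec (t ≡ p)) -> 𝟙 a + 𝟙 b + 𝟙 c ≤ 1 + 𝟙 d
     pointwise {t} t< (yes a) (yes b) _ _ = ⊥-elim (ind t< t< a b (inj₁ (≤-refl , m<m+n t 0<w)))
     pointwise t< _ (yes b) (yes c) _ = ⊥-elim (ind p< t< pp b c)
     pointwise t< (yes a) (no _) (yes c) (yes _) = ≤-refl
     pointwise t< (yes a) (no _) (yes c) (no ne) = absurd (only t< a c) ne
     pointwise t< (yes _) (no _) (no _) d = s≤s z≤n
     pointwise t< (no _) (yes _) (no _) d = s≤s z≤n
     pointwise t< (no _) (no _) c d = ≤-trans (𝟙≤1 c) (s≤s z≤n)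

 T : Set
 T = Bool × ℕ

 E : T -> T -> Set
 E (false , s) (true , t) = s < m × t < m × Cross s t
 E (true , t) (false , s) = s < m × t < m × Cross s t
 E (false , s) (false , t) = s < m × t < m × Far s t
 E (true , s) (true , t) = s < m × t < m × Far s t

 E? : ∀ x y -> Dec (E x y)
 E? (false , s) (true , t) = s <? m ×? (t <? m ×? Cross? s t)
 E? (true , t) (false , s) = s <? m ×? (t <? m ×? Cross? s t)
 E? (false , s) (false , t) = s <? m ×? (t <? m ×? Far? s t)
 E? (true , s) (true , t) = s <? m ×? (t <? m ×? Far? s t)

 E-sym : ∀ {x y} -> E x y -> E y x
 E-sym {false , _} {true , _} h = h
 E-sym {true , _} {false , _} h = h
 E-sym {false , _} {false , _} (p , q , f) = q , p , far-sym f
 E-sym {true , _} {true , _} (p , q , f) = q , p , far-sym f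

 E-triangle-free : ∀ {x y z} -> E x y -> E y z -> E x z -> ⊥
 E-triangle-free {false , x} {false , y} {false , z} (_ , _ , f) (_ , _ , g) (_ , _ , h) = far-triangle f g h
 E-triangle-free {true , x} {true , y} {true , z} (_ , _ , f) (_ , _ , g) (_ , _ , h) = far-triangle f g h
 E-triangle-free {false , x} {false , y} {true , z} (x< , y< , f) (_ , _ , g) (_ , _ , h) = far-cross x< y< f h g
 E-triangle-free {false , x} {true , y} {false , z} (x< , _ , f) (z< , _ , g) (_ , _ , h) = far-cross x< z< h f g
 E-triangle-free {true , x} {false , y} {false , z} (y< , _ , f) (_ , z< , g) (_ , _ , h) = far-cross y< z< g f h
 E-triangle-free {false , x} {true , y} {true , z} (x< , _ , f) (_ , _ , g) (_ , _ , h) = cross-far x< g f h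
 E-triangle-free {true , x} {false , y} {true , z} (y< , _ , f) (_ , _ , g) (_ , _ , h) = cross-far y< h f g
 E-triangle-free {true , x} {true , y} {false , z} (_ , _ , f) (z< , _ , g) (_ , _ , h) = cross-far z< f h g

 L : List T
 L = map (false ,_) (range 0 m) ++ map (true ,_) (range 0 m)

 ∑-L : ∀ f -> ∑ f L ≡ ∑ (\ s -> f (false , s)) (range 0 m) + ∑ (\ s -> f (true , s)) (range 0 m)
 ∑-L f = trans (∑-++ f (map (false ,_) (range 0 m)) _) (cong₂ _+_ (∑-map f (false ,_) (range 0 m)) (∑-map f (true ,_) (range 0 m)))

 in-range : ∀ {s} -> s ∈ range 0 m -> s < m
 in-range h = proj₂ (∈-range⁻ 0 m h)

 ∈-L : ∀ b {s} -> s < m -> (b , s) ∈ L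
 ∈-L false h = ∈-++⁺ˡ (∈-map⁺ (false ,_) (∈-range⁺ 0 m z≤n h))
 ∈-L true h = ∈-++⁺ʳ (map (false ,_) (range 0 m)) (∈-map⁺ (true ,_) (∈-range⁺ 0 m z≤n h))

 degree-false : ∀ {s} -> s < m -> w + e + 1 ≤ # (E? (false , s)) L
 degree-false {s} s< = subst (w + e + 1 ≤_) (sym (∑-L _)) (lin (e ∷ (# (Far? s) (range 0 m)) ∷ w ∷ (# (Cross? s) (range 0 m)) ∷ (# (\ t -> E? (false , s) (false , t)) (range 0 m)) ∷ (# (\ t -> E? (false , s) (true , t)) (range 0 m)) ∷ []) (v2 :+ v0 :+ k 1 <: v4 :+ v5) (v0 :+ k 1 <: v1 by far-degree s< & v2 <: v3 by cross-degree s< & v1 <: v4 by (#-mono (Far? s) (\ t -> E? (false , s) (false , t)) (range 0 m) \ t∈ f -> s< , in-range t∈ , f) & v3 <: v5 by (#-mono (Cross? s) (\ t -> E? (false , s) (true , t)) (range 0 m) \ t∈ f -> s< , in-range t∈ , f) & □))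

 degree-true : ∀ {s} -> s < m -> w + e + 1 ≤ # (E? (true , s)) L
 degree-true {s} s< = subst (w + e + 1 ≤_) (sym (∑-L _)) (lin (e ∷ (# (Far? s) (range 0 m)) ∷ w ∷ (# (\ t -> Cross? t s) (range 0 m)) ∷ (# (\ t -> E? (true , s) (true , t)) (range 0 m)) ∷ (# (\ t -> E? (true , s) (false , t)) (range 0 m)) ∷ []) (v2 :+ v0 :+ k 1 <: v5 :+ v4) (v0 :+ k 1 <: v1 by far-degree s< & v2 <: v3 by cross-codegree s< & v1 <: v4 by (#-mono (Far? s) (\ t -> E? (true , s) (true , t)) (range 0 m) \ t∈ f -> s< , in-range t∈ , f) & v3 <: v5 by (#-mono (\ t -> Cross? t s) (\ t -> E? (true , s) (false , t)) (range 0 m) \ t∈ f -> in-range t∈ , s< , f) & □))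

 degree : ∀ {x} -> x ∈ L -> w + e + 1 ≤ # (E? x) L
 degree {x} x∈ = [ (\ h -> at-false (∈-map⁻ (false ,_) h)) , (\ h -> at-true (∈-map⁻ (true ,_) h)) ]′ (∈-++⁻ (map (false ,_) (range 0 m)) x∈)
  where
  at-false : (∃ \ s -> s ∈ range 0 m × x ≡ (false , s)) -> w + e + 1 ≤ # (E? x) L
  at-false (s , s∈ , refl) = degree-false (in-range s∈)
  at-true : (∃ \ s -> s ∈ range 0 m × x ≡ (true , s)) -> w + e + 1 ≤ # (E? x) L
  at-true (s , s∈ , refl) = degree-true (in-range s∈)

 independent : ∀ {P : T -> Set} (P? : Decidable P) -> (∀ {x y} -> x ∈ L -> y ∈ L -> P x -> P y -> ¬ E x y) -> # P? L ≤ w + e + 1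
 independent {P} P? ind = ≤-trans (≡⇒≤ (∑-L (\ x -> 𝟙 (P? x)))) (go (search A? (range 0 m)) (search B? (range 0 m)))
  where
  A? : Decidable (\ s -> P (false , s))
  A? s = P? (false , s)
  B? : Decidable (\ s -> P (true , s))
  B? s = P? (true , s)
  go : Dec (∃ \ s -> s ∈ range 0 m × P (false , s)) -> Dec (∃ \ s -> s ∈ range 0 m × P (true , s)) -> # A? (range 0 m) + # B? (range 0 m) ≤ w + e + 1
  go (yes (s , s∈ , a)) (yes (t , t∈ , b)) = cross-free A? B? (\ s< t< a b c -> ind (∈-L false s<) (∈-L true t<) a b (s< , t< , c)) (in-range s∈) a (in-range t∈) b
  go (no h) _ = ≤-trans (≡⇒≤ (cong (_+ # B? (range 0 m)) (#-none A? (range 0 m) \ m a -> h (_ , m , a))))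
   (far-free B? \ s< t< b b' f -> ind (∈-L true s<) (∈-L true t<) b b' (s< , t< , f))
  go _ (no h) = ≤-trans (≡⇒≤ (trans (cong (# A? (range 0 m) +_) (#-none B? (range 0 m) \ m b -> h (_ , m , b))) (+-identityʳ _)))
   (far-free A? \ s< t< a a' f -> ind (∈-L false s<) (∈-L false t<) a a' (s< , t< , f))

 size : length L ≡ m + m
 size = trans (sym (∑-ones L)) (trans (∑-L (\ _ -> 1)) (cong₂ _+_ ones ones))
  where
  ones : ∑ (\ _ -> 1) (range 0 m) ≡ m
  ones = trans (∑-ones (range 0 m)) ((length-range 0 m))

 circular : Sys (m + m) (w + e + 1)
 circular = record
  { T = T ; _≟T_ = ×-≡-dec Bool._≟_ _≟_ ; E = E ; E? = E? ; E-sym = \ {x} {y} -> E-sym {x} {y} ; triangle-free = \ {x} {y} {z} -> E-triangle-free {x} {y} {z}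
  ; L = L ; size = size
  ; degree = degree ; independent = independent }

-- Consecutive members of a chain differ by at most 1/Q in the ratio N/d, and the last ratio reaches the first one of the Mycielski graphs of the members.
record Chain (Q K : ℕ) : Set1 where
 field
  N d : ℕ -> ℕ
  sys : ∀ {i} -> i ≤ K -> Sys (N i) (d i)
  positive : ∀ {i} -> i ≤ K -> 0 < d i
  proper : ∀ {i} -> i ≤ K -> d i < N i
  close : ∀ {i} -> i < K -> Q * (N (suc i) * d i) ≤ Q * (N i * d (suc i)) + d i * d (suc i)
  loop : (N 0 * N 0 + d 0 * d 0) * d K ≤ N K * (d 0 * N 0)

mycielski-sys : ∀ {N d} -> 0 < d -> d < N -> Sys N d -> Sys (N * N + d * d) (d * N)
mycielski-sys {N} {d} 0<d d<N s = subst (\ n -> Sys (n * n + d * d) (d * n)) e (Mycielski.mycielski (subst (\ n -> Sys n d) (sym e) s) (m<n⇒0<n∸m d<N) 0<d)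
 where
 e : N ∸ d + d ≡ N
 e = m∸n+n≡m (<⇒≤ d<N)

rearrangement : ∀ {a b p q} -> b ≤ a -> p ≤ q -> a * p + b * q ≤ a * q + b * p
rearrangement {a} {b} {p} {q} b≤a p≤q = subst₂ (\ a q -> a * p + b * q ≤ a * q + b * p) (m+[n∸m]≡n b≤a) (m+[n∸m]≡n p≤q)
 (≤-trans (m≤m+n _ ((a ∸ b) * (q ∸ p))) (≡⇒≤ (lemma b (a ∸ b) p (q ∸ p))))
 where
 lemma : ∀ b y p x -> (b + y) * p + b * (p + x) + y * x ≡ (b + y) * (p + x) + b * p
 lemma = solve-∀

mycielski-cross : ∀ N d N' d' -> (N' * N' + d' * d') * (d * N) ≡ N * N' * (N' * d) + d * d' * (N * d')
mycielski-cross = solve-∀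

mycielski-cross' : ∀ N d N' d' -> N * N' * (N * d') + d * d' * (N' * d) ≡ (N * N + d * d) * (d' * N')
mycielski-cross' = solve-∀

-- W + 1/W increases for W at least 1; with denominators cleared this is the rearrangement
-- inequality.
mycielski-monotone : ∀ {N d N' d'} -> d ≤ N -> d' ≤ N' -> N' * d ≤ N * d' -> (N' * N' + d' * d') * (d * N) ≤ (N * N + d * d) * (d' * N')
mycielski-monotone {N} {d} {N'} {d'} h h' p≤q = ≤-trans (≡⇒≤ (mycielski-cross N d N' d'))
 (≤-trans (rearrangement (*-mono-≤ h h') p≤q) (≡⇒≤ (mycielski-cross' N d N' d')))

-- W + 1/W is non-expanding in W = N/d ≥ 1.
mycielski-close : ∀ Q {N d N' d'} -> d ≤ N -> d' ≤ N' -> Q * (N' * d) ≤ Q * (N * d') + d * d' ->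
 Q * ((N' * N' + d' * d') * (d * N)) ≤ Q * ((N * N + d * d) * (d' * N')) + d * N * (d' * N')
mycielski-close Q {N} {d} {N'} {d'} h h' c = go (≤-total (N' * d) (N * d'))
 where
 a = N * N'
 b = d * d'
 q = N * d'
 go : N' * d ≤ q ⊎ q ≤ N' * d -> Q * ((N' * N' + d' * d') * (d * N)) ≤ Q * ((N * N + d * d) * (d' * N')) + d * N * (d' * N')
 go (inj₁ le) = ≤-trans (*-monoʳ-≤ Q (mycielski-monotone h h' le)) (m≤m+n _ (d * N * (d' * N')))
 go (inj₂ le) = begin
  Q * ((N' * N' + d' * d') * (d * N)) ≡⟨ cong (Q *_) (trans (mycielski-cross N d N' d') (cong₂ (\ s t -> s * t + b * q) (sym a≡) (sym p≡))) ⟩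
  Q * ((b + y) * (q + x) + b * q) ≡⟨ lemma Q b y q x ⟩
  Q * ((b + y) * q + b * (q + x)) + Q * x * y ≤⟨ +-monoʳ-≤ _ (*-mono-≤ Qx≤b (m≤n+m y b)) ⟩
  Q * ((b + y) * q + b * (q + x)) + b * (b + y) ≡⟨ cong₂ (\ s t -> Q * (s * q + b * t) + b * s) a≡ p≡ ⟩
  Q * (a * q + b * (N' * d)) + b * a ≡⟨ cong₂ (\ s t -> Q * s + t) (mycielski-cross' N d N' d') (swap d d' N N') ⟩
  Q * ((N * N + d * d) * (d' * N')) + d * N * (d' * N') ∎
  where
  x = N' * d ∸ q
  y = a ∸ b
  p≡ : q + x ≡ N' * d
  p≡ = m+[n∸m]≡n le
  a≡ : b + y ≡ a
  a≡ = m+[n∸m]≡n (*-mono-≤ h h')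
  Qx≤b : Q * x ≤ b
  Qx≤b = +-cancelˡ-≤ (Q * q) _ _ (≤-trans (≡⇒≤ (trans (sym (*-distribˡ-+ Q q x)) (cong (Q *_) p≡))) c)
  lemma : ∀ Q b y q x -> Q * ((b + y) * (q + x) + b * q) ≡ Q * ((b + y) * q + b * (q + x)) + Q * x * y
  lemma = solve-∀
  swap : ∀ d e N M -> d * e * (N * M) ≡ d * N * (e * M)
  swap = solve-∀

-- Closeness survives because W + 1/W is non-expanding, and `loop` because it is increasing.
mycielski-chain : ∀ {Q K} -> Chain Q K -> Chain Q K
mycielski-chain {Q} {K} 𝒞 = record
 { N = \ i -> N i * N i + d i * d i
 ; d = \ i -> d i * N i
 ; sys = \ i≤ -> mycielski-sys (positive i≤) (proper i≤) (sys i≤)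
 ; positive = \ i≤ -> *-mono-< (positive i≤) (≤-<-trans z≤n (proper i≤))
 ; proper = \ {i} i≤ -> <-≤-trans (*-monoˡ-< (N i) {{>-nonZero (≤-<-trans z≤n (proper i≤))}} (proper i≤)) (m≤m+n (N i * N i) _)
 ; close = \ {i} i< -> mycielski-close Q (<⇒≤ (proper (<⇒≤ i<))) (<⇒≤ (proper i<)) (close i<)
 ; loop = mycielski-monotone {N K} {d K} {N 0 * N 0 + d 0 * d 0} {d 0 * N 0} (<⇒≤ (proper ≤-refl))
   (≤-trans (*-monoˡ-≤ (N 0) (<⇒≤ (proper z≤n))) (m≤m+n (N 0 * N 0) _)) loop
 }
 where open Chain 𝒞

module _ (P Q : ℕ) where

 Between : Set1
 Between = ∃₂ \ N d -> Sys N d × 0 < d × d < N × P * d ≤ Q * N × Q * N ≤ (P + 1) * d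

 -- Steps of at most 1/Q cannot jump over the window from P/Q to (P + 1)/Q.
 scan : ∀ {K} (𝒞 : Chain Q K) -> ∀ g i -> i + g ≡ K -> Q * Chain.N 𝒞 i ≤ P * Chain.d 𝒞 i -> Between ⊎ Q * Chain.N 𝒞 K ≤ P * Chain.d 𝒞 K
 scan 𝒞 zero i refl h = inj₂ (subst (\ j -> Q * Chain.N 𝒞 j ≤ P * Chain.d 𝒞 j) (sym (+-identityʳ i)) h)
 scan {K} 𝒞 (suc g) i e h = go (P * d (suc i) ≤? Q * N (suc i))
  where
  open Chain 𝒞
  i<K : i < K
  i<K = m+n≤o⇒m≤o (suc i) (≡⇒≤ (trans (sym (+-suc i g)) e))
  go : Dec (P * d (suc i) ≤ Q * N (suc i)) -> Between ⊎ Q * N K ≤ P * d K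
  go (no ¬le) = scan 𝒞 g (suc i) (trans (sym (+-suc i g)) e) (<⇒≤ (≰⇒> ¬le))
  go (yes le) = inj₁ (N (suc i) , d (suc i) , sys i<K , positive i<K , proper i<K , le , *-cancelʳ-≤ _ _ (d i) {{>-nonZero (positive (<⇒≤ i<K))}} (begin
   Q * N (suc i) * d i ≡⟨ *-assoc Q (N (suc i)) (d i) ⟩
   Q * (N (suc i) * d i) ≤⟨ close i<K ⟩
   Q * (N i * d (suc i)) + d i * d (suc i) ≡⟨ cong (_+ d i * d (suc i)) (*-assoc Q (N i) (d (suc i))) ⟨
   Q * N i * d (suc i) + d i * d (suc i) ≤⟨ +-monoˡ-≤ _ (*-monoˡ-≤ (d (suc i)) h) ⟩
   P * d i * d (suc i) + d i * d (suc i) ≡⟨ lemma P (d i) (d (suc i)) ⟩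
   (P + 1) * d (suc i) * d i ∎))
   where
   lemma : ∀ P d e -> P * d * e + d * e ≡ (P + 1) * e * d
   lemma = solve-∀

 -- Each Mycielski step increases the first ratio N/d by d/N ≥ Q/P as long as it is at most P/Q.
 climb : ∀ {K} -> 0 < P -> 0 < Q -> (𝒞 : Chain Q K) -> ∀ fuel j -> fuel + j ≡ P * P -> Q * Chain.N 𝒞 0 ≤ P * Chain.d 𝒞 0 ->
  P * Chain.d 𝒞 0 + j * (Q * Chain.d 𝒞 0) ≤ P * Chain.N 𝒞 0 -> Between
 climb {K} 0<P 0<Q 𝒞 fuel j e head growth = go fuel e (scan 𝒞 K 0 refl head)
  where
  open Chain 𝒞
  -- If the chain ends below P/Q, then by `loop` the next one starts below P/Q, so that no gap
  -- arises between them.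
  next-head : Q * N K ≤ P * d K -> Q * (N 0 * N 0 + d 0 * d 0) ≤ P * (d 0 * N 0)
  next-head h = *-cancelʳ-≤ _ _ (d K) {{>-nonZero (positive ≤-refl)}} (begin
   Q * (N 0 * N 0 + d 0 * d 0) * d K ≡⟨ *-assoc Q _ (d K) ⟩
   Q * ((N 0 * N 0 + d 0 * d 0) * d K) ≤⟨ *-monoʳ-≤ Q loop ⟩
   Q * (N K * (d 0 * N 0)) ≡⟨ *-assoc Q (N K) _ ⟨
   Q * N K * (d 0 * N 0) ≤⟨ *-monoˡ-≤ (d 0 * N 0) h ⟩
   P * d K * (d 0 * N 0) ≡⟨ lemma P (d K) (d 0 * N 0) ⟩
   P * (d 0 * N 0) * d K ∎)
   where
   lemma : ∀ P d e -> P * d * e ≡ P * e * d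
   lemma = solve-∀
  next-growth : P * (d 0 * N 0) + suc j * (Q * (d 0 * N 0)) ≤ P * (N 0 * N 0 + d 0 * d 0)
  next-growth = begin
   P * (d 0 * N 0) + suc j * (Q * (d 0 * N 0)) ≡⟨ lemma P (d 0) (N 0) j Q ⟩
   (P * d 0 + j * (Q * d 0)) * N 0 + Q * N 0 * d 0 ≤⟨ +-mono-≤ (*-monoˡ-≤ (N 0) growth) (*-monoˡ-≤ (d 0) head) ⟩
   P * N 0 * N 0 + P * d 0 * d 0 ≡⟨ lemma' P (N 0) (d 0) ⟩
   P * (N 0 * N 0 + d 0 * d 0) ∎
   where
   lemma : ∀ P d N j Q -> P * (d * N) + (1 + j) * (Q * (d * N)) ≡ (P * d + j * (Q * d)) * N + Q * N * d
   lemma = solve-∀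
   lemma' : ∀ P N d -> P * N * N + P * d * d ≡ P * (N * N + d * d)
   lemma' = solve-∀
  go : ∀ fuel -> fuel + j ≡ P * P -> Between ⊎ Q * N K ≤ P * d K -> Between
  go _ _ (inj₁ found) = found
  go (suc fuel) e (inj₂ h) = climb 0<P 0<Q (mycielski-chain 𝒞) fuel (suc j) (trans (+-suc fuel j) e) (next-head h) next-growth
  -- After P² steps the first ratio is at least `1 + PQ`, contrary to its being at most P/Q.
  go zero refl (inj₂ _) = ⊥-elim (<⇒≱ exceeded (begin
   Q * (P * N 0) ≡⟨ lemma Q P (N 0) ⟩
   P * (Q * N 0) ≤⟨ *-monoʳ-≤ P head ⟩
   P * (P * d 0) ∎))
   where
   lemma : ∀ Q P N -> Q * (P * N) ≡ P * (Q * N)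
   lemma = solve-∀
   expand : ∀ Q P d -> Q * (P * d + P * P * (Q * d)) ≡ Q * P * d + P * (P * d) * (Q * Q)
   expand = solve-∀
   exceeded : P * (P * d 0) < Q * (P * N 0)
   exceeded = begin-strict
    P * (P * d 0) <⟨ m<n+m _ (*-mono-< (*-mono-< 0<Q 0<P) (positive z≤n)) ⟩
    Q * P * d 0 + P * (P * d 0) ≤⟨ +-monoʳ-≤ (Q * P * d 0) (≤-trans (≡⇒≤ (sym (*-identityʳ _))) (*-monoʳ-≤ (P * (P * d 0)) (*-mono-≤ 0<Q 0<Q))) ⟩
    Q * P * d 0 + P * (P * d 0) * (Q * Q) ≡⟨ expand Q P (d 0) ⟨
    Q * (P * d 0 + P * P * (Q * d 0)) ≤⟨ *-monoʳ-≤ Q growth ⟩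
    Q * (P * N 0) ∎

-- Here e runs from `w - 1` down to 0 with `w = 4 + 2Q`, and the ratio `(4w + 2e) / (w + e + 1)`
-- climbs from below 3 towards 4. The summand 2Q makes the steps fine. The summand 4 serves `loop`:
-- for w = 3 the first Mycielski ratio 8/3 + 3/8 would exceed the last ratio 3.
circular-chain : ∀ Q -> Chain Q (3 + 2 * Q)
circular-chain Q = record
 { N = N ; d = d
 ; sys = \ {i} _ -> Circular.circular w (K ∸ i) (s≤s z≤n) (s≤s (m∸n≤m K i))
 ; positive = \ _ -> s≤s z≤n
 ; proper = \ {i} _ -> proper (K ∸ i)
 ; close = \ {i} i<K -> subst (\ f -> Q * (N (suc i) * (w + f + 1)) ≤ Q * ((w + w + f + (w + w + f)) * d (suc i)) + (w + f + 1) * d (suc i)) (suc-∸ i<K) (close (K ∸ suc i))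
 ; loop = subst (\ f -> (N 0 * N 0 + d 0 * d 0) * (w + f + 1) ≤ (w + w + f + (w + w + f)) * (d 0 * N 0)) (sym (n∸n≡0 K))
   (≤-trans (m≤m+n _ _) (≡⇒≤ (loop-identity (2 * Q))))
 }
 where
 K = 3 + 2 * Q
 w = 1 + K
 N d : ℕ -> ℕ
 N i = w + w + (K ∸ i) + (w + w + (K ∸ i))
 d i = w + (K ∸ i) + 1
 suc-∸ : ∀ {i} -> i < K -> suc (K ∸ suc i) ≡ K ∸ i
 suc-∸ {i} i<K = sym (+-∸-assoc 1 i<K)
 proper : ∀ f -> w + f + 1 < w + w + f + (w + w + f)
 proper f = (lin (w ∷ f ∷ []) (k 1 :+ (v0 :+ v1 :+ k 1) <: v0 :+ v0 :+ v1 :+ (v0 :+ v0 :+ v1)) (k 1 <: v0 by 3 · s≤s z≤n & □))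
 close : ∀ f -> Q * ((w + w + f + (w + w + f)) * (w + suc f + 1)) ≤ Q * ((w + w + suc f + (w + w + suc f)) * (w + f + 1)) + (w + suc f + 1) * (w + f + 1)
 close f = ≤-trans (≡⇒≤ (identity Q K f)) (+-monoʳ-≤ (Q * ((w + w + suc f + (w + w + suc f)) * (w + f + 1))) (*-mono-≤
  (lin (Q ∷ f ∷ []) (2 :* v0 <: k 1 :+ (k 3 :+ 2 :* v0) :+ (k 1 :+ v1) :+ k 1) (□)) (lin (K ∷ f ∷ []) (v0 <: k 1 :+ v0 :+ v1 :+ k 1) (□))))
  where
  identity : ∀ Q K f -> Q * ((1 + K + (1 + K) + f + (1 + K + (1 + K) + f)) * (1 + K + (1 + f) + 1)) ≡
   Q * ((1 + K + (1 + K) + (1 + f) + (1 + K + (1 + K) + (1 + f))) * (1 + K + f + 1)) + 2 * Q * K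
  identity = solve-∀
 loop-identity : ∀ j -> (((4 + j) + (4 + j) + (3 + j) + ((4 + j) + (4 + j) + (3 + j))) * ((4 + j) + (4 + j) + (3 + j) + ((4 + j) + (4 + j) + (3 + j))) +
   ((4 + j) + (3 + j) + 1) * ((4 + j) + (3 + j) + 1)) * ((4 + j) + 0 + 1) + (76 + 148 * j + 64 * (j * j) + 8 * (j * j * j)) ≡
  ((4 + j) + (4 + j) + 0 + ((4 + j) + (4 + j) + 0)) * (((4 + j) + (3 + j) + 1) * ((4 + j) + (4 + j) + (3 + j) + ((4 + j) + (4 + j) + (3 + j))))
 loop-identity = solve-∀

dense-ratios : ∀ P Q -> 0 < Q -> 4 * Q ≤ P -> Between P Q
dense-ratios P Q 0<Q h = climb P Q (<-≤-trans 0<Q (≤-trans (m≤m+n Q _) h)) 0<Q 𝒞 (P * P) 0 (+-identityʳ _) head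
 (≤-trans (≡⇒≤ (+-identityʳ _)) (*-monoʳ-≤ P (<⇒≤ (proper z≤n))))
 where
 𝒞 = circular-chain Q
 open Chain 𝒞
 identity : ∀ j -> (4 + j) + (4 + j) + (3 + j) + ((4 + j) + (4 + j) + (3 + j)) + (10 + 2 * j) ≡ 4 * ((4 + j) + (3 + j) + 1)
 identity = solve-∀
 head : Q * N 0 ≤ P * d 0
 head = begin
  Q * N 0 ≤⟨ *-monoʳ-≤ Q (≤-trans (m≤m+n (N 0) (10 + 2 * (2 * Q))) (≡⇒≤ (identity (2 * Q)))) ⟩
  Q * (4 * d 0) ≡⟨ *-assoc Q 4 (d 0) ⟨
  Q * 4 * d 0 ≤⟨ *-monoˡ-≤ (d 0) (≤-trans (≡⇒≤ (*-comm Q 4)) h) ⟩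
  P * d 0 ∎

-- Templates and their blow-ups

Free : ∀ {n} -> ℕ -> Graph n -> Set
Free s = CliquesFree (3 Vec.∷ suc s Vec.∷ Vec.[])

-- A weighted pattern on M vertices with multiplicity. Up to rounding, blow-ups preserve `α / M` and
-- the edge density `D / M²`.
record Template (s M α D : ℕ) : Set1 where
 field
  T : Set
  _≟T_ : ∀ (x y : T) -> Dec (x ≡ y)
  𝒢 : ColouredGraph T
 open Graphs 𝒢 public
 field
  L : List T
  size : length L ≡ M
  red-free : ∀ {x y z} -> Red x y -> Red y z -> Red x z -> ⊥
  blue-bounded : ∀ {C} -> AllPairs Blue C -> length C ≤ s
  independent : ∀ {P : T -> Set} (P? : Decidable P) -> (∀ {x y} -> x ∈ L -> y ∈ L -> P x -> P y -> ¬ Adj x y) -> # P? L ≤ α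
  degrees : D ≤ ∑ (\ x -> # (Adj? x) L) L

∑-lookup : ∀ {A : Set} (f : A -> ℕ) Y -> ∑ (\ i -> f (lookup Y i)) (allFin (length Y)) ≡ ∑ f Y
∑-lookup f Y = trans (sym (∑-map f (lookup Y) (allFin (length Y)))) (cong (∑ f) (trans (map-tabulate (\ i -> i) (lookup Y)) (tabulate-lookup Y)))

∑-take-≤ : ∀ {A : Set} (f : A -> ℕ) r xs -> ∑ f (take r xs) ≤ ∑ f xs
∑-take-≤ f zero xs = z≤n
∑-take-≤ f (suc r) [] = z≤n
∑-take-≤ f (suc r) (x ∷ xs) = +-monoʳ-≤ (f x) (∑-take-≤ f r xs)

injective-count : ∀ {t n} (f : Fin t -> Fin n) -> (∀ {a b} -> f a ≡ f b -> a ≡ b) -> {P : Fin n -> Set} (P? : Decidable P) -> (∀ a -> P (f a)) -> t ≤ # P? (allFin n)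
injective-count {t} {n} f injective {P} P? h = begin
 t ≡⟨ trans (∑-ones (allFin t)) ((length-tabulate {n = t} (\ i -> i))) ⟨
 ∑ (\ _ -> 1) (allFin t) ≤⟨ ∑-mono (allFin t) (\ {a} _ -> #-∈ (f a Fin.≟_) (allFin n) (∈-allFin (f a)) refl) ⟩
 ∑ (\ a -> # (f a Fin.≟_) (allFin n)) (allFin t) ≡⟨ ∑-swap (\ a i -> 𝟙 (f a Fin.≟ i)) (allFin t) (allFin n) ⟩
 ∑ (\ i -> # (\ a -> f a Fin.≟ i) (allFin t)) (allFin n) ≤⟨ ∑-mono (allFin n) (\ {i} _ -> fibre i (P? i)) ⟩
 # P? (allFin n) ∎
 where
 fibre : ∀ i -> (d : Dec (P i)) -> # (\ a -> f a Fin.≟ i) (allFin t) ≤ 𝟙 d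
 fibre i (yes _) = #-exclusive (\ a -> f a Fin.≟ i) (allFin t) (AllPairs.map (\ ne e e' -> ne (injective (trans e (sym e')))) (allFin⁺ t))
 fibre i (no ¬p) = ≡⇒≤ (#-none (\ a -> f a Fin.≟ i) (allFin t) \ {a} _ e -> ¬p (subst P e (h a)))

module FromList {T : Set} (𝒢 : ColouredGraph T) (Y : List T) where
 open Graphs 𝒢

 seen : Colour -> Bool
 seen none = false
 seen red = true
 seen blue = true

 shade : Colour -> Fin 2
 shade none = zero
 shade red = zero
 shade blue = suc zero

 graph : Graph (length Y)
 graph = record
  { adj = \ i j -> seen (χ (lookup Y i) (lookup Y j))
  ; sym = \ i j -> cong seen (χ-sym _ _)
  ; irrefl = \ i -> cong seen (χ-irrefl _) }

 colouring : Colouring 2 graph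
 colouring = record { col = \ i j -> shade (χ (lookup Y i) (lookup Y j)) ; col-sym = \ i j -> cong shade (χ-sym _ _) }

 seen-none : ∀ c -> seen c ≡ false -> c ≡ none
 seen-none none _ = refl

 is-red : ∀ c -> seen c ≡ true × shade c ≡ zero -> c ≡ red
 is-red red _ = refl

 is-blue : ∀ c -> seen c ≡ true × shade c ≡ suc zero -> c ≡ blue
 is-blue blue _ = refl

 seen-indicator : ∀ c -> indicator (seen c) ≡ 𝟙 (¬? (c ≟ᶜ none))
 seen-indicator none = refl
 seen-indicator red = refl
 seen-indicator blue = refl

 cliques-free : ∀ s -> RedFree -> (∀ {C} -> AllPairs Blue C -> length C ≤ s) ->
  Free s graph
 cliques-free s red-free blue-bounded = colouring , \ { zero (f , _ , h) -> red-free (is-red _ (h zero 1F \ ())) (is-red _ (h 1F 2F \ ())) (is-red _ (h zero 2F \ ()))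
                          ; 1F (f , _ , h) -> <⇒≱ {s} ≤-refl (subst (_≤ s) (clique-length f) (blue-bounded (clique f h))) }
  where
  clique : (f : Fin (suc s) -> Fin (length Y)) -> (∀ a b -> a ≢ b -> (adj graph (f a) (f b) ≡ true) × (col colouring (f a) (f b) ≡ suc zero)) ->
   AllPairs Blue (map (\ a -> lookup Y (f a)) (allFin (suc s)))
  clique f h = AllPairs.map⁺ (AllPairs.map (\ ne -> is-blue _ (h _ _ ne)) (allFin⁺ (suc s)))
  clique-length : (f : Fin (suc s) -> Fin (length Y)) -> length (map (\ a -> lookup Y (f a)) (allFin (suc s))) ≡ suc s
  clique-length f = trans (length-map _ (allFin (suc s))) (length-tabulate {n = suc s} (\ i -> i))

 module _ (_≟T_ : ∀ (x y : T) -> Dec (x ≡ y)) where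

  independence : ∀ {α} -> (∀ {P : T -> Set} (P? : Decidable P) -> (∀ {x y} -> P x -> P y -> ¬ Adj x y) -> # P? Y ≤ α) -> ∀ t -> IndepSet graph t -> t ≤ α
  independence {α} bound t (f , injective , h) = ≤-trans (injective-count f (\ {a} {b} -> injective {a} {b}) (\ i -> P? (lookup Y i)) \ a -> a , refl)
   (≤-trans (≡⇒≤ (∑-lookup (\ x -> 𝟙 (P? x)) Y)) (bound P? \ { (a , refl) (b , refl) e -> apart a b e }))
   where
   P? : Decidable (\ x -> ∃ \ a -> lookup Y (f a) ≡ x)
   P? x = FinP.any? \ a -> lookup Y (f a) ≟T x
   apart : ∀ a b -> ¬ Adj (lookup Y (f a)) (lookup Y (f b))
   apart a b e with a Fin.≟ b
   ... | yes refl = e (χ-irrefl _)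
   ... | no a≢b = e (seen-none _ (h a b a≢b))

 edges : 2 * edgeCount graph ≡ ∑ (\ x -> # (Adj? x) Y) Y
 edges = trans (edgeCount-degrees graph) (trans (∑-cong (allFin (length Y)) \ {i} _ ->
  trans (∑-cong (allFin (length Y)) \ {j} _ -> seen-indicator _) (∑-lookup (\ y -> 𝟙 (Adj? (lookup Y i) y)) Y)) (∑-lookup (\ x -> # (Adj? x) Y) Y))

Estimate : (s n w u x b y c : ℕ) -> Set
Estimate s n w u x b y c = Σ (Graph n) \ G -> Free s G × (∀ t -> IndepSet G t -> w * t ≤ u * n) × x * (n * n) ≤ b * (y * edgeCount G) + c * (n * n)

module BlowUp {s M α D : ℕ} (𝒯 : Template s M α D) {{_ : NonZero M}} (n : ℕ) where
 open Template 𝒯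

 q r : ℕ
 q = n / M
 r = n % M

 n≡ : n ≡ r + q * M
 n≡ = m≡m%n+[m/n]*n n M

 Y : List T
 Y = copies q L ++ take r L

 length-Y : length Y ≡ n
 length-Y = trans (length-++ (copies q L)) (trans (cong₂ _+_ (trans (length-copies q L) (cong (q *_) size))
  (trans (length-take r L) (trans (cong (r ⊓_) size) (m≤n⇒m⊓n≡m (<⇒≤ (m%n<n n M)))))) (trans (+-comm (q * M) r) (sym n≡)))

 ∑-Y-upper : ∀ f -> ∑ f Y ≤ (q + 1) * ∑ f L
 ∑-Y-upper f = begin
  ∑ f Y ≡⟨ ∑-++ f (copies q L) (take r L) ⟩
  ∑ f (copies q L) + ∑ f (take r L) ≤⟨ +-mono-≤ (≡⇒≤ (∑-copies f q L)) (∑-take-≤ f r L) ⟩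
  q * ∑ f L + ∑ f L ≡⟨ lemma q (∑ f L) ⟩
  (q + 1) * ∑ f L ∎
  where
  lemma : ∀ q x -> q * x + x ≡ (q + 1) * x
  lemma = solve-∀

 ∑-Y-lower : ∀ f -> q * ∑ f L ≤ ∑ f Y
 ∑-Y-lower f = ≤-trans (≡⇒≤ (sym (∑-copies f q L))) (≤-trans (m≤m+n _ _) (≡⇒≤ (sym (∑-++ f (copies q L) (take r L)))))

 open FromList 𝒢 Y

 edge-count : q * q * D ≤ 2 * edgeCount graph
 edge-count = begin
  q * q * D ≤⟨ *-monoʳ-≤ (q * q) degrees ⟩
  q * q * ∑ (\ x -> # (Adj? x) L) L ≡⟨ trans (*-assoc q q _) (cong (q *_) (sym (∑-* q _ L))) ⟩
  q * ∑ (\ x -> q * # (Adj? x) L) L ≤⟨ ∑-Y-lower _ ⟩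
  ∑ (\ x -> q * # (Adj? x) L) Y ≤⟨ ∑-mono Y (\ {x} _ -> ∑-Y-lower (\ y -> 𝟙 (Adj? x y))) ⟩
  ∑ (\ x -> # (Adj? x) Y) Y ≡⟨ edges ⟨
  2 * edgeCount graph ∎

 independence-number : ∀ t -> IndepSet graph t -> t ≤ (q + 1) * α
 independence-number = independence _≟T_ \ P? ind -> ≤-trans (∑-Y-upper (\ x -> 𝟙 (P? x))) (*-monoʳ-≤ (q + 1) (independent P? \ _ _ -> ind))

 -- The number of vertices is made a variable so that the graph on `length Y` vertices can be
 -- transported to n.
 Realised : ℕ -> Set
 Realised m = Σ (Graph m) \ G -> Free s G × (∀ t -> IndepSet G t -> t ≤ (q + 1) * α) × q * q * D ≤ 2 * edgeCount G

 realised : Realised n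
 realised = subst Realised length-Y (graph , cliques-free s red-free blue-bounded , independence-number , edge-count)

 -- Entries of L occur at most q + 1 times. Strictness of `wα < uM` absorbs the additional copy once
 -- q is at least wα, and for n at least 2aM the rounding of n to qM costs at most n² in the
 -- weighted count of edges.
 estimate : ∀ {w u a b c} -> w * α < u * M -> a * (M * M) ≤ b * D + c * (M * M) -> w * α * M + 2 * a * M ≤ n ->
  Estimate s n w u a b 2 (c + 1)
 estimate {w} {u} {a} {b} {c} sparse dense large = finish realised
  where
  wα≤q : w * α ≤ q
  wα≤q = ≤-pred (*-cancelʳ-< M (w * α) (1 + q) (≤-<-trans (≤-trans (m≤m+n _ _) large) (m<[1+m/n]*n n M)))
  qM≤n : q * M ≤ n
  qM≤n = ≤-trans (m≤n+m (q * M) r) (≡⇒≤ (sym n≡))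
  small : w * ((q + 1) * α) ≤ u * n
  small = begin
   w * ((q + 1) * α) ≡⟨ lemma w q α ⟩
   w * α * q + w * α ≤⟨ +-monoʳ-≤ (w * α * q) wα≤q ⟩
   w * α * q + q ≡⟨ +-comm _ q ⟩
   suc (w * α) * q ≤⟨ *-monoˡ-≤ q sparse ⟩
   u * M * q ≡⟨ trans (*-assoc u M q) (cong (u *_) (*-comm M q)) ⟩
   u * (q * M) ≤⟨ *-monoʳ-≤ u qM≤n ⟩
   u * n ∎
   where
   lemma : ∀ w q α -> w * ((q + 1) * α) ≡ w * α * q + w * α
   lemma = solve-∀
  square : n * n ≤ q * q * (M * M) + 2 * M * n
  square = begin
   n * n ≡⟨ cong (_* n) n≡ ⟩
   (r + q * M) * n ≡⟨ trans (*-distribʳ-+ n r (q * M)) (cong (\ x -> r * n + q * M * x) n≡) ⟩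
   r * n + q * M * (r + q * M) ≤⟨ +-mono-≤ (*-monoˡ-≤ n r≤M) (≤-trans (≡⇒≤ (lemma q M r)) (+-monoˡ-≤ _ (*-mono-≤ qM≤n r≤M))) ⟩
   M * n + (n * M + q * q * (M * M)) ≡⟨ lemma' M n (q * q * (M * M)) ⟩
   q * q * (M * M) + 2 * M * n ∎
   where
   r≤M : r ≤ M
   r≤M = <⇒≤ (m%n<n n M)
   lemma : ∀ q M r -> q * M * (r + q * M) ≡ q * M * r + q * q * (M * M)
   lemma = solve-∀
   lemma' : ∀ M n x -> M * n + (n * M + x) ≡ x + 2 * M * n
   lemma' = solve-∀
  finish : Realised n -> Estimate s n w u a b 2 (c + 1)
  finish (G , free , ind , edges) = G , free , (\ t I -> ≤-trans (*-monoʳ-≤ w (ind t I)) small) , (begin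
   a * (n * n) ≤⟨ *-monoʳ-≤ a square ⟩
   a * (q * q * (M * M) + 2 * M * n) ≡⟨ lemma a q M n ⟩
   q * q * (a * (M * M)) + 2 * a * M * n ≤⟨ +-mono-≤ (*-monoʳ-≤ (q * q) dense) (*-monoˡ-≤ n (≤-trans (m≤n+m (2 * a * M) (w * α * M)) large)) ⟩
   q * q * (b * D + c * (M * M)) + n * n ≡⟨ lemma' q b D c M n ⟩
   b * (q * q * D) + c * (q * M * (q * M)) + n * n ≤⟨ +-monoˡ-≤ (n * n) (+-mono-≤ (*-monoʳ-≤ b edges) (*-monoʳ-≤ c (*-mono-≤ qM≤n qM≤n))) ⟩
   b * (2 * edgeCount G) + c * (n * n) + n * n ≡⟨ lemma″ (b * (2 * edgeCount G)) c n ⟩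
   b * (2 * edgeCount G) + (c + 1) * (n * n) ∎)
   where
   lemma : ∀ a q M n -> a * (q * q * (M * M) + 2 * M * n) ≡ q * q * (a * (M * M)) + 2 * a * M * n
   lemma = solve-∀
   lemma' : ∀ q b D c M n -> q * q * (b * D + c * (M * M)) + n * n ≡ b * (q * q * D) + c * (q * M * (q * M)) + n * n
   lemma' = solve-∀
   lemma″ : ∀ x c n -> x + c * (n * n) + n * n ≡ x + (c + 1) * (n * n)
   lemma″ = solve-∀

-- The three patterns

paint : ∀ {E : Set} -> Colour -> Dec E -> Colour
paint c (yes _) = c
paint c (no _) = none

paint-edge : ∀ {E : Set} {c d} (e : Dec E) -> d ≢ none -> paint c e ≡ d -> E × c ≡ d
paint-edge (yes e) _ p = e , p
paint-edge (no _) d≢ p = absurd (sym p) d≢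

paint-cong : ∀ {E F : Set} c (e : Dec E) (f : Dec F) -> (E -> F) -> (F -> E) -> paint c e ≡ paint c f
paint-cong c (yes _) (yes _) _ _ = refl
paint-cong c (no _) (no _) _ _ = refl
paint-cong c (yes e) (no ¬f) g _ = absurd (g e) ¬f
paint-cong c (no ¬e) (yes f) _ g = absurd (g f) ¬e

paint-adj : ∀ {E : Set} c (e : Dec E) -> c ≢ none -> E -> paint c e ≢ none
paint-adj c (yes _) c≢ _ = c≢
paint-adj c (no ¬e) _ e = absurd e ¬e

blue≢none : blue ≢ none
blue≢none ()

red≢none : red ≢ none
red≢none ()

size-positive : ∀ {N d} (𝒮 : Sys N d) -> 0 < N -> ∃ \ x -> x ∈ Sys.L 𝒮
size-positive 𝒮 0<N = go (Sys.L 𝒮) (≤-trans 0<N (≡⇒≤ (sym (Sys.size 𝒮))))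
 where
 go : ∀ (L : List (Sys.T 𝒮)) -> 0 < length L -> ∃ \ x -> x ∈ L
 go (x ∷ _) _ = x , here refl

module BlueParts {T : Set} (𝒢 : ColouredGraph T) {r : ℕ} (κ : Fin r -> Fin r -> Colour) (part : T -> Fin r) (κ-diagonal : ∀ i -> κ i i ≡ none)
 (κ-blue-free : ∀ i j l -> κ i j ≡ blue -> κ j l ≡ blue -> κ i l ≡ blue -> ⊥)
 (E : T -> T -> Set) (E-triangle-free : ∀ {p q s} -> E p q -> E q s -> E p s -> ⊥)
 (blue-split : ∀ {p q} -> Graphs.Blue 𝒢 p q -> (part p ≡ part q × E p q) ⊎ κ (part p) (part q) ≡ blue) where
 open Graphs 𝒢

 same-part : ∀ {C} -> AllPairs Blue C -> (∀ {p q} -> p ∈ C -> q ∈ C -> part p ≡ part q) -> length C ≤ 2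
 same-part {[]} c h = z≤n
 same-part {p ∷ []} c h = s≤s z≤n
 same-part {p ∷ q ∷ []} c h = s≤s (s≤s z≤n)
 same-part {p ∷ q ∷ s ∷ C} ((pq ∷ ps ∷ _) ∷ (qs ∷ _) ∷ _) h =
  ⊥-elim (E-triangle-free (edge pq (here refl) (there (here refl))) (edge qs (there (here refl)) (there (there (here refl)))) (edge ps (here refl) (there (there (here refl)))))
  where
  edge : ∀ {a b} -> Blue a b -> a ∈ p ∷ q ∷ s ∷ C -> b ∈ p ∷ q ∷ s ∷ C -> E a b
  edge {a} {b} e m m' = [ proj₂ , (\ z -> absurd (trans (sym (κ-diagonal (part a))) (trans (cong (κ (part a)) (h m m')) z)) \ ()) ]′ (blue-split e)

 blue-cross : ∀ {p q} -> Blue p q -> part p ≢ part q -> κ (part p) (part q) ≡ blue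
 blue-cross e ne = [ (\ h -> absurd (proj₁ h) ne) , (\ h -> h) ]′ (blue-split e)

 -- Besides the part of its first vertex, a blue clique meets at most one other part.
 module Split {p : T} {C : List T} (c : AllPairs Blue (p ∷ C)) where
  Here? : ∀ q -> Dec (part p ≡ part q)
  Here? q = part p Fin.≟ part q

  here-few : # Here? (p ∷ C) ≤ 2
  here-few = subst (_≤ 2) (#-length Here? (p ∷ C)) (same-part (AllPairs.filter⁺ Here? c) \ m m' ->
   trans (sym (proj₂ (∈-filter⁻ Here? {xs = p ∷ C} m))) (proj₂ (∈-filter⁻ Here? {xs = p ∷ C} m')))

  away : ∀ {q} -> q ∈ filter (\ q -> ¬? (Here? q)) (p ∷ C) -> q ∈ p ∷ C × part p ≢ part q
  away = ∈-filter⁻ (\ q -> ¬? (Here? q)) {xs = p ∷ C}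

  from-p : ∀ {q} -> q ∈ p ∷ C -> part p ≢ part q -> Blue p q
  from-p (here refl) ne = absurd refl ne
  from-p (there m) ne = All.lookup (AllPairs.head c) m

  there-few : # (\ q -> ¬? (Here? q)) (p ∷ C) ≤ 2
  there-few = subst (_≤ 2) (#-length (\ q -> ¬? (Here? q)) (p ∷ C)) (same-part (AllPairs.filter⁺ (\ q -> ¬? (Here? q)) c) \ {q} {s} m m' -> aligned q s m m' (part q Fin.≟ part s))
   where
   connected : ∀ {C q s} -> AllPairs Blue C -> q ∈ C -> s ∈ C -> part q ≢ part s -> Blue q s
   connected (h ∷ c) (here refl) (here refl) ne = absurd refl ne
   connected (h ∷ c) (here refl) (there m) ne = All.lookup h m
   connected (h ∷ c) (there m) (here refl) ne = χ-flip (All.lookup h m)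
   connected (h ∷ c) (there m) (there m') ne = connected c m m' ne
   aligned : ∀ q s -> q ∈ filter (\ q -> ¬? (Here? q)) (p ∷ C) -> s ∈ filter (\ q -> ¬? (Here? q)) (p ∷ C) -> Dec (part q ≡ part s) -> part q ≡ part s
   aligned q s m m' (yes e) = e
   aligned q s m m' (no ne) = ⊥-elim (κ-blue-free (part p) (part q) (part s) (blue-cross {p} {q} (from-p (proj₁ (away m)) (proj₂ (away m))) (proj₂ (away m)))
    (blue-cross {q} {s} (connected c (proj₁ (away m)) (proj₁ (away m')) ne) ne) (blue-cross {p} {s} (from-p (proj₁ (away m')) (proj₂ (away m'))) (proj₂ (away m'))))

 blue-bounded-4 : ∀ {C} -> AllPairs Blue C -> length C ≤ 4
 blue-bounded-4 {[]} c = z≤n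
 blue-bounded-4 {p ∷ C} c = ≤-trans (≡⇒≤ (sym (#+#¬ (Split.Here? c) (p ∷ C)))) (+-mono-≤ (Split.here-few c) (Split.there-few c))

 blue-bounded-2 : (∀ i j -> κ i j ≢ blue) -> ∀ {C} -> AllPairs Blue C -> length C ≤ 2
 blue-bounded-2 no-blue c = same-part c (together c)
  where
  aligned : ∀ {a b} -> Blue a b -> part a ≡ part b
  aligned {a} {b} e = [ proj₁ , (\ z -> absurd z (no-blue _ _)) ]′ (blue-split e)
  together : ∀ {C p q} -> AllPairs Blue C -> p ∈ C -> q ∈ C -> part p ≡ part q
  together (h ∷ c) (here refl) (here refl) = refl
  together (h ∷ c) (here refl) (there m) = aligned (All.lookup h m)
  together (h ∷ c) (there m) (here refl) = sym (aligned (All.lookup h m))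
  together (h ∷ c) (there m) (there m') = together c m m'

module CopiesPattern (r : ℕ) (κ : Fin r -> Fin r -> Colour) (κ-sym : ∀ i j -> κ i j ≡ κ j i) (κ-adj : ∀ i j -> i ≢ j -> κ i j ≢ none)
 (κ-diagonal : ∀ i -> κ i i ≡ none)
 (κ-red-free : ∀ i j l -> κ i j ≡ red -> κ j l ≡ red -> κ i l ≡ red -> ⊥) (κ-blue-free : ∀ i j l -> κ i j ≡ blue -> κ j l ≡ blue -> κ i l ≡ blue -> ⊥)
 {N d : ℕ} (𝒮 : Sys N d) (0<N : 0 < N) where
 open Sys 𝒮 renaming (T to T0; _≟T_ to _≟0_; L to L0; size to size0; independent to independent0; degree to degree0)

 T : Set
 T = Fin r × T0

 inner : ∀ i j -> Dec (i ≡ j) -> T0 -> T0 -> Colour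
 inner i j (yes _) x y = paint blue (E? x y)
 inner i j (no _) x y = κ i j

 χ : T -> T -> Colour
 χ (i , x) (j , y) = inner i j (i Fin.≟ j) x y

 χ-same : ∀ i x y -> χ (i , x) (i , y) ≡ paint blue (E? x y)
 χ-same i x y with i Fin.≟ i
 ... | yes _ = refl
 ... | no ne = absurd refl ne

 χ-other : ∀ {i j} x y -> i ≢ j -> χ (i , x) (j , y) ≡ κ i j
 χ-other {i} {j} x y ne with i Fin.≟ j
 ... | yes e = absurd e ne
 ... | no _ = refl

 𝒢 : ColouredGraph T
 𝒢 = record { χ = χ ; χ-sym = χ-sym ; χ-irrefl = \ (i , x) -> trans (χ-same i x x) (no-loop x (E? x x)) }
  where
  no-loop : ∀ x (d : Dec (E x x)) -> paint blue d ≡ none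
  no-loop x (yes e) = ⊥-elim (triangle-free e e e)
  no-loop x (no _) = refl
  χ-sym : ∀ p q -> χ p q ≡ χ q p
  χ-sym (i , x) (j , y) with i Fin.≟ j
  ... | yes refl = trans (paint-cong blue (E? x y) (E? y x) E-sym E-sym) (sym (χ-same i y x))
  ... | no ne = trans (κ-sym i j) (sym (χ-other y x \ e -> ne (sym e)))

 open Graphs 𝒢 hiding (χ)

 red-κ : ∀ p q -> Red p q -> κ (proj₁ p) (proj₁ q) ≡ red
 red-κ (i , x) (j , y) h with i Fin.≟ j
 ... | yes _ = absurd (proj₂ (paint-edge (E? x y) red≢none h)) \ ()
 ... | no _ = h

 blue-κ : ∀ p q -> Blue p q -> (proj₁ p ≡ proj₁ q × E (proj₂ p) (proj₂ q)) ⊎ κ (proj₁ p) (proj₁ q) ≡ blue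
 blue-κ (i , x) (j , y) h with i Fin.≟ j
 ... | yes e = inj₁ (e , proj₁ (paint-edge (E? x y) blue≢none h))
 ... | no _ = inj₂ h

 copied : List (Fin r) -> List T
 copied [] = []
 copied (i ∷ is) = map (i ,_) L0 ++ copied is

 ∑-copied : ∀ f is -> ∑ f (copied is) ≡ ∑ (\ i -> ∑ (\ x -> f (i , x)) L0) is
 ∑-copied f [] = refl
 ∑-copied f (i ∷ is) = trans (∑-++ f (map (i ,_) L0) _) (cong₂ _+_ (∑-map f (i ,_) L0) (∑-copied f is))

 ∈-copied⁺ : ∀ {i x is} -> i ∈ is -> x ∈ L0 -> (i , x) ∈ copied is
 ∈-copied⁺ {is = i ∷ is} (here refl) m = ∈-++⁺ˡ (∈-map⁺ (i ,_) m)
 ∈-copied⁺ {is = i ∷ is} (there h) m = ∈-++⁺ʳ (map (i ,_) L0) (∈-copied⁺ h m)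

 ∈-copied⁻ : ∀ is {p} -> p ∈ copied is -> proj₂ p ∈ L0
 ∈-copied⁻ (i ∷ is) {p} h = [ (\ m -> at (∈-map⁻ (i ,_) m)) , ∈-copied⁻ is ]′ (∈-++⁻ (map (i ,_) L0) h)
  where
  at : (∃ \ x -> x ∈ L0 × p ≡ (i , x)) -> proj₂ p ∈ L0
  at (x , m , refl) = m

 L : List T
 L = copied (allFin r)

 length-allFin : length (allFin r) ≡ r
 length-allFin = length-tabulate {n = r} (\ i -> i)

 size : length L ≡ r * N
 size = trans (sym (∑-ones L)) (trans (∑-copied (\ _ -> 1) (allFin r))
  (trans (∑-cong (allFin r) \ _ -> trans (∑-ones L0) (size0)) (trans (∑-const N (allFin r)) (cong (_* N) length-allFin))))

 red-free : ∀ {p q s} -> Red p q -> Red q s -> Red p s -> ⊥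
 red-free {p} {q} {s} h h' h″ = κ-red-free _ _ _ (red-κ p q h) (red-κ q s h') (red-κ p s h″)

 open BlueParts 𝒢 κ proj₁ κ-diagonal κ-blue-free (\ p q -> E (proj₂ p) (proj₂ q)) triangle-free (\ {p} {q} -> blue-κ p q) public using (blue-bounded-4; blue-bounded-2)

 independent : ∀ {P : T -> Set} (P? : Decidable P) -> (∀ {x y} -> x ∈ L -> y ∈ L -> P x -> P y -> ¬ Adj x y) -> # P? L ≤ d
 independent {P} P? ind = ≤-trans (≡⇒≤ (∑-copied (\ p -> 𝟙 (P? p)) (allFin r)))
  (go (search (\ i -> search (\ x -> P? (i , x)) L0) (allFin r)))
  where
  go : Dec (∃ \ i -> i ∈ allFin r × ∃ \ x -> x ∈ L0 × P (i , x)) -> ∑ (\ i -> # (\ x -> P? (i , x)) L0) (allFin r) ≤ d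
  go (no nowhere) = ≤-trans (≡⇒≤ (trans (∑-cong (allFin r) \ {i} i∈ -> #-none (\ x -> P? (i , x)) L0 \ m p -> nowhere (i , i∈ , _ , m , p)) (trans (∑-const 0 (allFin r)) (*-zeroʳ (length (allFin r)))))) z≤n
  go (yes (i , i∈ , x , x∈ , p)) = begin
   ∑ (\ j -> # (\ y -> P? (j , y)) L0) (allFin r) ≤⟨ ∑-mono (allFin r) (\ {j} j∈ -> bounded j j∈ (i Fin.≟ j)) ⟩
   ∑ (\ j -> d * 𝟙 (i Fin.≟ j)) (allFin r) ≡⟨ ∑-* d _ (allFin r) ⟩
   d * # (i Fin.≟_) (allFin r) ≤⟨ *-monoʳ-≤ d (#-exclusive (i Fin.≟_) (allFin r) (AllPairs.map (\ ne e f -> ne (trans (sym e) f)) (allFin⁺ r))) ⟩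
   d * 1 ≡⟨ *-identityʳ d ⟩
   d ∎
   where
   bounded : ∀ j -> j ∈ allFin r -> (e : Dec (i ≡ j)) -> # (\ y -> P? (j , y)) L0 ≤ d * 𝟙 e
   bounded j j∈ (yes refl) = ≤-trans (independent0 (\ y -> P? (j , y)) \ {y} {z} y∈ z∈ py pz e -> ind (∈-copied⁺ j∈ y∈) (∈-copied⁺ j∈ z∈) py pz
    (subst (_≢ none) (sym (χ-same j y z)) (paint-adj blue (E? y z) blue≢none e))) (≡⇒≤ (sym (*-identityʳ d)))
   bounded j j∈ (no ne) = ≤-trans (≡⇒≤ (#-none (\ y -> P? (j , y)) L0 \ {y} y∈ py -> ind (∈-copied⁺ i∈ x∈) (∈-copied⁺ j∈ y∈) p py
    (subst (_≢ none) (sym (χ-other x y ne)) (κ-adj i j ne)))) z≤n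

 -- Each vertex sees all other copies and at least d vertices of its own, in total `rN - N + d`; the
 -- subtracted term stands on the other side.
 degrees : r * N * (r * N + d) ≤ ∑ (\ p -> # (Adj? p) L) L + r * N * N
 degrees = begin
  r * N * (r * N + d) ≡⟨ trans (∑-const (r * N + d) L) (cong (_* (r * N + d)) size) ⟨
  ∑ (\ _ -> r * N + d) L ≤⟨ ∑-mono L (\ {p} m -> degree-at p (∈-copied⁻ (allFin r) m)) ⟩
  ∑ (\ p -> # (Adj? p) L + N) L ≡⟨ trans (∑-+ _ _ L) (cong (∑ (\ p -> # (Adj? p) L) L +_) (trans (∑-const N L) (cong (_* N) size))) ⟩
  ∑ (\ p -> # (Adj? p) L) L + r * N * N ∎
  where
  degree-at : ∀ p -> proj₂ p ∈ L0 -> r * N + d ≤ # (Adj? p) L + N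
  degree-at (i , x) x∈ = begin
   r * N + d ≡⟨ cong (_+ d) (sym (trans (∑-const N (allFin r)) (cong (_* N) length-allFin))) ⟩
   ∑ (\ _ -> N) (allFin r) + d ≤⟨ +-monoʳ-≤ _ (≤-trans (≡⇒≤ (sym (*-identityʳ d))) (*-monoʳ-≤ d (#-∈ (i Fin.≟_) (allFin r) (∈-allFin i) refl))) ⟩
   ∑ (\ _ -> N) (allFin r) + d * # (i Fin.≟_) (allFin r) ≡⟨ trans (cong (∑ (\ _ -> N) (allFin r) +_) (sym (∑-* d _ (allFin r)))) (sym (∑-+ _ _ (allFin r))) ⟩
   ∑ (\ j -> N + d * 𝟙 (i Fin.≟ j)) (allFin r) ≤⟨ ∑-mono (allFin r) (\ {j} _ -> part j (i Fin.≟ j)) ⟩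
   ∑ (\ j -> # (\ y -> Adj? (i , x) (j , y)) L0 + N * 𝟙 (i Fin.≟ j)) (allFin r) ≡⟨ trans (∑-+ _ _ (allFin r)) (cong₂ _+_ (sym (∑-copied (\ q -> 𝟙 (Adj? (i , x) q)) (allFin r))) (∑-* N _ (allFin r))) ⟩
   # (Adj? (i , x)) L + N * # (i Fin.≟_) (allFin r) ≤⟨ +-monoʳ-≤ (# (Adj? (i , x)) L) (≤-trans (*-monoʳ-≤ N (#-exclusive (i Fin.≟_) (allFin r)
    (AllPairs.map (\ ne e f -> ne (trans (sym e) f)) (allFin⁺ r)))) (≡⇒≤ (*-identityʳ N))) ⟩
   # (Adj? (i , x)) L + N ∎
   where
   part : ∀ j (e : Dec (i ≡ j)) -> N + d * 𝟙 e ≤ # (\ y -> Adj? (i , x) (j , y)) L0 + N * 𝟙 e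
   part j (yes refl) = ≤-trans (≡⇒≤ (trans (cong (N +_) (*-identityʳ d)) (+-comm N d))) (+-mono-≤ (≤-trans (degree0 x∈) (#-mono (E? x) (\ y -> Adj? (i , x) (i , y)) L0 \ {y} _ e ->
    subst (_≢ none) (sym (χ-same i x y)) (paint-adj blue (E? x y) blue≢none e))) (≡⇒≤ (sym (*-identityʳ N))))
   part j (no ne) = +-mono-≤ (≡⇒≤ (sym (trans (#-all (\ y -> Adj? (i , x) (j , y)) L0 \ {y} _ ->
    subst (_≢ none) (sym (χ-other x y ne)) (κ-adj i j ne)) size0))) (≡⇒≤ (trans (*-zeroʳ d) (sym (*-zeroʳ N))))

 template : ∀ {s} -> (∀ {C} -> AllPairs Blue C -> length C ≤ s) -> ∀ {D} -> D + r * N * N ≡ r * N * (r * N + d) -> Template s (r * N) d D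
 template blue-bounded {D} e = record
  { T = T ; _≟T_ = ×-≡-dec Fin._≟_ _≟0_ ; 𝒢 = 𝒢 ; L = L ; size = size ; red-free = \ {p} {q} {s} -> red-free {p} {q} {s} ; blue-bounded = blue-bounded
  ; independent = independent ; degrees = +-cancelʳ-≤ (r * N * N) D _ (≤-trans (≡⇒≤ e) degrees) }

κ2 : Fin 2 -> Fin 2 -> Colour
κ2 zero 1F = red
κ2 1F zero = red
κ2 _ _ = none

-- The Ramsey colouring of K5 by differences modulo 5, with 1 and 4 red and 2 and 3 blue: two
-- five-cycles, hence no monochromatic triangle.
κ5 : Fin 5 -> Fin 5 -> Colour
κ5 i j = cyclic ((Fin.toℕ i + 5 ∸ Fin.toℕ j) % 5)
 where
 open import Data.Nat.DivMod using (_%_)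
 cyclic : ℕ -> Colour
 cyclic 0 = none
 cyclic 1 = red
 cyclic 4 = red
 cyclic _ = blue

template33 : ∀ {N d} -> Sys N d -> 0 < N -> Template 2 (2 * N) d (2 * N * (1 * N + d))
template33 {N} {d} 𝒮 0<N = template (blue-bounded-2 no-blue) (lemma N d)
 where
 symmetric : ∀ i j -> κ2 i j ≡ κ2 j i
 symmetric = toWitness {a? = FinP.all? \ i -> FinP.all? \ j -> κ2 i j ≟ᶜ κ2 j i} tt
 complete : ∀ i j -> i ≢ j -> κ2 i j ≢ none
 complete = toWitness {a? = FinP.all? \ i -> FinP.all? \ j -> ¬? (i Fin.≟ j) →-dec ¬? (κ2 i j ≟ᶜ none)} tt
 diagonal : ∀ i -> κ2 i i ≡ none
 diagonal = toWitness {a? = FinP.all? \ i -> κ2 i i ≟ᶜ none} tt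
 no-blue : ∀ i j -> κ2 i j ≢ blue
 no-blue = toWitness {a? = FinP.all? \ i -> FinP.all? \ j -> ¬? (κ2 i j ≟ᶜ blue)} tt
 red-triangle : ∀ i j l -> κ2 i j ≡ red -> κ2 j l ≡ red -> κ2 i l ≢ red
 red-triangle = toWitness {a? = FinP.all? \ i -> FinP.all? \ j -> FinP.all? \ l -> (κ2 i j ≟ᶜ red) →-dec ((κ2 j l ≟ᶜ red) →-dec ¬? (κ2 i l ≟ᶜ red))} tt
 open CopiesPattern 2 κ2 symmetric complete diagonal red-triangle (\ i j l h _ _ -> no-blue i j h) 𝒮 0<N
 lemma : ∀ N d -> 2 * N * (1 * N + d) + 2 * N * N ≡ 2 * N * (2 * N + d)
 lemma = solve-∀

template35 : ∀ {N d} -> Sys N d -> 0 < N -> Template 4 (5 * N) d (5 * N * (4 * N + d))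
template35 {N} {d} 𝒮 0<N = template blue-bounded-4 (lemma N d)
 where
 symmetric : ∀ i j -> κ5 i j ≡ κ5 j i
 symmetric = toWitness {a? = FinP.all? \ i -> FinP.all? \ j -> κ5 i j ≟ᶜ κ5 j i} tt
 complete : ∀ i j -> i ≢ j -> κ5 i j ≢ none
 complete = toWitness {a? = FinP.all? \ i -> FinP.all? \ j -> ¬? (i Fin.≟ j) →-dec ¬? (κ5 i j ≟ᶜ none)} tt
 diagonal : ∀ i -> κ5 i i ≡ none
 diagonal = toWitness {a? = FinP.all? \ i -> κ5 i i ≟ᶜ none} tt
 no-triangle? : ∀ c -> Dec (∀ i j l -> κ5 i j ≡ c -> κ5 j l ≡ c -> κ5 i l ≢ c)
 no-triangle? c = FinP.all? \ i -> FinP.all? \ j -> FinP.all? \ l -> (κ5 i j ≟ᶜ c) →-dec ((κ5 j l ≟ᶜ c) →-dec ¬? (κ5 i l ≟ᶜ c))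
 open CopiesPattern 5 κ5 symmetric complete diagonal (toWitness {a? = no-triangle? red} tt) (toWitness {a? = no-triangle? blue} tt) 𝒮 0<N
 lemma : ∀ N d -> 5 * N * (4 * N + d) + 5 * N * N ≡ 5 * N * (5 * N + d)
 lemma = solve-∀

-- Kinds of vertices: 0 and 1 for the two blue parts; 2 for the red part outside a maximum independent set I, 3 and 4 for the two copies of I.
κ34 : Fin 5 -> Fin 5 -> Colour
κ34 i j = matrix (Fin.toℕ i) (Fin.toℕ j)
 where
 matrix : ℕ -> ℕ -> Colour
 matrix 0 0 = blue
 matrix 1 1 = blue
 matrix 0 1 = red
 matrix 1 0 = red
 matrix 0 3 = red
 matrix 3 0 = red
 matrix 1 4 = red
 matrix 4 1 = red
 matrix 2 2 = red
 matrix 2 3 = red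
 matrix 3 2 = red
 matrix 2 4 = red
 matrix 4 2 = red
 matrix 3 3 = none
 matrix 4 4 = none
 matrix _ _ = blue

κ34-sym : ∀ i j -> κ34 i j ≡ κ34 j i
κ34-sym = toWitness {a? = FinP.all? \ i -> FinP.all? \ j -> κ34 i j ≟ᶜ κ34 j i} tt

-- Red triangles of kinds occur only within the third part, whose red edges are all edges of the
-- triangle-free graph `F1`.
κ34-red : ∀ i j l -> κ34 i j ≡ red -> κ34 j l ≡ red -> κ34 i l ≡ red -> 2 ≤ Fin.toℕ i × 2 ≤ Fin.toℕ j × 2 ≤ Fin.toℕ l
κ34-red = toWitness {a? = FinP.all? \ i -> FinP.all? \ j -> FinP.all? \ l -> (κ34 i j ≟ᶜ red) →-dec ((κ34 j l ≟ᶜ red) →-dec ((κ34 i l ≟ᶜ red) →-dec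
 (2 ≤? Fin.toℕ i ×? (2 ≤? Fin.toℕ j ×? 2 ≤? Fin.toℕ l))))} tt

sideness : Fin 5 -> ℕ
sideness i = 𝟙 (Fin.toℕ i <? 2)

-- A blue triangle of kinds lies in one side, where edges come from the triangle-free graph `F2`, or
-- has exactly two vertices in the sides. The latter cannot hold for all triples of a blue K4.
κ34-blue : ∀ i j l -> κ34 i j ≡ blue -> κ34 i l ≡ blue -> κ34 j l ≡ blue -> (Fin.toℕ i < 2 × i ≡ j × i ≡ l) ⊎ sideness i + sideness j + sideness l ≡ 2
κ34-blue = toWitness {a? = FinP.all? \ i -> FinP.all? \ j -> FinP.all? \ l -> (κ34 i j ≟ᶜ blue) →-dec ((κ34 i l ≟ᶜ blue) →-dec ((κ34 j l ≟ᶜ blue) →-dec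
 ((Fin.toℕ i <? 2 ×? (i Fin.≟ j ×? i Fin.≟ l)) ⊎-dec (sideness i + sideness j + sideness l ≟ 2))))} tt

module TwoOfThree {T : Set} (𝒢 : ColouredGraph T) (σ : T -> ℕ) (σ≤1 : ∀ x -> σ x ≤ 1)
 (triangle : ∀ {x y z} -> Graphs.Blue 𝒢 x y -> Graphs.Blue 𝒢 x z -> Graphs.Blue 𝒢 y z -> σ x + σ y + σ z ≡ 2) where
 open Graphs 𝒢

 -- If each triple out of four vertices has exactly two marked ones, all four marks agree, and
 -- `3 σ(x) = 2` is impossible.
 blue-bounded-3 : ∀ {C} -> AllPairs Blue C -> length C ≤ 3
 blue-bounded-3 {[]} _ = z≤n
 blue-bounded-3 {x ∷ []} _ = s≤s z≤n
 blue-bounded-3 {x ∷ y ∷ []} _ = s≤s (s≤s z≤n)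
 blue-bounded-3 {x ∷ y ∷ z ∷ []} _ = s≤s (s≤s (s≤s z≤n))
 blue-bounded-3 {x ∷ y ∷ z ∷ w ∷ _} ((xy ∷ xz ∷ xw ∷ _) ∷ (yz ∷ yw ∷ _) ∷ (zw ∷ _) ∷ _) =
  ⊥-elim (thrice (σ x) (lin ((σ x) ∷ (σ y) ∷ (σ z) ∷ (σ w) ∷ []) (3 :* v0 <: k 2) (v0 :+ v1 :+ v2 <: k 2 by≡ triangle xy xz yz & v0 :+ v1 :+ v3 <: k 2 by≡ triangle xy xw yw & v0 :+ v2 :+ v3 <: k 2 by≡ triangle xz xw zw & k 2 <: v1 :+ v2 :+ v3 by≡ 2 · sym (triangle yz yw zw) & □))
   (lin ((σ x) ∷ (σ y) ∷ (σ z) ∷ (σ w) ∷ []) (k 2 <: 3 :* v0) (k 2 <: v0 :+ v1 :+ v2 by≡ sym (triangle xy xz yz) & k 2 <: v0 :+ v1 :+ v3 by≡ sym (triangle xy xw yw) & k 2 <: v0 :+ v2 :+ v3 by≡ sym (triangle xz xw zw) & v1 :+ v2 :+ v3 <: k 2 by≡ 2 · triangle yz yw zw & □)))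
  where
  thrice : ∀ n -> 3 * n ≤ 2 -> 2 ≤ 3 * n -> ⊥
  thrice zero _ ()
  thrice (suc n) h _ = <⇒≱ {2} {3} ≤-refl (≤-trans (*-monoʳ-≤ 3 (s≤s z≤n)) h)

module Pattern {N2 d2 N1 d1 : ℕ} (𝒮2 : Sys N2 d2) (𝒮1 : Sys N1 d1) (0<N2 : 0 < N2) (0<d1 : 0 < d1) {o : Sys.T 𝒮1} (o∈ : o ∈ Sys.L 𝒮1) where
 module F2 = Sys 𝒮2
 module F1 = Sys 𝒮1

 T : Set
 T = (Fin 2 × F2.T) ⊎ (Fin 3 × F1.T)

 pattern side i x = inj₁ (i , x)
 pattern third j x = inj₂ (j , x)

 kind : T -> Fin 5
 kind (side i _) = i Fin.↑ˡ 3
 kind (third j _) = 2 Fin.↑ʳ j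

 Sides : Fin 2 -> Fin 2 -> F2.T -> F2.T -> Set
 Sides zero zero = F2.E
 Sides (suc _) (suc _) = F2.E
 Sides _ _ _ _ = ⊤

 -- The relation is total on the copies of I; the table `κ34` then gives no colour within a copy and
 -- blue between the two copies, which become a complete bipartite blue graph.
 Thirds : Fin 3 -> Fin 3 -> F1.T -> F1.T -> Set
 Thirds zero _ = F1.E
 Thirds (suc _) zero = F1.E
 Thirds (suc _) (suc _) _ _ = ⊤

 Rel : T -> T -> Set
 Rel (side i x) (side j y) = Sides i j x y
 Rel (third i x) (third j y) = Thirds i j x y
 Rel (side _ _) (third _ _) = ⊤
 Rel (third _ _) (side _ _) = ⊤

 Rel? : ∀ p q -> Dec (Rel p q)
 Rel? (side zero x) (side zero y) = F2.E? x y
 Rel? (side zero x) (side (suc _) y) = yes tt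
 Rel? (side (suc _) x) (side zero y) = yes tt
 Rel? (side (suc _) x) (side (suc _) y) = F2.E? x y
 Rel? (third zero x) (third _ y) = F1.E? x y
 Rel? (third (suc _) x) (third zero y) = F1.E? x y
 Rel? (third (suc _) x) (third (suc _) y) = yes tt
 Rel? (side _ _) (third _ _) = yes tt
 Rel? (third _ _) (side _ _) = yes tt

 Rel-sym : ∀ p q -> Rel p q -> Rel q p
 Rel-sym (side zero x) (side zero y) = F2.E-sym
 Rel-sym (side zero x) (side (suc _) y) _ = tt
 Rel-sym (side (suc _) x) (side zero y) _ = tt
 Rel-sym (side (suc _) x) (side (suc _) y) = F2.E-sym
 Rel-sym (third zero x) (third zero y) = F1.E-sym
 Rel-sym (third zero x) (third (suc _) y) = F1.E-sym
 Rel-sym (third (suc _) x) (third zero y) = F1.E-sym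
 Rel-sym (third (suc _) x) (third (suc _) y) _ = tt
 Rel-sym (side _ _) (third _ _) _ = tt
 Rel-sym (third _ _) (side _ _) _ = tt

 𝒢 : ColouredGraph T
 𝒢 = record
  { χ = \ p q -> paint (κ34 (kind p) (kind q)) (Rel? p q)
  ; χ-sym = \ p q -> trans (paint-cong _ (Rel? p q) (Rel? q p) (Rel-sym p q) (Rel-sym q p)) (cong (\ c -> paint c (Rel? q p)) (κ34-sym (kind p) (kind q)))
  ; χ-irrefl = loopless
  }
  where
  unrelated : ∀ c {E : Set} (e : Dec E) -> ¬ E -> paint c e ≡ none
  unrelated c (yes e) ¬e = absurd e ¬e
  unrelated c (no _) _ = refl
  loopless : ∀ p -> paint (κ34 (kind p) (kind p)) (Rel? p p) ≡ none
  loopless (side zero x) = unrelated _ (F2.E? x x) \ e -> F2.triangle-free e e e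
  loopless (side 1F x) = unrelated _ (F2.E? x x) \ e -> F2.triangle-free e e e
  loopless (third zero x) = unrelated _ (F1.E? x x) \ e -> F1.triangle-free e e e
  loopless (third 1F x) = refl
  loopless (third 2F x) = refl

 open Graphs 𝒢

 red-parts : ∀ p q -> Red p q -> Rel p q × κ34 (kind p) (kind q) ≡ red
 red-parts p q = paint-edge (Rel? p q) red≢none

 blue-parts : ∀ p q -> Blue p q -> Rel p q × κ34 (kind p) (kind q) ≡ blue
 blue-parts p q = paint-edge (Rel? p q) blue≢none

 adjacent : ∀ p q -> κ34 (kind p) (kind q) ≢ none -> Rel p q -> Adj p q
 adjacent p q = paint-adj _ (Rel? p q)

 E1 E2 : T -> T -> Set
 E1 (third _ x) (third _ y) = F1.E x y
 E1 _ _ = ⊥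
 E2 (side _ x) (side _ y) = F2.E x y
 E2 _ _ = ⊥

 E1-triangle-free : ∀ p q s -> E1 p q -> E1 q s -> E1 p s -> ⊥
 E1-triangle-free (third _ x) (third _ y) (third _ z) = F1.triangle-free

 E2-triangle-free : ∀ p q s -> E2 p q -> E2 q s -> E2 p s -> ⊥
 E2-triangle-free (side _ x) (side _ y) (side _ z) = F2.triangle-free

 red-E1 : ∀ p q -> Red p q -> 2 ≤ Fin.toℕ (kind p) -> 2 ≤ Fin.toℕ (kind q) -> E1 p q
 red-E1 (side zero _) q _ () _
 red-E1 (side 1F _) q _ (s≤s ()) _
 red-E1 (third j x) (side zero _) _ _ ()
 red-E1 (third j x) (side 1F _) _ _ (s≤s ())
 red-E1 (third zero x) (third j y) r _ _ = proj₁ (red-parts (third zero x) (third j y) r)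
 red-E1 (third (suc j) x) (third zero y) r _ _ = proj₁ (red-parts (third (suc j) x) (third zero y) r)
 red-E1 (third 1F x) (third 1F y) () _ _
 red-E1 (third 1F x) (third 2F y) () _ _
 red-E1 (third 2F x) (third 1F y) () _ _
 red-E1 (third 2F x) (third 2F y) () _ _

 red-free : ∀ {p q s} -> Red p q -> Red q s -> Red p s -> ⊥
 red-free {p} {q} {s} pq qs ps = refute (κ34-red (kind p) (kind q) (kind s) (proj₂ (red-parts p q pq)) (proj₂ (red-parts q s qs)) (proj₂ (red-parts p s ps)))
  where
  refute : 2 ≤ Fin.toℕ (kind p) × 2 ≤ Fin.toℕ (kind q) × 2 ≤ Fin.toℕ (kind s) -> ⊥
  refute (hp , hq , hs) = E1-triangle-free p q s (red-E1 p q pq hp hq) (red-E1 q s qs hq hs) (red-E1 p s ps hp hs)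

 same-side : ∀ p q -> Fin.toℕ (kind p) < 2 -> kind p ≡ kind q -> Rel p q -> E2 p q
 same-side (third _ _) q (s≤s (s≤s ())) _ _
 same-side (side zero x) (side zero y) _ _ e = e
 same-side (side 1F x) (side 1F y) _ _ e = e
 same-side (side zero x) (side 1F y) _ () _
 same-side (side 1F x) (side zero y) _ () _
 same-side (side zero x) (third _ y) _ () _
 same-side (side 1F x) (third _ y) _ () _

 σ : T -> ℕ
 σ p = sideness (kind p)

 blue-triangle : ∀ {p q s} -> Blue p q -> Blue p s -> Blue q s -> σ p + σ q + σ s ≡ 2
 blue-triangle {p} {q} {s} pq ps qs = [ (\ (h , pq≡ , ps≡) -> ⊥-elim (E2-triangle-free p q s (same-side p q h pq≡ (proj₁ (blue-parts p q pq)))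
   (same-side q s (subst (\ i -> Fin.toℕ i < 2) pq≡ h) (trans (sym pq≡) ps≡) (proj₁ (blue-parts q s qs))) (same-side p s h ps≡ (proj₁ (blue-parts p s ps))))) , (\ e -> e) ]′
  (κ34-blue (kind p) (kind q) (kind s) (proj₂ (blue-parts p q pq)) (proj₂ (blue-parts p s ps)) (proj₂ (blue-parts q s qs)))

 blue-bounded : ∀ {C} -> AllPairs Blue C -> length C ≤ 3
 blue-bounded = TwoOfThree.blue-bounded-3 𝒢 σ (\ p -> 𝟙≤1 (Fin.toℕ (kind p) <? 2)) (\ {p} {q} {s} -> blue-triangle {p} {q} {s})

 -- A neighbourhood in a triangle-free graph is independent, and here it has exactly d1 vertices: a
 -- maximum independent set.
 I? : Decidable (F1.E o)
 I? = F1.E? o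

 J? : Decidable (\ x -> ¬ F1.E o x)
 J? x = ¬? (I? x)

 Lᵢ Lⱼ : List F1.T
 Lᵢ = filter I? F1.L
 Lⱼ = filter J? F1.L

 ∈-Lᵢ : ∀ {x} -> x ∈ Lᵢ -> x ∈ F1.L × F1.E o x
 ∈-Lᵢ = ∈-filter⁻ I?

 ∈-Lⱼ : ∀ {x} -> x ∈ Lⱼ -> x ∈ F1.L × ¬ F1.E o x
 ∈-Lⱼ = ∈-filter⁻ J?

 I-size : # I? F1.L ≡ d1
 I-size = ≤-antisym (F1.independent I? \ _ _ ex ey e -> F1.triangle-free ex e ey) (F1.degree o∈)

 n0 B : ℕ
 n0 = # J? F1.L
 B = n0 + (d1 + d1)

 Lᵢ-length : length Lᵢ ≡ d1
 Lᵢ-length = trans (#-length I? F1.L) I-size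

 Lⱼ-length : length Lⱼ ≡ n0
 Lⱼ-length = #-length J? F1.L

 B≡ : B ≡ N1 + d1
 B≡ = trans (lemma n0 d1) (cong (_+ d1) (trans (cong (_+ n0) (sym I-size)) (trans (#+#¬ I? F1.L) F1.size)))
  where
  lemma : ∀ n d -> n + (d + d) ≡ d + n + d
  lemma = solve-∀

 0<B : 0 < B
 0<B = ≤-trans 0<d1 (≤-trans (m≤m+n d1 d1) (m≤n+m _ n0))

 splits : ∀ {Q : F1.T -> Set} (Q? : Decidable Q) -> # Q? F1.L ≡ # Q? Lᵢ + # Q? Lⱼ
 splits Q? = trans (trans (#-partition Q? I? F1.L) (cong₂ _+_ (#-cong _ _ F1.L (\ _ (q , i) -> i , q) (\ _ (i , q) -> q , i)) (#-cong _ _ F1.L (\ _ (q , i) -> i , q) (\ _ (i , q) -> q , i))))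
  (cong₂ _+_ (sym (#-filter I? Q? F1.L)) (sym (#-filter J? Q? F1.L)))

 -- The multiplicities B and N2 balance the pattern: each of the three parts gets `B * N2` vertices.
 sides thirds L : List T
 sides = map (\ x -> side zero x) F2.L ++ map (\ x -> side 1F x) F2.L
 thirds = map (\ x -> third zero x) Lⱼ ++ (map (\ x -> third 1F x) Lᵢ ++ map (\ x -> third 2F x) Lᵢ)
 L = copies B sides ++ copies N2 thirds

 ∑-sides : ∀ f -> ∑ f sides ≡ ∑ (\ x -> f (side zero x)) F2.L + ∑ (\ x -> f (side 1F x)) F2.L
 ∑-sides f = trans (∑-++ f (map (\ x -> side zero x) F2.L) _) (cong₂ _+_ (∑-map f _ F2.L) (∑-map f _ F2.L))

 ∑-thirds : ∀ f -> ∑ f thirds ≡ ∑ (\ x -> f (third zero x)) Lⱼ + (∑ (\ x -> f (third 1F x)) Lᵢ + ∑ (\ x -> f (third 2F x)) Lᵢ)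
 ∑-thirds f = trans (∑-++ f (map (\ x -> third zero x) Lⱼ) _) (cong₂ _+_ (∑-map f _ Lⱼ)
  (trans (∑-++ f (map (\ x -> third 1F x) Lᵢ) _) (cong₂ _+_ (∑-map f _ Lᵢ) (∑-map f _ Lᵢ))))

 ∑-L : ∀ f -> ∑ f L ≡ B * ∑ f sides + N2 * ∑ f thirds
 ∑-L f = trans (∑-++ f (copies B sides) _) (cong₂ _+_ (∑-copies f B sides) (∑-copies f N2 thirds))

 size : length L ≡ B * (N2 + N2) + N2 * B
 size = trans (sym (∑-ones L)) (trans (∑-L (\ _ -> 1)) (cong₂ (\ s t -> B * s + N2 * t)
  (trans (∑-sides (\ _ -> 1)) (cong₂ _+_ (trans (∑-ones F2.L) F2.size) (trans (∑-ones F2.L) F2.size)))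
  (trans (∑-thirds (\ _ -> 1)) (cong₂ _+_ (trans (∑-ones Lⱼ) Lⱼ-length) (cong₂ _+_ (trans (∑-ones Lᵢ) Lᵢ-length) (trans (∑-ones Lᵢ) Lᵢ-length))))))

 everywhere : ∀ {A : Set} p (g : A -> T) xs {n} -> length xs ≡ n -> (∀ x -> Adj p (g x)) -> n ≤ # (\ x -> Adj? p (g x)) xs
 everywhere p g xs e h = ≡⇒≤ (sym (trans (#-all (\ x -> Adj? p (g x)) xs \ {x} _ -> h x) e))

 side-third : ∀ i j x y -> Adj (side i x) (third j y)
 side-third i j x y = adjacent (side i x) (third j y) (complete i j) tt
  where
  complete : ∀ i j -> κ34 (i Fin.↑ˡ 3) (2 Fin.↑ʳ j) ≢ none
  complete = toWitness {a? = FinP.all? \ i -> FinP.all? \ j -> ¬? (κ34 (i Fin.↑ˡ 3) (2 Fin.↑ʳ j) ≟ᶜ none)} tt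

 third-side : ∀ i j x y -> Adj (third j y) (side i x)
 third-side i j x y = Adj-sym {side i x} {third j y} (side-third i j x y)

 sd : ℕ
 sd = B * (d2 + N2) + N2 * B

 side-degree : ∀ i {x} -> x ∈ F2.L -> sd ≤ # (Adj? (side i x)) L
 side-degree i {x} x∈ = ≤-trans (+-mono-≤ (*-monoʳ-≤ B (on-sides i)) (*-monoʳ-≤ N2 on-thirds)) (≡⇒≤ (sym (∑-L (\ q -> 𝟙 (Adj? (side i x) q)))))
  where
  on-thirds : B ≤ # (Adj? (side i x)) thirds
  on-thirds = ≤-trans (+-mono-≤ (everywhere (side i x) (\ y -> third zero y) Lⱼ Lⱼ-length \ y -> side-third i zero x y) (+-mono-≤ (everywhere (side i x) (\ y -> third 1F y) Lᵢ Lᵢ-length \ y -> side-third i 1F x y)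
   (everywhere (side i x) (\ y -> third 2F y) Lᵢ Lᵢ-length \ y -> side-third i 2F x y))) (≡⇒≤ (sym (∑-thirds (\ q -> 𝟙 (Adj? (side i x) q)))))
  on-sides : ∀ i -> d2 + N2 ≤ # (Adj? (side i x)) sides
  on-sides zero = ≤-trans (+-mono-≤ (≤-trans (F2.degree x∈) (#-mono (F2.E? x) (\ y -> Adj? (side zero x) (side zero y)) F2.L \ {y} _ -> adjacent (side zero x) (side zero y) blue≢none))
   (everywhere (side zero x) (\ y -> side 1F y) F2.L F2.size \ y -> adjacent (side zero x) (side 1F y) red≢none tt)) (≡⇒≤ (sym (∑-sides (\ q -> 𝟙 (Adj? (side zero x) q)))))
  on-sides 1F = ≤-trans (≤-trans (≡⇒≤ (+-comm d2 N2)) (+-mono-≤ (everywhere (side 1F x) (\ y -> side zero y) F2.L F2.size \ y -> adjacent (side 1F x) (side zero y) red≢none tt)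
   (≤-trans (F2.degree x∈) (#-mono (F2.E? x) (\ y -> Adj? (side 1F x) (side 1F y)) F2.L \ {y} _ -> adjacent (side 1F x) (side 1F y) blue≢none)))) (≡⇒≤ (sym (∑-sides (\ q -> 𝟙 (Adj? (side 1F x) q)))))

 third-sides : ∀ j x -> N2 + N2 ≤ # (Adj? (third j x)) sides
 third-sides j x = ≤-trans (+-mono-≤ (everywhere (third j x) (\ y -> side zero y) F2.L F2.size \ y -> third-side zero j y x) (everywhere (third j x) (\ y -> side 1F y) F2.L F2.size \ y -> third-side 1F j y x))
  (≡⇒≤ (sym (∑-sides (\ q -> 𝟙 (Adj? (third j x) q)))))

 e1 : F1.T -> ℕ
 e1 x = # (F1.E? x) Lᵢ

 joint : ℕ
 joint = B * (N2 + N2)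

 -- Neighbours in I count twice, because I is present in two copies.
 plain-degree : ∀ {x} -> x ∈ Lⱼ -> joint + N2 * (d1 + e1 x) ≤ # (Adj? (third zero x)) L
 plain-degree {x} x∈ = ≤-trans (+-mono-≤ (*-monoʳ-≤ B (third-sides zero x)) (*-monoʳ-≤ N2 on-thirds)) (≡⇒≤ (sym (∑-L (\ q -> 𝟙 (Adj? (third zero x) q)))))
  where
  on-thirds : d1 + e1 x ≤ # (Adj? (third zero x)) thirds
  on-thirds = ≤-trans (lin (d1 ∷ (# (F1.E? x) F1.L) ∷ (e1 x) ∷ (# (F1.E? x) Lⱼ) ∷ (# (\ y -> Adj? (third zero x) (third zero y)) Lⱼ) ∷ (# (\ y -> Adj? (third zero x) (third 1F y)) Lᵢ) ∷ (# (\ y -> Adj? (third zero x) (third 2F y)) Lᵢ) ∷ []) (v0 :+ v2 <: v4 :+ (v5 :+ v6)) (v0 <: v1 by F1.degree (proj₁ (∈-Lⱼ x∈)) & v1 <: v2 :+ v3 by≡ splits (F1.E? x) & v3 <: v4 by (#-mono (F1.E? x) (\ y -> Adj? (third zero x) (third zero y)) Lⱼ \ {y} _ -> adjacent (third zero x) (third zero y) red≢none) & v2 <: v5 by (#-mono (F1.E? x) (\ y -> Adj? (third zero x) (third 1F y)) Lᵢ \ {y} _ -> adjacent (third zero x) (third 1F y) red≢none) & v2 <: v6 by (#-mono (F1.E? x) (\ y -> Adj? (third zero x) (third 2F y)) Lᵢ \ {y} _ -> adjacent (third zero x) (third 2F y) red≢none) & □))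
   (≡⇒≤ (sym (∑-thirds (\ q -> 𝟙 (Adj? (third zero x) q)))))

 outside-degree : ∀ {x} -> x ∈ Lᵢ -> d1 ≤ # (F1.E? x) Lⱼ
 outside-degree {x} x∈ = (lin (d1 ∷ (# (F1.E? x) F1.L) ∷ (e1 x) ∷ (# (F1.E? x) Lⱼ) ∷ []) (v0 <: v3) (v0 <: v1 by F1.degree (proj₁ (∈-Lᵢ x∈)) & v1 <: v2 :+ v3 by≡ splits (F1.E? x) & v2 <: k 0 by≡ (#-none (F1.E? x) Lᵢ \ y∈ e -> F1.triangle-free (proj₂ (∈-Lᵢ x∈)) e (proj₂ (∈-Lᵢ y∈))) & □))

 -- A vertex of I has at least d1 neighbours outside I, none inside, and is joined to all d1
 -- vertices of the opposite copy.
 copy-degree : ∀ j {x} -> x ∈ Lᵢ -> joint + N2 * (d1 + d1) ≤ # (Adj? (third (suc j) x)) L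
 copy-degree j {x} x∈ = ≤-trans (+-mono-≤ (*-monoʳ-≤ B (third-sides (suc j) x)) (*-monoʳ-≤ N2 (≤-trans (on-thirds j) (≡⇒≤ (sym (∑-thirds (\ q -> 𝟙 (Adj? (third (suc j) x) q)))))))) (≡⇒≤ (sym (∑-L (\ q -> 𝟙 (Adj? (third (suc j) x) q)))))
  where
  plains : ∀ j -> κ34 (2 Fin.↑ʳ suc j) (2 Fin.↑ʳ zero) ≢ none -> d1 ≤ # (\ y -> Adj? (third (suc j) x) (third zero y)) Lⱼ
  plains j c = ≤-trans (outside-degree x∈) (#-mono (F1.E? x) (\ y -> Adj? (third (suc j) x) (third zero y)) Lⱼ \ {y} _ -> adjacent (third (suc j) x) (third zero y) c)
  on-thirds : ∀ j -> d1 + d1 ≤ # (\ y -> Adj? (third (suc j) x) (third zero y)) Lⱼ + (# (\ y -> Adj? (third (suc j) x) (third 1F y)) Lᵢ + # (\ y -> Adj? (third (suc j) x) (third 2F y)) Lᵢ)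
  on-thirds zero = +-mono-≤ (plains zero red≢none) (≤-trans (everywhere (third 1F x) (\ y -> third 2F y) Lᵢ Lᵢ-length \ y -> adjacent (third 1F x) (third 2F y) blue≢none tt)
   (m≤n+m _ (# (\ y -> Adj? (third 1F x) (third 1F y)) Lᵢ)))
  on-thirds 1F = +-mono-≤ (plains 1F red≢none) (≤-trans (everywhere (third 2F x) (\ y -> third 1F y) Lᵢ Lᵢ-length \ y -> adjacent (third 2F x) (third 1F y) blue≢none tt)
   (m≤m+n _ (# (\ y -> Adj? (third 2F x) (third 2F y)) Lᵢ)))

 D : ℕ
 D = B * (N2 * sd + N2 * sd) + N2 * (n0 * (joint + N2 * d1) + N2 * (d1 * d1) + (d1 * (joint + N2 * (d1 + d1)) + d1 * (joint + N2 * (d1 + d1))))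

 degrees : D ≤ ∑ (\ p -> # (Adj? p) L) L
 degrees = ≤-trans (+-mono-≤ (*-monoʳ-≤ B (≤-trans (+-mono-≤ (side-total zero) (side-total 1F)) (≡⇒≤ (sym (∑-sides (\ p -> # (Adj? p) L))))))
  (*-monoʳ-≤ N2 (≤-trans (+-mono-≤ plain-total (+-mono-≤ (copy-total zero) (copy-total 1F))) (≡⇒≤ (sym (∑-thirds (\ p -> # (Adj? p) L))))))) (≡⇒≤ (sym (∑-L (\ p -> # (Adj? p) L))))
  where
  total : ∀ {A : Set} {f : A -> ℕ} {xs n} c -> length xs ≡ n -> (∀ {x} -> x ∈ xs -> c ≤ f x) -> n * c ≤ ∑ f xs
  total {xs = xs} c e h = ≤-trans (≡⇒≤ (sym (trans (∑-const c xs) (cong (_* c) e)))) (∑-mono xs h)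
  side-total : ∀ i -> N2 * sd ≤ ∑ (\ x -> # (Adj? (side i x)) L) F2.L
  side-total i = total sd F2.size (side-degree i)
  copy-total : ∀ j -> d1 * (joint + N2 * (d1 + d1)) ≤ ∑ (\ x -> # (Adj? (third (suc j) x)) L) Lᵢ
  copy-total j = total _ Lᵢ-length (copy-degree j)
  -- The terms `e1 x` are summed from the other end: each of the d1 vertices of I has at least d1
  -- neighbours outside I.
  plain-total : n0 * (joint + N2 * d1) + N2 * (d1 * d1) ≤ ∑ (\ x -> # (Adj? (third zero x)) L) Lⱼ
  plain-total = begin
   n0 * (joint + N2 * d1) + N2 * (d1 * d1) ≤⟨ +-mono-≤ (≡⇒≤ (sym (trans (∑-const _ Lⱼ) (cong (_* (joint + N2 * d1)) Lⱼ-length))))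
    (*-monoʳ-≤ N2 (≤-trans (total d1 Lᵢ-length \ {y} y∈ -> ≤-trans (outside-degree y∈) (#-mono (F1.E? y) (\ x -> F1.E? x y) Lⱼ \ _ -> F1.E-sym))
     (≡⇒≤ (∑-swap (\ y x -> 𝟙 (F1.E? x y)) Lᵢ Lⱼ)))) ⟩
   ∑ (\ _ -> joint + N2 * d1) Lⱼ + N2 * ∑ e1 Lⱼ ≡⟨ trans (cong (∑ (\ _ -> joint + N2 * d1) Lⱼ +_) (sym (∑-* N2 e1 Lⱼ))) (sym (∑-+ _ _ Lⱼ)) ⟩
   ∑ (\ x -> joint + N2 * d1 + N2 * e1 x) Lⱼ ≤⟨ ∑-mono Lⱼ (\ {x} x∈ -> ≤-trans (≡⇒≤ (regroup joint N2 d1 (e1 x))) (plain-degree x∈)) ⟩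
   ∑ (\ x -> # (Adj? (third zero x)) L) Lⱼ ∎
   where
   regroup : ∀ b N d e -> b + N * d + N * e ≡ b + N * (d + e)
   regroup = solve-∀

 side∈ : ∀ i {x} -> x ∈ F2.L -> side i x ∈ L
 side∈ i {x} m = ∈-++⁺ˡ (∈-copies⁺ 0<B (at i))
  where
  at : ∀ i -> side i x ∈ sides
  at zero = ∈-++⁺ˡ (∈-map⁺ (\ x -> side zero x) m)
  at 1F = ∈-++⁺ʳ (map (\ x -> side zero x) F2.L) (∈-map⁺ (\ x -> side 1F x) m)

 plain∈ : ∀ {x} -> x ∈ Lⱼ -> third zero x ∈ L
 plain∈ m = ∈-++⁺ʳ (copies B sides) (∈-copies⁺ 0<N2 (∈-++⁺ˡ (∈-map⁺ (\ x -> third zero x) m)))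

 copy∈ : ∀ j {x} -> x ∈ Lᵢ -> third (suc j) x ∈ L
 copy∈ j {x} m = ∈-++⁺ʳ (copies B sides) (∈-copies⁺ 0<N2 (∈-++⁺ʳ (map (\ x -> third zero x) Lⱼ) (at j)))
  where
  at : ∀ j -> third (suc j) x ∈ map (\ x -> third 1F x) Lᵢ ++ map (\ x -> third 2F x) Lᵢ
  at zero = ∈-++⁺ˡ (∈-map⁺ (\ x -> third 1F x) m)
  at 1F = ∈-++⁺ʳ (map (\ x -> third 1F x) Lᵢ) (∈-map⁺ (\ x -> third 2F x) m)

 module Independent {P : T -> Set} (P? : Decidable P) (ind : ∀ {x y} -> x ∈ L -> y ∈ L -> P x -> P y -> ¬ Adj x y) where

  S0 S1 R0 R1 R2 : ℕ
  S0 = # (\ x -> P? (side zero x)) F2.L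
  S1 = # (\ x -> P? (side 1F x)) F2.L
  R0 = # (\ x -> P? (third zero x)) Lⱼ
  R1 = # (\ x -> P? (third 1F x)) Lᵢ
  R2 = # (\ x -> P? (third 2F x)) Lᵢ

  count : # P? L ≡ B * (S0 + S1) + N2 * (R0 + (R1 + R2))
  count = trans (∑-L (\ p -> 𝟙 (P? p))) (cong₂ (\ s t -> B * s + N2 * t) (∑-sides (\ p -> 𝟙 (P? p))) (∑-thirds (\ p -> 𝟙 (P? p))))

  side-few : ∀ i -> # (\ x -> P? (side i x)) F2.L ≤ d2
  side-few zero = F2.independent _ \ x∈ y∈ px py e -> ind (side∈ zero x∈) (side∈ zero y∈) px py (adjacent (side zero _) (side zero _) blue≢none e)
  side-few 1F = F2.independent _ \ x∈ y∈ px py e -> ind (side∈ 1F x∈) (side∈ 1F y∈) px py (adjacent (side 1F _) (side 1F _) blue≢none e)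

  -- Independent sets use only one copy of I, and I has no inner edges.
  third-few : ∀ j -> κ34 (2 Fin.↑ʳ zero) (2 Fin.↑ʳ suc j) ≢ none -> R0 + # (\ x -> P? (third (suc j) x)) Lᵢ ≤ d1
  third-few j c = begin
   R0 + # (\ x -> P? (third (suc j) x)) Lᵢ ≡⟨ cong₂ _+_ (#-filter J? (\ x -> P? (third zero x)) F1.L) (#-filter I? (\ x -> P? (third (suc j) x)) F1.L) ⟩
   # X? F1.L + # Y? F1.L ≤⟨ #-disjoint X? Y? Z? F1.L (\ _ -> inj₁) (\ _ -> inj₂) (\ _ (ni , _) (i , _) -> ni i) ⟩
   # Z? F1.L ≤⟨ F1.independent Z? apart ⟩
   d1 ∎
   where
   X? : ∀ x -> Dec (¬ F1.E o x × P (third zero x))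
   X? x = J? x ×? P? (third zero x)
   Y? : ∀ x -> Dec (F1.E o x × P (third (suc j) x))
   Y? x = I? x ×? P? (third (suc j) x)
   Z? : ∀ x -> Dec ((¬ F1.E o x × P (third zero x)) ⊎ (F1.E o x × P (third (suc j) x)))
   Z? x = X? x ⊎-dec Y? x
   plain-copy : ∀ {x y} -> x ∈ F1.L -> y ∈ F1.L -> ¬ F1.E o x -> P (third zero x) -> F1.E o y -> P (third (suc j) y) -> ¬ F1.E x y
   plain-copy {x} {y} x∈ y∈ nx px oy py e = ind (plain∈ (∈-filter⁺ J? x∈ nx)) (copy∈ j (∈-filter⁺ I? y∈ oy)) px py (adjacent (third zero x) (third (suc j) y) c e)
   apart : ∀ {x y} -> x ∈ F1.L -> y ∈ F1.L -> (¬ F1.E o x × P (third zero x)) ⊎ (F1.E o x × P (third (suc j) x)) ->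
    (¬ F1.E o y × P (third zero y)) ⊎ (F1.E o y × P (third (suc j) y)) -> ¬ F1.E x y
   apart {x} {y} x∈ y∈ (inj₁ (nx , px)) (inj₁ (ny , py)) e = ind (plain∈ (∈-filter⁺ J? x∈ nx)) (plain∈ (∈-filter⁺ J? y∈ ny)) px py (adjacent (third zero x) (third zero y) red≢none e)
   apart x∈ y∈ (inj₁ (nx , px)) (inj₂ (oy , py)) e = plain-copy x∈ y∈ nx px oy py e
   apart x∈ y∈ (inj₂ (ox , px)) (inj₁ (ny , py)) e = plain-copy y∈ x∈ ny py ox px (F1.E-sym e)
   apart x∈ y∈ (inj₂ (ox , _)) (inj₂ (oy , _)) e = F1.triangle-free ox e oy

  no-thirds : ∀ {i x} -> x ∈ F2.L -> P (side i x) -> R0 + (R1 + R2) ≡ 0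
  no-thirds {i} {x} x∈ p = cong₂ _+_ (#-none (\ y -> P? (third zero y)) Lⱼ \ {y} y∈ q -> ind (side∈ i x∈) (plain∈ y∈) p q (side-third i zero x y))
   (cong₂ _+_ (#-none (\ y -> P? (third 1F y)) Lᵢ \ {y} y∈ q -> ind (side∈ i x∈) (copy∈ zero y∈) p q (side-third i 1F x y))
        (#-none (\ y -> P? (third 2F y)) Lᵢ \ {y} y∈ q -> ind (side∈ i x∈) (copy∈ 1F y∈) p q (side-third i 2F x y)))

  bound : # P? L ≤ B * d2 ⊔ N2 * d1
  bound = ≤-trans (≡⇒≤ count) (go (search (\ x -> P? (side zero x)) F2.L) (search (\ x -> P? (side 1F x)) F2.L))
   where
   weigh : ∀ {s t} -> s ≤ d2 -> t ≡ 0 -> B * s + N2 * t ≤ B * d2 ⊔ N2 * d1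
   weigh {s} h refl = ≤-trans (≡⇒≤ (trans (cong (B * s +_) (*-zeroʳ N2)) (+-identityʳ _))) (≤-trans (*-monoʳ-≤ B h) (m≤m⊔n (B * d2) (N2 * d1)))
   go : Dec (∃ \ x -> x ∈ F2.L × P (side zero x)) -> Dec (∃ \ x -> x ∈ F2.L × P (side 1F x)) -> B * (S0 + S1) + N2 * (R0 + (R1 + R2)) ≤ B * d2 ⊔ N2 * d1
   go (yes (x , x∈ , p)) _ = weigh (≤-trans (≡⇒≤ (trans (cong (S0 +_) (#-none (\ y -> P? (side 1F y)) F2.L \ {y} y∈ q ->
    ind (side∈ zero x∈) (side∈ 1F y∈) p q (adjacent (side zero x) (side 1F y) red≢none tt))) (+-identityʳ S0))) (side-few zero)) (no-thirds x∈ p)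
   go (no h) (yes (x , x∈ , p)) = weigh (≤-trans (≡⇒≤ (cong (_+ S1) (#-none (\ y -> P? (side zero y)) F2.L \ y∈ q -> h (_ , y∈ , q)))) (side-few 1F)) (no-thirds x∈ p)
   go (no h) (no h') = begin
    B * (S0 + S1) + N2 * (R0 + (R1 + R2)) ≡⟨ cong (\ s -> B * s + N2 * (R0 + (R1 + R2))) (cong₂ _+_ (#-none (\ y -> P? (side zero y)) F2.L \ y∈ q -> h (_ , y∈ , q))
      (#-none (\ y -> P? (side 1F y)) F2.L \ y∈ q -> h' (_ , y∈ , q))) ⟩
    B * 0 + N2 * (R0 + (R1 + R2)) ≡⟨ cong (_+ N2 * (R0 + (R1 + R2))) (*-zeroʳ B) ⟩
    N2 * (R0 + (R1 + R2)) ≤⟨ *-monoʳ-≤ N2 (one-copy (search (\ x -> P? (third 1F x)) Lᵢ)) ⟩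
    N2 * d1 ≤⟨ m≤n⊔m (B * d2) (N2 * d1) ⟩
    B * d2 ⊔ N2 * d1 ∎
    where
    one-copy : Dec (∃ \ x -> x ∈ Lᵢ × P (third 1F x)) -> R0 + (R1 + R2) ≤ d1
    one-copy (no g) = ≤-trans (≡⇒≤ (cong (\ t -> R0 + (t + R2)) (#-none (\ y -> P? (third 1F y)) Lᵢ \ y∈ q -> g (_ , y∈ , q)))) (third-few 1F red≢none)
    one-copy (yes (x , x∈ , p)) = ≤-trans (≡⇒≤ (cong (R0 +_) (trans (cong (R1 +_) (#-none (\ y -> P? (third 2F y)) Lᵢ \ {y} y∈ q ->
     ind (copy∈ zero x∈) (copy∈ 1F y∈) p q (adjacent (third 1F x) (third 2F y) blue≢none tt))) (+-identityʳ R1)))) (third-few zero red≢none)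

 template34 : Template 3 (B * (N2 + N2) + N2 * B) (B * d2 ⊔ N2 * d1) D
 template34 = record
  { T = T ; _≟T_ = ⊎-≡-dec (×-≡-dec Fin._≟_ F2._≟T_) (×-≡-dec Fin._≟_ F1._≟T_) ; 𝒢 = 𝒢 ; L = L ; size = size
  ; red-free = \ {p} {q} {s} -> red-free {p} {q} {s} ; blue-bounded = blue-bounded
  ; independent = \ P? ind -> Independent.bound P? ind ; degrees = degrees }

-- Rational approximation and the limits

-- At least (A/B − 1/e) n² edges, and independence number at most (u/w) n.
Dense-graphs : (s u w e A B : ℕ) -> Set
Dense-graphs s u w e A B = ∃ \ n0 -> ∀ n -> n0 ≤ n -> Estimate s n w u (A * e) (B * e) 1 B

realise : ∀ {s M α D u w e A b c} -> Template s M α D -> 0 < M -> w * α < u * M -> A * e * (M * M) ≤ b * e * D + c * (M * M) -> c + 1 ≤ 2 * b -> Dense-graphs s u w e A (2 * b)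
realise {s} {M} {α} {D} {u} {w} {e} {A} {b} {c} 𝒯 0<M sparse dense c< = w * α * M + 2 * (A * e) * M , \ n large -> weaken (BlowUp.estimate 𝒯 {{>-nonZero 0<M}} n {w = w} {u = u} {a = A * e} {b = b * e} {c = c} sparse dense large)
 where
 weaken : ∀ {n} -> Estimate s n w u (A * e) (b * e) 2 (c + 1) -> Estimate s n w u (A * e) (2 * b * e) 1 (2 * b)
 weaken {n} (G , free , ind , h) = G , free , ind , ≤-trans h (+-mono-≤ (≡⇒≤ (lemma b e (edgeCount G))) (*-monoˡ-≤ (n * n) c<))
  where
  lemma : ∀ b e x -> b * e * (2 * x) ≡ 2 * b * e * (1 * x)
  lemma = solve-∀

-- Over the denominator `6w²` this is `1/3 + δ/2 + 3δ²/2` for `δ = u / w`.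
numerator : ℕ -> ℕ -> ℕ
numerator u w = 2 * (w * w) + 3 * u * w + 9 * (u * u)

module _ (u w e : ℕ) (0<u : 0 < u) (0<e : 0 < e) (20u≤w : 20 * u ≤ w) where

 -- The target ratio is d/N = c u/w, approximated from below.
 P : ℕ
 P = w * e + 1

 Q : ℕ -> ℕ
 Q c = c * u * e

 Q-positive : ∀ c -> 0 < c -> 0 < Q c
 Q-positive c 0<c = *-mono-< (*-mono-< 0<c 0<u) 0<e

 Q≤P : ∀ c -> c ≤ 20 -> Q c ≤ P
 Q≤P c c≤ = ≤-trans (*-monoˡ-≤ e (≤-trans (*-monoˡ-≤ u c≤) 20u≤w)) (m≤m+n _ 1)

 2≤w : 2 ≤ w
 2≤w = ≤-trans (*-mono-≤ {2} {20} (s≤s (s≤s z≤n)) 0<u) 20u≤w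

 -- The summand 1 in `P = we + 1` makes the independence ratio strictly smaller than its target, as
 -- blow-ups with a remainder require.
 sparse-ratio : ∀ c {N d} -> 0 < d -> P * d ≤ Q c * N -> w * d < u * (c * N)
 sparse-ratio c {N} {d} 0<d h = *-cancelˡ-< e (w * d) (u * (c * N)) (begin-strict
  e * (w * d) <⟨ m<m+n _ 0<d ⟩
  e * (w * d) + d ≡⟨ lemma e w d ⟩
  P * d ≤⟨ h ⟩
  Q c * N ≡⟨ lemma' c u e N ⟩
  e * (u * (c * N)) ∎)
  where
  lemma : ∀ e w d -> e * (w * d) + d ≡ (w * e + 1) * d
  lemma = solve-∀
  lemma' : ∀ c u e N -> c * u * e * N ≡ e * (u * (c * N))
  lemma' = solve-∀

 -- The price of approximating from below: an error of 2N, which becomes 2N/e after division by e.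
 dense-ratio : ∀ c {N d} -> d ≤ N -> Q c * N ≤ (P + 1) * d -> Q c * N ≤ w * e * d + 2 * N
 dense-ratio c {N} {d} d≤N h = ≤-trans h (≤-trans (≡⇒≤ (lemma w e d)) (+-monoʳ-≤ (w * e * d) (*-monoʳ-≤ 2 d≤N)))
  where
  lemma : ∀ w e d -> (w * e + 1 + 1) * d ≡ w * e * d + 2 * d
  lemma = solve-∀

 ratio : ∀ c -> 0 < c -> 4 * c ≤ 20 -> Between P (Q c)
 ratio c 0<c h = dense-ratios P (Q c) (Q-positive c 0<c) (≤-trans (≡⇒≤ (lemma c u e)) (Q≤P (4 * c) h))
  where
  lemma : ∀ c u e -> 4 * (c * u * e) ≡ 4 * c * u * e
  lemma = solve-∀

 lower-copies : ∀ r {s} -> 4 * suc r ≤ 20 -> (∀ {N d} -> Sys N d -> 0 < N -> Template s (suc r * N) d (suc r * N * (r * N + d))) ->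
  Dense-graphs s u w e (r * w + suc r * u) (2 * (suc r * w))
 lower-copies r {s} small template = go (ratio (suc r) (s≤s z≤n) small)
  where
  go : Between P (Q (suc r)) -> Dense-graphs s u w e (r * w + suc r * u) (2 * (suc r * w))
  go (N , d , 𝒮 , 0<d , d<N , above , below) = realise {u = u} {w = w} {e = e} {A = r * w + suc r * u} {b = suc r * w} {c = 2} (template 𝒮 0<N)
   (≤-trans 0<N (m≤m+n N _)) (sparse-ratio (suc r) 0<d above) (begin
    (r * w + R * u) * e * (R * N * (R * N)) ≡⟨ lemma r R w u e N ⟩
    R * R * N * (r * w * e * N + R * u * e * N) ≤⟨ *-monoʳ-≤ (R * R * N) (+-monoʳ-≤ (r * w * e * N) (dense-ratio R (<⇒≤ d<N) below)) ⟩
    R * R * N * (r * w * e * N + (w * e * d + 2 * N)) ≡⟨ lemma' r R w e N d ⟩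
    R * w * e * (R * N * (r * N + d)) + 2 * (R * N * (R * N)) ∎)
   (≤-trans (s≤s (s≤s (s≤s z≤n))) (*-mono-≤ {2} ≤-refl (*-mono-≤ {1} {R} (s≤s z≤n) 2≤w)))
   where
   R = suc r
   0<N : 0 < N
   0<N = ≤-<-trans z≤n d<N
   lemma : ∀ r R w u e N -> (r * w + R * u) * e * (R * N * (R * N)) ≡ R * R * N * (r * w * e * N + R * u * e * N)
   lemma = solve-∀
   lemma' : ∀ r R w e N d -> R * R * N * (r * w * e * N + (w * e * d + 2 * N)) ≡ R * w * e * (R * N * (r * N + d)) + 2 * (R * N * (R * N))
   lemma' = solve-∀

 lower33 : Dense-graphs 2 u w e (1 * w + 2 * u) (2 * (2 * w))
 lower33 = lower-copies 1 (m≤m+n 8 12) template33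

 lower35 : Dense-graphs 4 u w e (4 * w + 5 * u) (2 * (5 * w))
 lower35 = lower-copies 4 ≤-refl template35

 module _ {N2 d2 B d1 : ℕ} (d2≤N2 : d2 ≤ N2) (d1≤B : d1 ≤ B) (h2 : Q 3 * N2 ≤ (P + 1) * d2) (h1 : Q 3 * B ≤ (P + 1) * d1) where

  -- Source of the term `3δ²/2`: as `d1 / B` is close to 3u/w, its square `9u² / w²` is bounded by
  -- `d1² / B²` up to an error of order 1/e.
  square-ratio : 9 * (u * u) * e * (B * B) ≤ (w * w * e + (4 * w + 4)) * (d1 * d1)
  square-ratio = *-cancelˡ-≤ e {{>-nonZero 0<e}} (begin
   e * (9 * (u * u) * e * (B * B)) ≡⟨ lemma u e B ⟩
   Q 3 * B * (Q 3 * B) ≤⟨ *-mono-≤ h1 h1 ⟩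
   (P + 1) * d1 * ((P + 1) * d1) ≡⟨ lemma' w e d1 ⟩
   e * (w * w * e + 4 * w) * (d1 * d1) + 4 * (d1 * d1) ≤⟨ +-monoʳ-≤ _ (≤-trans (≡⇒≤ (sym (*-identityˡ _))) (*-monoˡ-≤ (4 * (d1 * d1)) 0<e)) ⟩
   e * (w * w * e + 4 * w) * (d1 * d1) + e * (4 * (d1 * d1)) ≡⟨ lemma″ w e d1 ⟩
   e * ((w * w * e + (4 * w + 4)) * (d1 * d1)) ∎)
   where
   lemma : ∀ u e B -> e * (9 * (u * u) * e * (B * B)) ≡ 3 * u * e * B * (3 * u * e * B)
   lemma = solve-∀
   lemma' : ∀ w e d -> (w * e + 1 + 1) * d * ((w * e + 1 + 1) * d) ≡ e * (w * w * e + 4 * w) * (d * d) + 4 * (d * d)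
   lemma' = solve-∀
   lemma″ : ∀ w e d -> e * (w * w * e + 4 * w) * (d * d) + e * (4 * (d * d)) ≡ e * ((w * w * e + (4 * w + 4)) * (d * d))
   lemma″ = solve-∀

  -- `9X` for X = `(N2 * B)²` is the square of the number of vertices. In the degree sum, `6X`
  -- counts pairs in different parts, the term with d2 the edges inside the sides, and the terms
  -- with d1 those of the third part.
  dense34 : numerator u w * e * (9 * (N2 * B * (N2 * B))) ≤
   3 * (w * w) * e * (6 * (N2 * B * (N2 * B)) + 2 * (B * B * N2 * d2) + N2 * N2 * (B * d1 + 3 * (d1 * d1))) + (6 * w + 4) * (9 * (N2 * B * (N2 * B)))
  dense34 = begin
   numerator u w * e * (9 * (N2 * B * (N2 * B)))
    ≡⟨ lemma w u e N2 B ⟩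
   18 * (w * w) * e * X + 6 * w * (N2 * (B * B)) * (3 * u * e * N2) + 3 * w * (N2 * N2 * B) * (3 * u * e * B) + 9 * (N2 * N2) * (9 * (u * u) * e * (B * B))
    ≤⟨ +-mono-≤ (+-mono-≤ (+-monoʳ-≤ (18 * (w * w) * e * X) (*-monoʳ-≤ (6 * w * (N2 * (B * B))) (dense-ratio 3 d2≤N2 h2)))
      (*-monoʳ-≤ (3 * w * (N2 * N2 * B)) (dense-ratio 3 d1≤B h1)))
      (*-monoʳ-≤ (9 * (N2 * N2)) (≤-trans square-ratio (≤-trans (≡⇒≤ (*-distribʳ-+ (d1 * d1) (w * w * e) (4 * w + 4))) (+-monoʳ-≤ (w * w * e * (d1 * d1)) (*-monoʳ-≤ (4 * w + 4) (*-mono-≤ d1≤B d1≤B)))))) ⟩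
   18 * (w * w) * e * X + 6 * w * (N2 * (B * B)) * (w * e * d2 + 2 * N2) + 3 * w * (N2 * N2 * B) * (w * e * d1 + 2 * B) + 9 * (N2 * N2) * (w * w * e * (d1 * d1) + (4 * w + 4) * (B * B))
    ≡⟨ lemma' w e N2 B d1 d2 ⟩
   3 * (w * w) * e * (6 * X + 2 * (B * B * N2 * d2) + N2 * N2 * (B * d1 + 3 * (d1 * d1))) + (6 * w + 4) * (9 * X) ∎
   where
   X = N2 * B * (N2 * B)
   lemma : ∀ w u e N B -> (2 * (w * w) + 3 * u * w + 9 * (u * u)) * e * (9 * (N * B * (N * B))) ≡
    18 * (w * w) * e * (N * B * (N * B)) + 6 * w * (N * (B * B)) * (3 * u * e * N) + 3 * w * (N * N * B) * (3 * u * e * B) + 9 * (N * N) * (9 * (u * u) * e * (B * B))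
   lemma = solve-∀
   lemma' : ∀ w e N B d1 d2 -> 18 * (w * w) * e * (N * B * (N * B)) + 6 * w * (N * (B * B)) * (w * e * d2 + 2 * N) + 3 * w * (N * N * B) * (w * e * d1 + 2 * B) +
     9 * (N * N) * (w * w * e * (d1 * d1) + (4 * w + 4) * (B * B)) ≡
    3 * (w * w) * e * (6 * (N * B * (N * B)) + 2 * (B * B * N * d2) + N * N * (B * d1 + 3 * (d1 * d1))) + (6 * w + 4) * (9 * (N * B * (N * B)))
   lemma' = solve-∀

 lower34 : Dense-graphs 3 u w e (numerator u w) (2 * (3 * (w * w)))
 lower34 = go (ratio 3 (s≤s z≤n) (m≤m+n 12 8)) (dense-ratios P' (Q 3) (Q-positive 3 (s≤s z≤n)) 4Q≤P')
  where
  -- Doubling I gives the third part the ratio `B / d1 = N1 / d1 + 1`, so the graph inside it has to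
  -- approximate P/Q - 1.
  P' = P ∸ Q 3
  P≡ : P' + Q 3 ≡ P
  P≡ = m∸n+n≡m (Q≤P 3 (m≤m+n 3 17))
  4Q≤P' : 4 * Q 3 ≤ P'
  4Q≤P' = +-cancelʳ-≤ (Q 3) _ _ (≤-trans (≡⇒≤ (lemma u e)) (≤-trans (Q≤P 15 (m≤m+n 15 5)) (≡⇒≤ (sym P≡))))
   where
   lemma : ∀ u e -> 4 * (3 * u * e) + 3 * u * e ≡ 15 * u * e
   lemma = solve-∀
  Goal = Dense-graphs 3 u w e (numerator u w) (2 * (3 * (w * w)))
  slack : 6 * w + 4 + 1 ≤ 2 * (3 * (w * w))
  slack = ≤-trans (lin (w ∷ []) (6 :* v0 :+ k 4 :+ k 1 <: 12 :* v0) (k 2 <: v0 by 6 · 2≤w & □)) (≤-trans (≡⇒≤ (lemma w)) (*-monoʳ-≤ 2 (*-monoʳ-≤ 3 (*-monoˡ-≤ w 2≤w))))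
   where
   lemma : ∀ w -> 12 * w ≡ 2 * (3 * (2 * w))
   lemma = solve-∀
  go : Between P (Q 3) -> Between P' (Q 3) -> Goal
  go (N2 , d2 , 𝒮2 , 0<d2 , d2<N2 , above2 , below2) (N1 , d1 , 𝒮1 , 0<d1 , d1<N1 , above1 , below1) = with-vertex (size-positive 𝒮1 (≤-<-trans z≤n d1<N1))
   where
   0<N2 : 0 < N2
   0<N2 = ≤-<-trans z≤n d2<N2
   with-vertex : (∃ \ o -> o ∈ Sys.L 𝒮1) -> Goal
   with-vertex (o , o∈) = realise {u = u} {w = w} {e = e} {A = 2 * (w * w) + 3 * u * w + 9 * (u * u)} {b = 3 * (w * w)} {c = 6 * w + 4} 𝒯.template34 (≤-trans (*-mono-< 0<N2 𝒯.0<B) (m≤n+m _ (𝒯.B * (N2 + N2)))) sparse dense slack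
    where
    module 𝒯 = Pattern 𝒮2 𝒮1 0<N2 0<d1 o∈
    B n0 : ℕ
    B = 𝒯.B
    n0 = 𝒯.n0
    above : P * d1 ≤ Q 3 * B
    above = begin
     P * d1 ≡⟨ trans (cong (_* d1) (sym P≡)) (*-distribʳ-+ d1 P' (Q 3)) ⟩
     P' * d1 + Q 3 * d1 ≤⟨ +-monoˡ-≤ (Q 3 * d1) above1 ⟩
     Q 3 * N1 + Q 3 * d1 ≡⟨ trans (sym (*-distribˡ-+ (Q 3) N1 d1)) (cong (Q 3 *_) (sym 𝒯.B≡)) ⟩
     Q 3 * B ∎
    below : Q 3 * B ≤ (P + 1) * d1
    below = begin
     Q 3 * B ≡⟨ trans (cong (Q 3 *_) 𝒯.B≡) (*-distribˡ-+ (Q 3) N1 d1) ⟩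
     Q 3 * N1 + Q 3 * d1 ≤⟨ +-monoˡ-≤ (Q 3 * d1) below1 ⟩
     (P' + 1) * d1 + Q 3 * d1 ≡⟨ trans (regroup P' d1 (Q 3)) (cong (\ p -> (p + 1) * d1) P≡) ⟩
     (P + 1) * d1 ∎
     where
     regroup : ∀ p d q -> (p + 1) * d + q * d ≡ (p + q + 1) * d
     regroup = solve-∀
    M≡ : u * (B * (N2 + N2) + N2 * B) ≡ u * (3 * N2) * B
    M≡ = lemma u B N2
     where
     lemma : ∀ u B N -> u * (B * (N + N) + N * B) ≡ u * (3 * N) * B
     lemma = solve-∀
    sparse : w * (B * d2 ⊔ N2 * d1) < u * (B * (N2 + N2) + N2 * B)
    sparse = [ (\ e -> subst (\ α -> w * α < u * (B * (N2 + N2) + N2 * B)) (sym e) (begin-strict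
          w * (B * d2) ≡⟨ lemma w B d2 ⟩
          w * d2 * B <⟨ *-monoˡ-< B {{>-nonZero 𝒯.0<B}} (sparse-ratio 3 0<d2 above2) ⟩
          u * (3 * N2) * B ≡⟨ M≡ ⟨
          u * (B * (N2 + N2) + N2 * B) ∎)) ,
         (\ e -> subst (\ α -> w * α < u * (B * (N2 + N2) + N2 * B)) (sym e) (begin-strict
          w * (N2 * d1) ≡⟨ lemma w N2 d1 ⟩
          w * d1 * N2 <⟨ *-monoˡ-< N2 {{>-nonZero 0<N2}} (sparse-ratio 3 0<d1 above) ⟩
          u * (3 * B) * N2 ≡⟨ trans (swap u B N2) (sym M≡) ⟩
          u * (B * (N2 + N2) + N2 * B) ∎)) ]′ (⊔-sel (B * d2) (N2 * d1))
     where
     lemma : ∀ w b d -> w * (b * d) ≡ w * d * b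
     lemma = solve-∀
     swap : ∀ u b n -> u * (3 * b) * n ≡ u * (3 * n) * b
     swap = solve-∀
    square : ∀ N B -> (B * (N + N) + N * B) * (B * (N + N) + N * B) ≡ 9 * (N * B * (N * B))
    square = solve-∀
    expand : ∀ n d1 d2 N -> let B = n + (d1 + d1) in
     6 * (N * B * (N * B)) + 2 * (B * B * N * d2) + N * N * (B * d1 + 3 * (d1 * d1)) ≡
     B * (N * (B * (d2 + N) + N * B) + N * (B * (d2 + N) + N * B)) +
      N * (n * (B * (N + N) + N * d1) + N * (d1 * d1) + (d1 * (B * (N + N) + N * (d1 + d1)) + d1 * (B * (N + N) + N * (d1 + d1))))
    expand n d1 d2 N = expanded n d1 d2 N
     where
     expanded : ∀ n d1 d2 N ->
      6 * (N * (n + (d1 + d1)) * (N * (n + (d1 + d1)))) + 2 * ((n + (d1 + d1)) * (n + (d1 + d1)) * N * d2) + N * N * ((n + (d1 + d1)) * d1 + 3 * (d1 * d1)) ≡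
      (n + (d1 + d1)) * (N * ((n + (d1 + d1)) * (d2 + N) + N * (n + (d1 + d1))) + N * ((n + (d1 + d1)) * (d2 + N) + N * (n + (d1 + d1)))) +
       N * (n * ((n + (d1 + d1)) * (N + N) + N * d1) + N * (d1 * d1) + (d1 * ((n + (d1 + d1)) * (N + N) + N * (d1 + d1)) + d1 * ((n + (d1 + d1)) * (N + N) + N * (d1 + d1))))
     expanded = solve-∀
    dense : numerator u w * e * ((B * (N2 + N2) + N2 * B) * (B * (N2 + N2) + N2 * B)) ≤
     3 * (w * w) * e * 𝒯.D + (6 * w + 4) * ((B * (N2 + N2) + N2 * B) * (B * (N2 + N2) + N2 * B))
    dense = subst₂ (\ m D -> numerator u w * e * m ≤ 3 * (w * w) * e * D + (6 * w + 4) * m) (sym (square N2 B)) (expand n0 d1 d2 N2)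
     (dense34 (<⇒≤ d2<N2) (≤-trans (m≤m+n d1 d1) (m≤n+m _ n0)) below2 below)

-- δ0 = 1/(below-huge + 1).
below-huge : ℕ
below-huge = 9999999999999999999999999999999999999999

module _ {u w n a : ℕ} (wa≤un : w * a ≤ u * n) where

 clear-copies : ∀ r {x} -> suc r * (2 * x) + n * n ≤ suc r * (n * n) + suc r * (n * a) + 0 -> 2 * (suc r * w) * x ≤ (r * w + suc r * u) * (n * n)
 clear-copies r {x} h = begin
  2 * (R * w) * x ≡⟨ lemma R w x ⟩
  w * (R * (2 * x)) ≤⟨ *-monoʳ-≤ w (lin ((R * (2 * x)) ∷ (n * n) ∷ (r * (n * n)) ∷ (R * (n * a)) ∷ []) (v0 <: v2 :+ v3) (v0 :+ v1 <: v1 :+ v2 :+ v3 :+ k 0 by h & □)) ⟩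
  w * (r * (n * n) + R * (n * a)) ≡⟨ lemma' r R w n a ⟩
  r * w * (n * n) + R * n * (w * a) ≤⟨ +-monoʳ-≤ (r * w * (n * n)) (*-monoʳ-≤ (R * n) wa≤un) ⟩
  r * w * (n * n) + R * n * (u * n) ≡⟨ lemma″ r R w n u ⟩
  (r * w + R * u) * (n * n) ∎
  where
  R = suc r
  lemma : ∀ R w x -> 2 * (R * w) * x ≡ w * (R * (2 * x))
  lemma = solve-∀
  lemma' : ∀ r R w n a -> w * (r * (n * n) + R * (n * a)) ≡ r * w * (n * n) + R * n * (w * a)
  lemma' = solve-∀
  lemma″ : ∀ r R w n u -> r * w * (n * n) + R * n * (u * n) ≡ (r * w + R * u) * (n * n)
  lemma″ = solve-∀

 clear34 : ∀ {x} -> 3 * (2 * x) + n * n ≤ 3 * (n * n) + 3 * (n * a) + 9 * (a * a) -> 2 * (3 * (w * w)) * x ≤ numerator u w * (n * n)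
 clear34 {x} h = begin
  2 * (3 * (w * w)) * x ≡⟨ lemma w x ⟩
  w * w * (3 * (2 * x)) ≤⟨ *-monoʳ-≤ (w * w) (lin (x ∷ (n * n) ∷ (n * a) ∷ (a * a) ∷ []) (3 :* (2 :* v0) <: 2 :* v1 :+ 3 :* v2 :+ 9 :* v3) (3 :* (2 :* v0) :+ v1 <: 3 :* v1 :+ 3 :* v2 :+ 9 :* v3 by h & □)) ⟩
  w * w * (2 * (n * n) + 3 * (n * a) + 9 * (a * a)) ≡⟨ lemma' w n a ⟩
  2 * (w * w) * (n * n) + 3 * w * n * (w * a) + 9 * (w * a * (w * a)) ≤⟨ +-mono-≤ (+-monoʳ-≤ (2 * (w * w) * (n * n)) (*-monoʳ-≤ (3 * w * n) wa≤un)) (*-monoʳ-≤ 9 (*-mono-≤ wa≤un wa≤un)) ⟩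
  2 * (w * w) * (n * n) + 3 * w * n * (u * n) + 9 * (u * n * (u * n)) ≡⟨ lemma″ w n u ⟩
  numerator u w * (n * n) ∎
  where
  lemma : ∀ w x -> 2 * (3 * (w * w)) * x ≡ w * w * (3 * (2 * x))
  lemma = solve-∀
  lemma' : ∀ w n a -> w * w * (2 * (n * n) + 3 * (n * a) + 9 * (a * a)) ≡ 2 * (w * w) * (n * n) + 3 * w * n * (w * a) + 9 * (w * a * (w * a))
  lemma' = solve-∀
  lemma″ : ∀ w n u -> 2 * (w * w) * (n * n) + 3 * w * n * (u * n) + 9 * (u * n * (u * n)) ≡ (2 * (w * w) + 3 * u * w + 9 * (u * u)) * (n * n)
  lemma″ = solve-∀

module Target {δ : ℚ.ℚ} (0<δ : ℚ.0ℚ ℚ.< δ) (δ<δ0 : δ ℚ.< unit-fraction below-huge) where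
 open Fraction (fraction δ 0<δ)

 huge-u≤w : huge * u ≤ w
 huge-u≤w = below below-huge δ<δ0

 20u≤w : 20 * u ≤ w
 20u≤w = (lin-κ 499999999999999999999999999999999999999 (u ∷ w ∷ []) (20 :* v0 <: v1) (10000000000000000000000000000000000000000 :* v0 <: v1 by huge-u≤w & □))

 instance
  w-nonZero : NonZero w
  w-nonZero = >-nonZero 0<w

 -- Independence numbers are integers, so being at most δn means being at most this floor; the upper
 -- bounds are applied to it.
 floor : ℕ -> ℕ
 floor n = u * n / w

 floor-upper : ∀ n -> w * floor n ≤ u * n
 floor-upper n = ≤-trans (≡⇒≤ (*-comm w (floor n))) (m/n*n≤m (u * n) w)

 floor-bound : ∀ {t n} -> w * t ≤ u * n -> t ≤ floor n
 floor-bound {t} {n} h = ≤-pred (*-cancelʳ-< w t (1 + floor n) (≤-<-trans (≤-trans (≡⇒≤ (*-comm t w)) h) (m<[1+m/n]*n (u * n) w)))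

 floor-small : ∀ c -> c * u ≤ w -> ∀ n -> c * floor n ≤ n
 floor-small c h n = *-cancelˡ-≤ w (begin
  w * (c * floor n) ≡⟨ lemma w c (floor n) ⟩
  c * (w * floor n) ≤⟨ *-monoʳ-≤ c (floor-upper n) ⟩
  c * (u * n) ≡⟨ *-assoc c u n ⟨
  c * u * n ≤⟨ *-monoˡ-≤ n h ⟩
  w * n ∎)
  where
  lemma : ∀ w c f -> w * (c * f) ≡ c * (w * f)
  lemma = solve-∀

 -- Everything is reduced to naturals through r = A / B, δ = u / w and ε = g / e; the threshold for
 -- n is the sum of those for the two bounds.
 rho : ∀ start c -> c * u ≤ w -> ∀ {s r} A B -> 0 < B -> r ℚ.* ι B ≡ ι A ->
  (∀ {n} (G : Graph n) -> (∀ t -> IndepSet G t -> t ≤ floor n) -> start ≤ n -> c * floor n ≤ n -> Free s G -> B * edgeCount G ≤ A * (n * n)) ->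
  (∀ e -> 0 < e -> Dense-graphs s u w e A B) -> RhoEq (3 Vec.∷ suc s Vec.∷ Vec.[]) δ r
 rho start c cu≤w {s} {r} A B 0<B r-value upper lower ε 0<ε = go (fraction ε 0<ε)
  where
  go : Fraction ε -> _
  go ε-fraction = with-graphs (lower e 0<e)
   where
   open Fraction ε-fraction using () renaming (u to g; w to e; 0<u to 0<g; 0<w to 0<e; value to ε-value)
   with-graphs : Dense-graphs s u w e A B -> _
   with-graphs (n0 , graphs) = start + n0 , \ n large -> (\ G free ind ->
     edges-≤ {r} {A} {B} 0<B r-value {ε} {n * n} 0<ε (upper G (\ t I -> floor-bound (clear-≤ {δ} {u} {w} 0<w value (ind t I))) (≤-trans (m≤m+n start n0) large) (floor-small c cu≤w n) free)) ,
    extremal n (graphs n (≤-trans (m≤n+m n0 start) large))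
    where
    extremal : ∀ n -> Estimate s n w u (A * e) (B * e) 1 B ->
     Σ (Graph n) \ G -> Free s G × IndepAtMost G (δ ℚ.* ℕ→ℚ n) × (r ℚ.- ε) ℚ.* ℕ→ℚ (n * n) ℚ.≤ ℕ→ℚ (edgeCount G)
    extremal n (G , free , ind , edges) = G , free , (\ t I -> unclear-≤ {δ} {u} {w} 0<w value (ind t I)) , ≤-edges {r} {A} {B} 0<B r-value {ε} {e} {g} {n * n} 0<e 0<g ε-value (subst (\ x -> A * e * (n * n) ≤ B * e * x + B * (n * n)) (*-identityˡ (edgeCount G)) edges)

 rho33 : RhoEq (3 Vec.∷ 3 Vec.∷ Vec.[]) δ ((ℤ.+ 1 ℚ./ 4) ℚ.+ (ℤ.+ 1 ℚ./ 2) ℚ.* δ)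
 rho33 = rho many huge huge-u≤w {2} {(ℤ.+ 1 ℚ./ 4) ℚ.+ (ℤ.+ 1 ℚ./ 2) ℚ.* δ} (1 * w + 2 * u) (2 * (2 * w)) (*-mono-< {0} {2} (s≤s z≤n) (*-mono-< {0} {2} (s≤s z≤n) 0<w)) (trans (value33 {δ} {u} {w} value) (cong (\ x -> ι (x + 2 * u)) (sym (*-identityˡ w))))
  (\ {n} G bound large small free -> clear-copies {u} {w} {n} {floor n} (floor-upper n) 1 (EdgeBounds.upper33 G bound large small free))
  \ e 0<e -> lower33 u w e 0<u 0<e 20u≤w

 rho34 : RhoEq (3 Vec.∷ 4 Vec.∷ Vec.[]) δ ((ℤ.+ 1 ℚ./ 3) ℚ.+ (ℤ.+ 1 ℚ./ 2) ℚ.* δ ℚ.+ (ℤ.+ 3 ℚ./ 2) ℚ.* (δ ℚ.* δ))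
 rho34 = rho many huge huge-u≤w {3} {(ℤ.+ 1 ℚ./ 3) ℚ.+ (ℤ.+ 1 ℚ./ 2) ℚ.* δ ℚ.+ (ℤ.+ 3 ℚ./ 2) ℚ.* (δ ℚ.* δ)} (numerator u w) (2 * (3 * (w * w))) (*-mono-< {0} {2} (s≤s z≤n) (*-mono-< {0} {3} (s≤s z≤n) (*-mono-< 0<w 0<w))) (value34 {δ} {u} {w} value)
  (\ {n} G bound large small free -> clear34 {u} {w} {n} {floor n} (floor-upper n) (EdgeBounds.upper34 G bound large small free))
  \ e 0<e -> lower34 u w e 0<u 0<e 20u≤w

 rho35 : RhoEq (3 Vec.∷ 5 Vec.∷ Vec.[]) δ ((ℤ.+ 2 ℚ./ 5) ℚ.+ (ℤ.+ 1 ℚ./ 2) ℚ.* δ)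
 rho35 = rho many huge huge-u≤w {4} {(ℤ.+ 2 ℚ./ 5) ℚ.+ (ℤ.+ 1 ℚ./ 2) ℚ.* δ} (4 * w + 5 * u) (2 * (5 * w)) (*-mono-< {0} {2} (s≤s z≤n) (*-mono-< {0} {5} (s≤s z≤n) 0<w)) (value35 {δ} {u} {w} value)
  (\ {n} G bound large small free -> clear-copies {u} {w} {n} {floor n} (floor-upper n) 4 (EdgeBounds.upper35 G bound large small free))
  \ e 0<e -> lower35 u w e 0<u 0<e 20u≤w

0<unit-fraction : ∀ h -> ℚ.0ℚ ℚ.< unit-fraction h
0<unit-fraction h = ℚ.*<* (ℤ.+<+ (s≤s z≤n))

theorem1p1 : Σ ℚ.ℚ \ δ0 -> ℚ.0ℚ ℚ.< δ0 × (∀ (δ : ℚ.ℚ) -> ℚ.0ℚ ℚ.< δ -> δ ℚ.< δ0 ->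
 RhoEq (3 Vec.∷ 3 Vec.∷ Vec.[]) δ ((ℤ.+ 1 ℚ./ 4) ℚ.+ (ℤ.+ 1 ℚ./ 2) ℚ.* δ) ×
 RhoEq (3 Vec.∷ 4 Vec.∷ Vec.[]) δ ((ℤ.+ 1 ℚ./ 3) ℚ.+ (ℤ.+ 1 ℚ./ 2) ℚ.* δ ℚ.+ (ℤ.+ 3 ℚ./ 2) ℚ.* (δ ℚ.* δ)) ×
 RhoEq (3 Vec.∷ 5 Vec.∷ Vec.[]) δ ((ℤ.+ 2 ℚ./ 5) ℚ.+ (ℤ.+ 1 ℚ./ 2) ℚ.* δ))
theorem1p1 = unit-fraction below-huge , 0<unit-fraction below-huge , \ δ 0<δ δ<δ0 -> Target.rho33 0<δ δ<δ0 , Target.rho34 0<δ δ<δ0 , Target.rho35 0<δ δ<δ0
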